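{- For every integer $k\ge 2$, the $3$-graph $K_4^3\cup k\cdot e$ (the disjoint union of a $K_4^3$ and $k$ pairwise disjoint edges, on $4+3k$ vertices) is $\lambda$-perfect, i.e. $\pi_\lambda(K_4^3\cup k\cdot e)=3!\,\lambda(K_{3k+3}^3)$.
   Context: For a $3$-graph $G$ on $[n]$ and $\vec x\in[0,\infty)^n$, $\lambda(G,\vec x)=\sum_{e\in E(G)}\prod_{i\in e}x_i$ and $\lambda(G)=\max\{\lambda(G,\vec x):\sum_i x_i=1, x_i\ge0\}$. The Lagrangian density is $\pi_\lambda(F)=\sup\{r!\lambda(G): G \text{ is } F\text{ -free}\}$. An $r$-graph $H$ on $t$ vertices is $\lambda$-perfect if $\pi_\lambda(H)=r!\,\lambda(K_{t-1}^r)$. -}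

module Defs where

open import Algebra.Bundles using (CommutativeRing)
import Algebra.Definitions.RawMonoid as Mult
open import Data.Bool.Base using (if_then_else_)
import Data.Bool.Properties as Bool
import Data.Empty as Empty
open import Data.Fin.Base using (Fin)
import Data.Fin.Properties as Fin
open import Data.Fin.Subset using (Subset; inside; outside; ∣_∣; ⊥)
open import Data.Fin.Subset.Properties using (_∈?_; ∣⊥∣≡0)
open import Data.List.Base as List using (List; filter; map)
open import Data.Nat.Base using (ℕ; zero; suc; _+_; _*_; _∸_; _!)
open import Data.Nat.Properties using (_≟_; +-identityʳ)
open import Data.Product.Base using (∃; _×_; _,_)
open import Data.Sum.Base using (_⊎_; inj₁; inj₂)
open import Data.Vec.Base using ([]; _∷_; _++_; lookup; tabulate; take; drop)
open import Data.Vec.Functional using (Vector)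
open import Data.Vec.Properties using (≡-dec; take++drop≡id)
open import Function.Definitions using (Injective)
open import Level using (0ℓ) renaming (suc to lsuc)
open import Relation.Binary.Core using (Rel)
open import Relation.Binary.PropositionalEquality
  using (_≡_; refl; sym; trans; cong; cong₂)
open import Relation.Binary.Structures using (IsDecTotalOrder)
open import Relation.Nullary using (¬_; does; no)
open import Relation.Nullary.Decidable using (_×-dec_; _⊎-dec_)
open import Relation.Unary using (Pred; Decidable)

-- The real numbers, axiomatised as a (classical) Dedekind-complete ordered
-- field.  Classically there is exactly one such structure up to isomorphism,
-- namely ℝ, so quantifying over all of them is the same as speaking about ℝ.

record CompleteOrderedField : Set₁ where
  field
    commutativeRing : CommutativeRing 0ℓ 0ℓ

  open CommutativeRing commutativeRing public
    using (Carrier; _≈_; _≉_; 0#; 1#; +-rawMonoid; *-rawMonoid)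
    renaming (_+_ to _⊕_; _*_ to _⊛_)

  infix 4 _≤_

  field
    _≤_             : Rel Carrier 0ℓ
    isDecTotalOrder : IsDecTotalOrder _≈_ _≤_
    1≉0             : 1# ≉ 0#
    inverse         : ∀ x → x ≉ 0# → ∃ λ y → x ⊛ y ≈ 1#
    +-monoʳ-≤       : ∀ x {y z} → y ≤ z → x ⊕ y ≤ x ⊕ z
    *-nonneg        : ∀ {x y} → 0# ≤ x → 0# ≤ y → 0# ≤ x ⊛ y

  IsUpperBound : ∀ {ℓ} → Pred Carrier ℓ → Carrier → Set ℓ
  IsUpperBound P b = ∀ x → P x → x ≤ b

  IsSupremum : ∀ {ℓ} → Pred Carrier ℓ → Carrier → Set ℓ
  IsSupremum P s = IsUpperBound P s × (∀ b → IsUpperBound P b → s ≤ b)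

  field
    complete : (P : Pred Carrier 0ℓ) → ∃ P → ∃ (IsUpperBound P) →
               ∃ (IsSupremum P)

-- r-graphs on the vertex set Fin n: sets of r-element subsets of Fin n.

record Hypergraph (r n : ℕ) : Set₁ where
  field
    E       : Pred (Subset n) 0ℓ
    E?      : Decidable E
    uniform : ∀ {e} → E e → ∣ e ∣ ≡ r

open Hypergraph

-- Each subset of Fin n occurs exactly once in this list.

subsets : ∀ n → List (Subset n)
subsets zero    = List.[ [] ]
subsets (suc n) = map (inside ∷_) (subsets n) List.++ map (outside ∷_) (subsets n)

edges : ∀ {r n} → Hypergraph r n → List (Subset n)
edges {n = n} G = filter (E? G) (subsets n)

K : ∀ r n → Hypergraph r n
K r n = record
  { E       = λ e → ∣ e ∣ ≡ r
  ; E?      = λ e → ∣ e ∣ ≟ r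
  ; uniform = λ ∣e∣≡r → ∣e∣≡r
  }

private
  ∣++∣ : ∀ {m n} (p : Subset m) (q : Subset n) → ∣ p ++ q ∣ ≡ ∣ p ∣ + ∣ q ∣
  ∣++∣ []            q = refl
  ∣++∣ (inside  ∷ p) q = cong suc (∣++∣ p q)
  ∣++∣ (outside ∷ p) q = ∣++∣ p q

  ∣take∣+∣drop∣ : ∀ m {n} (p : Subset (m + n)) →
                 ∣ p ∣ ≡ ∣ take m p ∣ + ∣ drop m p ∣
  ∣take∣+∣drop∣ m p =
    trans (cong ∣_∣ (sym (take++drop≡id m p))) (∣++∣ (take m p) (drop m p))

  ∣≡⊥∣ : ∀ {n} {p : Subset n} → p ≡ ⊥ → ∣ p ∣ ≡ 0
  ∣≡⊥∣ {n} refl = ∣⊥∣≡0 n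

-- Disjoint union: the first m vertices carry G, the last n carry H.

infixr 6 _⊔_
_⊔_ : ∀ {r m n} → Hypergraph r m → Hypergraph r n → Hypergraph r (m + n)
_⊔_ {r} {m} G H = record
  { E       = λ e → (E G (take m e) × drop m e ≡ ⊥)
                  ⊎ (take m e ≡ ⊥ × E H (drop m e))
  ; E?      = λ e → (E? G (take m e) ×-dec ≡-dec Bool._≟_ (drop m e) ⊥)
              ⊎-dec (≡-dec Bool._≟_ (take m e) ⊥ ×-dec E? H (drop m e))
  ; uniform = uniform-⊔
  }
  where
  uniform-⊔ : ∀ {e} → (E G (take m e) × drop m e ≡ ⊥)
                    ⊎ (take m e ≡ ⊥ × E H (drop m e)) → ∣ e ∣ ≡ r
  uniform-⊔ {e} (inj₁ (g , d≡⊥)) =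
    trans (∣take∣+∣drop∣ m e)
      (trans (cong₂ _+_ (uniform G g) (∣≡⊥∣ d≡⊥)) (+-identityʳ r))
  uniform-⊔ {e} (inj₂ (t≡⊥ , h)) =
    trans (∣take∣+∣drop∣ m e) (cong₂ _+_ (∣≡⊥∣ t≡⊥) (uniform H h))

edgeless : ∀ r n → Hypergraph r n
edgeless r n = record
  { E       = λ _ → Empty.⊥
  ; E?      = λ _ → no λ ()
  ; uniform = λ ()
  }

-- k vertex-disjoint copies of G.

infixr 7 _·_
_·_ : ∀ {r n} (k : ℕ) → Hypergraph r n → Hypergraph r (k * n)
zero  · G = edgeless _ 0
suc k · G = G ⊔ k · G

image : ∀ {m n} → (Fin m → Fin n) → Subset m → Subset n
image f p = tabulate λ j → does (Fin.any? λ i → (i ∈? p) ×-dec (f i Fin.≟ j))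

-- G contains a (not necessarily induced) copy of F.

_⊑_ : ∀ {r m n} → Hypergraph r m → Hypergraph r n → Set
_⊑_ {m = m} {n} F G = ∃ λ (f : Fin m → Fin n) →
  Injective _≡_ _≡_ f × (∀ e → E F e → E G (image f e))

_-free : ∀ {r m n} → Hypergraph r m → Hypergraph r n → Set
(F -free) G = ¬ (F ⊑ G)

module Lagrangian (ℝ : CompleteOrderedField) where

  open CompleteOrderedField ℝ

  private
    module Sum  = Mult +-rawMonoid
    module Prod = Mult *-rawMonoid

  monomial : ∀ {n} → Vector Carrier n → Subset n → Carrier
  monomial x e = Prod.sum λ i → if lookup e i then x i else 1#

  -- The Lagrange polynomial λ(G, x).

  lagrangePoly : ∀ {r n} → Hypergraph r n → Vector Carrier n → Carrier
  lagrangePoly G x = List.foldr _⊕_ 0# (map (monomial x) (edges G))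

  Simplex : ∀ {n} → Pred (Vector Carrier n) 0ℓ
  Simplex x = (∀ i → 0# ≤ x i) × Sum.sum x ≈ 1#

  -- λ(G) and π_λ(F) are given by their graphs: IsLagrangian G l means
  -- "l = λ(G)" and IsLagrangianDensity F d means "d = π_λ(F)".

  IsLagrangian : ∀ {r n} → Hypergraph r n → Carrier → Set
  IsLagrangian G l =
      (∃ λ x → Simplex x × lagrangePoly G x ≈ l)
    × (∀ x → Simplex x → lagrangePoly G x ≤ l)

  -- The values r! λ(G) for F-free G.  A G on the empty vertex set contributes
  -- nothing, its simplex being empty.

  FreeValue : ∀ {r t} → Hypergraph r t → Pred Carrier (lsuc 0ℓ)
  FreeValue {r} F d = ∃ λ n → ∃ λ (G : Hypergraph r n) → ∃ λ l →
    (F -free) G × IsLagrangian G l × d ≈ (r !) Sum.× l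

  IsLagrangianDensity : ∀ {r t} → Hypergraph r t → Carrier → Set₁
  IsLagrangianDensity F = IsSupremum (FreeValue F)

  λPerfect : ∀ {r t} → Hypergraph r t → Set₁
  λPerfect {r} {t} H = ∃ λ l →
    IsLagrangian (K r (t ∸ 1)) l × IsLagrangianDensity H ((r !) Sum.× l)

open Lagrangian public

{-# OPTIONS --safe #-}
module Submission where

-- With the weights scaled to total s = 3k + 3, all links at a maximiser of the Lagrange
-- polynomial of a K₄ ∪ k·e-free 3-graph have the same mass θ, and θ ≤ (s - 1)(s - 2) is needed.
--
-- For k ≥ 3 this follows from k - 1. If the heaviest vertex a has weight above 1, deleting it
-- destroys all copies of K₄ ∪ (k - 1)·e, as otherwise 3k + 1 vertices would meet all pairs of
-- its link; if not, some pair ab of large codegree has this property. The bound for k - 1,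
-- applied to the remaining weights, is too small.
--
-- Let k = 2, s = 9 and θ > 56. By de Caen's counting argument there is a K₄.
--
-- If all weights are at most 1, let A be a lightest K₄. The edges avoiding A intersect pairwise.
-- A vertex j outside A that is lighter than a vertex of A cannot replace it, so some pairs of A
-- are missing from the link of j, and its link outside A is large: the link of the lightest such
-- vertex o is no star and has more than four pairs, and every other link has more than three
-- pairs avoiding o. No intersecting family has these properties.
--
-- If a vertex h has weight above 1, deleting it destroys all copies of K₄ ∪ e. Let A be a
-- lightest K₄ avoiding h, if there is one. Then A ∪ h meets every edge, and counting the missing
-- triples yields a K₄ with two vertices in A and two outside A ∪ h, which is lighter. If every K₄
-- contains h, de Caen's argument bounds the sum of squares of the other weights. Therefore h lies
-- in a K₄ with three light vertices, and some edge avoiding this K₄ is light as well. It meets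
-- all other edges avoiding the K₄, so some link is too small.

open import Defs
open import Algebra.Bundles using (CommutativeRing)
import Algebra.Definitions.RawMonoid as Mult
import Algebra.Properties.Ring as RingProperties
import Algebra.Properties.Semiring.Sum as SemiringSum
open import Data.Bool.Base using (Bool; true; false; if_then_else_; _∧_)
import Data.Bool.Properties as Boolₚ
open import Data.Empty using (⊥; ⊥-elim)
open import Data.Fin.Base as Fin using (Fin; zero; suc)
import Data.Fin.Properties as Finₚ
open import Data.Fin.Subset as Subset using (Subset; ⁅_⁆; _∪_; ∣_∣)
import Data.Fin.Subset.Properties as Subsetₚ
open import Data.Integer.Base as ℤ using (ℤ; +_; -[1+_])
import Data.Integer.Properties as ℤₚ
open import Data.List.Base as List using (List; []; _∷_; length; allFin; cartesianProduct)
open import Data.List.Membership.Propositional using (_∈_; _∉_)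
open import Data.List.Membership.Propositional.Properties using (∈-allFin; ∈-cartesianProduct⁺)
open import Data.List.Relation.Unary.All as All using (All; []; _∷_)
open import Data.List.Relation.Unary.Any as Any using (Any; here; there)
open import Data.Nat.Base as ℕ using (ℕ; zero; suc)
import Data.Nat.Properties as ℕₚ
open import Data.Product.Base using (∃; _×_; _,_; proj₁; proj₂; ∃₂)
open import Data.Sum.Base using (_⊎_; inj₁; inj₂; [_,_]′)
open import Data.Vec.Base as Vec using ([]; _∷_)
import Data.Vec.Properties as Vecₚ
open import Function.Base using (_∘_)
open import Relation.Binary.PropositionalEquality as ≡ using (_≡_; refl; _≢_)
open import Relation.Binary.Structures using (IsDecTotalOrder)
open import Relation.Nullary using (¬_; Dec; yes; no; does)
open import Relation.Nullary.Decidable using (¬?; _×-dec_; _⊎-dec_; dec-true; dec-false)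

-- The extremal weighting is K_s with all weights 1, where every link has mass (s - 1)(s - 2); this
-- is 56 for s = 9. A bound on θ concerns weights of total exactly s, whereas deleting vertices
-- lowers the total. The induction therefore passes through `Bound`, a homogeneous inequality for
-- arbitrary weights that forbids copies on their support only; a maximiser on that support reduces
-- it to `Core`. Cases can be distinguished only for `_≤_` and for finite searches over vertices.
-- Hence the maximiser is found by approximations under a double negation, and what is drawn from
-- them are inequalities and contradictions, for which double negations can be removed. The
-- numerical parts are polynomial inequalities in a few quantities. Each comes with an identity: a
-- positive multiple of the right side minus the left side is a sum of products of hypotheses and
-- squares. The type checker only expands it. Coefficients must be natural numbers, so common
-- denominators are cleared, and the integers become large.

infixl 6 _:+_ _:-_
infixl 7 _:*_
infix 8 :-_
infix 4 _≦_ _≐_ _≺_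

-- Polynomial expressions, their normal forms, and certificates of positivity

data Expr : Set where
  var       : ℕ → Expr
  con       : ℤ → Expr
  _:+_ _:*_ : Expr → Expr → Expr
  :-_       : Expr → Expr

_:-_ : Expr → Expr → Expr
a :- b = a :+ :- b

nat : ℕ → Expr
nat n = con (+ n)

-- A monomial is the sorted list of its variables.

Mono Poly : Set
Mono = List ℕ
Poly = List (ℤ × Mono)

-- Only equality carries evidence, since merging equal monomials is the one step whose soundness
-- depends on the comparison. A wrong `lt′` or `gt′` could merely leave a sum unmerged.
data Cmp (a b : Mono) : Set where
  lt′ gt′ : Cmp a b
  eq′     : a ≡ b → Cmp a b

cmp : ∀ a b → Cmp a b
cmp []      []      = eq′ refl
cmp []      (_ ∷ _) = lt′
cmp (_ ∷ _) []      = gt′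
cmp (x ∷ a) (y ∷ b) with x ℕ.<ᵇ y | y ℕ.<ᵇ x | x ℕₚ.≟ y
... | true  | _     | _      = lt′
... | false | true  | _      = gt′
-- This combination cannot occur, and any answer would be sound.
... | false | false | no _   = lt′
... | false | false | yes refl with cmp a b
...   | lt′     = lt′
...   | gt′     = gt′
...   | eq′ refl = eq′ refl

insert : ℕ → Mono → Mono
insert x []      = x ∷ []
insert x (y ∷ a) = if x ℕ.≤ᵇ y then x ∷ y ∷ a else y ∷ insert x a

mulMono : Mono → Mono → Mono
mulMono []      b = b
mulMono (x ∷ a) b = insert x (mulMono a b)

-- Zero coefficients are dropped here, so that a polynomial that cancels completely becomes the
-- empty list, which is all that `isZero` tests.
cons : ℤ → Mono → Poly → Poly
cons (+ 0)      m p = p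
cons c          m p = (c , m) ∷ p

mutual
  _+ᴾ_ : Poly → Poly → Poly
  []              +ᴾ q = q
  p@(_ ∷ _)       +ᴾ [] = p
  p@((c , m) ∷ p′) +ᴾ q@((d , n) ∷ q′) = merge c m p′ d n q′ (cmp m n)

  merge : ∀ (c : ℤ) (m : Mono) (p : Poly) (d : ℤ) (n : Mono) (q : Poly) → Cmp m n → Poly
  merge c m p d n q lt′     = (c , m) ∷ (p +ᴾ ((d , n) ∷ q))
  merge c m p d n q gt′     = (d , n) ∷ ins c m p q
  merge c m p d n q (eq′ _) = cons (c ℤ.+ d) m (p +ᴾ q)

  -- This is `((c , m) ∷ p) +ᴾ q` with the first head taken apart. Spelling it out keeps the
  -- recursion structural when only the second polynomial gets shorter.
  ins : ∀ (c : ℤ) (m : Mono) (p : Poly) → Poly → Poly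
  ins c m p []             = (c , m) ∷ p
  ins c m p ((d , n) ∷ q)  = merge c m p d n q (cmp m n)

scale : ℤ → Mono → Poly → Poly
scale c m []            = []
scale c m ((d , n) ∷ p) = ((c ℤ.* d) , mulMono m n) ∷ scale c m p

-- Scaling can break the order of the monomials, hence the insertion one by one.

addAll : Poly → Poly → Poly
addAll []      q = q
addAll (t ∷ p) q = (t ∷ []) +ᴾ addAll p q

_*ᴾ_ : Poly → Poly → Poly
[]            *ᴾ q = []
((c , m) ∷ p) *ᴾ q = addAll (scale c m q) (p *ᴾ q)

negᴾ : Poly → Poly
negᴾ []            = []
negᴾ ((c , m) ∷ p) = (ℤ.- c , m) ∷ negᴾ p

nf : Expr → Poly
nf (var i)  = (+ 1 , i ∷ []) ∷ []
nf (con c)  = cons c [] []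
nf (a :+ b) = nf a +ᴾ nf b
nf (a :* b) = nf a *ᴾ nf b
nf (:- a)   = negᴾ (nf a)

isZero : Poly → Bool
isZero []      = true
isZero (_ ∷ _) = false

data Atom : Set where
  _≦_ _≐_ _≺_ : Expr → Expr → Atom

-- A certificate of nonnegativity: hyp i is the i-th hypothesis (right side
-- minus left side), eqn i e the multiple by e of the i-th hypothesis, which
-- must be an equation.

infixl 6 _⊞_
infixl 7 _⊠_

data Cert : Set where
  hyp     : ℕ → Cert
  eqn     : ℕ → Expr → Cert
  sq      : Expr → Cert
  cst     : ℕ → Cert
  _⊞_ _⊠_ : Cert → Cert → Cert

infixr 8 _∙_

_∙_ : ℕ → Cert → Cert
n ∙ c = cst n ⊠ c

pattern h₀ = hyp 0
pattern h₁ = hyp 1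
pattern h₂ = hyp 2
pattern h₃ = hyp 3
pattern h₄ = hyp 4
pattern h₅ = hyp 5
pattern h₆ = hyp 6
pattern h₇ = hyp 7
pattern h₈ = hyp 8
pattern h₉ = hyp 9

diff : Atom → Expr
diff (a ≦ b) = b :- a
diff (a ≐ b) = b :- a
diff (a ≺ b) = b :- a

-- An inequality contributes 0: its difference is only known to be nonnegative, while `eqn` allows
-- multipliers of any sign.
eqDiff : Atom → Expr
eqDiff (a ≐ b) = b :- a
eqDiff _       = con (+ 0)

nth : (Atom → Expr) → List Atom → ℕ → Expr
nth f []       _       = con (+ 0)
nth f (a ∷ as) zero    = f a
nth f (a ∷ as) (suc i) = nth f as i

toExpr : List Atom → Cert → Expr
toExpr hs (hyp i)   = nth diff hs i
toExpr hs (eqn i e) = nth eqDiff hs i :* e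
toExpr hs (sq e)    = e :* e
toExpr hs (cst n)   = con (+ n)
toExpr hs (c ⊞ d)   = toExpr hs c :+ toExpr hs d
toExpr hs (c ⊠ d)   = toExpr hs c :* toExpr hs d

-- 3-graphs as symmetric Boolean functions, and copies of K₄ ∪ k·e in them

record Triples (n : ℕ) : Set where
  field
    E      : Fin n → Fin n → Fin n → Bool
    swap₁₂ : ∀ i j k → E i j k ≡ E j i k
    swap₂₃ : ∀ i j k → E i j k ≡ E i k j
    irr    : ∀ i k → E i i k ≡ false

module Edges {n} (G : Triples n) where

  open Triples G

  Edge : Fin n → Fin n → Fin n → Set
  Edge i j k = E i j k ≡ true

  -- Copies of K₄ ∪ k·e, with the list of their vertices.

  data Copy : ℕ → List (Fin n) → Set where
    k₄  : ∀ {a b c d} → Edge a b c → Edge a b d → Edge a c d → Edge b c d →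
          Copy 0 (a ∷ b ∷ c ∷ d ∷ [])
    add : ∀ {k l} → Copy k l → ∀ i j m → Edge i j m → i ∉ l → j ∉ l → m ∉ l →
          Copy (suc k) (i ∷ j ∷ m ∷ l)

  Free : ℕ → Set
  Free k = ∀ {l} → ¬ Copy k l

-- The vertex set stays the same, so that weights need no renaming; deleted vertices merely lose all
-- their edges.
restrict : ∀ {n} → (Fin n → Bool) → Triples n → Triples n
restrict P G = record
  { E      = λ i j k → P i ∧ (P j ∧ (P k ∧ E i j k))
  ; swap₁₂ = λ i j k → ≡.trans (∧-swap (P i) (P j) _)
                         (≡.cong (λ e → P j ∧ (P i ∧ (P k ∧ e))) (swap₁₂ i j k))
  ; swap₂₃ = λ i j k → ≡.cong (P i ∧_) (≡.trans (∧-swap (P j) (P k) _)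
                         (≡.cong (λ e → P k ∧ (P j ∧ e)) (swap₂₃ i j k)))
  ; irr    = λ i k → ≡.trans (≡.cong (λ e → P i ∧ (P i ∧ (P k ∧ e))) (irr i k)) (lem (P i) (P i) (P k))
  }
  where
  open Triples G
  ∧-swap : ∀ a b c → a ∧ (b ∧ c) ≡ b ∧ (a ∧ c)
  ∧-swap true  b     c = refl
  ∧-swap false true  c = refl
  ∧-swap false false c = refl
  lem : ∀ a b c → a ∧ (b ∧ (c ∧ false)) ≡ false
  lem false _     _     = refl
  lem true  false _     = refl
  lem true  true  false = refl
  lem true  true  true  = refl

∧⁻ : ∀ {a b} → a ∧ b ≡ true → a ≡ true × b ≡ true
∧⁻ {true} {true} _ = refl , refl

does⁻ : ∀ {A : Set} (d : Dec A) → does d ≡ true → A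
does⁻ (yes a) _ = a

unrestrict : ∀ {n} (P : Fin n → Bool) (G : Triples n) i j k → Edges.Edge (restrict P G) i j k →
             P i ≡ true × P j ≡ true × P k ≡ true × Edges.Edge G i j k
unrestrict P G i j k e with ∧⁻ {P i} {P j ∧ (P k ∧ Triples.E G i j k)} e
... | pi , f with ∧⁻ {P j} {P k ∧ Triples.E G i j k} f
...   | pj , g with ∧⁻ {P k} {Triples.E G i j k} g
...     | pk , h = pi , pj , pk , h

restrict-copy : ∀ {n} (P : Fin n → Bool) (G : Triples n) {k l} → Edges.Copy (restrict P G) k l →
                Edges.Copy G k l × All (λ i → P i ≡ true) l
restrict-copy P G (Edges.k₄ {a} {b} {c} {d} e₁ e₂ e₃ e₄)
  with unrestrict P G a b c e₁ | unrestrict P G a b d e₂ | unrestrict P G a c d e₃ | unrestrict P G b c d e₄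
... | pa , pb , pc , f₁ | _ , _ , pd , f₂ | _ , _ , _ , f₃ | _ , _ , _ , f₄ =
  Edges.k₄ f₁ f₂ f₃ f₄ , pa ∷ pb ∷ pc ∷ pd ∷ []
restrict-copy P G (Edges.add c i j m e p q r) with restrict-copy P G c | unrestrict P G i j m e
... | c′ , ps | pi , pj , pm , f = Edges.add c′ i j m f p q r , pi ∷ pj ∷ pm ∷ ps

-- Intersecting families of triples

InPairs : ∀ {n} → Fin n → Fin n → List (Fin n × Fin n) → Set
InPairs p q = Any λ ab → (p ≡ proj₁ ab × q ≡ proj₂ ab) ⊎ (p ≡ proj₂ ab × q ≡ proj₁ ab)

inPairs? : ∀ {n} (p q : Fin n) l → Dec (InPairs p q l)
inPairs? p q = Any.any? λ ab →
  ((p Finₚ.≟ proj₁ ab) ×-dec (q Finₚ.≟ proj₂ ab)) ⊎-dec ((p Finₚ.≟ proj₂ ab) ×-dec (q Finₚ.≟ proj₁ ab))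

-- An intersecting family of triples on the points S, in which all links of
-- points other than o have more than three pairs avoiding o while the link of o is
-- large and not a star, does not exist.

module Intersecting {n} (Edge : Fin n → Fin n → Fin n → Set) (edge? : ∀ i j k → Dec (Edge i j k))
  (swap : ∀ {i j k} → Edge i j k → Edge i k j) (distinct : ∀ {i j k} → Edge i j k → i ≢ j × i ≢ k × j ≢ k)
  (S : Fin n → Set)
  (clash : ∀ {i j k p q r} → Edge i j k → Edge p q r → S i → S j → S k → S p → S q → S r →
           p ≢ i × p ≢ j × p ≢ k → q ≢ i × q ≢ j × q ≢ k → r ≢ i × r ≢ j × r ≢ k → ⊥)
  {o} (yo : S o)
  (avoiding : ∀ b → o ≢ b → ∃₂ λ p q → (S p × S q × Edge o p q) × p ≢ b × q ≢ b)
  (outside : ∀ l → length l ℕ.≤ 4 → ∃₂ λ p q → (S p × S q × Edge o p q) × ¬ InPairs p q l)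
  (finish : ∀ {j} → S j → j ≢ o → ∀ l → length l ℕ.≤ 3 →
            (∀ {u v} → S u → S v → u ≢ o → v ≢ o → Edge j u v → InPairs u v l) → ⊥)
  (fifth : ∀ p q r s → ∃ λ t → S t × t ≢ o × t ≢ p × t ≢ q × t ≢ r × t ≢ s)
  where

  Disjoint : Fin n → Fin n → Fin n → Fin n → Set
  Disjoint p i j k = p ≢ i × p ≢ j × p ≢ k

  meet : ∀ {o s t j u v} → Edge o s t → Edge j u v → S o → S s → S t → S j → S u → S v →
         Disjoint j o s t → u ≢ o → v ≢ o → (u ≡ s ⊎ u ≡ t) ⊎ (v ≡ s ⊎ v ≡ t)
  meet {o} {s} {t} {j} {u} {v} e f yo ys yt yj yu yv dj u≢o v≢o
    with u Finₚ.≟ s | u Finₚ.≟ t | v Finₚ.≟ s | v Finₚ.≟ t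
  ... | yes p | _ | _ | _ = inj₁ (inj₁ p)
  ... | no _ | yes p | _ | _ = inj₁ (inj₂ p)
  ... | no _ | no _ | yes p | _ = inj₂ (inj₁ p)
  ... | no _ | no _ | no _ | yes p = inj₂ (inj₂ p)
  ... | no p | no q | no r | no w = ⊥-elim (clash e f yo ys yt yj yu yv dj (u≢o , p , q) (v≢o , r , w))

  L : Fin n → Fin n → Set
  L p q = S p × S q × Edge o p q

  L-sym : ∀ {p q} → L p q → L q p
  L-sym (yp , yq , e) = yq , yp , swap e

  L-≢ : ∀ {p q} → L p q → o ≢ p × o ≢ q × p ≢ q
  L-≢ (_ , _ , e) = distinct e

  Matching : Set
  Matching = ∃₂ λ p q → ∃₂ λ r s → L p q × L r s × p ≢ r × p ≢ s × q ≢ r × q ≢ s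

  -- A graph whose edges meet pairwise is a star or a triangle. `avoiding` excludes stars and
  -- `outside` excludes triangles, so the link of `o` contains two disjoint pairs.
  matching : Matching
  matching with outside [] ℕ.z≤n
  ... | p , q , pq , _ with avoiding p (proj₁ (L-≢ pq))
  ...   | r , s , rs , r≢p , s≢p = case₁ (r Finₚ.≟ q) (s Finₚ.≟ q)
    where
    case₃ : ∀ {c} → L q c → c ≢ p → ∀ {u v} → L u v → ¬ InPairs u v ((p , q) ∷ (q , c) ∷ (p , c) ∷
        []) → L p c → Matching
    case₃ {c} qc c≢p {u} {v} uv out pc with u Finₚ.≟ p | u Finₚ.≟ q | u Finₚ.≟ c | v Finₚ.≟ p | v Finₚ.≟ q | v Finₚ.≟
        c
    ... | yes refl | _ | _ | _ | yes v≡q | _ = ⊥-elim (out (here (inj₁ (refl , v≡q))))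
    ... | yes refl | _ | _ | _ | no v≢q | yes v≡c = ⊥-elim (out (there (there (here (inj₁ (refl , v≡c))))))
    ... | yes refl | _ | _ | _ | no v≢q | no v≢c = u , v , q , c , uv , qc , proj₂ (proj₂ (L-≢ pq)) , (λ e →
        c≢p (≡.sym e)) , v≢q , v≢c
    ... | no u≢p | yes refl | _ | yes v≡p | _ | _ = ⊥-elim (out (here (inj₂ (refl , v≡p))))
    ... | no u≢p | yes refl | _ | no v≢p | _ | yes v≡c = ⊥-elim (out (there (here (inj₁ (refl , v≡c)))))
    ... | no u≢p | yes refl | _ | no v≢p | _ | no v≢c = u , v , p , c , uv , pc , u≢p , proj₂ (proj₂ (L-≢ qc)) ,
        v≢p , v≢c
    ... | no u≢p | no u≢q | yes refl | yes v≡p | _ | _ = ⊥-elim (out (there (there (here (inj₂ (refl , v≡p))))))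
    ... | no u≢p | no u≢q | yes refl | no v≢p | yes v≡q | _ = ⊥-elim (out (there (here (inj₂ (refl , v≡q)))))
    ... | no u≢p | no u≢q | yes refl | no v≢p | no v≢q | _ = u , v , p , q , uv , pq , u≢p , u≢q , v≢p , v≢q
    ... | no u≢p | no u≢q | no u≢c | yes refl | _ | _ = u , v , q , c , uv , qc , u≢q , u≢c ,
        proj₂ (proj₂ (L-≢ pq)) , (λ e → c≢p (≡.sym e))
    ... | no u≢p | no u≢q | no u≢c | no v≢p | yes refl | _ = u , v , p , c , uv , pc , u≢p , u≢c , v≢p ,
        proj₂ (proj₂ (L-≢ qc))
    ... | no u≢p | no u≢q | no u≢c | no v≢p | no v≢q | _ = u , v , p , q , uv , pq , u≢p , u≢q , v≢p , v≢q
    triangle : ∀ {c} → L q c → c ≢ p → L p c → Matching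
    triangle {c} qc c≢p pc with outside ((p , q) ∷ (q , c) ∷ (p , c) ∷ []) (ℕ.s≤s (ℕ.s≤s (ℕ.s≤s ℕ.z≤n)))
    ... | u , v , uv , out = case₃ qc c≢p uv out pc
    -- `pq` and `qc` meet in `q`. A pair avoiding `q` is disjoint from one of them unless it is
    -- `pc`.
    case₂ : ∀ {c} → L q c → c ≢ p → Matching
    case₂ {c} qc c≢p with avoiding q (proj₁ (proj₂ (L-≢ pq)))
    ... | u , v , uv , u≢q , v≢q with u Finₚ.≟ p | v Finₚ.≟ p | u Finₚ.≟ c | v Finₚ.≟ c
    ...   | yes refl | _ | _ | yes refl = triangle qc c≢p uv
    ...   | yes refl | _ | _ | no v≢c = u , v , q , c , uv , qc , u≢q , (λ e → c≢p (≡.sym e)) , v≢q , v≢c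
    ...   | no u≢p | yes refl | yes refl | _ = triangle qc c≢p (L-sym uv)
    ...   | no u≢p | yes refl | no u≢c | _ = u , v , q , c , uv , qc , u≢q , u≢c , v≢q , (λ e → c≢p (≡.sym e))
    ...   | no u≢p | no v≢p | _ | _ = u , v , p , q , uv , pq , u≢p , u≢q , v≢p , v≢q
    case₁ : Dec (r ≡ q) → Dec (s ≡ q) → Matching
    case₁ (yes refl) _ = case₂ rs s≢p
    case₁ (no _) (yes refl) = case₂ (L-sym rs) r≢p
    case₁ (no r≢q) (no s≢q) = p , q , r , s , pq , rs , (λ e → r≢p (≡.sym e)) , (λ e → s≢p (≡.sym e)) , (λ e →
        r≢q (≡.sym e)) , (λ e → s≢q (≡.sym e))

  module _ {p q r s} (pq : L p q) (rs : L r s) (p≢r : p ≢ r) (p≢s : p ≢ s) (q≢r : q ≢ r) (q≢s : q ≢ s) where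

    private
      p≢q = proj₂ (proj₂ (L-≢ pq))
      r≢s = proj₂ (proj₂ (L-≢ rs))

    Outside : Fin n → Set
    Outside j = j ≢ o × j ≢ p × j ≢ q × j ≢ r × j ≢ s

    crosses : List (Fin n × Fin n)
    crosses = (p , r) ∷ (p , s) ∷ (q , r) ∷ (q , s) ∷ []

    -- `opq` and `ors` are edges, and `j` lies on neither of them. A pair of its link without `o`
    -- must therefore meet both `pq` and `rs`.
    cross : ∀ {j} → S j → Outside j → ∀ {u v} → S u → S v → u ≢ o → v ≢ o → Edge j u v → InPairs u v crosses
    cross yj (jo , jp , jq , jr , js) yu yv u≢o v≢o e
      with meet (proj₂ (proj₂ pq)) e yo (proj₁ pq) (proj₁ (proj₂ pq)) yj yu yv (jo , jp , jq) u≢o v≢o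
         | meet (proj₂ (proj₂ rs)) e yo (proj₁ rs) (proj₁ (proj₂ rs)) yj yu yv (jo , jr , js) u≢o v≢o
    ... | inj₁ (inj₁ refl) | inj₁ (inj₁ e′) = ⊥-elim (p≢r e′)
    ... | inj₁ (inj₁ refl) | inj₁ (inj₂ e′) = ⊥-elim (p≢s e′)
    ... | inj₁ (inj₁ refl) | inj₂ (inj₁ e′) = here (inj₁ (refl , e′))
    ... | inj₁ (inj₁ refl) | inj₂ (inj₂ e′) = there (here (inj₁ (refl , e′)))
    ... | inj₁ (inj₂ refl) | inj₁ (inj₁ e′) = ⊥-elim (q≢r e′)
    ... | inj₁ (inj₂ refl) | inj₁ (inj₂ e′) = ⊥-elim (q≢s e′)
    ... | inj₁ (inj₂ refl) | inj₂ (inj₁ e′) = there (there (here (inj₁ (refl , e′))))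
    ... | inj₁ (inj₂ refl) | inj₂ (inj₂ e′) = there (there (there (here (inj₁ (refl , e′)))))
    ... | inj₂ (inj₁ refl) | inj₁ (inj₁ e′) = here (inj₂ (e′ , refl))
    ... | inj₂ (inj₁ refl) | inj₁ (inj₂ e′) = there (here (inj₂ (e′ , refl)))
    ... | inj₂ (inj₁ refl) | inj₂ (inj₁ e′) = ⊥-elim (p≢r e′)
    ... | inj₂ (inj₁ refl) | inj₂ (inj₂ e′) = ⊥-elim (p≢s e′)
    ... | inj₂ (inj₂ refl) | inj₁ (inj₁ e′) = there (there (here (inj₂ (e′ , refl))))
    ... | inj₂ (inj₂ refl) | inj₁ (inj₂ e′) = there (there (there (here (inj₂ (e′ , refl)))))
    ... | inj₂ (inj₂ refl) | inj₂ (inj₁ e′) = ⊥-elim (q≢r e′)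
    ... | inj₂ (inj₂ refl) | inj₂ (inj₂ e′) = ⊥-elim (q≢s e′)

    drop : ∀ {j t t′ u v l} → ¬ Edge j t t′ → Edge j u v → InPairs u v ((t , t′) ∷ l) → InPairs u v l
    drop ne e (here (inj₁ (refl , refl))) = ⊥-elim (ne e)
    drop ne e (here (inj₂ (refl , refl))) = ⊥-elim (ne (swap e))
    drop ne e (there m) = m

    -- If one cross were missing, the link of `j` off `o` would lie in three pairs, against
    -- `finish`.
    all-crosses : ∀ {j} → S j → Outside j → Edge j p r × Edge j p s × Edge j q r × Edge j q s
    all-crosses {j} yj out with edge? j p r | edge? j p s | edge? j q r | edge? j q s
    ... | yes e₁ | yes e₂ | yes e₃ | yes e₄ = e₁ , e₂ , e₃ , e₄
    ... | no n₁ | _ | _ | _ = ⊥-elim (finish yj (proj₁ out) ((p , s) ∷ (q , r) ∷ (q , s) ∷ []) ℕₚ.≤-refl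
            λ yu yv u≢o v≢o e → drop n₁ e (cross yj out yu yv u≢o v≢o e))
    ... | yes _ | no n₂ | _ | _ = ⊥-elim (finish yj (proj₁ out) ((p , r) ∷ (q , r) ∷ (q , s) ∷ []) ℕₚ.≤-refl
            λ yu yv u≢o v≢o e → lem e (cross yj out yu yv u≢o v≢o e))
      where
      lem : ∀ {u v} → Edge j u v → InPairs u v crosses → InPairs u v ((p , r) ∷ (q , r) ∷ (q , s) ∷ [])
      lem e (here z) = here z
      lem e (there m) = there (drop n₂ e m)
    ... | yes _ | yes _ | no n₃ | _ = ⊥-elim (finish yj (proj₁ out) ((p , r) ∷ (p , s) ∷ (q , s) ∷ []) ℕₚ.≤-refl
            λ yu yv u≢o v≢o e → lem e (cross yj out yu yv u≢o v≢o e))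
      where
      lem : ∀ {u v} → Edge j u v → InPairs u v crosses → InPairs u v ((p , r) ∷ (p , s) ∷ (q , s) ∷ [])
      lem e (here z) = here z
      lem e (there (here z)) = there (here z)
      lem e (there (there m)) = there (there (drop n₃ e m))
    ... | yes _ | yes _ | yes _ | no n₄ = ⊥-elim (finish yj (proj₁ out) ((p , r) ∷ (p , s) ∷ (q , r) ∷ []) ℕₚ.≤-refl
            λ yu yv u≢o v≢o e → lem e (cross yj out yu yv u≢o v≢o e))
      where
      lem : ∀ {u v} → Edge j u v → InPairs u v crosses → InPairs u v ((p , r) ∷ (p , s) ∷ (q , r) ∷ [])
      lem e (here z) = here z
      lem e (there (here z)) = there (here z)
      lem e (there (there (here z))) = there (there (here z))
      lem e (there (there (there m))) = there (there (there (drop n₄ e m)))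

    module _ {t} (yt : S t) (out : Outside t) where

      private
        t≢o = proj₁ out
        t≢p = proj₁ (proj₂ out)
        t≢q = proj₁ (proj₂ (proj₂ out))
        t≢r = proj₁ (proj₂ (proj₂ (proj₂ out)))
        t≢s = proj₂ (proj₂ (proj₂ (proj₂ out)))
        tpr = proj₁ (all-crosses yt out)
        tps = proj₁ (proj₂ (all-crosses yt out))
        tqr = proj₁ (proj₂ (proj₂ (all-crosses yt out)))
        tqs = proj₂ (proj₂ (proj₂ (all-crosses yt out)))
        yp = proj₁ pq
        yq = proj₁ (proj₂ pq)
        yr = proj₁ rs
        ys = proj₁ (proj₂ rs)
        sm : ∀ {i j : Fin n} → i ≢ j → j ≢ i
        sm f e = f (≡.sym e)

      -- `tpr` and `vqs` would be disjoint edges. So `o`, `p`, `q`, `r`, `s` and `t` are all the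
      -- points of `S`.
      no-sixth : ∀ {v} → S v → Outside v → v ≢ t → ⊥
      no-sixth {v} yv out′ v≢t = clash tpr (proj₂ (proj₂ (proj₂ (all-crosses yv out′)))) yt yp yr yv yq ys
        (v≢t , proj₁ (proj₂ out′) , proj₁ (proj₂ (proj₂ (proj₂ out′))))
        (sm t≢q , sm p≢q , q≢r) (sm t≢s , sm p≢s , sm r≢s)

      cases : ∀ {v} → S v → v ≢ o → v ≢ t → v ≡ p ⊎ v ≡ q ⊎ v ≡ r ⊎ v ≡ s
      cases {v} yv v≢o v≢t with v Finₚ.≟ p | v Finₚ.≟ q | v Finₚ.≟ r | v Finₚ.≟ s
      ... | yes e | _ | _ | _ = inj₁ e
      ... | no _ | yes e | _ | _ = inj₂ (inj₁ e)
      ... | no _ | no _ | yes e | _ = inj₂ (inj₂ (inj₁ e))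
      ... | no _ | no _ | no _ | yes e = inj₂ (inj₂ (inj₂ e))
      ... | no n₁ | no n₂ | no n₃ | no n₄ = ⊥-elim (no-sixth yv (v≢o , n₁ , n₂ , n₃ , n₄) v≢t)

      -- A cross in the link of `o`, such as `pr`, would be disjoint from the edge formed by `t` and
      -- the complementary cross, here `tqs`.
      base : ∀ {u v} → L u v → u ≢ t → v ≢ t → InPairs u v ((p , q) ∷ (r , s) ∷ [])
      base {u} {v} (yu , yv , e) u≢t v≢t
        with cases yu (λ z → proj₁ (distinct e) (≡.sym z)) u≢t | cases yv (λ z →
            proj₁ (proj₂ (distinct e)) (≡.sym z)) v≢t
      ... | inj₁ refl | inj₁ refl = ⊥-elim (proj₂ (proj₂ (distinct e)) refl)
      ... | inj₁ refl | inj₂ (inj₁ refl) = here (inj₁ (refl , refl))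
      ... | inj₁ refl | inj₂ (inj₂ (inj₁ refl)) = ⊥-elim (clash tqs e yt yq ys yo yu yv (sm t≢o ,
          proj₁ (proj₂ (L-≢ pq)) , proj₁ (proj₂ (L-≢ rs))) (u≢t , p≢q , p≢s) (v≢t , sm q≢r , r≢s))
      ... | inj₁ refl | inj₂ (inj₂ (inj₂ refl)) = ⊥-elim (clash tqr e yt yq yr yo yu yv (sm t≢o ,
          proj₁ (proj₂ (L-≢ pq)) , proj₁ (L-≢ rs)) (u≢t , p≢q , p≢r) (v≢t , sm q≢s , sm r≢s))
      ... | inj₂ (inj₁ refl) | inj₁ refl = here (inj₂ (refl , refl))
      ... | inj₂ (inj₁ refl) | inj₂ (inj₁ refl) = ⊥-elim (proj₂ (proj₂ (distinct e)) refl)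
      ... | inj₂ (inj₁ refl) | inj₂ (inj₂ (inj₁ refl)) = ⊥-elim (clash tps e yt yp ys yo yu yv (sm t≢o ,
          proj₁ (L-≢ pq) , proj₁ (proj₂ (L-≢ rs))) (u≢t , sm p≢q , q≢s) (v≢t , sm p≢r , r≢s))
      ... | inj₂ (inj₁ refl) | inj₂ (inj₂ (inj₂ refl)) = ⊥-elim (clash tpr e yt yp yr yo yu yv (sm t≢o ,
          proj₁ (L-≢ pq) , proj₁ (L-≢ rs)) (u≢t , sm p≢q , q≢r) (v≢t , sm p≢s , sm r≢s))
      ... | inj₂ (inj₂ (inj₁ refl)) | inj₁ refl = ⊥-elim (clash tqs e yt yq ys yo yu yv (sm t≢o ,
          proj₁ (proj₂ (L-≢ pq)) , proj₁ (proj₂ (L-≢ rs))) (u≢t , sm q≢r , r≢s) (v≢t , p≢q , p≢s))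
      ... | inj₂ (inj₂ (inj₁ refl)) | inj₂ (inj₁ refl) = ⊥-elim (clash tps e yt yp ys yo yu yv (sm t≢o ,
          proj₁ (L-≢ pq) , proj₁ (proj₂ (L-≢ rs))) (u≢t , sm p≢r , r≢s) (v≢t , sm p≢q , q≢s))
      ... | inj₂ (inj₂ (inj₁ refl)) | inj₂ (inj₂ (inj₁ refl)) = ⊥-elim (proj₂ (proj₂ (distinct e)) refl)
      ... | inj₂ (inj₂ (inj₁ refl)) | inj₂ (inj₂ (inj₂ refl)) = there (here (inj₁ (refl , refl)))
      ... | inj₂ (inj₂ (inj₂ refl)) | inj₁ refl = ⊥-elim (clash tqr e yt yq yr yo yu yv (sm t≢o ,
          proj₁ (proj₂ (L-≢ pq)) , proj₁ (L-≢ rs)) (u≢t , sm q≢s , sm r≢s) (v≢t , p≢q , p≢r))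
      ... | inj₂ (inj₂ (inj₂ refl)) | inj₂ (inj₁ refl) = ⊥-elim (clash tpr e yt yp yr yo yu yv (sm t≢o ,
          proj₁ (L-≢ pq) , proj₁ (L-≢ rs)) (u≢t , sm p≢s , sm r≢s) (v≢t , sm p≢q , q≢r))
      ... | inj₂ (inj₂ (inj₂ refl)) | inj₂ (inj₂ (inj₁ refl)) = there (here (inj₂ (refl , refl)))
      ... | inj₂ (inj₂ (inj₂ refl)) | inj₂ (inj₂ (inj₂ refl)) = ⊥-elim (proj₂ (proj₂ (distinct e)) refl)

      -- With two of the pairs at `t` missing, the link of `o` lies in four pairs: the other two at
      -- `t` and, by `base`, `pq` and `rs`. This contradicts `outside`.
      missing-two : ∀ i j k l → (∀ {v} → v ≡ p ⊎ v ≡ q ⊎ v ≡ r ⊎ v ≡ s → v ≡ i ⊎ v ≡ j ⊎ v ≡ k ⊎ v ≡ l) →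
                    ¬ Edge o t i → ¬ Edge o t j → ⊥
      missing-two i j k l which ni nj with outside ((t , k) ∷ (t , l) ∷ (p , q) ∷ (r , s) ∷
          []) (ℕ.s≤s (ℕ.s≤s (ℕ.s≤s (ℕ.s≤s ℕ.z≤n))))
      ... | u , v , uv , notin with u Finₚ.≟ t | v Finₚ.≟ t
      ...   | no u≢t | no v≢t = notin (there (there (base uv u≢t v≢t)))
      ...   | yes refl | _ with which (cases (proj₁ (proj₂ uv)) (λ z → proj₁ (proj₂ (L-≢ uv)) (≡.sym z)) (λ z →
          proj₂ (proj₂ (L-≢ uv)) (≡.sym z)))
      ...     | inj₁ refl = ni (proj₂ (proj₂ uv))
      ...     | inj₂ (inj₁ refl) = nj (proj₂ (proj₂ uv))
      ...     | inj₂ (inj₂ (inj₁ refl)) = notin (here (inj₁ (refl , refl)))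
      ...     | inj₂ (inj₂ (inj₂ refl)) = notin (there (here (inj₁ (refl , refl))))
      missing-two i j k l which ni nj
          | u , v , uv , notin | no u≢t | yes refl with which (cases (proj₁ uv) (λ z → proj₁ (L-≢ uv) (≡.sym z)) u≢t)
      ...     | inj₁ refl = ni (swap (proj₂ (proj₂ uv)))
      ...     | inj₂ (inj₁ refl) = nj (swap (proj₂ (proj₂ uv)))
      ...     | inj₂ (inj₂ (inj₁ refl)) = notin (here (inj₂ (refl , refl)))
      ...     | inj₂ (inj₂ (inj₂ refl)) = notin (there (here (inj₂ (refl , refl))))

      -- The pairs in the link of z meet each of ik, ti, tk, tm, so only ti and tk are left.

      last : ∀ {i k m z} → L i k → S m → S z → Edge o t i → Edge o t k → Edge o t m →
             t ≢ i → t ≢ k → t ≢ m → i ≢ m → k ≢ m → z ≢ o → z ≢ t → z ≢ i → z ≢ k → z ≢ m → ⊥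
      last {i} {k} {m} {z} (yi , yk , oik) ym yz oti otk otm t≢i t≢k t≢m i≢m k≢m z≢o z≢t z≢i z≢k z≢m =
        finish yz z≢o ((t , i) ∷ (t , k) ∷ []) (ℕ.s≤s (ℕ.s≤s ℕ.z≤n)) lem
        where
        i≢k = proj₂ (proj₂ (distinct oik))
        lem : ∀ {u v} → S u → S v → u ≢ o → v ≢ o → Edge z u v → InPairs u v ((t , i) ∷ (t , k) ∷ [])
        lem yu yv u≢o v≢o e
          with meet oik e yo yi yk yz yu yv (z≢o , z≢i , z≢k) u≢o v≢o
             | meet oti e yo yt yi yz yu yv (z≢o , z≢t , z≢i) u≢o v≢o
             | meet otk e yo yt yk yz yu yv (z≢o , z≢t , z≢k) u≢o v≢o
             | meet otm e yo yt ym yz yu yv (z≢o , z≢t , z≢m) u≢o v≢o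
        ... | inj₁ (inj₁ refl) | _ | inj₁ (inj₁ e′) | _ = ⊥-elim (t≢i (≡.sym e′))
        ... | inj₁ (inj₁ refl) | _ | inj₁ (inj₂ e′) | _ = ⊥-elim (i≢k e′)
        ... | inj₁ (inj₁ refl) | _ | inj₂ (inj₁ e′) | _ = here (inj₂ (refl , e′))
        ... | inj₁ (inj₁ refl) | _ | inj₂ (inj₂ refl) | inj₁ (inj₁ e′) = ⊥-elim (t≢i (≡.sym e′))
        ... | inj₁ (inj₁ refl) | _ | inj₂ (inj₂ refl) | inj₁ (inj₂ e′) = ⊥-elim (i≢m e′)
        ... | inj₁ (inj₁ refl) | _ | inj₂ (inj₂ refl) | inj₂ (inj₁ e′) = ⊥-elim (t≢k (≡.sym e′))
        ... | inj₁ (inj₁ refl) | _ | inj₂ (inj₂ refl) | inj₂ (inj₂ e′) = ⊥-elim (k≢m e′)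
        ... | inj₁ (inj₂ refl) | inj₁ (inj₁ e′) | _ | _ = ⊥-elim (t≢k (≡.sym e′))
        ... | inj₁ (inj₂ refl) | inj₁ (inj₂ e′) | _ | _ = ⊥-elim (i≢k (≡.sym e′))
        ... | inj₁ (inj₂ refl) | inj₂ (inj₁ e′) | _ | _ = there (here (inj₂ (refl , e′)))
        ... | inj₁ (inj₂ refl) | inj₂ (inj₂ refl) | _ | inj₁ (inj₁ e′) = ⊥-elim (t≢k (≡.sym e′))
        ... | inj₁ (inj₂ refl) | inj₂ (inj₂ refl) | _ | inj₁ (inj₂ e′) = ⊥-elim (k≢m e′)
        ... | inj₁ (inj₂ refl) | inj₂ (inj₂ refl) | _ | inj₂ (inj₁ e′) = ⊥-elim (t≢i (≡.sym e′))
        ... | inj₁ (inj₂ refl) | inj₂ (inj₂ refl) | _ | inj₂ (inj₂ e′) = ⊥-elim (i≢m e′)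
        ... | inj₂ (inj₁ refl) | _ | inj₁ (inj₁ e′) | _ = here (inj₁ (e′ , refl))
        ... | inj₂ (inj₁ refl) | _ | inj₂ (inj₁ e′) | _ = ⊥-elim (t≢i (≡.sym e′))
        ... | inj₂ (inj₁ refl) | _ | inj₂ (inj₂ e′) | _ = ⊥-elim (i≢k e′)
        ... | inj₂ (inj₁ refl) | _ | inj₁ (inj₂ refl) | inj₁ (inj₁ e′) = ⊥-elim (t≢k (≡.sym e′))
        ... | inj₂ (inj₁ refl) | _ | inj₁ (inj₂ refl) | inj₁ (inj₂ e′) = ⊥-elim (k≢m e′)
        ... | inj₂ (inj₁ refl) | _ | inj₁ (inj₂ refl) | inj₂ (inj₁ e′) = ⊥-elim (t≢i (≡.sym e′))
        ... | inj₂ (inj₁ refl) | _ | inj₁ (inj₂ refl) | inj₂ (inj₂ e′) = ⊥-elim (i≢m e′)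
        ... | inj₂ (inj₂ refl) | inj₂ (inj₁ e′) | _ | _ = ⊥-elim (t≢k (≡.sym e′))
        ... | inj₂ (inj₂ refl) | inj₂ (inj₂ e′) | _ | _ = ⊥-elim (i≢k (≡.sym e′))
        ... | inj₂ (inj₂ refl) | inj₁ (inj₁ e′) | _ | _ = there (here (inj₁ (e′ , refl)))
        ... | inj₂ (inj₂ refl) | inj₁ (inj₂ refl) | _ | inj₁ (inj₁ e′) = ⊥-elim (t≢i (≡.sym e′))
        ... | inj₂ (inj₂ refl) | inj₁ (inj₂ refl) | _ | inj₁ (inj₂ e′) = ⊥-elim (i≢m e′)
        ... | inj₂ (inj₂ refl) | inj₁ (inj₂ refl) | _ | inj₂ (inj₁ e′) = ⊥-elim (t≢k (≡.sym e′))
        ... | inj₂ (inj₂ refl) | inj₁ (inj₂ refl) | _ | inj₂ (inj₂ e′) = ⊥-elim (k≢m e′)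

      private
        p≢o = sm (proj₁ (L-≢ pq))
        q≢o = sm (proj₁ (proj₂ (L-≢ pq)))
        r≢o = sm (proj₁ (L-≢ rs))
        s≢o = sm (proj₁ (proj₂ (L-≢ rs)))

      -- By `missing-two`, at least three of the pairs `tp`, `tq`, `tr`, `ts` lie in the link of
      -- `o`. Three of them involve both ends of `pq` or both ends of `rs`, which is the
      -- configuration of `last`; the point it rules out is the remaining one.
      impossible : ⊥
      impossible with edge? o t p | edge? o t q | edge? o t r | edge? o t s
      ... | yes fp | yes fq | yes fr | _ = last pq yr ys fp fq fr t≢p t≢q t≢r p≢r q≢r s≢o (sm t≢s) (sm p≢s) (sm q≢s)
          (sm r≢s)
      ... | yes fp | yes fq | no fr | yes fs = last pq ys yr fp fq fs t≢p t≢q t≢s p≢s q≢s r≢o (sm t≢r) (sm p≢r) (sm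
          q≢r) r≢s
      ... | yes fp | yes fq | no fr | no fs = missing-two r s p q
            (λ { (inj₁ e) → inj₂ (inj₂ (inj₁ e)) ; (inj₂ (inj₁ e)) → inj₂ (inj₂ (inj₂ e)) ; (inj₂ (inj₂ (inj₁ e))) →
                inj₁ e ; (inj₂ (inj₂ (inj₂ e))) → inj₂ (inj₁ e) })
            fr fs
      ... | yes fp | no fq | yes fr | yes fs = last rs yp yq fr fs fp t≢r t≢s t≢p (sm p≢r) (sm p≢s) q≢o (sm t≢q) q≢r
          q≢s (sm p≢q)
      ... | yes fp | no fq | no fr | _ = missing-two q r p s
            (λ { (inj₁ e) → inj₂ (inj₂ (inj₁ e)) ; (inj₂ (inj₁ e)) → inj₁ e ; (inj₂ (inj₂ (inj₁ e))) →
                inj₂ (inj₁ e) ; (inj₂ (inj₂ (inj₂ e))) → inj₂ (inj₂ (inj₂ e)) })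
            fq fr
      ... | yes fp | no fq | yes fr | no fs = missing-two q s p r
            (λ { (inj₁ e) → inj₂ (inj₂ (inj₁ e)) ; (inj₂ (inj₁ e)) → inj₁ e ; (inj₂ (inj₂ (inj₁ e))) →
                inj₂ (inj₂ (inj₂ e)) ; (inj₂ (inj₂ (inj₂ e))) → inj₂ (inj₁ e) })
            fq fs
      ... | no fp | yes fq | yes fr | yes fs = last rs yq yp fr fs fq t≢r t≢s t≢q (sm q≢r) (sm q≢s) p≢o (sm t≢p) p≢r
          p≢s p≢q
      ... | no fp | no fq | _ | _ = missing-two p q r s (λ z → z) fp fq
      ... | no fp | yes fq | no fr | _ = missing-two p r q s
            (λ { (inj₁ e) → inj₁ e ; (inj₂ (inj₁ e)) → inj₂ (inj₂ (inj₁ e)) ; (inj₂ (inj₂ (inj₁ e))) →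
                inj₂ (inj₁ e) ; (inj₂ (inj₂ (inj₂ e))) → inj₂ (inj₂ (inj₂ e)) })
            fp fr
      ... | no fp | yes fq | yes fr | no fs = missing-two p s q r
            (λ { (inj₁ e) → inj₁ e ; (inj₂ (inj₁ e)) → inj₂ (inj₂ (inj₁ e)) ; (inj₂ (inj₂ (inj₁ e))) →
                inj₂ (inj₂ (inj₂ e)) ; (inj₂ (inj₂ (inj₂ e))) → inj₂ (inj₁ e) })
            fp fs

  contradiction : ⊥
  contradiction = lem matching
    where
    lem : Matching → ⊥
    lem (p , q , r , s , pq , rs , n₁ , n₂ , n₃ , n₄) =
      let t , yt , out = fifth p q r s in impossible pq rs n₁ n₂ n₃ n₄ yt out

-- From hypergraphs on subsets to triples, and from copies to embeddings

∣⁅i⁆∪p∣ : ∀ {n} {i : Fin n} (p : Subset n) → i Subset.∉ p → ∣ ⁅ i ⁆ ∪ p ∣ ≡ suc ∣ p ∣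
∣⁅i⁆∪p∣ {i = zero}  (true ∷ p)  i∉p = ⊥-elim (i∉p Vec.here)
∣⁅i⁆∪p∣ {i = zero}  (false ∷ p) i∉p = ≡.cong (λ q → suc ∣ q ∣) (Subsetₚ.∪-identityˡ p)
∣⁅i⁆∪p∣ {i = suc i} (true ∷ p)  i∉p = ≡.cong suc (∣⁅i⁆∪p∣ p (i∉p ∘ Vec.there))
∣⁅i⁆∪p∣ {i = suc i} (false ∷ p) i∉p = ∣⁅i⁆∪p∣ p (i∉p ∘ Vec.there)

triangle : ∀ {n} → Fin n → Fin n → Fin n → Subset n
triangle i j k = ⁅ i ⁆ ∪ (⁅ j ⁆ ∪ ⁅ k ⁆)

∉pair : ∀ {n} {i j k : Fin n} → i ≢ j → i ≢ k → i Subset.∉ ⁅ j ⁆ ∪ ⁅ k ⁆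
∉pair i≢j i≢k m = [ (λ p → i≢j (Subsetₚ.x∈⁅y⁆⇒x≡y _ p)) , (λ p → i≢k (Subsetₚ.x∈⁅y⁆⇒x≡y _ p)) ]′ (Subsetₚ.x∈p∪q⁻ _ _
    m)

∣pair∣ : ∀ {n} {j k : Fin n} → j ≢ k → ∣ ⁅ j ⁆ ∪ ⁅ k ⁆ ∣ ≡ 2
∣pair∣ {k = k} j≢k = ≡.trans (∣⁅i⁆∪p∣ ⁅ k ⁆ (λ m → j≢k (Subsetₚ.x∈⁅y⁆⇒x≡y k m))) (≡.cong suc (Subsetₚ.∣⁅x⁆∣≡1 k))

∣triangle∣ : ∀ {n} {i j k : Fin n} → i ≢ j → i ≢ k → j ≢ k → ∣ triangle i j k ∣ ≡ 3
∣triangle∣ i≢j i≢k j≢k = ≡.trans (∣⁅i⁆∪p∣ _ (∉pair i≢j i≢k)) (≡.cong suc (∣pair∣ j≢k))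

-- With a repeated index the set has at most two elements, so uniformity alone makes `triples`
-- irreflexive.
∣degenerate∣ : ∀ {n} (i k : Fin n) → ∣ triangle i i k ∣ ≢ 3
∣degenerate∣ i k e with ≡.trans (≡.sym (≡.cong ∣_∣ (≡.trans (≡.sym (Subsetₚ.∪-assoc ⁅ i ⁆ ⁅ i ⁆ ⁅ k ⁆))
                                                   (≡.cong (_∪ ⁅ k ⁆) (Subsetₚ.∪-idem ⁅ i ⁆))))) e
... | e′ with i Finₚ.≟ k
...   | no i≢k with ≡.trans (≡.sym (∣pair∣ i≢k)) e′
...     | ()
∣degenerate∣ i .i e | e′ | yes refl with ≡.trans (≡.sym (≡.trans (≡.cong ∣_∣ (Subsetₚ.∪-idem ⁅ i ⁆)) (Subsetₚ.∣⁅x⁆∣≡1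
    i))) e′
...     | ()

triples : ∀ {n} → Hypergraph 3 n → Triples n
triples G = record
  { E      = λ i j k → does (Hypergraph.E? G (triangle i j k))
  ; swap₁₂ = λ i j k → ≡.cong (λ e → does (Hypergraph.E? G e)) (lem i j k)
  ; swap₂₃ = λ i j k → ≡.cong (λ e → does (Hypergraph.E? G (⁅ i ⁆ ∪ e))) (Subsetₚ.∪-comm ⁅ j ⁆ ⁅ k ⁆)
  ; irr    = λ i k → dec-false (Hypergraph.E? G (triangle i i k)) (λ e → ∣degenerate∣ i k (Hypergraph.uniform G e))
  }
  where
  lem : ∀ {n} (i j k : Fin n) → triangle i j k ≡ triangle j i k
  lem i j k = ≡.trans (≡.sym (Subsetₚ.∪-assoc ⁅ i ⁆ ⁅ j ⁆ ⁅ k ⁆))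
    (≡.trans (≡.cong (_∪ ⁅ k ⁆) (Subsetₚ.∪-comm ⁅ i ⁆ ⁅ j ⁆)) (Subsetₚ.∪-assoc ⁅ j ⁆ ⁅ i ⁆ ⁅ k ⁆))

∈image⁻ : ∀ {m n} (f : Fin m → Fin n) (p : Subset m) {y} → y Subset.∈ image f p → ∃ λ i → i Subset.∈ p × f i ≡ y
∈image⁻ f p {y} m = does⁻ (Finₚ.any? λ i → (i Subsetₚ.∈? p) ×-dec (f i Finₚ.≟ y))
  (≡.trans (≡.sym (Vecₚ.lookup∘tabulate _ y)) (Vecₚ.[]=⇒lookup m))

∈image⁺ : ∀ {m n} (f : Fin m → Fin n) {p : Subset m} {i} → i Subset.∈ p → f i Subset.∈ image f p
∈image⁺ f {p} {i} m = Vecₚ.lookup⇒[]= _ _ (≡.trans (Vecₚ.lookup∘tabulate _ (f i))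
  (dec-true (Finₚ.any? λ i′ → (i′ Subsetₚ.∈? p) ×-dec (f i′ Finₚ.≟ f i)) (i , m , refl)))

∈triangle⁻ : ∀ {n} {i j k y : Fin n} → y Subset.∈ triangle i j k → y ≡ i ⊎ y ≡ j ⊎ y ≡ k
∈triangle⁻ m with Subsetₚ.x∈p∪q⁻ _ _ m
... | inj₁ p = inj₁ (Subsetₚ.x∈⁅y⁆⇒x≡y _ p)
... | inj₂ p with Subsetₚ.x∈p∪q⁻ _ _ p
...   | inj₁ q = inj₂ (inj₁ (Subsetₚ.x∈⁅y⁆⇒x≡y _ q))
...   | inj₂ q = inj₂ (inj₂ (Subsetₚ.x∈⁅y⁆⇒x≡y _ q))

∈triangle⁺ : ∀ {n} {i j k y : Fin n} → y ≡ i ⊎ y ≡ j ⊎ y ≡ k → y Subset.∈ triangle i j k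
∈triangle⁺ (inj₁ refl)        = Subsetₚ.x∈p∪q⁺ (inj₁ (Subsetₚ.x∈⁅x⁆ _))
∈triangle⁺ (inj₂ (inj₁ refl)) = Subsetₚ.x∈p∪q⁺ (inj₂ (Subsetₚ.x∈p∪q⁺ (inj₁ (Subsetₚ.x∈⁅x⁆ _))))
∈triangle⁺ (inj₂ (inj₂ refl)) = Subsetₚ.x∈p∪q⁺ (inj₂ (Subsetₚ.x∈p∪q⁺ (inj₂ (Subsetₚ.x∈⁅x⁆ _))))

image-triangle : ∀ {m n} (f : Fin m → Fin n) i j k → image f (triangle i j k) ≡ triangle (f i) (f j) (f k)
image-triangle f i j k = Subsetₚ.⊆-antisym to from
  where
  to : image f (triangle i j k) Subset.⊆ triangle (f i) (f j) (f k)
  to m with ∈image⁻ f _ m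
  ... | _ , p , refl with ∈triangle⁻ {i = i} p
  ...   | inj₁ refl        = ∈triangle⁺ {i = f i} (inj₁ refl)
  ...   | inj₂ (inj₁ refl) = ∈triangle⁺ {i = f i} (inj₂ (inj₁ refl))
  ...   | inj₂ (inj₂ refl) = ∈triangle⁺ {i = f i} (inj₂ (inj₂ refl))
  from : triangle (f i) (f j) (f k) Subset.⊆ image f (triangle i j k)
  from m with ∈triangle⁻ {i = f i} m
  ... | inj₁ refl        = ∈image⁺ f (∈triangle⁺ {i = i} (inj₁ refl))
  ... | inj₂ (inj₁ refl) = ∈image⁺ f (∈triangle⁺ {i = i} (inj₂ (inj₁ refl)))
  ... | inj₂ (inj₂ refl) = ∈image⁺ f (∈triangle⁺ {i = i} (inj₂ (inj₂ refl)))

join : ∀ {A : Set} m {n} → (Fin m → A) → (Fin n → A) → Fin (m ℕ.+ n) → A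
join m f g = [ f , g ]′ ∘ Fin.splitAt m

-- An edge of `_⊔_` is described by its halves `take m e` and `drop m e`; this is the corresponding
-- description of its image.
image-join : ∀ m {n p} (f : Fin m → Fin p) (g : Fin n → Fin p) (u : Subset m) (v : Subset n) →
             image (join m f g) (u Vec.++ v) ≡ image f u ∪ image g v
image-join m {n} f g u v = Subsetₚ.⊆-antisym to from
  where
  to : image (join m f g) (u Vec.++ v) Subset.⊆ image f u ∪ image g v
  to y∈ with ∈image⁻ (join m f g) (u Vec.++ v) y∈
  ... | i , i∈ , refl with Fin.splitAt m i | Vecₚ.lookup-splitAt m u v i
  ...   | inj₁ a | e = Subsetₚ.x∈p∪q⁺ (inj₁ (∈image⁺ f (Vecₚ.lookup⇒[]= a u (≡.trans (≡.sym e) (Vecₚ.[]=⇒lookup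
      i∈)))))
  ...   | inj₂ b | e = Subsetₚ.x∈p∪q⁺ (inj₂ (∈image⁺ g (Vecₚ.lookup⇒[]= b v (≡.trans (≡.sym e) (Vecₚ.[]=⇒lookup
      i∈)))))
  from : image f u ∪ image g v Subset.⊆ image (join m f g) (u Vec.++ v)
  from y∈ with Subsetₚ.x∈p∪q⁻ _ _ y∈
  ... | inj₁ p with ∈image⁻ f u p
  ...   | a , a∈ , refl = ≡.subst (Subset._∈ image (join m f g) (u Vec.++ v)) (≡.cong [ f ,
      g ]′ (Finₚ.splitAt-↑ˡ m a n))
            (∈image⁺ (join m f g) (Vecₚ.lookup⇒[]= _ _ (≡.trans (Vecₚ.lookup-++ˡ u v a) (Vecₚ.[]=⇒lookup a∈))))
  from y∈ | inj₂ p with ∈image⁻ g v p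
  ...   | b , b∈ , refl = ≡.subst (Subset._∈ image (join m f g) (u Vec.++ v)) (≡.cong [ f ,
      g ]′ (Finₚ.splitAt-↑ʳ m n b))
            (∈image⁺ (join m f g) (Vecₚ.lookup⇒[]= _ _ (≡.trans (Vecₚ.lookup-++ʳ u v b) (Vecₚ.[]=⇒lookup b∈))))

image-⊥ : ∀ {m n} (f : Fin m → Fin n) → image f Subset.⊥ ≡ Subset.⊥
image-⊥ f = Subsetₚ.⊆-antisym (λ m → ⊥-elim (Subsetₚ.∉⊥ (proj₁ (proj₂ (∈image⁻ f _ m))))) (λ m →
    ⊥-elim (Subsetₚ.∉⊥ m))

⊔-⊑ : ∀ {r m n p} {F : Hypergraph r m} {H : Hypergraph r n} {G : Hypergraph r p} (φ : F ⊑ G) (ψ : H ⊑ G) →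
      (∀ a b → proj₁ φ a ≢ proj₁ ψ b) → (F ⊔ H) ⊑ G
⊔-⊑ {m = m} {n} {F = F} {H} {G} (f , f-inj , f-edge) (g , g-inj , g-edge) apart = join m f g , inj , edge
  where
  inj : ∀ {i j} → join m f g i ≡ join m f g j → i ≡ j
  inj {i} {j} e with Fin.splitAt m i in ei | Fin.splitAt m j in ej
  ... | inj₁ a | inj₁ b = ≡.trans (≡.sym (Finₚ.splitAt⁻¹-↑ˡ ei)) (≡.trans (≡.cong (Fin._↑ˡ n) (f-inj e))
      (Finₚ.splitAt⁻¹-↑ˡ ej))
  ... | inj₁ a | inj₂ b = ⊥-elim (apart a b e)
  ... | inj₂ a | inj₁ b = ⊥-elim (apart b a (≡.sym e))
  ... | inj₂ a | inj₂ b = ≡.trans (≡.sym (Finₚ.splitAt⁻¹-↑ʳ ei)) (≡.trans (≡.cong (m Fin.↑ʳ_) (g-inj e))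
      (Finₚ.splitAt⁻¹-↑ʳ ej))
  split : ∀ e → image (join m f g) e ≡ image f (Vec.take m e) ∪ image g (Vec.drop m e)
  split e = ≡.trans (≡.cong (image (join m f g)) (≡.sym (Vecₚ.take++drop≡id m e))) (image-join m f g (Vec.take m e)
      (Vec.drop m e))
  edge : ∀ e → Hypergraph.E (F ⊔ H) e → Hypergraph.E G (image (join m f g) e)
  edge e (inj₁ (Fe , d≡⊥)) = ≡.subst (Hypergraph.E G) (≡.sym (≡.trans (split e) (≡.trans
    (≡.cong (image f (Vec.take m e) ∪_) (≡.trans (≡.cong (image g) d≡⊥) (image-⊥ g))) (Subsetₚ.∪-identityʳ _))))
        (f-edge _ Fe)
  edge e (inj₂ (t≡⊥ , He)) = ≡.subst (Hypergraph.E G) (≡.sym (≡.trans (split e) (≡.trans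
    (≡.cong (_∪ image g (Vec.drop m e)) (≡.trans (≡.cong (image f) t≡⊥) (image-⊥ f))) (Subsetₚ.∪-identityˡ _))))
        (g-edge _ He)

module _ {n} (G : Hypergraph 3 n) where

  open Edges (triples G)

  Edge⇒E : ∀ {i j k} → Edge i j k → Hypergraph.E G (triangle i j k)
  Edge⇒E {i} {j} {k} = does⁻ (Hypergraph.E? G (triangle i j k))

  Edge⇒≢ : ∀ {i j k} → Edge i j k → i ≢ j × i ≢ k × j ≢ k
  Edge⇒≢ {i} {j} {k} e = lem , (λ { refl → lem′ (≡.trans (Triples.swap₂₃ (triples G) i i j) e) }) ,
      (λ { refl → lem′ (≡.trans (Triples.swap₂₃ (triples G) j j i) (≡.trans (Triples.swap₁₂ (triples G) j i j) e)) })
    where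
    lem′ : ∀ {i k} → Edge i i k → ⊥
    lem′ {i} {k} e with ≡.trans (≡.sym (Triples.irr (triples G) i k)) e
    ... | ()
    lem : i ≢ j
    lem refl = lem′ e

  edge-⊑ : ∀ {i j k} → Edge i j k → ∃ λ (φ : K 3 3 ⊑ G) → ∀ a → proj₁ φ a ∈ i ∷ j ∷ k ∷ []
  edge-⊑ {i} {j} {k} e = (f , (λ {a} {b} → inj {a} {b}) , edge) , mem
    where
    f : Fin 3 → Fin n
    f zero = i
    f (suc zero) = j
    f (suc (suc zero)) = k
    i≢j = proj₁ (Edge⇒≢ e)
    i≢k = proj₁ (proj₂ (Edge⇒≢ e))
    j≢k = proj₂ (proj₂ (Edge⇒≢ e))
    inj : ∀ {a b} → f a ≡ f b → a ≡ b
    inj {zero} {zero} _ = refl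
    inj {zero} {suc zero} p = ⊥-elim (i≢j p)
    inj {zero} {suc (suc zero)} p = ⊥-elim (i≢k p)
    inj {suc zero} {zero} p = ⊥-elim (i≢j (≡.sym p))
    inj {suc zero} {suc zero} _ = refl
    inj {suc zero} {suc (suc zero)} p = ⊥-elim (j≢k p)
    inj {suc (suc zero)} {zero} p = ⊥-elim (i≢k (≡.sym p))
    inj {suc (suc zero)} {suc zero} p = ⊥-elim (j≢k (≡.sym p))
    inj {suc (suc zero)} {suc (suc zero)} _ = refl
    edge : ∀ p → ∣ p ∣ ≡ 3 → Hypergraph.E G (image f p)
    edge (true ∷ true ∷ true ∷ []) _ = ≡.subst (Hypergraph.E G) (≡.sym (image-triangle f zero (suc zero) (suc (suc
        zero)))) (Edge⇒E e)
    edge (true ∷ true ∷ false ∷ []) ()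
    edge (true ∷ false ∷ true ∷ []) ()
    edge (true ∷ false ∷ false ∷ []) ()
    edge (false ∷ true ∷ true ∷ []) ()
    edge (false ∷ true ∷ false ∷ []) ()
    edge (false ∷ false ∷ true ∷ []) ()
    edge (false ∷ false ∷ false ∷ []) ()
    mem : ∀ a → f a ∈ i ∷ j ∷ k ∷ []
    mem zero = here refl
    mem (suc zero) = there (here refl)
    mem (suc (suc zero)) = there (there (here refl))

  K₄-⊑ : ∀ {a b c d} → Edge a b c → Edge a b d → Edge a c d → Edge b c d →
         ∃ λ (φ : K 3 4 ⊑ G) → ∀ i → proj₁ φ i ∈ a ∷ b ∷ c ∷ d ∷ []
  K₄-⊑ {a} {b} {c} {d} e₁ e₂ e₃ e₄ = (f , (λ {i} {j} → inj {i} {j}) , edge) , mem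
    where
    f : Fin 4 → Fin n
    f zero = a
    f (suc zero) = b
    f (suc (suc zero)) = c
    f (suc (suc (suc zero))) = d
    a≢b = proj₁ (Edge⇒≢ e₁)
    a≢c = proj₁ (proj₂ (Edge⇒≢ e₁))
    b≢c = proj₂ (proj₂ (Edge⇒≢ e₁))
    a≢d = proj₁ (proj₂ (Edge⇒≢ e₂))
    b≢d = proj₂ (proj₂ (Edge⇒≢ e₂))
    c≢d = proj₂ (proj₂ (Edge⇒≢ e₃))
    inj : ∀ {i j} → f i ≡ f j → i ≡ j
    inj {zero} {zero} _ = refl
    inj {zero} {suc zero} p = ⊥-elim (a≢b p)
    inj {zero} {suc (suc zero)} p = ⊥-elim (a≢c p)
    inj {zero} {suc (suc (suc zero))} p = ⊥-elim (a≢d p)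
    inj {suc zero} {zero} p = ⊥-elim (a≢b (≡.sym p))
    inj {suc zero} {suc zero} _ = refl
    inj {suc zero} {suc (suc zero)} p = ⊥-elim (b≢c p)
    inj {suc zero} {suc (suc (suc zero))} p = ⊥-elim (b≢d p)
    inj {suc (suc zero)} {zero} p = ⊥-elim (a≢c (≡.sym p))
    inj {suc (suc zero)} {suc zero} p = ⊥-elim (b≢c (≡.sym p))
    inj {suc (suc zero)} {suc (suc zero)} _ = refl
    inj {suc (suc zero)} {suc (suc (suc zero))} p = ⊥-elim (c≢d p)
    inj {suc (suc (suc zero))} {zero} p = ⊥-elim (a≢d (≡.sym p))
    inj {suc (suc (suc zero))} {suc zero} p = ⊥-elim (b≢d (≡.sym p))
    inj {suc (suc (suc zero))} {suc (suc zero)} p = ⊥-elim (c≢d (≡.sym p))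
    inj {suc (suc (suc zero))} {suc (suc (suc zero))} _ = refl
    of : ∀ i j k → Edge (f i) (f j) (f k) → Hypergraph.E G (image f (triangle i j k))
    of i j k e = ≡.subst (Hypergraph.E G) (≡.sym (image-triangle f i j k)) (Edge⇒E e)
    edge : ∀ p → ∣ p ∣ ≡ 3 → Hypergraph.E G (image f p)
    edge (true ∷ true ∷ true ∷ false ∷ []) _ = of zero (suc zero) (suc (suc zero)) e₁
    edge (true ∷ true ∷ false ∷ true ∷ []) _ = of zero (suc zero) (suc (suc (suc zero))) e₂
    edge (true ∷ false ∷ true ∷ true ∷ []) _ = of zero (suc (suc zero)) (suc (suc (suc zero))) e₃
    edge (false ∷ true ∷ true ∷ true ∷ []) _ = of (suc zero) (suc (suc zero)) (suc (suc (suc zero))) e₄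
    edge (true ∷ true ∷ true ∷ true ∷ []) ()
    edge (true ∷ true ∷ false ∷ false ∷ []) ()
    edge (true ∷ false ∷ true ∷ false ∷ []) ()
    edge (true ∷ false ∷ false ∷ true ∷ []) ()
    edge (true ∷ false ∷ false ∷ false ∷ []) ()
    edge (false ∷ true ∷ true ∷ false ∷ []) ()
    edge (false ∷ true ∷ false ∷ true ∷ []) ()
    edge (false ∷ true ∷ false ∷ false ∷ []) ()
    edge (false ∷ false ∷ true ∷ true ∷ []) ()
    edge (false ∷ false ∷ true ∷ false ∷ []) ()
    edge (false ∷ false ∷ false ∷ true ∷ []) ()
    edge (false ∷ false ∷ false ∷ false ∷ []) ()
    mem : ∀ i → f i ∈ a ∷ b ∷ c ∷ d ∷ []
    mem zero = here refl
    mem (suc zero) = there (here refl)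
    mem (suc (suc zero)) = there (there (here refl))
    mem (suc (suc (suc zero))) = there (there (there (here refl)))

  -- `Copy` grows around its K₄, whereas in `K 3 4 ⊔ k · K 3 3` the edges form a summand of their
  -- own. Hence the two embeddings are kept separate and are joined only in `free⇒Free`. Membership
  -- in `l` is what makes each new edge disjoint from both.
  copy-parts : ∀ {k l} → Copy k l → ∃₂ λ (φ : K 3 4 ⊑ G) (ψ : (k · K 3 3) ⊑ G) →
               (∀ a b → proj₁ φ a ≢ proj₁ ψ b) × (∀ a → proj₁ φ a ∈ l) × (∀ b → proj₁ ψ b ∈ l)
  copy-parts (k₄ e₁ e₂ e₃ e₄) = proj₁ K₄ , ((λ ()) , (λ {}) , λ _ ()) , (λ _ ()) , proj₂ K₄ , λ ()
    where K₄ = K₄-⊑ e₁ e₂ e₃ e₄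
  copy-parts (add {k} {l} c i j m e i∉ j∉ m∉) with copy-parts c | edge-⊑ e
  ... | φ , ψ , apart , φ∈ , ψ∈ | χ , χ∈ = φ , ⊔-⊑ {F = K 3 3} {k · K 3 3} {G} χ ψ (λ a b p →
      new a (≡.subst (_∈ l) (≡.sym p) (ψ∈ b))) ,
      (λ a b → apart′ a b) , (λ a → there (there (there (φ∈ a)))) , mem
    where
    new : ∀ a → proj₁ χ a ∉ l
    new a with proj₁ χ a | χ∈ a
    ... | _ | here refl = i∉
    ... | _ | there (here refl) = j∉
    ... | _ | there (there (here refl)) = m∉
    apart′ : ∀ a b → proj₁ φ a ≢ join 3 (proj₁ χ) (proj₁ ψ) b
    apart′ a b with Fin.splitAt 3 b
    ... | inj₁ b′ = λ p → new b′ (≡.subst (_∈ l) p (φ∈ a))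
    ... | inj₂ b′ = apart a b′
    mem : ∀ b → join 3 (proj₁ χ) (proj₁ ψ) b ∈ i ∷ j ∷ m ∷ l
    mem b with Fin.splitAt 3 b
    ... | inj₂ b′ = there (there (there (ψ∈ b′)))
    ... | inj₁ b′ with proj₁ χ b′ | χ∈ b′
    ...   | _ | here p = here p
    ...   | _ | there (here p) = there (here p)
    ...   | _ | there (there (here p)) = there (there (here p))

  free⇒Free : ∀ {k} → ((K 3 4 ⊔ k · K 3 3) -free) G → Free k
  free⇒Free {k} free c = let φ , ψ , apart , _ = copy-parts c in free (⊔-⊑ {F = K 3 4} {k · K 3 3} {G} φ ψ apart)

-- Arithmetic in an ordered field

module _ (ℝ : CompleteOrderedField) where

  open CompleteOrderedField ℝ
  open CommutativeRing commutativeRing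
    using (ring; setoid; semiring;
           +-cong; +-congˡ; +-congʳ; *-cong; *-congˡ; *-congʳ;
           +-assoc; +-comm; +-identityˡ; +-identityʳ; *-assoc; *-comm; *-identityˡ; *-identityʳ;
           distribˡ; distribʳ; zeroˡ; zeroʳ; -‿cong; -‿inverseˡ; -‿inverseʳ)
    renaming (-_ to ⊖_; refl to ≈-refl; sym to ≈-sym; trans to ≈-trans; reflexive to ≈-reflexive)
  open RingProperties ring
    using (-‿distribˡ-*; -‿distribʳ-*; -‿+-comm; -0#≈0#; -‿involutive)
  open IsDecTotalOrder isDecTotalOrder
    using (_≤?_; antisym; total)
    renaming (refl to ≤-refl; reflexive to ≤-reflexive; trans to ≤-trans;
              ≤-respˡ-≈ to ≤-respˡ; ≤-respʳ-≈ to ≤-respʳ)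
  open import Relation.Binary.Reasoning.Setoid setoid

  infixl 6 _⊖′_
  infix 4 _<_

  _⊖′_ : Carrier → Carrier → Carrier
  x ⊖′ y = x ⊕ ⊖ y

  _<_ : Carrier → Carrier → Set
  x < y = ¬ (y ≤ x)

  <⇒≤ : ∀ {x y} → x < y → x ≤ y
  <⇒≤ {x} {y} y≰x with total x y
  ... | inj₁ x≤y = x≤y
  ... | inj₂ y≤x = ⊥-elim (y≰x y≤x)

  ≤-stable : ∀ {x y} → ¬ ¬ (x ≤ y) → x ≤ y
  ≤-stable {x} {y} ¬¬p with x ≤? y
  ... | yes p = p
  ... | no ¬p = ⊥-elim (¬¬p ¬p)

  ≤-<-connex : ∀ x y → x ≤ y ⊎ y < x
  ≤-<-connex x y with x ≤? y
  ... | yes p = inj₁ p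
  ... | no ¬p = inj₂ ¬p

  +-mono : ∀ {a b c d} → a ≤ b → c ≤ d → a ⊕ c ≤ b ⊕ d
  +-mono {a} {b} {c} {d} p q =
    ≤-trans (+-monoʳ-≤ a q)
      (≤-respˡ (+-comm d a) (≤-respʳ (+-comm d b) (+-monoʳ-≤ d p)))

  0≤+ : ∀ {a b} → 0# ≤ a → 0# ≤ b → 0# ≤ a ⊕ b
  0≤+ p q = ≤-respˡ (+-identityˡ 0#) (+-mono p q)

  ≤⇒0≤ : ∀ {a b} → a ≤ b → 0# ≤ b ⊖′ a
  ≤⇒0≤ {a} {b} p = ≤-respˡ (-‿inverseˡ a) (≤-respʳ (+-comm (⊖ a) b) (+-monoʳ-≤ (⊖ a) p))

  0≤⇒≤ : ∀ {a b} → 0# ≤ b ⊖′ a → a ≤ b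
  0≤⇒≤ {a} {b} p = ≤-respˡ (+-identityʳ a) (≤-respʳ lem (+-monoʳ-≤ a p))
    where
    lem : a ⊕ (b ⊖′ a) ≈ b
    lem = begin
      a ⊕ (b ⊖′ a)   ≈⟨ +-comm a _ ⟩
      b ⊖′ a ⊕ a     ≈⟨ +-assoc b _ a ⟩
      b ⊕ (⊖ a ⊕ a)  ≈⟨ +-congˡ (-‿inverseˡ a) ⟩
      b ⊕ 0#         ≈⟨ +-identityʳ b ⟩
      b              ∎

  ⊖-≈0 : ∀ {a b} → a ≈ b → b ⊖′ a ≈ 0#
  ⊖-≈0 {a} {b} p = ≈-trans (+-congˡ (-‿cong p)) (-‿inverseʳ b)

  ≈0-⊖ : ∀ {a b} → b ⊖′ a ≈ 0# → b ≈ a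
  ≈0-⊖ {a} {b} p = begin
    b              ≈⟨ +-identityʳ b ⟨
    b ⊕ 0#         ≈⟨ +-congˡ (-‿inverseˡ a) ⟨
    b ⊕ (⊖ a ⊕ a)  ≈⟨ +-assoc b _ a ⟨
    b ⊖′ a ⊕ a     ≈⟨ +-congʳ p ⟩
    0# ⊕ a         ≈⟨ +-identityˡ a ⟩
    a              ∎

  0≤sq : ∀ a → 0# ≤ a ⊛ a
  0≤sq a with total 0# a
  ... | inj₁ p = *-nonneg p p
  ... | inj₂ p = ≤-respʳ lem (*-nonneg q q)
    where
    q : 0# ≤ ⊖ a
    q = ≤-respʳ (+-identityˡ _) (≤⇒0≤ p)
    lem : ⊖ a ⊛ ⊖ a ≈ a ⊛ a
    lem = begin
      ⊖ a ⊛ ⊖ a      ≈⟨ -‿distribˡ-* a (⊖ a) ⟨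
      ⊖ (a ⊛ ⊖ a)    ≈⟨ -‿cong (-‿distribʳ-* a a) ⟨
      ⊖ ⊖ (a ⊛ a)    ≈⟨ -‿involutive _ ⟩
      a ⊛ a          ∎

  0≤1 : 0# ≤ 1#
  0≤1 = ≤-respʳ (*-identityˡ 1#) (0≤sq 1#)

  0<1 : 0# < 1#
  0<1 p = 1≉0 (antisym p 0≤1)

  -- The separate clause for 1 makes `# 1` reduce to `1#`, so that literals in an `Expr` agree with
  -- indicator values without conversion.
  fromℕ : ℕ → Carrier
  fromℕ zero          = 0#
  fromℕ (suc zero)    = 1#
  fromℕ (suc (suc n)) = 1# ⊕ fromℕ (suc n)

  ι : ℤ → Carrier
  ι (+ n)    = fromℕ n
  ι -[1+ n ] = ⊖ fromℕ (suc n)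

  # : ℕ → Carrier
  # n = ι (+ n)

  fromℕ-suc : ∀ n → fromℕ (suc n) ≈ 1# ⊕ fromℕ n
  fromℕ-suc zero    = ≈-sym (+-identityʳ 1#)
  fromℕ-suc (suc n) = ≈-refl

  fromℕ-+ : ∀ m n → fromℕ (m ℕ.+ n) ≈ fromℕ m ⊕ fromℕ n
  fromℕ-+ zero    n = ≈-sym (+-identityˡ _)
  fromℕ-+ (suc m) n = begin
    fromℕ (suc (m ℕ.+ n))       ≈⟨ fromℕ-suc (m ℕ.+ n) ⟩
    1# ⊕ fromℕ (m ℕ.+ n)        ≈⟨ +-congˡ (fromℕ-+ m n) ⟩
    1# ⊕ (fromℕ m ⊕ fromℕ n)    ≈⟨ +-assoc _ _ _ ⟨
    1# ⊕ fromℕ m ⊕ fromℕ n      ≈⟨ +-congʳ (fromℕ-suc m) ⟨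
    fromℕ (suc m) ⊕ fromℕ n     ∎

  fromℕ-* : ∀ m n → fromℕ (m ℕ.* n) ≈ fromℕ m ⊛ fromℕ n
  fromℕ-* zero    n = ≈-sym (zeroˡ _)
  fromℕ-* (suc m) n = begin
    fromℕ (n ℕ.+ m ℕ.* n)             ≈⟨ fromℕ-+ n (m ℕ.* n) ⟩
    fromℕ n ⊕ fromℕ (m ℕ.* n)         ≈⟨ +-cong (≈-sym (*-identityˡ _)) (fromℕ-* m n) ⟩
    1# ⊛ fromℕ n ⊕ fromℕ m ⊛ fromℕ n  ≈⟨ distribʳ _ _ _ ⟨
    (1# ⊕ fromℕ m) ⊛ fromℕ n          ≈⟨ *-congʳ (fromℕ-suc m) ⟨
    fromℕ (suc m) ⊛ fromℕ n           ∎

  0≤fromℕ : ∀ n → 0# ≤ fromℕ n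
  0≤fromℕ zero    = ≤-refl
  0≤fromℕ (suc n) = ≤-respʳ (≈-sym (fromℕ-suc n)) (0≤+ 0≤1 (0≤fromℕ n))

  ι-neg : ∀ z → ι (ℤ.- z) ≈ ⊖ ι z
  ι-neg (+ zero)  = ≈-sym -0#≈0#
  ι-neg (+ suc n) = ≈-refl
  ι-neg -[1+ n ]  = ≈-sym (-‿involutive _)

  ι-⊖ : ∀ m n → ι (m ℤ.⊖ n) ≈ fromℕ m ⊖′ fromℕ n
  ι-⊖ m zero = ≈-sym (≈-trans (+-congˡ -0#≈0#) (+-identityʳ _))
  ι-⊖ zero (suc n) = ≈-sym (+-identityˡ _)
  ι-⊖ (suc m) (suc n) = begin
    ι (suc m ℤ.⊖ suc n)                       ≡⟨ ≡.cong ι (ℤₚ.[1+m]⊖[1+n]≡m⊖n m n) ⟩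
    ι (m ℤ.⊖ n)                               ≈⟨ ι-⊖ m n ⟩
    fromℕ m ⊖′ fromℕ n                        ≈⟨ +-congʳ (+-identityˡ _) ⟨
    0# ⊕ fromℕ m ⊖′ fromℕ n                   ≈⟨ +-congʳ (+-congʳ (-‿inverseʳ 1#)) ⟨
    1# ⊖′ 1# ⊕ fromℕ m ⊖′ fromℕ n             ≈⟨ +-congʳ (+-assoc _ _ _) ⟩
    1# ⊕ (⊖ 1# ⊕ fromℕ m) ⊖′ fromℕ n          ≈⟨ +-congʳ (+-congˡ (+-comm _ _)) ⟩
    1# ⊕ (fromℕ m ⊕ ⊖ 1#) ⊖′ fromℕ n          ≈⟨ +-congʳ (+-assoc _ _ _) ⟨
    1# ⊕ fromℕ m ⊕ ⊖ 1# ⊖′ fromℕ n            ≈⟨ +-assoc _ _ _ ⟩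
    1# ⊕ fromℕ m ⊕ (⊖ 1# ⊖′ fromℕ n)          ≈⟨ +-congˡ (-‿+-comm 1# (fromℕ n)) ⟩
    1# ⊕ fromℕ m ⊖′ (1# ⊕ fromℕ n)            ≈⟨ +-cong (fromℕ-suc m) (-‿cong (fromℕ-suc n)) ⟨
    fromℕ (suc m) ⊖′ fromℕ (suc n)            ∎

  ι-+ : ∀ a b → ι (a ℤ.+ b) ≈ ι a ⊕ ι b
  ι-+ (+ m)    (+ n)    = fromℕ-+ m n
  ι-+ (+ m)    -[1+ n ] = ι-⊖ m (suc n)
  ι-+ -[1+ m ] (+ n)    = ≈-trans (ι-⊖ n (suc m)) (+-comm _ _)
  ι-+ -[1+ m ] -[1+ n ] = begin
    ⊖ fromℕ (suc (suc (m ℕ.+ n)))        ≡⟨ ≡.cong (λ k → ⊖ fromℕ (suc k)) (ℕₚ.+-suc m n) ⟨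
    ⊖ fromℕ (suc m ℕ.+ suc n)            ≈⟨ -‿cong (fromℕ-+ (suc m) (suc n)) ⟩
    ⊖ (fromℕ (suc m) ⊕ fromℕ (suc n))    ≈⟨ -‿+-comm _ _ ⟨
    ⊖ fromℕ (suc m) ⊖′ fromℕ (suc n)     ∎

  ι-* : ∀ a b → ι (a ℤ.* b) ≈ ι a ⊛ ι b
  ι-* (+ m) (+ n) = ≈-trans (≈-reflexive (≡.cong ι (≡.sym (ℤₚ.pos-* m n)))) (fromℕ-* m n)
  ι-* (+ m) -[1+ n ] = begin
    ι (+ m ℤ.* -[1+ n ])          ≡⟨ ≡.cong ι (ℤₚ.neg-distribʳ-* (+ m) (+ suc n)) ⟨
    ι (ℤ.- (+ m ℤ.* + suc n))     ≈⟨ ι-neg (+ m ℤ.* + suc n) ⟩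
    ⊖ ι (+ m ℤ.* + suc n)         ≈⟨ -‿cong (ι-* (+ m) (+ suc n)) ⟩
    ⊖ (fromℕ m ⊛ fromℕ (suc n))   ≈⟨ -‿distribʳ-* _ _ ⟩
    fromℕ m ⊛ ⊖ fromℕ (suc n)     ∎
  ι-* -[1+ m ] (+ n) = begin
    ι (-[1+ m ] ℤ.* + n)          ≡⟨ ≡.cong ι (ℤₚ.neg-distribˡ-* (+ suc m) (+ n)) ⟨
    ι (ℤ.- (+ suc m ℤ.* + n))     ≈⟨ ι-neg (+ suc m ℤ.* + n) ⟩
    ⊖ ι (+ suc m ℤ.* + n)         ≈⟨ -‿cong (ι-* (+ suc m) (+ n)) ⟩
    ⊖ (fromℕ (suc m) ⊛ fromℕ n)   ≈⟨ -‿distribˡ-* _ _ ⟩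
    ⊖ fromℕ (suc m) ⊛ fromℕ n     ∎
  ι-* -[1+ m ] -[1+ n ] = begin
    ι (+ (suc m ℕ.* suc n))                ≈⟨ fromℕ-* (suc m) (suc n) ⟩
    fromℕ (suc m) ⊛ fromℕ (suc n)          ≈⟨ -‿involutive _ ⟨
    ⊖ ⊖ (fromℕ (suc m) ⊛ fromℕ (suc n))    ≈⟨ -‿cong (-‿distribʳ-* _ _) ⟩
    ⊖ (fromℕ (suc m) ⊛ ⊖ fromℕ (suc n))    ≈⟨ -‿distribˡ-* _ _ ⟩
    ⊖ fromℕ (suc m) ⊛ ⊖ fromℕ (suc n)      ∎

  -- Soundness of normal forms and certificates

  Env : Set
  Env = List Carrier

  at : Env → ℕ → Carrier
  at []      _       = 0#
  at (x ∷ ρ) zero    = x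
  at (x ∷ ρ) (suc i) = at ρ i

  ⟦_⟧ : Expr → Env → Carrier
  ⟦ var i ⟧  ρ = at ρ i
  ⟦ con c ⟧  ρ = ι c
  ⟦ a :+ b ⟧ ρ = ⟦ a ⟧ ρ ⊕ ⟦ b ⟧ ρ
  ⟦ a :* b ⟧ ρ = ⟦ a ⟧ ρ ⊛ ⟦ b ⟧ ρ
  ⟦ :- a ⟧   ρ = ⊖ ⟦ a ⟧ ρ

  private module _ (ρ : Env) where

    mono : Mono → Carrier
    mono []      = 1#
    mono (i ∷ m) = at ρ i ⊛ mono m

    poly : Poly → Carrier
    poly []            = 0#
    poly ((c , m) ∷ p) = ι c ⊛ mono m ⊕ poly p

    insert-ok : ∀ x m → mono (insert x m) ≈ at ρ x ⊛ mono m
    insert-ok x []      = ≈-refl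
    insert-ok x (y ∷ m) with x ℕ.≤ᵇ y
    ... | true  = ≈-refl
    ... | false = begin
      at ρ y ⊛ mono (insert x m)    ≈⟨ *-congˡ (insert-ok x m) ⟩
      at ρ y ⊛ (at ρ x ⊛ mono m)    ≈⟨ *-assoc _ _ _ ⟨
      at ρ y ⊛ at ρ x ⊛ mono m      ≈⟨ *-congʳ (*-comm _ _) ⟩
      at ρ x ⊛ at ρ y ⊛ mono m      ≈⟨ *-assoc _ _ _ ⟩
      at ρ x ⊛ (at ρ y ⊛ mono m)    ∎

    mulMono-ok : ∀ m n → mono (mulMono m n) ≈ mono m ⊛ mono n
    mulMono-ok []      n = ≈-sym (*-identityˡ _)
    mulMono-ok (x ∷ m) n = begin
      mono (insert x (mulMono m n))   ≈⟨ insert-ok x (mulMono m n) ⟩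
      at ρ x ⊛ mono (mulMono m n)     ≈⟨ *-congˡ (mulMono-ok m n) ⟩
      at ρ x ⊛ (mono m ⊛ mono n)      ≈⟨ *-assoc _ _ _ ⟨
      at ρ x ⊛ mono m ⊛ mono n        ∎

    cons-ok : ∀ c m p → poly (cons c m p) ≈ ι c ⊛ mono m ⊕ poly p
    cons-ok (+ zero)  m p = ≈-sym (≈-trans (+-congʳ (zeroˡ _)) (+-identityˡ _))
    cons-ok (+ suc n) m p = ≈-refl
    cons-ok -[1+ n ]  m p = ≈-refl

    swap : ∀ a b c → a ⊕ (b ⊕ c) ≈ b ⊕ (a ⊕ c)
    swap a b c = ≈-trans (≈-sym (+-assoc _ _ _)) (≈-trans (+-congʳ (+-comm _ _)) (+-assoc _ _ _))

    mutual
      +ᴾ-ok : ∀ p q → poly (p +ᴾ q) ≈ poly p ⊕ poly q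
      +ᴾ-ok []            q  = ≈-sym (+-identityˡ _)
      +ᴾ-ok (_ ∷ _)       [] = ≈-sym (+-identityʳ _)
      +ᴾ-ok ((c , m) ∷ p) ((d , n) ∷ q) = merge-ok c m p d n q (cmp m n)

      merge-ok : ∀ c m p d n q (o : Cmp m n) → poly (merge c m p d n q o) ≈
                 (ι c ⊛ mono m ⊕ poly p) ⊕ (ι d ⊛ mono n ⊕ poly q)
      merge-ok c m p d n q lt′ = begin
        ι c ⊛ mono m ⊕ poly (p +ᴾ ((d , n) ∷ q))                ≈⟨ +-congˡ (+ᴾ-ok p ((d , n) ∷ q)) ⟩
        ι c ⊛ mono m ⊕ (poly p ⊕ (ι d ⊛ mono n ⊕ poly q))       ≈⟨ +-assoc _ _ _ ⟨
        (ι c ⊛ mono m ⊕ poly p) ⊕ (ι d ⊛ mono n ⊕ poly q)       ∎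
      merge-ok c m p d n q gt′ = begin
        ι d ⊛ mono n ⊕ poly (ins c m p q)                       ≈⟨ +-congˡ (ins-ok c m p q) ⟩
        ι d ⊛ mono n ⊕ ((ι c ⊛ mono m ⊕ poly p) ⊕ poly q)       ≈⟨ swap _ _ _ ⟩
        (ι c ⊛ mono m ⊕ poly p) ⊕ (ι d ⊛ mono n ⊕ poly q)       ∎
      merge-ok c m p d .m q (eq′ refl) = begin
        poly (cons (c ℤ.+ d) m (p +ᴾ q))                        ≈⟨ cons-ok (c ℤ.+ d) m _ ⟩
        ι (c ℤ.+ d) ⊛ mono m ⊕ poly (p +ᴾ q)                    ≈⟨ +-cong (≈-trans (*-congʳ (ι-+ c d)) (distribʳ _ _
            _)) (+ᴾ-ok p q) ⟩
        (ι c ⊛ mono m ⊕ ι d ⊛ mono m) ⊕ (poly p ⊕ poly q)       ≈⟨ +-assoc _ _ _ ⟩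
        ι c ⊛ mono m ⊕ (ι d ⊛ mono m ⊕ (poly p ⊕ poly q))       ≈⟨ +-congˡ (swap _ _ _) ⟩
        ι c ⊛ mono m ⊕ (poly p ⊕ (ι d ⊛ mono m ⊕ poly q))       ≈⟨ +-assoc _ _ _ ⟨
        (ι c ⊛ mono m ⊕ poly p) ⊕ (ι d ⊛ mono m ⊕ poly q)       ∎

      ins-ok : ∀ c m p q → poly (ins c m p q) ≈ (ι c ⊛ mono m ⊕ poly p) ⊕ poly q
      ins-ok c m p []            = ≈-sym (+-identityʳ _)
      ins-ok c m p ((d , n) ∷ q) = merge-ok c m p d n q (cmp m n)

    scale-ok : ∀ c m p → poly (scale c m p) ≈ ι c ⊛ mono m ⊛ poly p
    scale-ok c m []            = ≈-sym (zeroʳ _)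
    scale-ok c m ((d , n) ∷ p) = begin
      ι (c ℤ.* d) ⊛ mono (mulMono m n) ⊕ poly (scale c m p)
        ≈⟨ +-cong (*-cong (ι-* c d) (mulMono-ok m n)) (scale-ok c m p) ⟩
      ι c ⊛ ι d ⊛ (mono m ⊛ mono n) ⊕ ι c ⊛ mono m ⊛ poly p
        ≈⟨ +-congʳ (exch (ι c) (ι d) (mono m) (mono n)) ⟩
      ι c ⊛ mono m ⊛ (ι d ⊛ mono n) ⊕ ι c ⊛ mono m ⊛ poly p
        ≈⟨ distribˡ _ _ _ ⟨
      ι c ⊛ mono m ⊛ (ι d ⊛ mono n ⊕ poly p) ∎
      where
      exch : ∀ a b c d → a ⊛ b ⊛ (c ⊛ d) ≈ a ⊛ c ⊛ (b ⊛ d)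
      exch a b c d = begin
        a ⊛ b ⊛ (c ⊛ d)    ≈⟨ *-assoc _ _ _ ⟩
        a ⊛ (b ⊛ (c ⊛ d))  ≈⟨ *-congˡ (≈-trans (≈-sym (*-assoc _ _ _)) (≈-trans (*-congʳ (*-comm _ _)) (*-assoc _ _
            _))) ⟩
        a ⊛ (c ⊛ (b ⊛ d))  ≈⟨ *-assoc _ _ _ ⟨
        a ⊛ c ⊛ (b ⊛ d)    ∎

    addAll-ok : ∀ p q → poly (addAll p q) ≈ poly p ⊕ poly q
    addAll-ok []      q = ≈-sym (+-identityˡ _)
    addAll-ok (t ∷ p) q = begin
      poly ((t ∷ []) +ᴾ addAll p q)   ≈⟨ +ᴾ-ok (t ∷ []) (addAll p q) ⟩
      poly (t ∷ []) ⊕ poly (addAll p q) ≈⟨ +-cong (+-identityʳ _) (addAll-ok p q) ⟩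
      _ ⊕ (poly p ⊕ poly q)           ≈⟨ +-assoc _ _ _ ⟨
      poly (t ∷ p) ⊕ poly q           ∎

    *ᴾ-ok : ∀ p q → poly (p *ᴾ q) ≈ poly p ⊛ poly q
    *ᴾ-ok []            q = ≈-sym (zeroˡ _)
    *ᴾ-ok ((c , m) ∷ p) q = begin
      poly (addAll (scale c m q) (p *ᴾ q))        ≈⟨ addAll-ok (scale c m q) _ ⟩
      poly (scale c m q) ⊕ poly (p *ᴾ q)          ≈⟨ +-cong (scale-ok c m q) (*ᴾ-ok p q) ⟩
      ι c ⊛ mono m ⊛ poly q ⊕ poly p ⊛ poly q     ≈⟨ distribʳ _ _ _ ⟨
      (ι c ⊛ mono m ⊕ poly p) ⊛ poly q            ∎

    neg-ok : ∀ p → poly (negᴾ p) ≈ ⊖ poly p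
    neg-ok []            = ≈-sym -0#≈0#
    neg-ok ((c , m) ∷ p) = begin
      ι (ℤ.- c) ⊛ mono m ⊕ poly (negᴾ p)   ≈⟨ +-cong (≈-trans (*-congʳ (ι-neg c)) (≈-sym (-‿distribˡ-* _ _))) (neg-ok
          p) ⟩
      ⊖ (ι c ⊛ mono m) ⊖′ poly p           ≈⟨ -‿+-comm _ _ ⟩
      ⊖ (ι c ⊛ mono m ⊕ poly p)            ∎

    nf-ok : ∀ e → poly (nf e) ≈ ⟦ e ⟧ ρ
    nf-ok (var i)  = ≈-trans (+-identityʳ _) (≈-trans (*-identityˡ _) (*-identityʳ _))
    nf-ok (con c)  = ≈-trans (cons-ok c [] []) (≈-trans (+-identityʳ _) (*-identityʳ _))
    nf-ok (a :+ b) = ≈-trans (+ᴾ-ok (nf a) (nf b)) (+-cong (nf-ok a) (nf-ok b))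
    nf-ok (a :* b) = ≈-trans (*ᴾ-ok (nf a) (nf b)) (*-cong (nf-ok a) (nf-ok b))
    nf-ok (:- a)   = ≈-trans (neg-ok (nf a)) (-‿cong (nf-ok a))

  identity : ∀ a b → isZero (nf (a :- b)) ≡ true → ∀ ρ → ⟦ a ⟧ ρ ≈ ⟦ b ⟧ ρ
  identity a b z ρ = ≈0-⊖ (≈-trans (≈-sym (nf-ok ρ (a :- b))) (lem (nf (a :- b)) z))
    where
    lem : ∀ p → isZero p ≡ true → poly ρ p ≈ 0#
    lem [] _ = ≈-refl

  Holds : Env → Atom → Set
  Holds ρ (a ≦ b) = ⟦ a ⟧ ρ ≤ ⟦ b ⟧ ρ
  Holds ρ (a ≐ b) = ⟦ a ⟧ ρ ≈ ⟦ b ⟧ ρ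
  Holds ρ (a ≺ b) = ⟦ a ⟧ ρ < ⟦ b ⟧ ρ

  private
    0≤hyp : ∀ ρ hs → All (Holds ρ) hs → ∀ i → 0# ≤ ⟦ nth diff hs i ⟧ ρ
    0≤hyp ρ []             ps       i       = ≤-refl
    0≤hyp ρ ((a ≦ b) ∷ hs) (p ∷ ps) zero    = ≤⇒0≤ p
    0≤hyp ρ ((a ≐ b) ∷ hs) (p ∷ ps) zero    = ≤-reflexive (≈-sym (⊖-≈0 p))
    0≤hyp ρ ((a ≺ b) ∷ hs) (p ∷ ps) zero    = ≤⇒0≤ (<⇒≤ p)
    0≤hyp ρ (_ ∷ hs)       (p ∷ ps) (suc i) = 0≤hyp ρ hs ps i

    eqn≈0 : ∀ ρ hs → All (Holds ρ) hs → ∀ i → ⟦ nth eqDiff hs i ⟧ ρ ≈ 0#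
    eqn≈0 ρ []             ps       i       = ≈-refl
    eqn≈0 ρ ((a ≦ b) ∷ hs) (p ∷ ps) zero    = ≈-refl
    eqn≈0 ρ ((a ≐ b) ∷ hs) (p ∷ ps) zero    = ⊖-≈0 p
    eqn≈0 ρ ((a ≺ b) ∷ hs) (p ∷ ps) zero    = ≈-refl
    eqn≈0 ρ (_ ∷ hs)       (p ∷ ps) (suc i) = eqn≈0 ρ hs ps i

    0≤cert : ∀ ρ hs → All (Holds ρ) hs → ∀ c → 0# ≤ ⟦ toExpr hs c ⟧ ρ
    0≤cert ρ hs ps (hyp i)   = 0≤hyp ρ hs ps i
    0≤cert ρ hs ps (eqn i e) = ≤-reflexive (≈-sym (≈-trans (*-congʳ (eqn≈0 ρ hs ps i)) (zeroˡ _)))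
    0≤cert ρ hs ps (sq e)    = 0≤sq _
    0≤cert ρ hs ps (cst n)   = 0≤fromℕ n
    0≤cert ρ hs ps (c ⊞ d)   = 0≤+ (0≤cert ρ hs ps c) (0≤cert ρ hs ps d)
    0≤cert ρ hs ps (c ⊠ d)   = *-nonneg (0≤cert ρ hs ps c) (0≤cert ρ hs ps d)

  +-pos : ∀ {a b} → 0# < a → 0# ≤ b → 0# < a ⊕ b
  +-pos {a} {b} p q r = p (≤-trans (≤-respˡ (+-identityʳ a) (+-monoʳ-≤ a q)) r)

  0<fromℕ : ∀ n → 0# < fromℕ (suc n)
  0<fromℕ n p = +-pos 0<1 (0≤fromℕ n) (≤-respˡ (fromℕ-suc n) p)

  *-cancel-0≤ : ∀ {a b} → 0# < a → 0# ≤ a ⊛ b → 0# ≤ b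
  *-cancel-0≤ {a} {b} 0<a p with total 0# b
  ... | inj₁ q = q
  ... | inj₂ q with inverse a (λ a≈0 → 0<a (≤-reflexive a≈0))
  ...   | a⁻¹ , aa⁻¹≈1 = ≤-respʳ lem (*-nonneg 0≤a⁻¹ p)
    where
    lem : a⁻¹ ⊛ (a ⊛ b) ≈ b
    lem = begin
      a⁻¹ ⊛ (a ⊛ b)  ≈⟨ *-assoc _ _ _ ⟨
      a⁻¹ ⊛ a ⊛ b    ≈⟨ *-congʳ (≈-trans (*-comm _ _) aa⁻¹≈1) ⟩
      1# ⊛ b         ≈⟨ *-identityˡ b ⟩
      b              ∎
    -- The reciprocal is `a` times a square, hence nonnegative.
    sq-inv : a ⊛ (a⁻¹ ⊛ a⁻¹) ≈ a⁻¹
    sq-inv = ≈-trans (≈-sym (*-assoc _ _ _)) (≈-trans (*-congʳ aa⁻¹≈1) (*-identityˡ _))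
    0≤a⁻¹ : 0# ≤ a⁻¹
    0≤a⁻¹ = ≤-respʳ sq-inv (*-nonneg (<⇒≤ 0<a) (0≤sq a⁻¹))

  -- The sum of hypotheses times nonnegative quantities given by the
  -- certificate must be a positive multiple of the right side minus the left.

  by : ∀ hs (k : ℕ) a b c →
       isZero (nf (con (+ suc k) :* (b :- a) :- toExpr hs c)) ≡ true →
       ∀ ρ → All (Holds ρ) hs → ⟦ a ⟧ ρ ≤ ⟦ b ⟧ ρ
  by hs k a b c z ρ ps = 0≤⇒≤ (*-cancel-0≤ (0<fromℕ k)
    (≤-respʳ (≈-sym (identity (con (+ suc k) :* (b :- a)) (toExpr hs c) z ρ)) (0≤cert ρ hs ps c)))

  pattern v₀ = var 0
  pattern v₁ = var 1
  pattern v₂ = var 2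
  pattern v₃ = var 3
  pattern v₄ = var 4
  pattern v₅ = var 5
  pattern v₆ = var 6
  pattern v₇ = var 7
  pattern v₈ = var 8
  pattern v₉ = var 9

  combine : List Atom → List (ℕ × Expr) → Expr
  combine hs []            = con (+ 0)
  combine hs ((i , e) ∷ c) = nth eqDiff hs i :* e :+ combine hs c

  private
    combine≈0 : ∀ ρ hs → All (Holds ρ) hs → ∀ c → ⟦ combine hs c ⟧ ρ ≈ 0#
    combine≈0 ρ hs ps []            = ≈-refl
    combine≈0 ρ hs ps ((i , e) ∷ c) = ≈-trans
      (+-cong (≈-trans (*-congʳ (eqn≈0 ρ hs ps i)) (zeroˡ _)) (combine≈0 ρ hs ps c)) (+-identityˡ _)

  -- An equation may be multiplied by a polynomial of any sign, so here the certificate is a linear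
  -- combination of equations with polynomial coefficients.
  equate : ∀ hs a b c → isZero (nf ((b :- a) :- combine hs c)) ≡ true →
           ∀ ρ → All (Holds ρ) hs → ⟦ a ⟧ ρ ≈ ⟦ b ⟧ ρ
  equate hs a b c z ρ ps =
    ≈-sym (≈0-⊖ (≈-trans (identity (b :- a) (combine hs c) z ρ) (combine≈0 ρ hs ps c)))

  -- Weighted sums over the vertices

  open SemiringSum semiring
    using (sum; sum-cong-≋; ∑-distrib-+; ∑-comm; *-distribˡ-sum)

  Weights : ℕ → Set
  Weights n = Fin n → Carrier

  sum-cong : ∀ {n} {f g : Weights n} → (∀ i → f i ≈ g i) → sum f ≈ sum g
  sum-cong = sum-cong-≋

  sum-mono : ∀ {n} {f g : Weights n} → (∀ i → f i ≤ g i) → sum f ≤ sum g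
  sum-mono {zero}  p = ≤-refl
  sum-mono {suc n} p = +-mono (p zero) (sum-mono (p ∘ suc))

  sum-0 : ∀ n → sum {n} (λ _ → 0#) ≈ 0#
  sum-0 zero    = ≈-refl
  sum-0 (suc n) = ≈-trans (+-identityˡ _) (sum-0 n)

  sum-nonneg : ∀ {n} {f : Weights n} → (∀ i → 0# ≤ f i) → 0# ≤ sum f
  sum-nonneg {n} p = ≤-respˡ (sum-0 n) (sum-mono p)

  [_] : Bool → Carrier
  [ true ]  = 1#
  [ false ] = 0#

  0≤[] : ∀ b → 0# ≤ [ b ]
  0≤[] true  = 0≤1
  0≤[] false = ≤-refl

  []≤1 : ∀ b → [ b ] ≤ 1#
  []≤1 true  = ≤-refl
  []≤1 false = 0≤1

  δ : ∀ {n} → Fin n → Fin n → Carrier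
  δ a i = [ does (a Finₚ.≟ i) ]

  δ-refl : ∀ {n} (a : Fin n) → δ a a ≈ 1#
  δ-refl a with a Finₚ.≟ a
  ... | yes _ = ≈-refl
  ... | no ¬p = ⊥-elim (¬p refl)

  δ-≢ : ∀ {n} {a i : Fin n} → a ≢ i → δ a i ≈ 0#
  δ-≢ {a = a} {i} a≢i with a Finₚ.≟ i
  ... | yes p = ⊥-elim (a≢i p)
  ... | no _  = ≈-refl

  opaque
    dot : ∀ {n} → Weights n → Weights n → Carrier
    dot x f = sum (λ i → x i ⊛ f i)

    dot-congʳ : ∀ {n} {x f g : Weights n} → (∀ i → f i ≈ g i) → dot x f ≈ dot x g
    dot-congʳ p = sum-cong (λ i → *-congˡ (p i))

    dot-comm : ∀ {n} (x f : Weights n) → dot x f ≈ dot f x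
    dot-comm x f = sum-cong (λ i → *-comm (x i) (f i))

    dot-+ : ∀ {n} (x f g : Weights n) → dot x (λ i → f i ⊕ g i) ≈ dot x f ⊕ dot x g
    dot-+ x f g = ≈-trans (sum-cong (λ i → distribˡ (x i) (f i) (g i)))
      (∑-distrib-+ (λ i → x i ⊛ f i) (λ i → x i ⊛ g i))

    dot-* : ∀ {n} (x : Weights n) c (f : Weights n) → dot x (λ i → c ⊛ f i) ≈ c ⊛ dot x f
    dot-* x c f = ≈-trans
      (sum-cong (λ i → identity (v₀ :* (v₁ :* v₂)) (v₁ :* (v₀ :* v₂)) refl (x i ∷ c ∷ f i ∷ [])))
      (≈-sym (*-distribˡ-sum c (λ i → x i ⊛ f i)))

    dot-const : ∀ {n} (x : Weights n) c → dot x (λ _ → c) ≈ c ⊛ sum x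
    dot-const x c = ≈-trans (sum-cong (λ i → *-comm (x i) c)) (≈-sym (*-distribˡ-sum c x))

    dot-+ˡ : ∀ {n} (x y f : Weights n) → dot (λ i → x i ⊕ y i) f ≈ dot x f ⊕ dot y f
    dot-+ˡ x y f = ≈-trans (sum-cong (λ i → distribʳ (f i) (x i) (y i)))
      (∑-distrib-+ (λ i → x i ⊛ f i) (λ i → y i ⊛ f i))

    dot-δ : ∀ {n} (a : Fin n) (f : Weights n) → dot (δ a) f ≈ f a
    dot-δ {suc n} zero f = begin
      1# ⊛ f zero ⊕ sum (λ i → 0# ⊛ f (suc i))  ≈⟨ +-cong (*-identityˡ _) (≈-trans (sum-cong (λ i →
          zeroˡ (f (suc i)))) (sum-0 n)) ⟩
      f zero ⊕ 0#                               ≈⟨ +-identityʳ _ ⟩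
      f zero                                    ∎
    dot-δ (suc a) f = begin
      0# ⊛ f zero ⊕ sum (λ i → δ (suc a) (suc i) ⊛ f (suc i))  ≈⟨ +-cong (zeroˡ _) (sum-cong (λ i →
          *-congʳ (δ-suc a i))) ⟩
      0# ⊕ dot (δ a) (f ∘ suc)                                 ≈⟨ +-identityˡ _ ⟩
      dot (δ a) (f ∘ suc)                                      ≈⟨ dot-δ a (f ∘ suc) ⟩
      f (suc a)                                                ∎
      where
      δ-suc : ∀ {n} (a i : Fin n) → δ (suc a) (suc i) ≈ δ a i
      δ-suc a i with a Finₚ.≟ i
      ... | yes _ = ≈-refl
      ... | no _  = ≈-refl

  NonNeg : ∀ {n} → Weights n → Set
  NonNeg x = ∀ i → 0# ≤ x i

  0<? : ∀ a → Dec (0# < a)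
  0<? a = ¬? (a ≤? 0#)

  opaque
    unfolding dot

    -- Terms of weight zero agree on both sides, so the comparison is required on the support only.
    -- Most combinatorial conditions enter the estimates through this.
    dot-mono : ∀ {n} {x f g : Weights n} → NonNeg x → (∀ i → 0# < x i → f i ≤ g i) → dot x f ≤ dot x g
    dot-mono {x = x} {f} {g} nn p = sum-mono lem
      where
      lem : ∀ i → x i ⊛ f i ≤ x i ⊛ g i
      lem i with 0<? (x i)
      ... | yes q = by ((con (+ 0) ≦ v₀) ∷ (v₁ ≦ v₂) ∷ []) 0 (v₀ :* v₁) (v₀ :* v₂) (hyp 0 ⊠ hyp 1) refl
                      (x i ∷ f i ∷ g i ∷ []) (nn i ∷ p i q ∷ [])
      ... | no ¬q = ≤-reflexive (≈-trans (*-congʳ xi≈0) (≈-trans (zeroˡ _) (≈-sym (≈-trans (*-congʳ xi≈0) (zeroˡ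
          _)))))
        where
        xi≈0 : x i ≈ 0#
        xi≈0 = antisym (≤-stable ¬q) (nn i)

  dot-cong⁺ : ∀ {n} {x f g : Weights n} → NonNeg x → (∀ i → 0# < x i → f i ≈ g i) → dot x f ≈ dot x g
  dot-cong⁺ nn p = antisym (dot-mono nn (λ i q → ≤-reflexive (p i q)))
                           (dot-mono nn (λ i q → ≤-reflexive (≈-sym (p i q))))

  opaque
    unfolding dot

    dot-nonneg : ∀ {n} {x f : Weights n} → NonNeg x → (∀ i → 0# < x i → 0# ≤ f i) → 0# ≤ dot x f
    dot-nonneg {n} {x} nn p = ≤-respˡ (≈-trans (sum-cong (λ i → zeroʳ (x i))) (sum-0 n)) (dot-mono nn p)

  -- Deletion of `a` is the case `v = ⊖ x a`, with the vertex set unchanged. One expansion formula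
  -- thus serves both deletions and the variation at a maximiser.
  bump : ∀ {n} → Weights n → Fin n → Carrier → Weights n
  bump x a v i = x i ⊕ v ⊛ δ a i

  opaque
    unfolding dot

    dot-bump : ∀ {n} (x : Weights n) a v f → dot (bump x a v) f ≈ dot x f ⊕ v ⊛ f a
    dot-bump x a v f = ≈-trans (dot-+ˡ x (λ i → v ⊛ δ a i) f) (+-congˡ (begin
      sum (λ i → v ⊛ δ a i ⊛ f i)    ≈⟨ sum-cong (λ i → *-assoc v (δ a i) (f i)) ⟩
      sum (λ i → v ⊛ (δ a i ⊛ f i))  ≈⟨ *-distribˡ-sum v (λ i → δ a i ⊛ f i) ⟨
      v ⊛ dot (δ a) f                ≈⟨ *-congˡ (dot-δ a f) ⟩
      v ⊛ f a                        ∎))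

    sum≈dot : ∀ {n} (x : Weights n) → sum x ≈ dot x (λ _ → 1#)
    sum≈dot x = sum-cong (λ i → ≈-sym (*-identityʳ (x i)))

  sum-bump : ∀ {n} (x : Weights n) a v → sum (bump x a v) ≈ sum x ⊕ v
  sum-bump x a v = begin
    sum (bump x a v)               ≈⟨ sum≈dot (bump x a v) ⟩
    dot (bump x a v) (λ _ → 1#)    ≈⟨ dot-bump x a v (λ _ → 1#) ⟩
    dot x (λ _ → 1#) ⊕ v ⊛ 1#      ≈⟨ +-cong (≈-sym (sum≈dot x)) (*-identityʳ v) ⟩
    sum x ⊕ v                      ∎

  sqs : ∀ {n} → Weights n → Carrier
  sqs x = dot x x

  sqs-bump : ∀ {n} (x : Weights n) a v → sqs (bump x a v) ≈ sqs x ⊕ # 2 ⊛ v ⊛ x a ⊕ v ⊛ v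
  sqs-bump x a v = ≈-trans (dot-bump x a v (bump x a v)) (≈-trans
    (+-cong (≈-trans (dot-comm x (bump x a v)) (dot-bump x a v x)) (*-congˡ (+-congˡ (*-congˡ (δ-refl a)))))
    (identity (v₀ :+ v₁ :* v₂ :+ v₁ :* (v₂ :+ v₁ :* nat 1)) (v₀ :+ nat 2 :* v₁ :* v₂ :+ v₁ :* v₁) refl
      (sqs x ∷ v ∷ x a ∷ [])))

  infixl 8 _∖_
  _∖_ : ∀ {n} → Weights n → Fin n → Weights n
  x ∖ a = bump x a (⊖ x a)

  ∖-at : ∀ {n} (x : Weights n) a → (x ∖ a) a ≈ 0#
  ∖-at x a = ≈-trans (+-congˡ (*-congˡ (δ-refl a)))
    (identity (v₀ :+ :- v₀ :* nat 1) (nat 0) refl (x a ∷ []))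

  ∖-≢ : ∀ {n} (x : Weights n) {a i} → a ≢ i → (x ∖ a) i ≈ x i
  ∖-≢ x {a} {i} a≢i = ≈-trans (+-congˡ (*-congˡ (δ-≢ a≢i)))
    (identity (v₀ :+ :- v₁ :* nat 0) v₀ refl (x i ∷ x a ∷ []))

  ∖-nonneg : ∀ {n} {x : Weights n} → NonNeg x → ∀ a → NonNeg (x ∖ a)
  ∖-nonneg {x = x} nn a i with a Finₚ.≟ i
  ... | yes refl = ≤-reflexive (≈-sym (identity (v₀ :+ :- v₀ :* nat 1) (nat 0) refl (x a ∷ [])))
  ... | no  _    = ≤-respʳ (≈-sym (identity (v₀ :+ :- v₁ :* nat 0) v₀ refl (x i ∷ x a ∷ []))) (nn i)

  ∖-supp : ∀ {n} (x : Weights n) {a i} → 0# < (x ∖ a) i → a ≢ i × 0# < x i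
  ∖-supp x {a} {i} p = lem , λ q → p (≤-respˡ (≈-sym (∖-≢ x lem)) q)
    where
    lem : a ≢ i
    lem refl = p (≤-reflexive (∖-at x a))

  supp-∖ : ∀ {n} (x : Weights n) {a i} → a ≢ i → 0# < x i → 0# < (x ∖ a) i
  supp-∖ x a≢i p q = p (≤-respˡ (∖-≢ x a≢i) q)

  sum-∖ : ∀ {n} (x : Weights n) a → sum x ≈ sum (x ∖ a) ⊕ x a
  sum-∖ x a = equate ((v₀ ≐ v₁ :+ :- v₂) ∷ []) v₁ (v₀ :+ v₂) ((0 , nat 1 :* :- nat 1) ∷ []) refl
    (sum (x ∖ a) ∷ sum x ∷ x a ∷ []) (sum-bump x a (⊖ x a) ∷ [])

  dot-∖ : ∀ {n} (x : Weights n) a f → dot x f ≈ dot (x ∖ a) f ⊕ x a ⊛ f a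
  dot-∖ x a f = equate ((v₀ ≐ v₁ :+ :- v₂ :* v₃) ∷ []) v₁ (v₀ :+ v₂ :* v₃) ((0 , :- nat 1) ∷ []) refl
    (dot (x ∖ a) f ∷ dot x f ∷ x a ∷ f a ∷ []) (dot-bump x a (⊖ x a) f ∷ [])

  sqs-∖ : ∀ {n} (x : Weights n) a → sqs x ≈ sqs (x ∖ a) ⊕ x a ⊛ x a
  sqs-∖ x a = equate ((v₀ ≐ v₁ :+ nat 2 :* :- v₂ :* v₂ :+ :- v₂ :* :- v₂) ∷ []) v₁ (v₀ :+ v₂ :* v₂)
    ((0 , :- nat 1) ∷ []) refl (sqs (x ∖ a) ∷ sqs x ∷ x a ∷ []) (sqs-bump x a (⊖ x a) ∷ [])

  -- Codegrees, links and mass, and their dependence on a single weight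

  module Graph {n} (G : Triples n) where

    open Triples G public

    E[_,_,_] : Fin n → Fin n → Fin n → Carrier
    E[ i , j , k ] = [ E i j k ]

    W : Weights n → Fin n → Fin n → Carrier
    W x i j = dot x E[ i , j ,_]

    link : Weights n → Fin n → Carrier
    link x i = dot x (W x i)

    -- The sum runs over ordered triples, so this is six times the Lagrange polynomial, and `link`
    -- is a third of its partial derivative.
    mass : Weights n → Carrier
    mass x = dot x (link x)

    W-sym : ∀ x i j → W x i j ≈ W x j i
    W-sym x i j = dot-congʳ (λ k → ≈-reflexive (≡.cong [_] (swap₁₂ i j k)))

    W-diag : ∀ x i → W x i i ≈ 0#
    W-diag x i = ≈-trans (dot-congʳ (λ k → ≈-reflexive (≡.cong [_] (irr i k)))) (≈-trans (dot-const x 0#) (zeroˡ _))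

    W-bump : ∀ x a v i j → W (bump x a v) i j ≈ W x i j ⊕ v ⊛ E[ i , j , a ]
    W-bump x a v i j = dot-bump x a v E[ i , j ,_]

    link-bump : ∀ x a v i → link (bump x a v) i ≈ link x i ⊕ # 2 ⊛ v ⊛ W x i a
    link-bump x a v i = begin
      link (bump x a v) i
        ≈⟨ dot-bump x a v (W (bump x a v) i) ⟩
      dot x (W (bump x a v) i) ⊕ v ⊛ W (bump x a v) i a
        ≈⟨ +-cong (≈-trans (dot-congʳ (λ j → ≈-trans (W-bump x a v i j)
             (+-congˡ (*-congˡ (≈-reflexive (≡.cong [_] (swap₂₃ i j a)))))))
             (≈-trans (dot-+ x (W x i) _) (+-congˡ (dot-* x v _))))
             (*-congˡ (≈-trans (W-bump x a v i a) (+-congˡ (*-congˡ (≈-reflexive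
               (≡.cong [_] (≡.trans (swap₁₂ i a a) (≡.trans (swap₂₃ a i a) (irr a i))))))))) ⟩
      link x i ⊕ v ⊛ W x i a ⊕ v ⊛ (W x i a ⊕ v ⊛ 0#)
        ≈⟨ identity (v₀ :+ v₁ :* v₂ :+ v₁ :* (v₂ :+ v₁ :* nat 0)) (v₀ :+ nat 2 :* v₁ :* v₂) refl
             (link x i ∷ v ∷ W x i a ∷ []) ⟩
      link x i ⊕ # 2 ⊛ v ⊛ W x i a ∎

    -- No edge contains `a` twice, so the terms of higher degree in `v` vanish. The factor 3 counts
    -- the places of `a` in an ordered triple.
    mass-bump : ∀ x a v → mass (bump x a v) ≈ mass x ⊕ # 3 ⊛ v ⊛ link x a
    mass-bump x a v = begin
      mass (bump x a v)
        ≈⟨ dot-bump x a v (link (bump x a v)) ⟩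
      dot x (link (bump x a v)) ⊕ v ⊛ link (bump x a v) a
        ≈⟨ +-cong (≈-trans (dot-congʳ (link-bump x a v)) (≈-trans (dot-+ x (link x) _)
             (+-congˡ (≈-trans (dot-* x (# 2 ⊛ v) _) (*-congˡ (dot-congʳ (λ i → W-sym x i a)))))))
             (*-congˡ (≈-trans (link-bump x a v a) (+-congˡ (*-congˡ (W-diag x a))))) ⟩
      mass x ⊕ # 2 ⊛ v ⊛ link x a ⊕ v ⊛ (link x a ⊕ # 2 ⊛ v ⊛ 0#)
        ≈⟨ identity (v₀ :+ nat 2 :* v₁ :* v₂ :+ v₁ :* (v₂ :+ nat 2 :* v₁ :* nat 0))
             (v₀ :+ nat 3 :* v₁ :* v₂) refl (mass x ∷ v ∷ link x a ∷ []) ⟩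
      mass x ⊕ # 3 ⊛ v ⊛ link x a ∎

    W-∖ : ∀ x a i j → W x i j ≈ W (x ∖ a) i j ⊕ x a ⊛ E[ i , j , a ]
    W-∖ x a i j = equate ((v₀ ≐ v₁ :+ :- v₂ :* v₃) ∷ []) v₁ (v₀ :+ v₂ :* v₃) ((0 , :- nat 1) ∷ []) refl
      (W (x ∖ a) i j ∷ W x i j ∷ x a ∷ E[ i , j , a ] ∷ []) (W-bump x a (⊖ x a) i j ∷ [])

    link-∖ : ∀ x a i → link x i ≈ link (x ∖ a) i ⊕ # 2 ⊛ x a ⊛ W x i a
    link-∖ x a i = equate ((v₀ ≐ v₁ :+ nat 2 :* :- v₂ :* v₃) ∷ []) v₁ (v₀ :+ nat 2 :* v₂ :* v₃)
      ((0 , :- nat 1) ∷ []) refl (link (x ∖ a) i ∷ link x i ∷ x a ∷ W x i a ∷ []) (link-bump x a (⊖ x a) i ∷ [])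

    mass-∖ : ∀ x a → mass x ≈ mass (x ∖ a) ⊕ # 3 ⊛ x a ⊛ link x a
    mass-∖ x a = equate ((v₀ ≐ v₁ :+ nat 3 :* :- v₂ :* v₃) ∷ []) v₁ (v₀ :+ nat 3 :* v₂ :* v₃)
      ((0 , :- nat 1) ∷ []) refl (mass (x ∖ a) ∷ mass x ∷ x a ∷ link x a ∷ []) (mass-bump x a (⊖ x a) ∷ [])

    E-irr₂₃ : ∀ i j → E i j j ≡ false
    E-irr₂₃ i j = ≡.trans (swap₁₂ i j j) (≡.trans (swap₂₃ j i j) (irr j i))

    E-irr₁₃ : ∀ i j → E i j i ≡ false
    E-irr₁₃ i j = ≡.trans (swap₂₃ i j i) (irr i j)

    W-∖-self : ∀ x a i → W (x ∖ a) i a ≈ W x i a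
    W-∖-self x a i = ≈-trans (W-bump x a (⊖ x a) i a)
      (≈-trans (+-congˡ (*-congˡ (≈-reflexive (≡.cong [_] (E-irr₂₃ i a)))))
        (identity (v₀ :+ v₁ :* nat 0) v₀ refl (W x i a ∷ ⊖ x a ∷ [])))

    link-∖-self : ∀ x a → link (x ∖ a) a ≈ link x a
    link-∖-self x a = ≈-trans (link-bump x a (⊖ x a) a) (≈-trans (+-congˡ (*-congˡ (W-diag x a)))
      (identity (v₀ :+ v₁ :* nat 0) v₀ refl (link x a ∷ # 2 ⊛ ⊖ x a ∷ [])))

    W-bound : ∀ {x} → NonNeg x → ∀ {i j} → i ≢ j → W x i j ≤ sum x ⊖′ x i ⊖′ x j
    W-bound {x} nn {i} {j} i≢j = ≤-respʳ eq (dot-mono nn (λ k _ → lem k))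
      where
      eq : dot x (λ k → 1# ⊕ (⊖ 1# ⊛ δ i k ⊕ ⊖ 1# ⊛ δ j k)) ≈ sum x ⊖′ x i ⊖′ x j
      eq = ≈-trans (dot-+ x _ _) (≈-trans (+-cong (≈-sym (sum≈dot x)) (≈-trans (dot-+ x _ _)
        (+-cong (≈-trans (dot-* x _ (δ i)) (*-congˡ (≈-trans (dot-comm x (δ i)) (dot-δ i x))))
                (≈-trans (dot-* x _ (δ j)) (*-congˡ (≈-trans (dot-comm x (δ j)) (dot-δ j x)))))))
        (identity (v₀ :+ (:- nat 1 :* v₁ :+ :- nat 1 :* v₂)) (v₀ :- v₁ :- v₂) refl (sum x ∷ x i ∷ x j ∷ [])))
      lem : ∀ k → E[ i , j , k ] ≤ 1# ⊕ (⊖ 1# ⊛ δ i k ⊕ ⊖ 1# ⊛ δ j k)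
      lem k with i Finₚ.≟ k | j Finₚ.≟ k
      ... | yes refl | yes refl = ⊥-elim (i≢j refl)
      ... | yes refl | no _ = ≤-reflexive (≈-trans (≈-reflexive (≡.cong [_] (E-irr₁₃ i j)))
                                (identity (nat 0) (nat 1 :+ (:- nat 1 :* nat 1 :+ :- nat 1 :* nat 0)) refl []))
      ... | no _ | yes refl = ≤-reflexive (≈-trans (≈-reflexive (≡.cong [_] (E-irr₂₃ i j)))
                                (identity (nat 0) (nat 1 :+ (:- nat 1 :* nat 0 :+ :- nat 1 :* nat 1)) refl []))
      ... | no _ | no _ = ≤-respʳ (identity (nat 1) (nat 1 :+ (:- nat 1 :* nat 0 :+ :- nat 1 :* nat 0)) refl [])
                                  ([]≤1 (E i j k))

    0≤W : ∀ {x} → NonNeg x → ∀ i j → 0# ≤ W x i j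
    0≤W nn i j = dot-nonneg nn (λ k _ → 0≤[] (E i j k))

    0≤link : ∀ {x} → NonNeg x → ∀ i → 0# ≤ link x i
    0≤link nn i = dot-nonneg nn (λ j _ → 0≤W nn i j)

  -- Limits and cluster points

  <-≤-trans : ∀ {a b c} → a < b → b ≤ c → a < c
  <-≤-trans p q r = p (≤-trans q r)

  ≤-<-trans : ∀ {a b c} → a ≤ b → b < c → a < c
  ≤-<-trans p q r = q (≤-trans r p)

  *-pos : ∀ {a b} → 0# < a → 0# < b → 0# < a ⊛ b
  *-pos {a} {b} p q r = q (≤-respˡ (*-identityʳ b)
    (0≤⇒≤ (*-cancel-0≤ p (by ((v₀ :* v₁ ≦ nat 0) ∷ []) 0 (nat 0) (v₀ :* (nat 0 :- v₁ :* nat 1)) (hyp 0) refl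
      (a ∷ b ∷ []) (r ∷ [])))))

  *-mono-nonneg : ∀ {a b c d} → 0# ≤ a → a ≤ b → 0# ≤ c → c ≤ d → a ⊛ c ≤ b ⊛ d
  *-mono-nonneg {a} {b} {c} {d} p q r s =
    by ((nat 0 ≦ v₀) ∷ (v₀ ≦ v₁) ∷ (nat 0 ≦ v₂) ∷ (v₂ ≦ v₃) ∷ []) 0 (v₀ :* v₂) (v₁ :* v₃)
      (hyp 0 ⊠ hyp 3 ⊞ hyp 1 ⊠ hyp 2 ⊞ hyp 1 ⊠ hyp 3) refl (a ∷ b ∷ c ∷ d ∷ []) (p ∷ q ∷ r ∷ s ∷ [])

  reciprocal : ∀ {a} → 0# < a → ∃ λ b → 0# < b × a ⊛ b ≈ 1#
  reciprocal {a} 0<a with inverse a (λ p → 0<a (≤-reflexive p))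
  ... | b , ab≈1 = b , 0<b , ab≈1
    where
    0≤b : 0# ≤ b
    0≤b = *-cancel-0≤ 0<a (≤-respʳ (≈-sym ab≈1) 0≤1)
    0<b : 0# < b
    0<b b≤0 = 1≉0 (≈-trans (≈-sym ab≈1) (≈-trans (*-congˡ (antisym b≤0 0≤b)) (zeroʳ a)))

  -- A gap g = a - b > 0 is refuted by ε = g / (K + 1 + g).

  limit : ∀ {a b K} → 0# ≤ K → (∀ ε → 0# < ε → ε ≤ 1# → a ≤ b ⊕ K ⊛ ε) → a ≤ b
  limit {a} {b} {K} 0≤K h = ≤-stable λ a≰b →
    let g = a ⊖′ b
        0<g : 0# < g
        0<g p = a≰b (by ((v₀ :- v₁ ≦ nat 0) ∷ []) 0 v₀ v₁ (hyp 0) refl (a ∷ b ∷ []) (p ∷ []))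
        D = K ⊕ 1# ⊕ g
        0<D : 0# < D
        0<D p = 0<1 (by ((nat 0 ≦ v₀) ∷ (nat 0 ≦ v₁) ∷ (v₀ :+ nat 1 :+ v₁ ≦ nat 0) ∷ []) 0 (nat 1) (nat 0)
                        (hyp 0 ⊞ hyp 1 ⊞ hyp 2) refl (K ∷ g ∷ []) (0≤K ∷ <⇒≤ 0<g ∷ p ∷ []))
        i , 0<i , Di≈1 = reciprocal 0<D
        ε≤1 : g ⊛ i ≤ 1#
        ε≤1 = by ((nat 0 ≦ v₀) ∷ (nat 0 ≦ v₁) ∷ (nat 0 ≦ v₂) ∷ ((v₀ :+ nat 1 :+ v₁) :* v₂ ≐ nat 1) ∷ []) 0
                (v₁ :* v₂) (nat 1) ((hyp 0 ⊞ cst 1) ⊠ hyp 2 ⊞ eqn 3 (nat 1)) refl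
                (K ∷ g ∷ i ∷ []) (0≤K ∷ <⇒≤ 0<g ∷ <⇒≤ 0<i ∷ Di≈1 ∷ [])
        -- a ≤ b + K g i together with (K + 1 + g) i = 1 gives g (1 + g) i ≤ 0.
        p = h (g ⊛ i) (*-pos 0<g 0<i) ε≤1
    in *-pos (*-pos 0<g 0<i) (+-pos 0<1 (<⇒≤ 0<g))
         (by ((v₀ ≦ v₁ :+ v₂ :* ((v₀ :- v₁) :* v₃)) ∷ ((v₂ :+ nat 1 :+ (v₀ :- v₁)) :* v₃ ≐ nat 1) ∷ []) 0
           ((v₀ :- v₁) :* v₃ :* (nat 1 :+ (v₀ :- v₁))) (nat 0)
           (hyp 0 ⊞ eqn 1 (v₀ :- v₁)) refl (a ∷ b ∷ K ∷ i ∷ []) (p ∷ Di≈1 ∷ []))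

  min : ∀ a b → 0# < a → 0# < b → ∃ λ c → 0# < c × c ≤ a × c ≤ b
  min a b p q with total a b
  ... | inj₁ a≤b = a , p , ≤-refl , a≤b
  ... | inj₂ b≤a = b , q , b≤a , ≤-refl

  Close : Carrier → Carrier → Carrier → Set
  Close ε z x = x ≤ z ⊕ ε × z ≤ x ⊕ ε

  module _ {X : Set} where

    -- This replaces a sequence: `N ε x` says that `x` is good up to `ε`, and sharpening `N`
    -- replaces passing to a subsequence. The double negation is what a supremum provides without
    -- excluded middle.
    Recurrent : (Carrier → X → Set) → Set
    Recurrent N = ∀ ε → 0# < ε → ¬ ¬ ∃ (N ε)

    Monotone : (Carrier → X → Set) → Set
    Monotone N = ∀ {ε η x} → ε ≤ η → N ε x → N η x

    -- `z` is the limit superior of `c` along `N`, the supremum of the values that `c` reaches at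
    -- every accuracy. The value z + ε is not reached in this sense, while some value within ε below
    -- `z` is.
    cluster : (N : Carrier → X → Set) → Monotone N → Recurrent N →
              (c : X → Carrier) → (∀ {ε x} → N ε x → 0# ≤ c x × c x ≤ 1#) →
              ∃ λ z → Recurrent (λ ε x → N ε x × Close ε z (c x))
    cluster N mon rec c bd = z , close
      where
      Q : Carrier → Set
      Q t = Recurrent (λ ε x → N ε x × t ≤ c x)
      sup = complete Q (0# , λ ε p ¬q → rec ε p (λ { (x , n) → ¬q (x , n , proj₁ (bd n)) }))
                     (1# , λ t q → ≤-stable (λ ¬p → q 1# 0<1 (λ { (x , n , t≤) → ¬p (≤-trans t≤ (proj₂ (bd n))) })))
      z = proj₁ sup
      ub : IsUpperBound Q z
      ub = proj₁ (proj₂ sup)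
      least : ∀ b → IsUpperBound Q b → z ≤ b
      least = proj₂ (proj₂ sup)
      close : Recurrent (λ ε x → N ε x × Close ε z (c x))
      close ε 0<ε ¬goal = lower λ { (t , q , z≤t+ε) → ¬Q λ η 0<η ¬above →
          let ζ , 0<ζ , ζ≤ε , ζ≤η = min ε η 0<ε 0<η in
          q ζ 0<ζ λ { (x , n , t≤cx) →
            [ (λ cx≤ → ¬goal (x , mon ζ≤ε n , cx≤ ,
                 ≤-trans z≤t+ε (+-mono t≤cx ≤-refl)))
            , (λ z+ε< → ¬above (x , mon ζ≤η n , <⇒≤ z+ε<)) ]′ (≤-<-connex (c x) (z ⊕ ε)) } }
        where
        ¬Q : ¬ Q (z ⊕ ε)
        ¬Q q = 0<ε (by ((v₀ :+ v₁ ≦ v₀) ∷ []) 0 v₁ (nat 0) (hyp 0) refl (z ∷ ε ∷ []) (ub (z ⊕ ε) q ∷ []))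
        lower : ¬ ¬ (∃ λ t → Q t × z ≤ t ⊕ ε)
        lower ¬p = 0<ε (by ((v₀ ≦ v₀ :- v₁) ∷ []) 0 v₁ (nat 0) (hyp 0) refl (z ∷ ε ∷ [])
          (least (z ⊖′ ε) (λ t q → [ (λ z≤ → ⊥-elim (¬p (t , q , z≤)))
            , (λ t+ε< → by ((v₀ :+ v₁ ≦ v₂) ∷ []) 0 v₀ (v₂ :- v₁) (hyp 0) refl (t ∷ ε ∷ z ∷ []) (<⇒≤ t+ε< ∷ []))
            ]′ (≤-<-connex z (t ⊕ ε))) ∷ []))

  -- The Bolzano-Weierstrass argument in n coordinates: closeness in one coordinate becomes part of
  -- `N` before the next one is treated.
  clusterAll : ∀ {X : Set} n (N : Carrier → X → Set) → Monotone N → Recurrent N →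
               (c : Fin n → X → Carrier) → (∀ {ε x} → N ε x → ∀ i → 0# ≤ c i x × c i x ≤ 1#) →
               ∃ λ (z : Fin n → Carrier) → Recurrent (λ ε x → N ε x × (∀ i → Close ε (z i) (c i x)))
  clusterAll zero    N mon rec c bd = (λ ()) , λ ε p ¬q → rec ε p (λ { (x , n) → ¬q (x , n , λ ()) })
  clusterAll (suc m) N mon rec c bd with cluster N mon rec (c zero) (λ n → bd n zero)
  ... | z₀ , rec₀ with clusterAll m (λ ε x → N ε x × Close ε z₀ (c zero x))
          (λ { le (n , p , q) → mon le n , ≤-trans p (+-monoʳ-≤ _ le) , ≤-trans q (+-monoʳ-≤ _ le) })
          rec₀ (c ∘ suc) (λ { (n , _) i → bd n (suc i) })
  ...   | z , rec′ = (λ { zero → z₀ ; (suc i) → z i }) , λ ε p ¬q → rec′ ε p (λ { (x , (n , cl₀) , cl) →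
            ¬q (x , n , (λ { zero → cl₀ ; (suc i) → cl i })) })

  sum-const : ∀ n c → sum {n} (λ _ → c) ≈ # n ⊛ c
  sum-const zero    c = ≈-sym (zeroˡ c)
  sum-const (suc n) c = ≈-trans (+-cong (≈-sym (*-identityˡ c)) (sum-const n c))
    (≈-trans (≈-sym (distribʳ c 1# (# n))) (*-congʳ (≈-sym (fromℕ-suc n))))

  sum-≥ : ∀ {n} {x : Weights n} → NonNeg x → ∀ i → x i ≤ sum x
  sum-≥ {x = x} nn i = by ((v₀ ≐ v₁ :+ v₂) ∷ (nat 0 ≦ v₁) ∷ []) 0 v₂ v₀ (eqn 0 (:- nat 1) ⊞ hyp 1) refl
    (sum x ∷ sum (x ∖ i) ∷ x i ∷ []) (sum-∖ x i ∷ sum-nonneg (∖-nonneg nn i) ∷ [])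

  sum-+const : ∀ {n} (z : Weights n) ε → sum (λ i → z i ⊕ ε) ≈ sum z ⊕ # n ⊛ ε
  sum-+const {n} z ε = ≈-trans (∑-distrib-+ z (λ _ → ε)) (+-congˡ (sum-const n ε))

  opaque
    unfolding dot

    dot-monoˡ : ∀ {n} {x y f : Weights n} → (∀ i → x i ≤ y i) → NonNeg f → dot x f ≤ dot y f
    dot-monoˡ {x = x} {y} {f} p nn = sum-mono (λ i →
      by ((v₀ ≦ v₁) ∷ (nat 0 ≦ v₂) ∷ []) 0 (v₀ :* v₂) (v₁ :* v₂) (hyp 0 ⊠ hyp 1) refl (x i ∷ y i ∷ f i ∷ []) (p i ∷
          nn i ∷ []))

  -- Existence of a maximiser and equality of its links

  Simplex′ : ∀ {n} → Weights n → Set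
  Simplex′ x = NonNeg x × sum x ≈ 1#

  module _ {n} (G : Triples n) where
    open Graph G

    W≤sum : ∀ {x} → NonNeg x → ∀ i j → W x i j ≤ sum x
    W≤sum {x} nn i j = ≤-respʳ (≈-sym (sum≈dot x)) (dot-mono nn (λ k _ → []≤1 (E i j k)))

    link≤sq : ∀ {x} → NonNeg x → ∀ i → link x i ≤ sum x ⊛ sum x
    link≤sq {x} nn i = ≤-respʳ (dot-const x (sum x)) (dot-mono nn (λ j _ → W≤sum nn i j))

    mass≤cube : ∀ {x} → NonNeg x → mass x ≤ sum x ⊛ sum x ⊛ sum x
    mass≤cube {x} nn = ≤-respʳ (dot-const x (sum x ⊛ sum x)) (dot-mono nn (λ i _ → link≤sq nn i))

    W-mono : ∀ {x y} → (∀ i → x i ≤ y i) → ∀ i j → W x i j ≤ W y i j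
    W-mono p i j = dot-monoˡ p (λ k → 0≤[] (E i j k))

    link-mono : ∀ {x y} → NonNeg x → (∀ i → x i ≤ y i) → ∀ i → link x i ≤ link y i
    link-mono {x} {y} nn p i = ≤-trans (dot-mono nn (λ j _ → W-mono p i j))
      (dot-monoˡ p (λ j → 0≤W (λ k → ≤-trans (nn k) (p k)) i j))

    mass-mono : ∀ {x y} → NonNeg x → (∀ i → x i ≤ y i) → mass x ≤ mass y
    mass-mono {x} {y} nn p = ≤-trans (dot-mono nn (λ j _ → link-mono nn p j))
      (dot-monoˡ p (λ j → 0≤link (λ k → ≤-trans (nn k) (p k)) j))

    private
      N : Carrier
      N = # n

    module _ {z : Weights n} (nn : NonNeg z) (Σz : sum z ≈ 1#) {ε} (0≤ε : 0# ≤ ε) (ε≤1 : ε ≤ 1#) where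
      private
        u : Weights n
        u i = z i ⊕ ε
        nnu : NonNeg u
        nnu i = 0≤+ (nn i) 0≤ε
        Σu : sum u ≈ 1# ⊕ N ⊛ ε
        Σu = ≈-trans (sum-+const z ε) (+-congʳ Σz)
        D : Carrier
        D = 1# ⊕ N
        Σu≤D : sum u ≤ D
        Σu≤D = by ((v₀ ≐ nat 1 :+ v₁ :* v₂) ∷ (v₂ ≦ nat 1) ∷ (nat 0 ≦ v₁) ∷ []) 0 v₀ (nat 1 :+ v₁)
          (eqn 0 (nat 1) ⊞ hyp 1 ⊠ hyp 2) refl (sum u ∷ N ∷ ε ∷ []) (Σu ∷ ε≤1 ∷ 0≤fromℕ n ∷ [])
        0≤D : 0# ≤ D
        0≤D = 0≤+ 0≤1 (0≤fromℕ n)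
        dot-u : ∀ f → dot u f ≈ dot z f ⊕ ε ⊛ sum f
        dot-u f = ≈-trans (dot-+ˡ z (λ _ → ε) f) (+-congˡ (≈-trans (dot-comm (λ _ → ε) f) (dot-const f ε)))
        W-u : ∀ i j → W u i j ≤ W z i j ⊕ ε ⊛ N
        W-u i j = ≤-respˡ (≈-sym (dot-u E[ i , j ,_])) (+-monoʳ-≤ _
          (*-mono-nonneg 0≤ε ≤-refl (sum-nonneg (λ k → 0≤[] (E i j k)))
            (≤-respʳ (≈-trans (sum-const n 1#) (*-identityʳ N)) (sum-mono (λ k → []≤1 (E i j k))))))
        bounded : ∀ {f : Weights n} {c} → (∀ i → f i ≤ c) → sum f ≤ N ⊛ c
        bounded {c = c} p = ≤-respʳ (sum-const n c) (sum-mono p)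
        link-u : ∀ i → link u i ≤ link z i ⊕ ε ⊛ (N ⊕ N ⊛ D)
        link-u i = ≤-respˡ (≈-sym (dot-u (W u i)))
          (by ((v₀ ≦ v₁ :+ v₂ :* v₃ :* v₄) ∷ (v₄ ≐ nat 1) ∷ (v₅ ≦ v₃ :* v₆) ∷ (nat 0 ≦ v₂) ∷ []) 0
            (v₀ :+ v₂ :* v₅) (v₁ :+ v₂ :* (v₃ :+ v₃ :* v₆)) (hyp 0 ⊞ eqn 1 (v₂ :* v₃) ⊞ hyp 3 ⊠ hyp 2) refl
            (dot z (W u i) ∷ link z i ∷ ε ∷ N ∷ sum z ∷ sum (W u i) ∷ D ∷ [])
            (≤-respʳ (≈-trans (dot-+ z (W z i) _) (+-congˡ (dot-const z (ε ⊛ N)))) (dot-mono nn (λ j _ → W-u i j))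
             ∷ Σz ∷ bounded (λ j → ≤-trans (W≤sum nnu i j) Σu≤D) ∷ 0≤ε ∷ []))
      -- Replacing `z` by z + ε in one of the three factors at a time costs ε times a sum of n
      -- values, bounded by 1, `D` and D² respectively. The three costs add up to the constant.
      mass-u : mass u ≤ mass z ⊕ (N ⊕ N ⊛ D ⊕ N ⊛ (D ⊛ D)) ⊛ ε
      mass-u = ≤-respˡ (≈-sym (dot-u (link u)))
          (by ((v₀ ≦ v₁ :+ v₂ :* (v₃ :+ v₃ :* v₆) :* v₄) ∷ (v₄ ≐ nat 1) ∷ (v₅ ≦ v₃ :* (v₆ :* v₆)) ∷ (nat 0 ≦ v₂) ∷
              []) 0
            (v₀ :+ v₂ :* v₅) (v₁ :+ (v₃ :+ v₃ :* v₆ :+ v₃ :* (v₆ :* v₆)) :* v₂)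
            (hyp 0 ⊞ eqn 1 (v₂ :* (v₃ :+ v₃ :* v₆)) ⊞ hyp 3 ⊠ hyp 2) refl
            (dot z (link u) ∷ mass z ∷ ε ∷ N ∷ sum z ∷ sum (link u) ∷ D ∷ [])
            (≤-respʳ (≈-trans (dot-+ z (link z) _) (+-congˡ (dot-const z _))) (dot-mono nn (λ j _ → link-u j))
             ∷ Σz ∷ bounded (λ j → ≤-trans (link≤sq nnu j) (*-mono-nonneg (sum-nonneg nnu) Σu≤D (sum-nonneg nnu)
                 Σu≤D))
             ∷ 0≤ε ∷ []))

    IsMax : Weights n → Set
    IsMax x = Simplex′ x × (∀ y → Simplex′ y → mass y ≤ mass x)

    -- Nearly maximal points cluster at some `z`. They satisfy x ≤ z + ε, so monotonicity and
    -- `mass-u` show that the mass of `z` falls short of the supremum by at most a multiple of ε.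
    maximiser : ∃ Simplex′ → ∃ IsMax
    maximiser (x₀ , sx₀) = z , (nnz , Σz) , λ y sy → ≤-trans (s-ub (mass y) (y , sy , ≈-refl)) s≤mass
      where
      Val : Carrier → Set
      Val v = ∃ λ x → Simplex′ x × mass x ≈ v
      sup = complete Val (mass x₀ , x₀ , sx₀ , ≈-refl) (1# , λ { v (x , (nn , Σx) , e) →
        ≤-respˡ e (≤-respʳ (≈-trans (*-cong (*-cong Σx Σx) Σx)
          (identity (nat 1 :* nat 1 :* nat 1) (nat 1) refl [])) (mass≤cube nn)) })
      s = proj₁ sup
      s-ub : ∀ v → Val v → v ≤ s
      s-ub = proj₁ (proj₂ sup)
      Near : Carrier → Weights n → Set
      Near ε x = Simplex′ x × s ≤ mass x ⊕ ε
      near : Recurrent Near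
      near ε 0<ε ¬p = 0<ε (by ((v₀ ≦ v₀ :- v₁) ∷ []) 0 v₁ (nat 0) (hyp 0) refl (s ∷ ε ∷ [])
        (proj₂ (proj₂ sup) (s ⊖′ ε) (λ { v (x , sx , e) → ≤-respˡ e
          ([ (λ q → ⊥-elim (¬p (x , sx , q)))
           , (λ q → by ((v₀ :+ v₁ ≦ v₂) ∷ []) 0 v₀ (v₂ :- v₁) (hyp 0) refl (mass x ∷ ε ∷ s ∷ []) (<⇒≤ q ∷ []))
           ]′ (≤-<-connex s (mass x ⊕ ε))) }) ∷ []))
      cl = clusterAll n Near (λ { le (sx , q) → sx , ≤-trans q (+-monoʳ-≤ _ le) }) near (λ i x → x i)
        (λ { ((nn , Σx) , _) i → nn i , ≤-respʳ Σx (sum-≥ nn i) })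
      z = proj₁ cl
      rec = proj₂ cl
      nnz : NonNeg z
      nnz i = limit 0≤1 (λ ε p _ → ≤-stable λ ¬q → rec ε p λ { (x , ((nn , _) , _) , c) →
        ¬q (≤-trans (nn i) (≤-respʳ (+-congˡ (≈-sym (*-identityˡ ε))) (proj₁ (c i)))) })
      Σz : sum z ≈ 1#
      Σz = antisym
        (limit (0≤fromℕ n) (λ ε p _ → ≤-stable λ ¬q → rec ε p λ { (x , ((_ , Σx) , _) , c) →
          ¬q (≤-respʳ (≈-trans (sum-+const x ε) (+-congʳ Σx)) (sum-mono (λ i → proj₂ (c i)))) }))
        (limit (0≤fromℕ n) (λ ε p _ → ≤-stable λ ¬q → rec ε p λ { (x , ((_ , Σx) , _) , c) →
          ¬q (≤-respˡ Σx (≤-respʳ (sum-+const z ε) (sum-mono (λ i → proj₁ (c i))))) }))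
      C : Carrier
      C = N ⊕ N ⊛ (1# ⊕ N) ⊕ N ⊛ ((1# ⊕ N) ⊛ (1# ⊕ N))
      0≤C : 0# ≤ C
      0≤C = by ((nat 0 ≦ v₀) ∷ []) 0 (nat 0) (v₀ :+ v₀ :* (nat 1 :+ v₀) :+ v₀ :* ((nat 1 :+ v₀) :* (nat 1 :+ v₀)))
        (hyp 0 ⊠ (cst 3 ⊞ cst 3 ⊠ hyp 0 ⊞ hyp 0 ⊠ hyp 0)) refl (N ∷ []) (0≤fromℕ n ∷ [])
      s≤mass : s ≤ mass z
      s≤mass = limit {K = 1# ⊕ C} (0≤+ 0≤1 0≤C) (λ ε p ε≤1 → ≤-stable λ ¬q → rec ε p λ { (x , ((nn , Σx) , s≤) , c) →
        ¬q (by ((v₀ ≦ v₁ :+ v₂) ∷ (v₁ ≦ v₃ :+ v₄ :* v₂) ∷ []) 0 v₀ (v₃ :+ (nat 1 :+ v₄) :* v₂) (hyp 0 ⊞ hyp 1) refl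
          (s ∷ mass x ∷ ε ∷ mass z ∷ C ∷ [])
          (s≤ ∷ ≤-trans (mass-mono nn (λ i → proj₁ (c i))) (mass-u nnz Σz (<⇒≤ p) ε≤1) ∷ [])) })

    -- Shifting the weight t = ε x i from `i` to `j` changes the mass by 3t (link j - link i) - 6t²
    -- W i j, which is not positive at a maximiser. Divide by 3t and let ε tend to 0.
    kkt : ∀ {x} → IsMax x → ∀ {i} j → 0# < x i → link x j ≤ link x i
    kkt {x} ((nn , Σx) , mx) {i} j 0<xi = limit {K = # 2 ⊛ x i}
        (by ((nat 0 ≦ v₀) ∷ []) 0 (nat 0) (nat 2 :* v₀) (cst 2 ⊠ hyp 0) refl (x i ∷ []) (nn i ∷ [])) step
      where
      step : ∀ ε → 0# < ε → ε ≤ 1# → link x j ≤ link x i ⊕ # 2 ⊛ x i ⊛ ε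
      step ε 0<ε ε≤1 = 0≤⇒≤ (*-cancel-0≤ {a = # 3 ⊛ t} (*-pos (0<fromℕ 2) (*-pos 0<xi 0<ε))
        (by ((v₀ ≐ v₁ :+ nat 3 :* v₂ :* v₃) ∷ (v₄ ≐ v₀ :+ nat 3 :* :- v₂ :* v₅) ∷ (v₅ ≐ v₆ :+ nat 2 :* v₂ :* v₇) ∷
             (v₄ ≦ v₁) ∷ (v₇ ≦ nat 1) ∷ (v₂ ≐ v₈ :* v₉) ∷ (nat 0 ≦ v₂) ∷ []) 0 (nat 0)
             (nat 3 :* v₂ :* (v₆ :+ nat 2 :* v₈ :* v₉ :- v₃))
             (hyp 3 ⊞ cst 6 ⊠ hyp 6 ⊠ hyp 6 ⊠ hyp 4 ⊞ eqn 0 (:- nat 1) ⊞ eqn 1 (:- nat 1) ⊞ eqn 2 (nat 3 :* v₂) ⊞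
                 eqn 5 (nat 6 :* v₂)) refl
             (mass (bump x j t) ∷ mass x ∷ t ∷ link x j ∷ mass y ∷ link (bump x j t) i ∷ link x i ∷ W x i j ∷ x i ∷
                 ε ∷ [])
             (mass-bump x j t ∷ mass-bump (bump x j t) i (⊖ t) ∷ link-bump x j t i ∷ mx y (nny , Σy) ∷
              ≤-respʳ Σx (W≤sum nn i j) ∷ ≈-refl ∷ <⇒≤ (*-pos 0<xi 0<ε) ∷ [])))
        where
        t = x i ⊛ ε
        y = bump (bump x j t) i (⊖ t)
        nny : NonNeg y
        nny k with i Finₚ.≟ k | j Finₚ.≟ k
        ... | yes refl | yes _ = by ((nat 0 ≦ v₀) ∷ []) 0 (nat 0) (v₀ :+ v₁ :* nat 1 :+ :- v₁ :* nat 1) (hyp 0) refl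
                                   (x i ∷ t ∷ []) (nn i ∷ [])
        ... | yes refl | no _  = by ((nat 0 ≦ v₀) ∷ (v₂ ≦ nat 1) ∷ []) 0 (nat 0)
                                   (v₀ :+ v₁ :* nat 0 :+ :- (v₀ :* v₂) :* nat 1) (hyp 0 ⊠ hyp 1) refl
                                   (x i ∷ t ∷ ε ∷ []) (nn i ∷ ε≤1 ∷ [])
        ... | no _ | yes refl  = by ((nat 0 ≦ v₀) ∷ (nat 0 ≦ v₁) ∷ []) 0 (nat 0) (v₀ :+ v₁ :* nat 1 :+ :- v₁ :* nat 0)
                                   (hyp 0 ⊞ hyp 1) refl (x k ∷ t ∷ []) (nn k ∷ <⇒≤ (*-pos 0<xi 0<ε) ∷ [])
        ... | no _ | no _      = by ((nat 0 ≦ v₀) ∷ []) 0 (nat 0) (v₀ :+ v₁ :* nat 0 :+ :- v₁ :* nat 0) (hyp 0) refl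
                                   (x k ∷ t ∷ []) (nn k ∷ [])
        Σy : sum y ≈ 1#
        Σy = ≈-trans (sum-bump (bump x j t) i (⊖ t)) (≈-trans (+-congʳ (≈-trans (sum-bump x j t) (+-congʳ Σx)))
          (identity (nat 1 :+ v₀ :+ :- v₀) (nat 1) refl (t ∷ [])))

  argmax : ∀ {n} (x : Fin (suc n) → Carrier) → ∃ λ a → ∀ i → x i ≤ x a
  argmax {zero}  x = zero , λ { zero → ≤-refl }
  argmax {suc n} x with argmax (x ∘ suc)
  ... | a , p with total (x zero) (x (suc a))
  ...   | inj₁ q = suc a , λ { zero → q ; (suc i) → p i }
  ...   | inj₂ q = zero , λ { zero → ≤-refl ; (suc i) → ≤-trans (p i) q }

  -- Weights with equal links, and the induction on k

  infix 4 _<?_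
  _<?_ : ∀ a b → Dec (a < b)
  a <? b = ¬? (b ≤? a)

  -- s = 3k + 3, one less than the number of vertices of K₄ ∪ k·e.

  size : ℕ → Carrier
  size k = # 3 ⊕ # 3 ⊛ # k

  sizeᵉ : Expr
  sizeᵉ = nat 3 :+ nat 3 :* v₀

  module _ {n} (G : Triples n) where
    open Graph G
    open Edges G

    -- θ is the common value of the links at a maximiser of total weight s.

    record Dense (s θ : Carrier) (x : Weights n) : Set where
      field
        nonneg  : NonNeg x
        sum≈    : sum x ≈ s
        link≈   : ∀ i → 0# < x i → link x i ≈ θ

    mass-dense : ∀ {s θ x} → Dense s θ x → mass x ≈ s ⊛ θ
    mass-dense {s} {θ} {x} D = ≈-trans (dot-cong⁺ nonneg link≈) (≈-trans (dot-const x θ)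
      (≈-trans (*-comm _ _) (*-congʳ sum≈)))
      where open Dense D

    -- All pairs of the link meet `l`, so at best it is a clique on the m vertices of `l` joined to
    -- an independent rest. As in the Motzkin-Straus theorem its density is at most that of a clique
    -- on m + 1 vertices, m / (m + 1).
    cover : ∀ a (l : List (Fin n)) {y} → NonNeg y →
            (∀ {p q} → 0# < y p → 0# < y q → p ∉ l → q ∉ l → E a p q ≡ false) →
            (# (length l) ⊕ 1#) ⊛ link y a ≤ # (length l) ⊛ (sum y ⊛ sum y)
    cover a [] {y} nn h = ≤-reflexive (≈-trans
      (*-congˡ (≈-trans (dot-cong⁺ {g = λ _ → 0#} nn (λ p 0<p → ≈-trans
        (dot-cong⁺ {g = λ _ → 0#} nn (λ q 0<q → ≈-reflexive (≡.cong [_] (h 0<p 0<q (λ ()) (λ ())))))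
        (≈-trans (dot-const y 0#) (zeroˡ _)))) (≈-trans (dot-const y 0#) (zeroˡ _))))
      (identity ((nat 0 :+ nat 1) :* nat 0) (nat 0 :* v₀) refl (sum y ⊛ sum y ∷ [])))
    cover a (c ∷ l) {y} nn h = 0≤⇒≤ (*-cancel-0≤ {a = # (length l) ⊕ 1#} (λ p → 0<fromℕ (length l)
        (≤-respˡ (≈-trans (+-comm _ _) (≈-sym (fromℕ-suc (length l)))) p))
      (by ((v₀ ≐ nat 1 :+ v₁) ∷ (v₂ ≐ v₃ :+ nat 2 :* v₄ :* v₅) ∷ (v₅ ≦ v₆) ∷ (v₇ ≐ v₆ :+ v₄) ∷ (nat 0 ≦ v₄) ∷
           (nat 0 ≦ v₁) ∷ ((v₁ :+ nat 1) :* v₃ ≦ v₁ :* (v₆ :* v₆)) ∷ []) 0 (nat 0)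
        ((v₁ :+ nat 1) :* (v₀ :* (v₇ :* v₇) :- (v₀ :+ nat 1) :* v₂))
        -- The square vanishes when `c` carries as much as the average of the m + 1 other parts,
        -- which is the case of equality.
        ((h₅ ⊞ cst 2) ⊠ hyp 6 ⊞ 2 ∙ (h₅ ⊞ cst 1) ⊠ (h₅ ⊞ cst 2) ⊠ h₄ ⊠ h₂ ⊞ sq ((v₁ :+ nat 1) :* v₄ :- v₆)
         ⊞ eqn 0 (:- ((v₁ :+ nat 1) :* (v₇ :* v₇ :- v₂)))
         ⊞ eqn 1 ((v₁ :+ nat 1) :* (v₁ :+ nat 2))
         ⊞ eqn 3 (:- ((v₁ :+ nat 1) :* (v₁ :+ nat 1) :* (v₇ :+ (v₆ :+ v₄))))) refl
        (# (suc (length l)) ∷ # (length l) ∷ link y a ∷ link (y ∖ c) a ∷ y c ∷ W y a c ∷ sum (y ∖ c) ∷ sum y ∷ [])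
        (fromℕ-suc (length l) ∷ link-∖ y c a ∷
         ≤-respˡ (W-∖-self y c a) (W≤sum G (∖-nonneg nn c) a c) ∷ sum-∖ y c ∷ nn c ∷ 0≤fromℕ (length l) ∷
         cover a l (∖-nonneg nn c) (λ p q p∉ q∉ → h (proj₂ (∖-supp y p)) (proj₂ (∖-supp y q))
           (λ { (here e) → proj₁ (∖-supp y p) (≡.sym e) ; (there m) → p∉ m })
           (λ { (here e) → proj₁ (∖-supp y q) (≡.sym e) ; (there m) → q∉ m })) ∷ [])))

    coverW : ∀ a b (l : List (Fin n)) {y M} → NonNeg y → (∀ i → y i ≤ M) → 0# ≤ M →
             (∀ {v} → 0# < y v → v ∉ l → E a b v ≡ false) → W y a b ≤ # (length l) ⊛ M
    coverW a b [] {y} {M} nn le 0≤M h = ≤-reflexive (≈-trans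
      (dot-cong⁺ {g = λ _ → 0#} nn (λ v 0<v → ≈-reflexive (≡.cong [_] (h 0<v (λ ())))))
      (≈-trans (dot-const y 0#) (≈-trans (zeroˡ _) (≈-sym (zeroˡ M)))))
    coverW a b (c ∷ l) {y} {M} nn le 0≤M h =
      by ((v₀ ≐ nat 1 :+ v₁) ∷ (v₂ ≐ v₃ :+ v₄ :* v₅) ∷ (v₃ ≦ v₁ :* v₆) ∷ (v₄ ≦ v₆) ∷ (v₅ ≦ nat 1) ∷ (nat 0 ≦ v₄) ∷
          []) 0
        v₂ (v₀ :* v₆) (h₂ ⊞ h₃ ⊞ h₅ ⊠ h₄ ⊞ eqn 0 (:- v₆) ⊞ eqn 1 (nat 1)) refl
        (# (suc (length l)) ∷ # (length l) ∷ W y a b ∷ W (y ∖ c) a b ∷ y c ∷ E[ a , b , c ] ∷ M ∷ [])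
        (fromℕ-suc (length l) ∷ W-∖ y c a b ∷
         coverW a b l (∖-nonneg nn c) (λ i → le∖ i) 0≤M (λ p v∉ → h (proj₂ (∖-supp y p))
           (λ { (here e) → proj₁ (∖-supp y p) (≡.sym e) ; (there m) → v∉ m })) ∷
         le c ∷ []≤1 (E a b c) ∷ nn c ∷ [])
      where
      le∖ : ∀ i → (y ∖ c) i ≤ M
      le∖ i with c Finₚ.≟ i
      ... | yes refl = ≤-respˡ (identity (nat 0) (v₀ :+ :- v₀ :* nat 1) refl (y c ∷ [])) 0≤M
      ... | no _ = ≤-respˡ (identity v₀ (v₀ :+ :- v₁ :* nat 0) refl (y i ∷ y c ∷ [])) (le i)

    copy-length : ∀ {k l} → Copy k l → # (length l) ≈ # 4 ⊕ # 3 ⊛ # k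
    copy-length (k₄ _ _ _ _) = identity (nat 4) (nat 4 :+ nat 3 :* nat 0) refl []
    copy-length (add {k} {l} c _ _ _ _ _ _ _) =
      equate ((v₀ ≐ nat 1 :+ v₁) ∷ (v₁ ≐ nat 1 :+ v₂) ∷ (v₂ ≐ nat 1 :+ v₃) ∷ (v₃ ≐ nat 4 :+ nat 3 :* v₄) ∷
          (v₅ ≐ nat 1 :+ v₄) ∷ [])
        v₀ (nat 4 :+ nat 3 :* v₅) ((0 , nat 1) ∷ (1 , nat 1) ∷ (2 , nat 1) ∷ (3 , nat 1) ∷ (4 , :- nat 3) ∷ []) refl
        (# (3 ℕ.+ length l) ∷ # (2 ℕ.+ length l) ∷ # (1 ℕ.+ length l) ∷ # (length l) ∷ # k ∷ # (suc k) ∷ [])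
        (fromℕ-suc (2 ℕ.+ length l) ∷ fromℕ-suc (1 ℕ.+ length l) ∷ fromℕ-suc (length l) ∷ copy-length c ∷
            fromℕ-suc k ∷ [])

    edge-≢ : ∀ {i j k} → Edge i j k → i ≢ j × i ≢ k × j ≢ k
    edge-≢ {i} {j} {k} e = (λ { refl → lem (irr i k) }) , (λ { refl → lem (E-irr₁₃ i j) }) , (λ { refl →
        lem (E-irr₂₃ i j) })
      where
      lem : E i j k ≡ false → ⊥
      lem f with ≡.trans (≡.sym f) e
      ... | ()

    e₁₂ : ∀ {i j k} → Edge i j k → Edge j i k
    e₁₂ {i} {j} {k} e = ≡.trans (≡.sym (swap₁₂ i j k)) e

    e₂₃ : ∀ {i j k} → Edge i j k → Edge i k j
    e₂₃ {i} {j} {k} e = ≡.trans (≡.sym (swap₂₃ i j k)) e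

    not-edge : ∀ {i j k} → ¬ Edge i j k → E i j k ≡ false
    not-edge {i} {j} {k} ne with E i j k
    ... | true  = ⊥-elim (ne refl)
    ... | false = refl

    link≈0 : ∀ {y} → NonNeg y → ∀ {j} → (∀ {p q} → 0# < y p → 0# < y q → ¬ Edge j p q) → link y j ≈ 0#
    link≈0 {y} nn none = ≈-trans (dot-cong⁺ {g = λ _ → 0#} nn (λ p 0<p → ≈-trans
      (dot-cong⁺ {g = λ _ → 0#} nn (λ q 0<q → ≈-reflexive (≡.cong [_] (not-edge (none 0<p 0<q)))))
      (≈-trans (dot-const y 0#) (zeroˡ _)))) (≈-trans (dot-const y 0#) (zeroˡ _))

  -- `Bound` is the homogeneous form of `Core`, of degree 3 in the weights. It excludes copies on
  -- the support only, so it can be applied after a vertex has been given weight 0.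
  Core Bound : ℕ → Set
  Core k = ∀ {n} (G : Triples n) {θ x} → Dense G (size k) θ x → Edges.Free G k →
           θ ≤ (size k ⊖′ # 1) ⊛ (size k ⊖′ # 2)
  Bound k = ∀ {n} (G : Triples n) {x} → NonNeg x →
            (∀ {l} → Edges.Copy G k l → All (λ i → 0# < x i) l → ⊥) →
            size k ⊛ size k ⊛ Graph.mass G x ≤ (size k ⊖′ # 1) ⊛ (size k ⊖′ # 2) ⊛ (sum x ⊛ sum x ⊛ sum x)

  0<size : ∀ k → 0# < size k
  0<size k = +-pos (0<fromℕ 2) (by ((nat 0 ≦ v₀) ∷ []) 0 (nat 0) (nat 3 :* v₀) (3 ∙ h₀) refl (# k ∷ []) (0≤fromℕ k ∷
      []))

  module Scale {n} (G : Triples n) where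
    open Graph G

    _⊙_ : Carrier → Weights n → Weights n
    (c ⊙ x) i = c ⊛ x i

    opaque
      unfolding dot

      dot-⊙ : ∀ c x f → dot (c ⊙ x) f ≈ c ⊛ dot x f
      dot-⊙ c x f = ≈-trans (sum-cong (λ i → *-assoc c (x i) (f i))) (≈-sym (*-distribˡ-sum c (λ i → x i ⊛ f i)))

    sum-⊙ : ∀ c x → sum (c ⊙ x) ≈ c ⊛ sum x
    sum-⊙ c x = ≈-sym (*-distribˡ-sum c x)

    link-⊙ : ∀ c x i → link (c ⊙ x) i ≈ c ⊛ c ⊛ link x i
    link-⊙ c x i = ≈-trans (dot-⊙ c x _) (≈-trans (*-congˡ (≈-trans (dot-congʳ (λ j → dot-⊙ c x E[ i , j ,_]))
      (dot-* x c (W x i)))) (≈-sym (*-assoc _ _ _)))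

    mass-⊙ : ∀ c x → mass (c ⊙ x) ≈ c ⊛ c ⊛ c ⊛ mass x
    mass-⊙ c x = ≈-trans (dot-⊙ c x _) (≈-trans (*-congˡ (≈-trans (dot-congʳ (link-⊙ c x)) (dot-* x (c ⊛ c) (link
        x))))
      (identity (v₀ :* (v₀ :* v₀ :* v₁)) (v₀ :* v₀ :* v₀ :* v₁) refl (c ∷ mass x ∷ [])))

  core⇒bound : ∀ k → Core k → Bound k
  core⇒bound k core {n} G {x} nn free with ≤-<-connex (sum x) 0#
  ... | inj₁ Σx≤0 = by ((nat 0 ≦ v₀) ∷ (v₀ ≦ nat 0) ∷ (v₁ ≦ v₀ :* v₀ :* v₀) ∷ (nat 0 ≦ v₂) ∷ []) 0
          (sz :* sz :* v₁) ((sz :- nat 1) :* (sz :- nat 2) :* (v₀ :* v₀ :* v₀))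
          ((3 ∙ h₃ ⊞ cst 3) ⊠ (3 ∙ h₃ ⊞ cst 3) ⊠ h₂ ⊞ (9 ∙ h₃ ⊞ cst 7) ⊠ h₀ ⊠ h₀ ⊠ h₁) refl
          (sum x ∷ mass x ∷ # k ∷ []) (sum-nonneg nn ∷ Σx≤0 ∷ mass≤cube G nn ∷ 0≤fromℕ k ∷ [])
    where
    open Graph G
    sz : Expr
    sz = nat 3 :+ nat 3 :* v₂
  ... | inj₂ 0<Σx = by
          ((v₀ :* v₁ ≐ nat 1) ∷ (v₂ ≐ v₁ :* v₁ :* v₁ :* v₃) ∷ (v₂ ≦ v₄) ∷
              (sz :* sz :* v₄ ≦ (sz :- nat 1) :* (sz :- nat 2)) ∷ (nat 0 ≦ v₀) ∷ (nat 0 ≦ v₅) ∷ []) 0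
          (sz :* sz :* v₃) ((sz :- nat 1) :* (sz :- nat 2) :* (v₀ :* v₀ :* v₀))
          (h₄ ⊠ h₄ ⊠ h₄ ⊠ h₃ ⊞ (3 ∙ hyp 5 ⊞ cst 3) ⊠ (3 ∙ hyp 5 ⊞ cst 3) ⊠ h₄ ⊠ h₄ ⊠ h₄ ⊠ h₂
           ⊞ eqn 1 (:- (sz :* sz :* v₀ :* v₀ :* v₀))
           ⊞ eqn 0 (:- (sz :* sz :* v₃ :* (v₀ :* v₁ :* v₀ :* v₁ :+ v₀ :* v₁ :+ nat 1)))) refl
          (sum x ∷ ρ ∷ mass′ y ∷ mass x ∷ mass′ z ∷ # k ∷ [])
          (Σρ≈1 ∷ ≈-trans (mass-⊙ ρ x) (*-congˡ mass≈) ∷ mx y sy ∷ core′ ∷ <⇒≤ 0<Σx ∷ 0≤fromℕ k ∷ [])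
    where
    sz : Expr
    sz = nat 3 :+ nat 3 :* v₅
    P : Fin n → Bool
    P i = does (0<? (x i))
    -- The maximiser ranges over all weights on `Fin n` and may leave the support of `x`. Removing
    -- the edges outside this support first ensures that no copy arises there.
    G′ : Triples n
    G′ = restrict P G
    open Graph G
    open Graph G′ using () renaming (mass to mass′; link to link′)
    open Scale G′
    P-true : ∀ {i} → 0# < x i → P i ≡ true
    P-true {i} p = dec-true (0<? (x i)) p
    P⇒ : ∀ {i} → P i ≡ true → 0# < x i
    P⇒ {i} = does⁻ (0<? (x i))
    mass≈ : mass′ x ≈ mass x
    mass≈ = dot-cong⁺ nn (λ i p → dot-cong⁺ nn (λ j q → dot-cong⁺ nn (λ m r →
      ≈-reflexive (≡.cong [_] (≡.cong₂ _∧_ (P-true p) (≡.cong₂ _∧_ (P-true q) (≡.cong (_∧ E i j m) (P-true r))))))))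
    rc = reciprocal 0<Σx
    ρ = proj₁ rc
    0<ρ : 0# < ρ
    0<ρ = proj₁ (proj₂ rc)
    Σρ≈1 : sum x ⊛ ρ ≈ 1#
    Σρ≈1 = proj₂ (proj₂ rc)
    y = ρ ⊙ x
    sy : Simplex′ y
    sy = (λ i → *-nonneg (<⇒≤ 0<ρ) (nn i)) , ≈-trans (sum-⊙ ρ x) (≈-trans (*-comm _ _) Σρ≈1)
    mz = maximiser G′ (y , sy)
    z = proj₁ mz
    sz′ : Simplex′ z
    sz′ = proj₁ (proj₂ mz)
    mx : ∀ w → Simplex′ w → mass′ w ≤ mass′ z
    mx = proj₂ (proj₂ mz)
    s = size k
    θ = s ⊛ s ⊛ mass′ z
    links : ∀ {i j} → 0# < z i → 0# < z j → link′ z i ≈ link′ z j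
    links {i} {j} p q = antisym (kkt G′ (proj₂ mz) i q) (kkt G′ (proj₂ mz) j p)
    -- For total 1 the mass is the mean of the links, and these agree on the support.
    link≈mass : ∀ i → 0# < z i → link′ z i ≈ mass′ z
    link≈mass i p = ≈-sym (≈-trans (dot-cong⁺ {g = λ _ → link′ z i} (proj₁ sz′) (λ j q → links q p))
      (≈-trans (dot-const z (link′ z i)) (≈-trans (*-congˡ (proj₂ sz′)) (*-identityʳ _))))
    core′ : s ⊛ s ⊛ mass′ z ≤ (s ⊖′ # 1) ⊛ (s ⊖′ # 2)
    core′ = core G′ {θ} {s ⊙ z} (record
      { nonneg = λ i → *-nonneg (<⇒≤ (0<size k)) (proj₁ sz′ i)
      ; sum≈ = ≈-trans (sum-⊙ s z) (≈-trans (*-congˡ (proj₂ sz′)) (*-identityʳ s))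
      ; link≈ = λ i p → ≈-trans (link-⊙ s z i) (*-congˡ (link≈mass i (λ q → p
          (by ((v₀ ≦ nat 0) ∷ (nat 0 ≦ v₁) ∷ []) 0 (v₁ :* v₀) (nat 0) (h₁ ⊠ h₀) refl (z i ∷ s ∷ []) (q ∷
              <⇒≤ (0<size k) ∷ [])))))
      }) (λ c → let c′ , ps = restrict-copy P G c in free c′ (All.map P⇒ ps))

  -- Here S = 6 + 3k is the total for `suc k` and S - 3 the one for `k`. The mass left after a
  -- deletion is an exact expression in θ and the deleted weights and codegrees, and it exceeds what
  -- `Bound k` allows.
  step : ∀ k → # 2 ≤ # k → Bound k → Core (suc k)
  step k 2≤k bound {zero} G D free = ⊥-elim (0<size (suc k) (≤-reflexive (≈-sym (Dense.sum≈ D))))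
  step k 2≤k bound {suc n} G {θ} {x} D free with argmax x
  ... | a , amax = ≤-stable λ θ≰ → [ small θ≰ , heavy (<⇒≤ θ≰) ]′ (≤-<-connex (x a) 1#)
    where
    open Dense D
    open Graph G
    open Edges G
    κ = # k
    s≈ : size (suc k) ≈ # 6 ⊕ # 3 ⊛ κ
    s≈ = equate ((v₀ ≐ nat 1 :+ v₁) ∷ []) (nat 3 :+ nat 3 :* v₀) (nat 6 :+ nat 3 :* v₁) ((0 , nat 3) ∷ []) refl
           (# (suc k) ∷ κ ∷ []) (fromℕ-suc k ∷ [])
    Σx : sum x ≈ # 6 ⊕ # 3 ⊛ κ
    Σx = ≈-trans sum≈ s≈
    S : Expr
    S = nat 6 :+ nat 3 :* v₀
    S≤ : ∀ {t} → (size (suc k) ⊖′ # 1) ⊛ (size (suc k) ⊖′ # 2) ≤ t →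
         (# 6 ⊕ # 3 ⊛ κ ⊖′ # 1) ⊛ (# 6 ⊕ # 3 ⊛ κ ⊖′ # 2) ≤ t
    S≤ = ≤-respˡ (*-cong (+-congʳ s≈) (+-congʳ s≈))
    0<xa : 0# < x a
    0<xa p = 0<size (suc k) (≤-respˡ sum≈ (≤-respʳ (sum-0 (suc n)) (sum-mono (λ i → ≤-trans (amax i) p))))
    mass≈ : mass x ≈ (# 6 ⊕ # 3 ⊛ κ) ⊛ θ
    mass≈ = ≈-trans (mass-dense G D) (*-congʳ s≈)
    x₁ = x ∖ a
    nn₁ : NonNeg x₁
    nn₁ = ∖-nonneg nonneg a
    Σx₁ : sum x ≈ sum x₁ ⊕ x a
    Σx₁ = sum-∖ x a
    mass₁ : mass x ≈ mass x₁ ⊕ # 3 ⊛ x a ⊛ θ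
    mass₁ = ≈-trans (mass-∖ x a) (+-congˡ (*-congˡ (link≈ a 0<xa)))
    shrink : ∀ {m c} → size k ⊛ size k ⊛ m ≤ (size k ⊖′ # 1) ⊛ (size k ⊖′ # 2) ⊛ (c ⊛ c ⊛ c) →
             (# 6 ⊕ # 3 ⊛ κ ⊖′ # 3) ⊛ (# 6 ⊕ # 3 ⊛ κ ⊖′ # 3) ⊛ m ≤
             (# 6 ⊕ # 3 ⊛ κ ⊖′ # 4) ⊛ (# 6 ⊕ # 3 ⊛ κ ⊖′ # 5) ⊛ (c ⊛ c ⊛ c)
    shrink {m} {c} p = by ((sizeᵉ :* sizeᵉ :* v₁ ≦ (sizeᵉ :- nat 1) :* (sizeᵉ :- nat 2) :* (v₂ :* v₂ :* v₂)) ∷ []) 0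
      ((S :- nat 3) :* (S :- nat 3) :* v₁) ((S :- nat 4) :* (S :- nat 5) :* (v₂ :* v₂ :* v₂)) h₀ refl (κ ∷ m ∷ c ∷
          []) (p ∷ [])
    heavy : (size (suc k) ⊖′ # 1) ⊛ (size (suc k) ⊖′ # 2) ≤ θ → 1# < x a → ⊥
    heavy θ≥ 1<xa = 0<1 (by
        ((S ≐ v₅ :+ v₁) ∷ (v₃ ≐ v₄ :+ nat 3 :* v₁ :* v₂) ∷ (v₃ ≐ S :* v₂) ∷
         ((S :- nat 3) :* (S :- nat 3) :* v₄ ≦ (S :- nat 4) :* (S :- nat 5) :* (v₅ :* v₅ :* v₅)) ∷
         ((S :- nat 4) :* (S :- nat 5) :* ((S :- v₁) :* (S :- v₁) :* (S :- v₁)) :+ nat 1 ≦ (S :- nat 3) :* (S :-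
             nat 3) :* (v₂ :* (S :- nat 3 :* v₁))) ∷ []) 0
        (nat 1) (nat 0) (h₃ ⊞ h₄ ⊞ eqn 2 (:- ((S :- nat 3) :* (S :- nat 3))) ⊞ eqn 1 ((S :- nat 3) :* (S :- nat 3))
          ⊞ eqn 0 (:- ((S :- nat 4) :* (S :- nat 5) :* ((S :- v₁) :* (S :- v₁) :+ (S :- v₁) :* v₅ :+ v₅ :* v₅)))) refl
        (κ ∷ x a ∷ θ ∷ mass x ∷ mass x₁ ∷ sum x₁ ∷ [])
        (S≈ ∷ mass₁ ∷ mass≈ ∷ bound₁ ∷ ineq ∷ []))
      where
      S≈ : # 6 ⊕ # 3 ⊛ κ ≈ sum x₁ ⊕ x a
      S≈ = ≈-trans (≈-sym Σx) Σx₁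
      0≤Σx₁ : 0# ≤ sum x₁
      0≤Σx₁ = sum-nonneg nn₁
      link₁ : link x₁ a ≈ θ
      link₁ = ≈-trans (link-∖-self x a) (link≈ a 0<xa)
      -- A copy would cover the link of `a` with S - 2 vertices, so `cover` gives (S - 1)θ ≤ (S -
      -- 2)(S - x a)². Together with θ ≥ (S - 1)(S - 2) this forces x a ≤ 1.
      noCopy : ∀ {l} → Copy k l → All (λ i → 0# < x₁ i) l → ⊥
      noCopy {l} c ps = 1<xa (0≤⇒≤ (*-cancel-0≤
          (λ q → 0<1 (≤-trans (by ((nat 2 ≦ v₀) ∷ (S ≐ v₁ :+ v₂) ∷ (nat 0 ≦ v₁) ∷
              []) 0 (nat 1) ((S :- nat 2) :* (S :- nat 1 :+ v₁))
                (cst 109 ⊞ 63 ∙ h₀ ⊞ 10 ∙ h₂ ⊞ 9 ∙ h₀ ⊠ h₀ ⊞ 3 ∙ h₀ ⊠ h₂) refl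
            (κ ∷ sum x₁ ∷ x a ∷ []) (2≤k ∷ S≈ ∷ 0≤Σx₁ ∷ [])) q))
          (by ((v₄ ≐ nat 4 :+ nat 3 :* v₀) ∷ ((v₄ :+ nat 1) :* v₃ ≦ v₄ :* (v₁ :* v₁)) ∷ (S ≐ v₁ :+ v₂) ∷
              ((S :- nat 1) :* (S :- nat 2) ≦ v₃) ∷ (nat 2 ≦ v₀) ∷ []) 0 (nat 0) ((S :- nat 2) :* (S :- nat 1 :+
              v₁) :* (nat 1 :- v₂))
                (h₁ ⊞ 11 ∙ h₃ ⊞ 3 ∙ h₃ ⊠ h₄ ⊞ eqn 2 (:- nat 1 :* ((S :- nat 2) :* (S :- nat 1 :+ v₁))) ⊞
                eqn 0 (:- nat 1 :* v₃) ⊞ eqn 0 (nat 1 :* (v₁ :* v₁))) refl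
            (κ ∷ sum x₁ ∷ x a ∷ θ ∷ # (length l) ∷ [])
            (copy-length G c ∷ ≤-respˡ (*-congˡ link₁) (cover G a l nn₁ λ 0<p 0<q p∉ q∉ → not-edge G λ e →
              free (add c a _ _ e (λ m → All.lookup ps m (≤-reflexive (∖-at x a))) p∉ q∉)) ∷ S≈ ∷ S≤ θ≥ ∷ 2≤k ∷ []))))
      bound₁ : (# 6 ⊕ # 3 ⊛ κ ⊖′ # 3) ⊛ (# 6 ⊕ # 3 ⊛ κ ⊖′ # 3) ⊛ mass x₁ ≤
               (# 6 ⊕ # 3 ⊛ κ ⊖′ # 4) ⊛ (# 6 ⊕ # 3 ⊛ κ ⊖′ # 5) ⊛ (sum x₁ ⊛ sum x₁ ⊛ sum x₁)
      bound₁ = shrink (bound G nn₁ noCopy)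
      -- From θ ≤ (S - x a)²: since (S - 1)(S - 2) is nearly (S - 3/2)², the weight of `a` barely
      -- exceeds 3/2, and for S ≥ 12 it is at most 38/25.
      25x≤38 : # 25 ⊛ x a ≤ # 38
      25x≤38 = ≤-stable λ q → 0<1 (by ((nat 2 ≦ v₀) ∷ (nat 38 ≦ nat 25 :* v₂) ∷ (S ≐ v₁ :+ v₂) ∷ (nat 0 ≦ v₁) ∷
          ((S :- nat 1) :* (S :- nat 2) ≦ v₃) ∷ (v₃ ≦ v₁ :* v₁) ∷ []) 105 (nat 1) (nat 0)
                (75 ∙ h₀ ⊞ 262 ∙ h₁ ⊞ 75 ∙ h₀ ⊠ h₁ ⊞ 25 ∙ h₁ ⊠ h₃ ⊞ 625 ∙ h₄ ⊞ 625 ∙ h₅ ⊞ eqn 2 (:- nat 625 :* S) ⊞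
                eqn 2 (:- nat 625 :* v₁) ⊞ eqn 2 (nat 950 :* (nat 1))) refl
        (κ ∷ sum x₁ ∷ x a ∷ θ ∷ []) (2≤k ∷ <⇒≤ q ∷ S≈ ∷ 0≤Σx₁ ∷ S≤ θ≥ ∷ ≤-respˡ link₁ (link≤sq G nn₁ a) ∷ []))
      -- The mass left without `a` is θ(S - 3 x a). Multiplied by (S - 3)² it exceeds the permitted
      -- value by at least 1.
      ineq : (# 6 ⊕ # 3 ⊛ κ ⊖′ # 4) ⊛ (# 6 ⊕ # 3 ⊛ κ ⊖′ # 5) ⊛ ((# 6 ⊕ # 3 ⊛ κ ⊖′ x a) ⊛ (# 6 ⊕
          # 3 ⊛ κ ⊖′ x a) ⊛ (# 6 ⊕ # 3 ⊛ κ ⊖′ x a)) ⊕ # 1 ≤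
             (# 6 ⊕ # 3 ⊛ κ ⊖′ # 3) ⊛ (# 6 ⊕ # 3 ⊛ κ ⊖′ # 3) ⊛ (θ ⊛ (# 6 ⊕ # 3 ⊛ κ ⊖′ # 3 ⊛ x a))
      ineq = by ((nat 2 ≦ v₀) ∷ (nat 1 ≦ v₁) ∷ (nat 25 :* v₁ ≦ nat 38) ∷ ((S :- nat 1) :* (S :- nat 2) ≦ v₂) ∷
          []) 2640624 ((S :- nat 4) :* (S :- nat 5) :* ((S :- v₁) :* (S :- v₁) :* (S :- v₁)) :+ nat 1) ((S :-
          nat 3) :* (S :- nat 3) :* (v₂ :* (S :- nat 3 :* v₁)))
                (cst 4837981083 ⊞ 4592386 ∙ h₂ ⊠ h₂ ⊠ h₂ ⊞ 1681568850 ∙ h₁ ⊠ h₂ ⊞ 115046250 ∙ h₁ ⊠ h₂ ⊠ h₂ ⊞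
                4593054960 ∙ h₀ ⊞ 710656830 ∙ h₀ ⊠ h₂ ⊞ 205144875 ∙ h₀ ⊠ h₁ ⊠ h₂ ⊞ 190125 ∙ h₀ ⊠ h₁ ⊠ h₂ ⊠ h₂ ⊞
                1433766087 ∙ h₀ ⊠ h₀ ⊞ 215116551 ∙ h₀ ⊠ h₀ ⊠ h₂ ⊞ 73160100 ∙ h₀ ⊠ h₀ ⊠ h₁ ⊠ h₂ ⊞
                38025 ∙ h₀ ⊠ h₀ ⊠ h₁ ⊠ h₂ ⊠ h₂ ⊞ 147498975 ∙ h₀ ⊠ h₀ ⊠ h₀ ⊞ 21560175 ∙ h₀ ⊠ h₀ ⊠ h₀ ⊠ h₂ ⊞
                658125 ∙ h₀ ⊠ h₀ ⊠ h₀ ⊠ h₁ ⊠ h₂ ⊠ h₂ ⊞ 16453125 ∙ h₀ ⊠ h₀ ⊠ h₀ ⊠ h₁ ⊠ h₁ ⊠ h₂ ⊞ 1591346250 ∙ h₃ ⊞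
                25666875 ∙ h₃ ⊠ h₂ ⊞ 1702569375 ∙ h₃ ⊠ h₀ ⊞ 17111250 ∙ h₃ ⊠ h₀ ⊠ h₂ ⊞ 604597500 ∙ h₃ ⊠ h₀ ⊠ h₀ ⊞
                2851875 ∙ h₃ ⊠ h₀ ⊠ h₀ ⊠ h₂ ⊞ 71296875 ∙ h₃ ⊠ h₀ ⊠ h₀ ⊠ h₀) refl
        (κ ∷ x a ∷ θ ∷ []) (2≤k ∷ <⇒≤ 1<xa ∷ 25x≤38 ∷ S≤ θ≥ ∷ [])
    small : (size (suc k) ⊖′ # 1) ⊛ (size (suc k) ⊖′ # 2) < θ → x a ≤ 1# → ⊥
    small θ> xa≤1 with Finₚ.any? (λ b → 0<? (x b) ×-dec ((# 4 ⊕ # 3 ⊛ κ) ⊛ x a <? W x a b))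
    -- Averaging the codegrees with `a` gives θ ≤ (S - 2) x a (S - x a). This grows with `x a` up to
    -- its value (S - 1)(S - 2) at x a = 1.
    ... | no none = θ> (≤-respʳ (≈-sym (*-cong (+-congʳ s≈) (+-congʳ s≈)))
        (by ((S ≐ v₁ :+ v₂) ∷ (v₃ ≦ (nat 4 :+ nat 3 :* v₀) :* v₂ :* v₁) ∷ (v₂ ≦ nat 1) ∷ (nat 2 ≦ v₀) ∷ []) 0
          v₃ ((S :- nat 1) :* (S :- nat 2))
          (h₁ ⊞ (3 ∙ h₃ ⊞ cst 10) ⊠ h₂ ⊠ (h₂ ⊞ 3 ∙ h₃ ⊞ cst 10) ⊞ eqn 0 (:- ((S :- nat 2) :* v₂))) refl
          (κ ∷ sum x₁ ∷ x a ∷ θ ∷ []) (≈-trans (≈-sym Σx) Σx₁ ∷ θ≤ ∷ xa≤1 ∷ 2≤k ∷ [])))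
      where
      θ≤ : θ ≤ (# 4 ⊕ # 3 ⊛ κ) ⊛ x a ⊛ sum x₁
      θ≤ = ≤-respˡ (≈-trans (≈-sym (≈-trans (dot-∖ x a (W x a)) (≈-trans (+-congˡ (≈-trans (*-congˡ (W-diag x a))
          (zeroʳ _)))
             (+-identityʳ _)))) (link≈ a 0<xa))
           (≤-respʳ (dot-const x₁ _) (dot-mono nn₁ (λ b p → ≤-stable λ q → none (b , proj₂ (∖-supp x p) , q))))
    ... | yes (b , 0<xb , W>) = 0<1 (by
        ((S ≐ v₅ :+ v₁ :+ v₂) ∷ (v₆ ≐ S :* v₄) ∷ (v₆ ≐ v₇ :+ nat 3 :* v₁ :* v₄) ∷ (v₇ ≐ v₈ :+ nat 3 :* v₂ :* v₉) ∷
         (v₄ ≐ v₉ :+ nat 2 :* v₁ :* v₃) ∷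
         ((S :- nat 3) :* (S :- nat 3) :* v₈ ≦ (S :- nat 4) :* (S :- nat 5) :* (v₅ :* v₅ :* v₅)) ∷
         ((S :- nat 4) :* (S :- nat 5) :* ((S :- v₁ :- v₂) :* (S :- v₁ :- v₂) :* (S :- v₁ :- v₂)) :+ nat 1 ≦
          (S :- nat 3) :* (S :- nat 3) :* (v₄ :* (S :- nat 3 :* v₁ :- nat 3 :* v₂) :+ nat 6 :* v₁ :* v₂ :* v₃)) ∷
              []) 0
        (nat 1) (nat 0)
        (h₅ ⊞ h₆ ⊞ eqn 1 (:- ((S :- nat 3) :* (S :- nat 3))) ⊞ eqn 2 ((S :- nat 3) :* (S :- nat 3))
         ⊞ eqn 3 ((S :- nat 3) :* (S :- nat 3)) ⊞ eqn 4 (:- ((S :- nat 3) :* (S :- nat 3) :* (nat 3 :* v₂)))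
         ⊞ eqn 0 (:- ((S :- nat 4) :* (S :- nat 5) :* ((S :- v₁ :- v₂) :* (S :- v₁ :- v₂) :+ (S :- v₁ :- v₂) :* v₅ :+
             v₅ :* v₅)))) refl
        (κ ∷ x a ∷ x b ∷ W x a b ∷ θ ∷ sum x₂ ∷ mass x ∷ mass x₁ ∷ mass x₂ ∷ link x₁ b ∷ [])
        (≈-trans (≈-sym Σx) (≈-trans Σx₁ (equate ((v₀ ≐ v₁ :+ v₂) ∷ []) (v₀ :+ v₃) (v₁ :+ v₃ :+ v₂) ((0 , nat 1) ∷
            []) refl
           (sum x₁ ∷ sum x₂ ∷ x b ∷ x a ∷ []) (≈-trans (sum-∖ x₁ b) (+-congˡ x₁b) ∷ [])))
         ∷ mass≈ ∷ mass₁ ∷ ≈-trans (mass-∖ x₁ b) (+-congˡ (*-congʳ (*-congˡ x₁b)))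
         ∷ ≈-trans (≈-sym (link≈ b 0<xb)) (≈-trans (link-∖ x a b) (+-congˡ (*-congˡ (W-sym x b a))))
         ∷ shrink (bound G nn₂ noCopy) ∷ ineq ∷ []))
      where
      a≢b : a ≢ b
      a≢b refl = W> (≤-respˡ (≈-sym (W-diag x a)) (*-nonneg (0≤+ (0≤fromℕ 4) (*-nonneg (0≤fromℕ 3) (0≤fromℕ k)))
          (nonneg a)))
      x₁b : x₁ b ≈ x b
      x₁b = ∖-≢ x a≢b
      x₂ = x₁ ∖ b
      nn₂ : NonNeg x₂
      nn₂ = ∖-nonneg nn₁ b
      -- Every edge through `ab` would have its third vertex in the copy. Its S - 2 vertices weigh
      -- at most `x a` each, which contradicts the choice of `b`.
      noCopy : ∀ {l} → Copy k l → All (λ i → 0# < x₂ i) l → ⊥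
      noCopy {l} c ps = W> (≤-respʳ (*-congʳ (copy-length G c)) (coverW G a b l nonneg amax (nonneg a)
        λ {v} _ v∉ → not-edge G λ e → free (add c a b v e
          (λ m → proj₂ (∖-supp x₁ (All.lookup ps m)) (≤-reflexive (∖-at x a)))
          (λ m → All.lookup ps m (≤-reflexive (∖-at x₁ b))) v∉)))
      ineq : (# 6 ⊕ # 3 ⊛ κ ⊖′ # 4) ⊛ (# 6 ⊕ # 3 ⊛ κ ⊖′ # 5) ⊛ ((# 6 ⊕ # 3 ⊛ κ ⊖′ x a ⊖′ x b) ⊛ (# 6 ⊕
          # 3 ⊛ κ ⊖′ x a ⊖′ x b) ⊛ (# 6 ⊕ # 3 ⊛ κ ⊖′ x a ⊖′ x b)) ⊕ # 1 ≤
             (# 6 ⊕ # 3 ⊛ κ ⊖′ # 3) ⊛ (# 6 ⊕ # 3 ⊛ κ ⊖′ # 3) ⊛ (θ ⊛ (# 6 ⊕ # 3 ⊛ κ ⊖′ # 3 ⊛ x a ⊖′ # 3 ⊛ x b) ⊕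
                 # 6 ⊛ x a ⊛ x b ⊛ W x a b)
      ineq = by ((nat 2 ≦ v₀) ∷ (nat 0 ≦ v₁) ∷ (v₁ ≦ nat 1) ∷ (nat 0 ≦ v₂) ∷ (v₂ ≦ nat 1) ∷
          ((S :- nat 1) :* (S :- nat 2) ≦ v₄) ∷ ((S :- nat 2) :* v₁ ≦ v₃) ∷
          []) 13 ((S :- nat 4) :* (S :- nat 5) :* ((S :- v₁ :- v₂) :* (S :- v₁ :- v₂) :* (S :- v₁ :- v₂)) :+
          nat 1) ((S :- nat 3) :* (S :- nat 3) :* (v₄ :* (S :- nat 3 :* v₁ :- nat 3 :* v₂) :+
          nat 6 :* v₁ :* v₂ :* v₃))
                (8336 ∙ h₄ ⊞ 62644 ∙ h₃ ⊠ h₄ ⊞ 784 ∙ h₃ ⊠ h₄ ⊠ h₄ ⊞ 109002 ∙ h₂ ⊠ h₄ ⊞ 24776 ∙ h₂ ⊠ h₄ ⊠ h₄ ⊠ h₄ ⊞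
                24776 ∙ h₂ ⊠ h₃ ⊠ h₃ ⊠ h₃ ⊞ 38340 ∙ h₂ ⊠ h₂ ⊠ h₃ ⊠ h₄ ⊞ 54366 ∙ h₂ ⊠ h₂ ⊠ h₂ ⊠ h₃ ⊞ 32466 ∙ h₁ ⊞
                10630 ∙ h₁ ⊠ h₂ ⊞ 55150 ∙ h₁ ⊠ h₂ ⊠ h₂ ⊞ 38340 ∙ h₁ ⊠ h₁ ⊠ h₄ ⊠ h₄ ⊞ 54366 ∙ h₁ ⊠ h₁ ⊠ h₂ ⊠ h₄ ⊞
                32004 ∙ h₀ ⊞ 40383 ∙ h₀ ⊠ h₄ ⊞ 27531 ∙ h₀ ⊠ h₃ ⊠ h₄ ⊞ 1575 ∙ h₀ ⊠ h₃ ⊠ h₄ ⊠ h₄ ⊞ 2142 ∙ h₀ ⊠ h₂ ⊞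
                11025 ∙ h₀ ⊠ h₂ ⊠ h₄ ⊞ 945 ∙ h₀ ⊠ h₂ ⊠ h₃ ⊠ h₃ ⊠ h₄ ⊞ 39186 ∙ h₀ ⊠ h₂ ⊠ h₂ ⊞
                945 ∙ h₀ ⊠ h₁ ⊠ h₄ ⊠ h₄ ⊠ h₄ ⊞ 67662 ∙ h₀ ⊠ h₁ ⊠ h₂ ⊠ h₄ ⊞ 630 ∙ h₀ ⊠ h₁ ⊠ h₂ ⊠ h₂ ⊞ 2898 ∙ h₀ ⊠ h₀ ⊞
                19530 ∙ h₀ ⊠ h₀ ⊠ h₄ ⊞ 10332 ∙ h₀ ⊠ h₀ ⊠ h₃ ⊠ h₄ ⊞ 504 ∙ h₀ ⊠ h₀ ⊠ h₃ ⊠ h₄ ⊠ h₄ ⊞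
                    13104 ∙ h₀ ⊠ h₀ ⊠ h₂ ⊞
                378 ∙ h₀ ⊠ h₀ ⊠ h₂ ⊠ h₄ ⊠ h₄ ⊠ h₄ ⊞ 6426 ∙ h₀ ⊠ h₀ ⊠ h₂ ⊠ h₂ ⊠ h₂ ⊠ h₃ ⊞
                378 ∙ h₀ ⊠ h₀ ⊠ h₁ ⊠ h₃ ⊠ h₃ ⊠ h₄ ⊞ 8820 ∙ h₀ ⊠ h₀ ⊠ h₁ ⊠ h₂ ⊞ 1134 ∙ h₀ ⊠ h₀ ⊠ h₁ ⊠ h₂ ⊠ h₄ ⊠ h₄ ⊞
                126 ∙ h₀ ⊠ h₀ ⊠ h₁ ⊠ h₂ ⊠ h₂ ⊞ 1134 ∙ h₀ ⊠ h₀ ⊠ h₁ ⊠ h₁ ⊠ h₃ ⊠ h₃ ⊞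
                    6426 ∙ h₀ ⊠ h₀ ⊠ h₁ ⊠ h₁ ⊠ h₁ ⊠ h₃ ⊞
                567 ∙ h₀ ⊠ h₀ ⊠ h₀ ⊞ 1701 ∙ h₀ ⊠ h₀ ⊠ h₀ ⊠ h₄ ⊞ 1701 ∙ h₀ ⊠ h₀ ⊠ h₀ ⊠ h₃ ⊠ h₄ ⊞
                1134 ∙ h₀ ⊠ h₀ ⊠ h₀ ⊠ h₂ ⊞ 567 ∙ h₀ ⊠ h₀ ⊠ h₀ ⊠ h₂ ⊠ h₂ ⊠ h₃ ⊠ h₃ ⊞
                1134 ∙ h₀ ⊠ h₀ ⊠ h₀ ⊠ h₁ ⊠ h₂ ⊠ h₄ ⊠ h₄ ⊞ 567 ∙ h₀ ⊠ h₀ ⊠ h₀ ⊠ h₁ ⊠ h₁ ⊠ h₃ ⊠ h₃ ⊞ 6804 ∙ h₅ ⊞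
                3402 ∙ h₅ ⊠ h₂ ⊞ 3402 ∙ h₅ ⊠ h₄ ⊞ 7938 ∙ h₅ ⊠ h₀ ⊞ 2268 ∙ h₅ ⊠ h₀ ⊠ h₂ ⊞ 2268 ∙ h₅ ⊠ h₀ ⊠ h₄ ⊞
                3024 ∙ h₅ ⊠ h₀ ⊠ h₀ ⊞ 378 ∙ h₅ ⊠ h₀ ⊠ h₀ ⊠ h₂ ⊞ 378 ∙ h₅ ⊠ h₀ ⊠ h₀ ⊠ h₄ ⊞ 378 ∙ h₅ ⊠ h₀ ⊠ h₀ ⊠ h₀ ⊞
                6804 ∙ h₆ ⊠ h₁ ⊠ h₃ ⊞ 4536 ∙ h₆ ⊠ h₁ ⊠ h₃ ⊠ h₀ ⊞ 756 ∙ h₆ ⊠ h₁ ⊠ h₃ ⊠ h₀ ⊠ h₀) refl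
        (κ ∷ x a ∷ x b ∷ W x a b ∷ θ ∷ []) (2≤k ∷ nonneg a ∷ xa≤1 ∷ nonneg b ∷ ≤-trans (amax b) xa≤1 ∷ S≤ (<⇒≤ θ>) ∷
          ≤-respˡ (*-congʳ (identity (nat 4 :+ nat 3 :* v₀) (S :- nat 2) refl (κ ∷ []))) (<⇒≤ W>) ∷ [])

  -- Tools for k = 2: few vertices, few pairs, removal of four vertices, de Caen's inequality

  minimum : ∀ {A : Set} {P : A → Set} → (∀ a → Dec (P a)) → (f : A → Carrier) → ∀ l →
            (∃ λ a → P a × ∀ b → b ∈ l → P b → f a ≤ f b) ⊎ (∀ b → b ∈ l → ¬ P b)
  minimum P? f []      = inj₂ λ _ ()
  minimum P? f (a ∷ l) with minimum P? f l | P? a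
  ... | inj₂ none | no ¬pa = inj₂ λ { b (here refl) → ¬pa ; b (there m) → none b m }
  ... | inj₂ none | yes pa = inj₁ (a , pa , λ { b (here refl) _ → ≤-refl ; b (there m) pb → ⊥-elim (none b m pb) })
  ... | inj₁ (c , pc , le) | no ¬pa = inj₁ (c , pc , λ { b (here refl) pb → ⊥-elim (¬pa pb) ; b (there m) pb →
      le b m pb })
  ... | inj₁ (c , pc , le) | yes pa with total (f a) (f c)
  ...   | inj₁ fa≤fc = inj₁ (a , pa , λ { b (here refl) _ → ≤-refl ; b (there m) pb → ≤-trans fa≤fc (le b m pb) })
  ...   | inj₂ fc≤fa = inj₁ (c , pc , λ { b (here refl) _ → fc≤fa ; b (there m) pb → le b m pb })

  -- Expand the sum of the squares (y i - 1)² over `l`.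
  sqs≥ : ∀ {n} (l : List (Fin n)) {y : Weights n} → (∀ i → 0# < y i → i ∈ l) → NonNeg y →
         # 2 ⊛ sum y ⊖′ # (length l) ≤ sqs y
  sqs≥ {n} [] {y} h nn = by ((v₀ ≦ nat 0) ∷ (nat 0 ≦ v₁) ∷ []) 0 (nat 2 :* v₀ :- nat 0) v₁ (2 ∙ h₀ ⊞ h₁) refl
    (sum y ∷ sqs y ∷ [])
    (Σ≤0 ∷ dot-nonneg nn (λ i _ → nn i) ∷ [])
    where
    lem : ∀ {i} → ¬ i ∈ []
    lem ()
    Σ≤0 : sum y ≤ 0#
    Σ≤0 = ≤-respʳ (sum-0 n) (sum-mono {g = λ _ → 0#} (λ i → ≤-stable λ p → lem (h i p)))
  sqs≥ (c ∷ l) {y} h nn = by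
    ((v₀ ≐ v₁ :+ v₂) ∷ (v₃ ≐ v₄ :+ v₂ :* v₂) ∷ (nat 2 :* v₁ :- v₅ ≦ v₄) ∷ (v₆ ≐ nat 1 :+ v₅) ∷ []) 0
    (nat 2 :* v₀ :- v₆) v₃ (h₂ ⊞ sq (v₂ :- nat 1) ⊞ eqn 0 (nat 2) ⊞ eqn 1 (:- nat 1) ⊞ eqn 3 (:- nat 1)) refl
    (sum y ∷ sum (y ∖ c) ∷ y c ∷ sqs y ∷ sqs (y ∖ c) ∷ # (length l) ∷ # (suc (length l)) ∷ [])
    (sum-∖ y c ∷ sqs-∖ y c ∷ sqs≥ l (λ i p → lem i (∖-supp y p)) (∖-nonneg nn c) ∷ fromℕ-suc (length l) ∷ [])
    where
    lem : ∀ i → c ≢ i × 0# < y i → i ∈ l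
    lem i (c≢i , p) with h i p
    ... | here refl = ⊥-elim (c≢i refl)
    ... | there m   = m

  module _ {n} (G : Triples n) where
    open Graph G
    open Edges G

    W≤ : ∀ {y} → NonNeg y → ∀ i j → W y i j ≤ sum y ⊖′ y j
    W≤ {y} nn i j = by ((v₀ ≦ v₁) ∷ (v₂ ≐ v₁ :+ v₃) ∷ []) 0 v₀ (v₂ :- v₃) (h₀ ⊞ eqn 1 (:- nat 1)) refl
      (W y i j ∷ sum (y ∖ j) ∷ sum y ∷ y j ∷ [])
      (≤-respˡ (W-∖-self y j i) (W≤sum G (∖-nonneg nn j) i j) ∷ sum-∖ y j ∷ [])

    pairs≈ : ∀ (y : Weights n) → dot y (λ p → sum y ⊖′ y p) ≈ sum y ⊛ sum y ⊖′ sqs y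
    pairs≈ y = ≈-trans (dot-+ y (λ _ → sum y) (λ p → ⊖ y p)) (+-cong (dot-const y (sum y))
      (≈-trans (dot-congʳ (λ p → identity (:- v₀) (:- nat 1 :* v₀) refl (y p ∷ [])))
        (≈-trans (dot-* y (⊖ 1#) y) (identity (:- nat 1 :* v₀) (:- v₀) refl (sqs y ∷ [])))))

    link≤ : ∀ {y} → NonNeg y → ∀ i → link y i ≤ sum y ⊛ sum y ⊖′ sqs y
    link≤ {y} nn i = ≤-respʳ (pairs≈ y) (dot-mono nn (λ p _ → W≤ nn i p))

    -- At most nine weights of total 9 have squares summing to at least 9. As x a = 1, the link of
    -- `a` is at most 8² less the other squares, that is 64 - 8.
    few-vertices : ∀ {x θ} → Dense G (# 9) θ x → (l : List (Fin n)) → # (length l) ≤ # 9 →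
                   (∀ i → 0# < x i → i ∈ l) → ∀ {a} → 1# ≤ x a → x a ≤ 1# → θ ≤ # 56
    few-vertices {x} {θ} D l len h {a} 1≤xa xa≤1 = by
      ((v₀ ≦ v₁ :* v₁ :- v₂) ∷ (nat 9 ≐ v₁ :+ v₃) ∷ (v₄ ≐ v₂ :+ v₃ :* v₃) ∷ (nat 2 :* nat 9 :- v₅ ≦ v₄) ∷
          (v₅ ≦ nat 9) ∷
       (nat 1 ≦ v₃) ∷ (v₃ ≦ nat 1) ∷ []) 0 v₀ (nat 56)
      (h₀ ⊞ h₃ ⊞ h₄ ⊞ 2 ∙ h₅ ⊠ (hyp 6 ⊞ cst 7) ⊞ eqn 1 (:- (nat 9 :- v₃ :+ v₁)) ⊞ eqn 2 (nat 1)) refl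
      (θ ∷ sum (x ∖ a) ∷ sqs (x ∖ a) ∷ x a ∷ sqs x ∷ # (length l) ∷ [])
      (≤-respˡ (≈-trans (link-∖-self x a) (link≈ a (<-≤-trans 0<1 1≤xa))) (link≤ (∖-nonneg nonneg a) a) ∷
       ≈-trans (≈-sym sum≈) (sum-∖ x a) ∷ sqs-∖ x a ∷ ≤-respˡ (+-congʳ (*-congˡ sum≈)) (sqs≥ l h nonneg) ∷ len ∷
       1≤xa ∷ xa≤1 ∷ [])
      where open Dense D

    private
      -- An upper bound for the indicator of `l`, in both orders, written as a sum of products so
      -- that `dot` can be evaluated on it.
      count : List (Fin n × Fin n) → Fin n → Fin n → Carrier
      count []            p q = 0#
      count ((a , b) ∷ l) p q = δ a p ⊛ δ b q ⊕ δ b p ⊛ δ a q ⊕ count l p q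

      0≤δδ : ∀ (a b p q : Fin n) → 0# ≤ δ a p ⊛ δ b q
      0≤δδ a b p q = *-nonneg (0≤[] (does (a Finₚ.≟ p))) (0≤[] (does (b Finₚ.≟ q)))

      0≤count : ∀ l p q → 0# ≤ count l p q
      0≤count []            p q = ≤-refl
      0≤count ((a , b) ∷ l) p q = 0≤+ (0≤+ (0≤δδ a b p q) (0≤δδ b a p q)) (0≤count l p q)

      δδ : ∀ (a b : Fin n) → δ a a ⊛ δ b b ≈ 1#
      δδ a b = ≈-trans (*-cong (δ-refl a) (δ-refl b)) (*-identityˡ 1#)

      1≤count : ∀ l {p q} → InPairs p q l → 1# ≤ count l p q
      1≤count ((a , b) ∷ l) (here (inj₁ (refl , refl))) =
        by ((v₀ ≐ nat 1) ∷ (nat 0 ≦ v₁) ∷ (nat 0 ≦ v₂) ∷ []) 0 (nat 1) (v₀ :+ v₁ :+ v₂) (eqn 0 (:- nat 1) ⊞ h₁ ⊞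
            h₂) refl
          (_ ∷ δ b a ⊛ δ a b ∷ count l a b ∷ []) (δδ a b ∷ 0≤δδ b a a b ∷ 0≤count l a b ∷ [])
      1≤count ((a , b) ∷ l) (here (inj₂ (refl , refl))) =
        by ((v₀ ≐ nat 1) ∷ (nat 0 ≦ v₁) ∷ (nat 0 ≦ v₂) ∷ []) 0 (nat 1) (v₁ :+ v₀ :+ v₂) (eqn 0 (:- nat 1) ⊞ h₁ ⊞
            h₂) refl
          (_ ∷ δ a b ⊛ δ b a ∷ count l b a ∷ []) (δδ b a ∷ 0≤δδ a b b a ∷ 0≤count l b a ∷ [])
      1≤count ((a , b) ∷ l) {p} {q} (there m) =
        by ((nat 0 ≦ v₀) ∷ (nat 0 ≦ v₁) ∷ (nat 1 ≦ v₂) ∷ []) 0 (nat 1) (v₀ :+ v₁ :+ v₂) (h₀ ⊞ h₁ ⊞ h₂) refl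
          (δ a p ⊛ δ b q ∷ δ b p ⊛ δ a q ∷ count l p q ∷ []) (0≤δδ a b p q ∷ 0≤δδ b a p q ∷ 1≤count l m ∷ [])

      dot-δδ : ∀ y (a b : Fin n) → dot y (λ p → dot y (λ q → δ a p ⊛ δ b q)) ≈ y a ⊛ y b
      dot-δδ y a b = ≈-trans (dot-congʳ (λ p → ≈-trans (dot-* y (δ a p) (δ b))
          (≈-trans (*-congˡ (≈-trans (dot-comm y (δ b)) (dot-δ b y))) (*-comm _ _))))
        (≈-trans (dot-* y (y b) (δ a)) (≈-trans (*-congˡ (≈-trans (dot-comm y (δ a)) (dot-δ a y))) (*-comm _ _)))

      count≤ : ∀ {y} → NonNeg y → (∀ i → y i ≤ 1#) → ∀ l →
               dot y (λ p → dot y (count l p)) ≤ # 2 ⊛ # (length l)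
      count≤ {y} nn le [] = ≤-reflexive (≈-trans (≈-trans
        (dot-congʳ (λ p → ≈-trans (dot-const y 0#) (zeroˡ _))) (≈-trans (dot-const y 0#) (zeroˡ _))) (≈-sym (zeroʳ
            _)))
      count≤ {y} nn le ((a , b) ∷ l) = ≤-respˡ (≈-sym eq)
        (by ((v₀ ≦ nat 2 :* v₁) ∷ (v₂ ≐ nat 1 :+ v₁) ∷ (nat 0 ≦ v₃) ∷ (v₃ ≦ nat 1) ∷ (nat 0 ≦ v₄) ∷ (v₄ ≦ nat 1) ∷
            []) 0
          (v₃ :* v₄ :+ v₄ :* v₃ :+ v₀) (nat 2 :* v₂) (h₀ ⊞ 2 ∙ h₃ ⊞ 2 ∙ h₂ ⊠ h₅ ⊞ eqn 1 (:- nat 2)) refl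
          (dot y (λ p → dot y (count l p)) ∷ # (length l) ∷ # (suc (length l)) ∷ y a ∷ y b ∷ [])
          (count≤ nn le l ∷ fromℕ-suc (length l) ∷ nn a ∷ le a ∷ nn b ∷ le b ∷ []))
        where
        eq : dot y (λ p → dot y (count ((a , b) ∷ l) p)) ≈ y a ⊛ y b ⊕ y b ⊛ y a ⊕ dot y (λ p → dot y (count l p))
        eq = ≈-trans (dot-congʳ (λ p → ≈-trans (dot-+ y _ _) (+-congʳ (dot-+ y _ _))))
          (≈-trans (dot-+ y _ _) (+-congʳ (≈-trans (dot-+ y _ _) (+-cong (dot-δδ y a b) (dot-δδ y b a)))))

    -- A pair has weight at most 1 and occurs in both orders, hence the factor 2.
    pairs-bound : ∀ {y} → NonNeg y → (∀ i → y i ≤ 1#) → ∀ j l →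
                  (∀ {p q} → 0# < y p → 0# < y q → Edge j p q → InPairs p q l) →
                  link y j ≤ # 2 ⊛ # (length l)
    pairs-bound {y} nn le j l h = ≤-trans (dot-mono nn (λ p 0<p → dot-mono nn (λ q 0<q →
        lem p q 0<p 0<q))) (count≤ nn le l)
      where
      lem : ∀ p q → 0# < y p → 0# < y q → E[ j , p , q ] ≤ count l p q
      lem p q 0<p 0<q with E j p q in eq
      ... | true  = 1≤count l (h 0<p 0<q eq)
      ... | false = 0≤count l p q

    star-bound : ∀ {y} → NonNeg y → ∀ j b →
                 (∀ {p q} → 0# < y p → 0# < y q → Edge j p q → ¬ (p ≢ b × q ≢ b)) →
                 link y j ≤ # 2 ⊛ y b ⊛ W y j b
    star-bound {y} nn j b h = ≤-reflexive (≈-trans (link-∖ y b j) (≈-trans (+-congʳ zero′) (+-identityˡ _)))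
      where
      zero′ : link (y ∖ b) j ≈ 0#
      zero′ = link≈0 G (∖-nonneg nn b) (λ 0<p 0<q e →
        let b≢p , 0<yp = ∖-supp y 0<p ; b≢q , 0<yq = ∖-supp y 0<q in
        h 0<yp 0<yq e ((λ p≡b → b≢p (≡.sym p≡b)) , (λ q≡b → b≢q (≡.sym q≡b))))

    search : ∀ (y : Weights n) j {C : Fin n → Fin n → Set} → (∀ p q → Dec (C p q)) →
             (∃₂ λ p q → 0# < y p × 0# < y q × Edge j p q × C p q) ⊎
             (∀ {p q} → 0# < y p → 0# < y q → Edge j p q → ¬ C p q)
    search y j C? with Finₚ.any? (λ p → Finₚ.any? λ q → 0<? (y p) ×-dec 0<? (y q) ×-dec (E j p q Boolₚ.≟ true) ×-dec
        C? p q)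
    ... | yes (p , q , r) = inj₁ (p , q , r)
    ... | no none = inj₂ λ {p} {q} a b e c → none (p , q , a , b , e , c)

    find-pair : ∀ {y} → NonNeg y → (∀ i → y i ≤ 1#) → ∀ j l → # 2 ⊛ # (length l) < link y j →
                ∃₂ λ p q → 0# < y p × 0# < y q × Edge j p q × ¬ InPairs p q l
    find-pair {y} nn le j l lt with search y j (λ p q → ¬? (inPairs? p q l))
    ... | inj₁ r = r
    ... | inj₂ h = ⊥-elim (lt (pairs-bound nn le j l λ {p} {q} a b e → stable (inPairs? p q l) (h a b e)))
      where
      stable : ∀ {A : Set} → Dec A → ¬ ¬ A → A
      stable (yes a) _ = a
      stable (no ¬a) f = ⊥-elim (f ¬a)

    find-avoiding : ∀ {y} → NonNeg y → ∀ j b → # 2 ⊛ y b ⊛ W y j b < link y j →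
                    ∃₂ λ p q → 0# < y p × 0# < y q × Edge j p q × p ≢ b × q ≢ b
    find-avoiding {y} nn j b lt with search y j (λ p q → ¬? (p Finₚ.≟ b) ×-dec ¬? (q Finₚ.≟ b))
    ... | inj₁ (p , q , r) = p , q , r
    ... | inj₂ h = ⊥-elim (lt (star-bound nn j b h))

    module _ {x : Weights n} (nn : NonNeg x) {a b c d : Fin n} (a≢b : a ≢ b) (a≢c : a ≢ c) (a≢d : a ≢ d)
             (b≢c : b ≢ c) (b≢d : b ≢ d) (c≢d : c ≢ d) where
      private
        x₁ = x ∖ a
        x₂ = x₁ ∖ b
        x₃ = x₂ ∖ c
        y  = x₃ ∖ d
        nn₁ = ∖-nonneg nn a
        nn₂ = ∖-nonneg nn₁ b
        nn₃ = ∖-nonneg nn₂ c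
        nny = ∖-nonneg nn₃ d
        xb : x₁ b ≈ x b
        xb = ∖-≢ x a≢b
        xc : x₂ c ≈ x c
        xc = ≈-trans (∖-≢ x₁ b≢c) (∖-≢ x a≢c)
        xd : x₃ d ≈ x d
        xd = ≈-trans (∖-≢ x₂ c≢d) (≈-trans (∖-≢ x₁ b≢d) (∖-≢ x a≢d))

      -- Half of what the pairs inside a, b, c, d contribute to the link of `j`.
      present : Fin n → Carrier
      present j = x a ⊛ x b ⊛ E[ j , a , b ] ⊕ x a ⊛ x c ⊛ E[ j , a , c ] ⊕ x a ⊛ x d ⊛ E[ j , a , d ]
                ⊕ x b ⊛ x c ⊛ E[ j , b , c ] ⊕ x b ⊛ x d ⊛ E[ j , b , d ] ⊕ x c ⊛ x d ⊛ E[ j , c , d ]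

      sum-∖₄ : sum x ≈ sum y ⊕ (x a ⊕ x b ⊕ x c ⊕ x d)
      sum-∖₄ = equate ((v₀ ≐ v₁ :+ v₂) ∷ (v₁ ≐ v₃ :+ v₄) ∷ (v₃ ≐ v₅ :+ v₆) ∷ (v₅ ≐ v₇ :+ v₈) ∷ []) v₀
        (v₇ :+ (v₂ :+ v₄ :+ v₆ :+ v₈)) ((0 , nat 1) ∷ (1 , nat 1) ∷ (2 , nat 1) ∷ (3 , nat 1) ∷ []) refl
        (sum x ∷ sum x₁ ∷ x a ∷ sum x₂ ∷ x b ∷ sum x₃ ∷ x c ∷ sum y ∷ x d ∷ [])
        (sum-∖ x a ∷ ≈-trans (sum-∖ x₁ b) (+-congˡ xb) ∷ ≈-trans (sum-∖ x₂ c) (+-congˡ xc) ∷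
         ≈-trans (sum-∖ x₃ d) (+-congˡ xd) ∷ [])

      link-∖₄ : ∀ j → link x j ≈ link y j ⊕ # 2 ⊛ (x a ⊛ W y j a ⊕ x b ⊛ W y j b ⊕ x c ⊛ W y j c ⊕ x d ⊛ W y j d)
                        ⊕ # 2 ⊛ present j
      link-∖₄ j = equate
          ((v₀ ≐ v₁ :+ nat 2 :* (var 10 :+ var 11 :+ var 12 :+ var 13 :+ var 14 :+ var 15) :+ nat 2 :* v₂ :* (v₃ :+
              v₄ :* v₅ :+ v₆ :* v₇ :+ v₈ :* v₉)) ∷ []) v₀
          (v₁ :+ nat 2 :* (v₂ :* v₃ :+ var 10 :+ var 11 :+ var 12) :+ nat 2 :* (v₂ :* v₄ :* v₅ :+ v₂ :* v₆ :* v₇ :+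
              v₂ :* v₈ :* v₉ :+ var 13 :+ var 14 :+ var 15))
          ((0 , nat 1) ∷ []) refl
          (link x j ∷ link y j ∷ x a ∷ W y j a ∷ x b ∷ E[ j , a , b ] ∷ x c ∷ E[ j , a , c ] ∷ x d ∷ E[ j , a , d ] ∷
           x b ⊛ W y j b ∷ x c ⊛ W y j c ∷ x d ⊛ W y j d ∷
           x b ⊛ x c ⊛ E[ j , b , c ] ∷ x b ⊛ x d ⊛ E[ j , b , d ] ∷ x c ⊛ x d ⊛ E[ j , c , d ] ∷ [])
          (step₁ ∷ [])
        where
        rest : Carrier
        rest = x b ⊛ W y j b ⊕ x c ⊛ W y j c ⊕ x d ⊛ W y j d ⊕ x b ⊛ x c ⊛ E[ j , b , c ] ⊕
            x b ⊛ x d ⊛ E[ j , b , d ] ⊕ x c ⊛ x d ⊛ E[ j , c , d ]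
        Wd : W x₃ j d ≈ W y j d
        Wd = ≈-sym (W-∖-self x₃ d j)
        Wc : W x₂ j c ≈ W y j c ⊕ x d ⊛ E[ j , c , d ]
        Wc = ≈-trans (≈-sym (W-∖-self x₂ c j)) (≈-trans (W-∖ x₃ d j c) (+-congˡ (*-congʳ xd)))
        Wb : W x₁ j b ≈ W y j b ⊕ x c ⊛ E[ j , b , c ] ⊕ x d ⊛ E[ j , b , d ]
        Wb = equate ((v₀ ≐ v₁ :+ v₂) ∷ (v₁ ≐ v₃ :+ v₄) ∷ []) v₀ (v₃ :+ v₂ :+ v₄) ((0 , nat 1) ∷ (1 , nat 1) ∷ []) refl
          (W x₁ j b ∷ W x₃ j b ∷ x c ⊛ E[ j , b , c ] ∷ W y j b ∷ x d ⊛ E[ j , b , d ] ∷ [])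
          (≈-trans (≈-sym (W-∖-self x₁ b j)) (≈-trans (W-∖ x₂ c j b) (+-congˡ (*-congʳ xc))) ∷
           ≈-trans (W-∖ x₃ d j b) (+-congˡ (*-congʳ xd)) ∷ [])
        Wa : W x j a ≈ W y j a ⊕ x b ⊛ E[ j , a , b ] ⊕ x c ⊛ E[ j , a , c ] ⊕ x d ⊛ E[ j , a , d ]
        Wa = equate ((v₀ ≐ v₁ :+ v₂) ∷ (v₁ ≐ v₃ :+ v₄) ∷ (v₃ ≐ v₅ :+ v₆) ∷ []) v₀ (v₅ :+ v₂ :+ v₄ :+ v₆)
          ((0 , nat 1) ∷ (1 , nat 1) ∷ (2 , nat 1) ∷ []) refl
          (W x j a ∷ W x₂ j a ∷ x b ⊛ E[ j , a , b ] ∷ W x₃ j a ∷ x c ⊛ E[ j , a , c ] ∷ W y j a ∷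
              x d ⊛ E[ j , a , d ] ∷ [])
          (≈-trans (≈-sym (W-∖-self x a j)) (≈-trans (W-∖ x₁ b j a) (+-congˡ (*-congʳ xb))) ∷
           ≈-trans (W-∖ x₂ c j a) (+-congˡ (*-congʳ xc)) ∷ ≈-trans (W-∖ x₃ d j a) (+-congˡ (*-congʳ xd)) ∷ [])
        step₁ : link x j ≈ link y j ⊕ # 2 ⊛ rest ⊕ # 2 ⊛ x a ⊛ (W y j a ⊕ x b ⊛ E[ j , a , b ] ⊕
            x c ⊛ E[ j , a , c ] ⊕ x d ⊛ E[ j , a , d ])
        step₁ = equate
          ((v₀ ≐ v₁ :+ nat 2 :* v₂ :* v₃) ∷ (v₁ ≐ v₄ :+ nat 2 :* v₅ :* (v₆ :+ v₇ :* v₈ :+ v₉ :* var 10)) ∷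
           (v₄ ≐ var 11 :+ nat 2 :* v₇ :* (var 12 :+ v₉ :* var 13)) ∷ (var 11 ≐ var 14 :+ nat 2 :* v₉ :* var 15) ∷
               []) v₀
          (var 14 :+ nat 2 :* (v₅ :* v₆ :+ v₇ :* var 12 :+ v₉ :* var 15 :+ v₅ :* v₇ :* v₈ :+ v₅ :* v₉ :* var 10 :+
              v₇ :* v₉ :* var 13)
            :+ nat 2 :* v₂ :* v₃)
          ((0 , nat 1) ∷ (1 , nat 1) ∷ (2 , nat 1) ∷ (3 , nat 1) ∷ []) refl
          (link x j ∷ link x₁ j ∷ x a ∷ _ ∷ link x₂ j ∷ x b ∷ W y j b ∷ x c ∷ E[ j , b , c ] ∷ x d ∷ E[ j , b , d ] ∷
           link x₃ j ∷ W y j c ∷ E[ j , c , d ] ∷ link y j ∷ W y j d ∷ [])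
          (≈-trans (link-∖ x a j) (+-congˡ (*-congˡ Wa)) ∷
           ≈-trans (link-∖ x₁ b j) (+-congˡ (*-cong (*-congˡ xb) Wb)) ∷
           ≈-trans (link-∖ x₂ c j) (+-congˡ (*-cong (*-congˡ xc) Wc)) ∷
           ≈-trans (link-∖ x₃ d j) (+-congˡ (*-cong (*-congˡ xd) Wd)) ∷ [])

      -- The link splits into pairs outside, mixed and inside. Of a mixed pair only this is used:
      -- its outer vertex is not `j`.
      link-∖₄≤ : ∀ j → link x j ≤ link y j ⊕ # 2 ⊛ (x a ⊕ x b ⊕ x c ⊕ x d) ⊛ (sum y ⊖′ y j) ⊕ # 2 ⊛ present j
      link-∖₄≤ j = by
        ((v₀ ≐ v₁ :+ nat 2 :* (v₂ :* v₃ :+ v₄ :* v₅ :+ v₆ :* v₇ :+ v₈ :* v₉) :+ var 11) ∷ (v₃ ≦ var 10) ∷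
            (v₅ ≦ var 10) ∷
         (v₇ ≦ var 10) ∷ (v₉ ≦ var 10) ∷ (nat 0 ≦ v₂) ∷ (nat 0 ≦ v₄) ∷ (nat 0 ≦ v₆) ∷ (nat 0 ≦ v₈) ∷ []) 0
        v₀ (v₁ :+ nat 2 :* (v₂ :+ v₄ :+ v₆ :+ v₈) :* var 10 :+ var 11)
        (2 ∙ h₅ ⊠ h₁ ⊞ 2 ∙ hyp 6 ⊠ h₂ ⊞ 2 ∙ hyp 7 ⊠ h₃ ⊞ 2 ∙ hyp 8 ⊠ h₄ ⊞ eqn 0 (nat 1)) refl
        (link x j ∷ link y j ∷ x a ∷ W y j a ∷ x b ∷ W y j b ∷ x c ∷ W y j c ∷ x d ∷ W y j d ∷ sum y ⊖′ y j ∷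
            # 2 ⊛ present j ∷ [])
        (link-∖₄ j ∷ le a ∷ le b ∷ le c ∷ le d ∷ nn a ∷ nn b ∷ nn c ∷ nn d ∷ [])
        where
        le : ∀ i → W y j i ≤ sum y ⊖′ y j
        le i = ≤-respˡ (W-sym y i j) (W≤ nny i j)

    -- De Caen's argument: without K₄ no vertex forms edges with all three pairs of an edge bcd.

    private
      opaque
        unfolding dot

        swap₂ : ∀ (y : Weights n) (f : Fin n → Fin n → Carrier) →
                dot y (λ b → dot y (f b)) ≈ dot y (λ c → dot y (λ b → f b c))
        swap₂ y f = ≈-trans (sum-cong (λ b → *-distribˡ-sum (y b) (λ c → y c ⊛ f b c)))
          (≈-trans (∑-comm (λ b c → y b ⊛ (y c ⊛ f b c)))
            (sum-cong (λ c → ≈-trans (sum-cong (λ b → identity (v₀ :* (v₁ :* v₂)) (v₁ :* (v₀ :* v₂)) refl (y b ∷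
                y c ∷ f b c ∷ [])))
              (≈-sym (*-distribˡ-sum (y c) (λ b → y b ⊛ f b c))))))

    trip : Weights n → (Fin n → Fin n → Fin n → Carrier) → Carrier
    trip y f = dot y (λ b → dot y (λ c → dot y (λ d → E[ b , c , d ] ⊛ f b c d)))

    trip-swap₁₂ : ∀ y f → trip y f ≈ trip y (λ b c d → f c b d)
    trip-swap₁₂ y f = ≈-trans (swap₂ y _) (dot-congʳ (λ c → dot-congʳ (λ b → dot-congʳ (λ d →
      *-congʳ (≈-reflexive (≡.cong [_] (swap₁₂ b c d)))))))

    trip-swap₂₃ : ∀ y f → trip y f ≈ trip y (λ b c d → f b d c)
    trip-swap₂₃ y f = dot-congʳ (λ b → ≈-trans (swap₂ y _) (dot-congʳ (λ d → dot-congʳ (λ c →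
      *-congʳ (≈-reflexive (≡.cong [_] (swap₂₃ b c d)))))))

    trip-+ : ∀ y f g → trip y (λ b c d → f b c d ⊕ g b c d) ≈ trip y f ⊕ trip y g
    trip-+ y f g = ≈-trans (dot-congʳ (λ b → ≈-trans (dot-congʳ (λ c → ≈-trans (dot-congʳ (λ d → distribˡ _ _ _))
      (dot-+ y _ _))) (dot-+ y _ _))) (dot-+ y _ _)

    trip-const : ∀ y (f : Fin n → Fin n → Carrier) → trip y (λ b c _ → f b c) ≈ dot y (λ b → dot y (λ c →
        W y b c ⊛ f b c))
    trip-const y f = dot-congʳ (λ b → dot-congʳ (λ c → ≈-trans (dot-congʳ (λ d → *-comm _ _))
      (≈-trans (dot-* y (f b c) _) (*-comm _ _))))

    trip-mass : ∀ y c → trip y (λ _ _ _ → c) ≈ c ⊛ mass y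
    trip-mass y c = ≈-trans (trip-const y (λ _ _ → c)) (≈-trans (dot-congʳ (λ b → ≈-trans (dot-congʳ (λ d →
        *-comm _ _))
      (dot-* y c (W y b)))) (dot-* y c (link y)))

    trip-vertices : ∀ y → trip y (λ b c d → y b ⊕ y c ⊕ y d) ≈ # 3 ⊛ dot y (λ b → y b ⊛ link y b)
    trip-vertices y = ≈-trans (trip-+ y _ _) (≈-trans (+-cong (≈-trans (trip-+ y _ _) (+-cong U₁ U₂)) U₃)
      (identity (v₀ :+ v₀ :+ v₀) (nat 3 :* v₀) refl (S ∷ [])))
      where
      S = dot y (λ b → y b ⊛ link y b)
      U₁ : trip y (λ b _ _ → y b) ≈ S
      U₁ = ≈-trans (trip-const y (λ b _ → y b)) (dot-congʳ (λ b → ≈-trans (dot-congʳ (λ c →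
          *-comm _ _)) (dot-* y (y b) (W y b))))
      U₂ : trip y (λ _ c _ → y c) ≈ S
      U₂ = ≈-trans (trip-swap₁₂ y _) U₁
      U₃ : trip y (λ _ _ d → y d) ≈ S
      U₃ = ≈-trans (trip-swap₂₃ y _) U₂

    trip-pairs : ∀ y (f : Fin n → Fin n → Carrier) → trip y (λ b c d → f b c ⊕ f b d ⊕ f c d ⊕ (y b ⊕ y c ⊕ y d)) ≈
                 # 3 ⊛ dot y (λ b → dot y (λ c → W y b c ⊛ f b c)) ⊕ # 3 ⊛ dot y (λ b → y b ⊛ link y b)
    trip-pairs y f = ≈-trans (trip-+ y _ _) (+-cong (≈-trans (trip-+ y _ _)
        (≈-trans (+-cong (≈-trans (trip-+ y _ _) (+-cong T₁ T₂)) T₃) (identity (v₀ :+ v₀ :+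
            v₀) (nat 3 :* v₀) refl (Q ∷ []))))
      (trip-vertices y))
      where
      Q = dot y (λ b → dot y (λ c → W y b c ⊛ f b c))
      T₁ : trip y (λ b c _ → f b c) ≈ Q
      T₁ = trip-const y f
      T₂ : trip y (λ b _ d → f b d) ≈ Q
      T₂ = ≈-trans (trip-swap₂₃ y _) T₁
      T₃ : trip y (λ _ c d → f c d) ≈ Q
      T₃ = ≈-trans (trip-swap₁₂ y _) T₂

    trip-mono : ∀ {y} → NonNeg y → ∀ {f g} →
                (∀ {b c d} → 0# < y b → 0# < y c → 0# < y d → Edge b c d → f b c d ≤ g b c d) → trip y f ≤ trip y g
    trip-mono {y} nn {f} {g} h = dot-mono nn (λ b pb → dot-mono nn (λ c pc → dot-mono nn (λ d pd →
        point b c d pb pc pd)))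
      where
      point : ∀ b c d → 0# < y b → 0# < y c → 0# < y d → E[ b , c , d ] ⊛ f b c d ≤ E[ b , c , d ] ⊛ g b c d
      point b c d pb pc pd with E b c d in e
      ... | false = ≤-reflexive (≈-trans (zeroˡ _) (≈-sym (zeroˡ _)))
      ... | true = ≤-respˡ (≈-sym (*-identityˡ _)) (≤-respʳ (≈-sym (*-identityˡ _)) (h pb pc pd e))

    K₄-free : Weights n → Set
    K₄-free y = ∀ {a b c d} → 0# < y a → 0# < y b → 0# < y c → 0# < y d →
                Edge a b c → Edge a b d → Edge a c d → Edge b c d → ⊥

    squareW : Weights n → Carrier
    squareW y = dot y (λ b → dot y (λ c → W y b c ⊛ W y b c))

    deCaen : ∀ {y} → NonNeg y → K₄-free y →
             # 3 ⊛ squareW y ⊕ # 3 ⊛ dot y (λ b → y b ⊛ link y b) ≤ # 2 ⊛ sum y ⊛ mass y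
    deCaen {y} nn free = ≤-respˡ (trip-pairs y (W y)) (≤-respʳ (trip-mass y (# 2 ⊛ sum y)) (trip-mono nn (point _ _
        _)))
      where
      F : Fin n → Fin n → Fin n → Carrier
      F b c d = W y b c ⊕ W y b d ⊕ W y c d ⊕ (y b ⊕ y c ⊕ y d)
      point : ∀ b c d → 0# < y b → 0# < y c → 0# < y d → Edge b c d → F b c d ≤ # 2 ⊛ sum y
      point b c d pb pc pd e = ≤-respˡ eq (≤-respʳ (dot-const y (# 2)) (dot-mono nn vertex))
        where
        eq : dot y (λ v → E[ b , c , v ] ⊕ E[ b , d , v ] ⊕ E[ c , d , v ] ⊕ (δ b v ⊕ δ c v ⊕ δ d v)) ≈ F b c d
        at′ : ∀ a → dot y (δ a) ≈ y a
        at′ a = ≈-trans (dot-comm y (δ a)) (dot-δ a y)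
        eq = ≈-trans (dot-+ y _ _) (+-cong (≈-trans (dot-+ y _ _) (+-congʳ (dot-+ y _ _)))
               (≈-trans (dot-+ y _ _) (+-cong (≈-trans (dot-+ y _ _) (+-cong (at′ b) (at′ c))) (at′ d))))
        ne = edge-≢ G e
        -- A vertex of `bcd` forms an edge with at most one pair of `bcd`, so the bound 2 leaves
        -- room for an extra 1 there. This gain yields the weights of `b`, `c` and `d`.
        vertex : ∀ v → 0# < y v → E[ b , c , v ] ⊕ E[ b , d , v ] ⊕ E[ c , d , v ] ⊕ (δ b v ⊕ δ c v ⊕ δ d v) ≤ # 2
        vertex v pv with b Finₚ.≟ v | c Finₚ.≟ v | d Finₚ.≟ v
        ... | yes refl | yes refl | _ = ⊥-elim (proj₁ ne refl)
        ... | yes refl | no _ | yes refl = ⊥-elim (proj₁ (proj₂ ne) refl)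
        ... | no _ | yes refl | yes refl = ⊥-elim (proj₂ (proj₂ ne) refl)
        ... | yes refl | no _ | no _ rewrite E-irr₁₃ b c | E-irr₁₃ b d =
              by ((v₀ ≦ nat 1) ∷ []) 0 (nat 0 :+ nat 0 :+ v₀ :+ (nat 1 :+ nat 0 :+
                  nat 0)) (nat 2) h₀ refl (E[ c , d , b ] ∷ []) ([]≤1 (E c d b) ∷ [])
        ... | no _ | yes refl | no _ rewrite E-irr₂₃ b c | E-irr₁₃ c d =
              by ((v₀ ≦ nat 1) ∷ []) 0 (nat 0 :+ v₀ :+ nat 0 :+ (nat 0 :+ nat 1 :+
                  nat 0)) (nat 2) h₀ refl (E[ b , d , c ] ∷ []) ([]≤1 (E b d c) ∷ [])
        ... | no _ | no _ | yes refl rewrite E-irr₂₃ b d | E-irr₂₃ c d =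
              by ((v₀ ≦ nat 1) ∷ []) 0 (v₀ :+ nat 0 :+ nat 0 :+ (nat 0 :+ nat 0 :+
                  nat 1)) (nat 2) h₀ refl (E[ b , c , d ] ∷ []) ([]≤1 (E b c d) ∷ [])
        ... | no _ | no _ | no _ with E b c v in e₁ | E b d v in e₂ | E c d v in e₃
        ...   | true | true | true = ⊥-elim (free pb pc pd pv e e₁ e₂ e₃)
        ...   | false | q | r = by ((v₀ ≦ nat 1) ∷ (v₁ ≦ nat 1) ∷ []) 0 (nat 0 :+ v₀ :+ v₁ :+ (nat 0 :+ nat 0 :+
            nat 0)) (nat 2) (h₀ ⊞ h₁) refl
                                  ([ q ] ∷ [ r ] ∷ []) ([]≤1 q ∷ []≤1 r ∷ [])
        ...   | true | false | r = by ((v₀ ≦ nat 1) ∷ []) 0 (nat 1 :+ nat 0 :+ v₀ :+ (nat 0 :+ nat 0 :+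
            nat 0)) (nat 2) h₀ refl
                                  ([ r ] ∷ []) ([]≤1 r ∷ [])
        ...   | true | true | false = ≤-reflexive (identity (nat 1 :+ nat 1 :+ nat 0 :+ (nat 0 :+ nat 0 :+
            nat 0)) (nat 2) refl [])

    -- The tangent to the square at t / s.

    squareW≥ : ∀ {y} → NonNeg y → ∀ s t →
               # 2 ⊛ s ⊛ t ⊛ mass y ⊖′ t ⊛ t ⊛ (sum y ⊛ sum y ⊖′ sqs y) ≤ s ⊛ s ⊛ squareW y
    squareW≥ {y} nn s t = ≤-respˡ eq (≤-respʳ eqʳ (dot-mono nn (λ b _ → dot-mono nn (λ c _ → point b c))))
      where
      f : Fin n → Fin n → Carrier
      f b c = # 2 ⊛ s ⊛ t ⊛ W y b c ⊕ (⊖ (t ⊛ t) ⊕ t ⊛ t ⊛ δ b c)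
      eqʳ : dot y (λ b → dot y (λ c → s ⊛ s ⊛ (W y b c ⊛ W y b c))) ≈ s ⊛ s ⊛ squareW y
      eqʳ = ≈-trans (dot-congʳ (λ b → dot-* y (s ⊛ s) _)) (dot-* y (s ⊛ s) _)
      eq : dot y (λ b → dot y (f b)) ≈ # 2 ⊛ s ⊛ t ⊛ mass y ⊖′ t ⊛ t ⊛ (sum y ⊛ sum y ⊖′ sqs y)
      eq = ≈-trans (dot-congʳ (λ b → ≈-trans (dot-+ y _ _) (+-cong (dot-* y (# 2 ⊛ s ⊛ t) (W y b))
              (≈-trans (dot-+ y _ _) (+-cong (dot-const y _) (≈-trans (dot-* y (t ⊛ t) (δ b))
                (*-congˡ (≈-trans (dot-comm y (δ b)) (dot-δ b y)))))))))
           (≈-trans (dot-+ y _ _) (≈-trans (+-cong (dot-* y (# 2 ⊛ s ⊛ t) (link y))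
              (≈-trans (dot-+ y _ _) (+-cong (dot-const y _) (dot-* y (t ⊛ t) y))))
              (identity (nat 2 :* v₄ :* v₀ :* v₁ :+ (:- (v₀ :* v₀) :* v₂ :* v₂ :+ v₀ :* v₀ :* v₃))
                        (nat 2 :* v₄ :* v₀ :* v₁ :- v₀ :* v₀ :* (v₂ :* v₂ :- v₃)) refl (t ∷ mass y ∷ sum y ∷ sqs y ∷
                            s ∷ []))))
      point : ∀ b c → f b c ≤ s ⊛ s ⊛ (W y b c ⊛ W y b c)
      point b c with b Finₚ.≟ c
      ... | no _ = by [] 0 (nat 2 :* v₂ :* v₀ :* v₁ :+ (:- (v₀ :* v₀) :+
          v₀ :* v₀ :* nat 0)) (v₂ :* v₂ :* (v₁ :* v₁)) (sq (v₀ :- v₂ :* v₁)) refl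
                     (t ∷ W y b c ∷ s ∷ []) []
      -- `W` vanishes on the diagonal, so the constant of the tangent is cancelled there; this is
      -- the origin of the term with `sqs y`.
      ... | yes refl = ≤-reflexive (equate ((v₁ ≐ nat 0) ∷ []) (nat 2 :* v₂ :* v₀ :* v₁ :+ (:- (v₀ :* v₀) :+
          v₀ :* v₀ :* nat 1)) (v₂ :* v₂ :* (v₁ :* v₁))
                     ((0 , nat 2 :* v₂ :* v₀ :- v₂ :* v₂ :* v₁) ∷ []) refl (t ∷ W y b b ∷ s ∷ []) (W-diag y b ∷ []))

  -- k = 2 with all weights at most 1

  pairSum : (x₁ x₂ x₃ x₄ : Carrier) (e₁₂ e₁₃ e₁₄ e₂₃ e₂₄ e₃₄ : Bool) → Carrier
  pairSum x₁ x₂ x₃ x₄ e₁₂ e₁₃ e₁₄ e₂₃ e₂₄ e₃₄ =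
    x₁ ⊛ x₂ ⊛ [ e₁₂ ] ⊕ x₁ ⊛ x₃ ⊛ [ e₁₃ ] ⊕ x₁ ⊛ x₄ ⊛ [ e₁₄ ] ⊕ x₂ ⊛ x₃ ⊛ [ e₂₃ ] ⊕ x₂ ⊛ x₄ ⊛ [ e₂₄ ] ⊕
        x₃ ⊛ x₄ ⊛ [ e₃₄ ]

  -- A triangle-free graph on four vertices lies in a 4-cycle or a star.

  module _ {x₁ x₂ x₃ x₄} (p₁ : 0# ≤ x₁) (p₂ : 0# ≤ x₂) (p₃ : 0# ≤ x₃) (p₄ : 0# ≤ x₄) where
    blocked : ∀ e₁₂ e₁₃ e₁₄ e₂₃ e₂₄ e₃₄ →
      (e₁₂ ≡ true → e₁₃ ≡ true → e₂₃ ≡ true → ⊥) → (e₁₂ ≡ true → e₁₄ ≡ true → e₂₄ ≡ true → ⊥) →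
      (e₁₃ ≡ true → e₁₄ ≡ true → e₃₄ ≡ true → ⊥) → (e₂₃ ≡ true → e₂₄ ≡ true → e₃₄ ≡ true → ⊥) →
      # 4 ⊛ pairSum x₁ x₂ x₃ x₄ e₁₂ e₁₃ e₁₄ e₂₃ e₂₄ e₃₄ ≤ (x₁ ⊕ x₂ ⊕ x₃ ⊕ x₄) ⊛ (x₁ ⊕ x₂ ⊕ x₃ ⊕ x₄)
    blocked false e₁₃ e₁₄ e₂₃ e₂₄ false _ _ _ _ = by ((nat 0 ≦ v₀) ∷ (nat 0 ≦ v₁) ∷ (nat 0 ≦ v₂) ∷ (nat 0 ≦ v₃) ∷
        (v₅ ≦ nat 1) ∷ (v₆ ≦ nat 1) ∷ (v₇ ≦ nat 1) ∷ (v₈ ≦ nat 1) ∷ []) 0 (nat 4 :* (v₀ :* v₁ :* (nat 0) :+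
        v₀ :* v₂ :* v₅ :+ v₀ :* v₃ :* v₆ :+ v₁ :* v₂ :* v₇ :+ v₁ :* v₃ :* v₈ :+ v₂ :* v₃ :* (nat 0))) ((v₀ :+ v₁ :+
        v₂ :+ v₃) :* (v₀ :+ v₁ :+ v₂ :+ v₃))
                (4 ∙ h₀ ⊠ h₂ ⊠ h₄ ⊞ 4 ∙ h₀ ⊠ h₃ ⊠ h₅ ⊞ 4 ∙ h₁ ⊠ h₂ ⊠ h₆ ⊞ 4 ∙ h₁ ⊠ h₃ ⊠ h₇ ⊞
                    sq (v₀ :+ v₁ :- v₂ :- v₃)) refl
      (x₁ ∷ x₂ ∷ x₃ ∷ x₄ ∷ [ false ] ∷ [ e₁₃ ] ∷ [ e₁₄ ] ∷ [ e₂₃ ] ∷ [ e₂₄ ] ∷ [ false ] ∷ []) (p₁ ∷ p₂ ∷ p₃ ∷ p₄ ∷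
          []≤1 e₁₃ ∷ []≤1 e₁₄ ∷ []≤1 e₂₃ ∷ []≤1 e₂₄ ∷ [])
    blocked e₁₂ false e₁₄ e₂₃ false e₃₄ _ _ _ _ = by ((nat 0 ≦ v₀) ∷ (nat 0 ≦ v₁) ∷ (nat 0 ≦ v₂) ∷ (nat 0 ≦ v₃) ∷
        (v₄ ≦ nat 1) ∷ (v₆ ≦ nat 1) ∷ (v₇ ≦ nat 1) ∷ (v₉ ≦ nat 1) ∷ []) 0 (nat 4 :* (v₀ :* v₁ :* v₄ :+
        v₀ :* v₂ :* (nat 0) :+ v₀ :* v₃ :* v₆ :+ v₁ :* v₂ :* v₇ :+ v₁ :* v₃ :* (nat 0) :+ v₂ :* v₃ :* v₉)) ((v₀ :+
        v₁ :+ v₂ :+ v₃) :* (v₀ :+ v₁ :+ v₂ :+ v₃))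
                (4 ∙ h₀ ⊠ h₁ ⊠ h₄ ⊞ 4 ∙ h₀ ⊠ h₃ ⊠ h₅ ⊞ 4 ∙ h₁ ⊠ h₂ ⊠ h₆ ⊞ 4 ∙ h₂ ⊠ h₃ ⊠ h₇ ⊞
                    sq (v₀ :+ v₂ :- v₁ :- v₃)) refl
      (x₁ ∷ x₂ ∷ x₃ ∷ x₄ ∷ [ e₁₂ ] ∷ [ false ] ∷ [ e₁₄ ] ∷ [ e₂₃ ] ∷ [ false ] ∷ [ e₃₄ ] ∷ []) (p₁ ∷ p₂ ∷ p₃ ∷ p₄ ∷
          []≤1 e₁₂ ∷ []≤1 e₁₄ ∷ []≤1 e₂₃ ∷ []≤1 e₃₄ ∷ [])
    blocked e₁₂ e₁₃ false false e₂₄ e₃₄ _ _ _ _ = by ((nat 0 ≦ v₀) ∷ (nat 0 ≦ v₁) ∷ (nat 0 ≦ v₂) ∷ (nat 0 ≦ v₃) ∷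
        (v₄ ≦ nat 1) ∷ (v₅ ≦ nat 1) ∷ (v₈ ≦ nat 1) ∷ (v₉ ≦ nat 1) ∷ []) 0 (nat 4 :* (v₀ :* v₁ :* v₄ :+
        v₀ :* v₂ :* v₅ :+ v₀ :* v₃ :* (nat 0) :+ v₁ :* v₂ :* (nat 0) :+ v₁ :* v₃ :* v₈ :+ v₂ :* v₃ :* v₉)) ((v₀ :+
        v₁ :+ v₂ :+ v₃) :* (v₀ :+ v₁ :+ v₂ :+ v₃))
                (4 ∙ h₀ ⊠ h₁ ⊠ h₄ ⊞ 4 ∙ h₀ ⊠ h₂ ⊠ h₅ ⊞ 4 ∙ h₁ ⊠ h₃ ⊠ h₆ ⊞ 4 ∙ h₂ ⊠ h₃ ⊠ h₇ ⊞
                    sq (v₀ :+ v₃ :- v₁ :- v₂)) refl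
      (x₁ ∷ x₂ ∷ x₃ ∷ x₄ ∷ [ e₁₂ ] ∷ [ e₁₃ ] ∷ [ false ] ∷ [ false ] ∷ [ e₂₄ ] ∷ [ e₃₄ ] ∷ []) (p₁ ∷ p₂ ∷ p₃ ∷ p₄ ∷
          []≤1 e₁₂ ∷ []≤1 e₁₃ ∷ []≤1 e₂₄ ∷ []≤1 e₃₄ ∷ [])
    blocked false false e₁₄ false e₂₄ e₃₄ _ _ _ _ = by ((nat 0 ≦ v₀) ∷ (nat 0 ≦ v₁) ∷ (nat 0 ≦ v₂) ∷ (nat 0 ≦ v₃) ∷
        (v₆ ≦ nat 1) ∷ (v₈ ≦ nat 1) ∷ (v₉ ≦ nat 1) ∷ []) 0 (nat 4 :* (v₀ :* v₁ :* (nat 0) :+ v₀ :* v₂ :* (nat 0) :+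
        v₀ :* v₃ :* v₆ :+ v₁ :* v₂ :* (nat 0) :+ v₁ :* v₃ :* v₈ :+ v₂ :* v₃ :* v₉)) ((v₀ :+ v₁ :+ v₂ :+ v₃) :* (v₀ :+
        v₁ :+ v₂ :+ v₃))
                (4 ∙ h₀ ⊠ h₃ ⊠ h₄ ⊞ 4 ∙ h₁ ⊠ h₃ ⊠ h₅ ⊞ 4 ∙ h₂ ⊠ h₃ ⊠ h₆ ⊞
                    sq (v₀ :+ v₁ :+ v₂ :+ v₃ :- nat 2 :* v₃)) refl
      (x₁ ∷ x₂ ∷ x₃ ∷ x₄ ∷ [ false ] ∷ [ false ] ∷ [ e₁₄ ] ∷ [ false ] ∷ [ e₂₄ ] ∷ [ e₃₄ ] ∷ []) (p₁ ∷ p₂ ∷ p₃ ∷ p₄ ∷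
          []≤1 e₁₄ ∷ []≤1 e₂₄ ∷ []≤1 e₃₄ ∷ [])
    blocked false e₁₃ false e₂₃ false e₃₄ _ _ _ _ = by ((nat 0 ≦ v₀) ∷ (nat 0 ≦ v₁) ∷ (nat 0 ≦ v₂) ∷ (nat 0 ≦ v₃) ∷
        (v₅ ≦ nat 1) ∷ (v₇ ≦ nat 1) ∷ (v₉ ≦ nat 1) ∷ []) 0 (nat 4 :* (v₀ :* v₁ :* (nat 0) :+ v₀ :* v₂ :* v₅ :+
        v₀ :* v₃ :* (nat 0) :+ v₁ :* v₂ :* v₇ :+ v₁ :* v₃ :* (nat 0) :+ v₂ :* v₃ :* v₉)) ((v₀ :+ v₁ :+ v₂ :+
        v₃) :* (v₀ :+ v₁ :+ v₂ :+ v₃))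
                (4 ∙ h₀ ⊠ h₂ ⊠ h₄ ⊞ 4 ∙ h₁ ⊠ h₂ ⊠ h₅ ⊞ 4 ∙ h₂ ⊠ h₃ ⊠ h₆ ⊞
                    sq (v₀ :+ v₁ :+ v₂ :+ v₃ :- nat 2 :* v₂)) refl
      (x₁ ∷ x₂ ∷ x₃ ∷ x₄ ∷ [ false ] ∷ [ e₁₃ ] ∷ [ false ] ∷ [ e₂₃ ] ∷ [ false ] ∷ [ e₃₄ ] ∷ []) (p₁ ∷ p₂ ∷ p₃ ∷ p₄ ∷
          []≤1 e₁₃ ∷ []≤1 e₂₃ ∷ []≤1 e₃₄ ∷ [])
    blocked e₁₂ false false e₂₃ e₂₄ false _ _ _ _ = by ((nat 0 ≦ v₀) ∷ (nat 0 ≦ v₁) ∷ (nat 0 ≦ v₂) ∷ (nat 0 ≦ v₃) ∷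
        (v₄ ≦ nat 1) ∷ (v₇ ≦ nat 1) ∷ (v₈ ≦ nat 1) ∷ []) 0 (nat 4 :* (v₀ :* v₁ :* v₄ :+ v₀ :* v₂ :* (nat 0) :+
        v₀ :* v₃ :* (nat 0) :+ v₁ :* v₂ :* v₇ :+ v₁ :* v₃ :* v₈ :+ v₂ :* v₃ :* (nat 0))) ((v₀ :+ v₁ :+ v₂ :+
        v₃) :* (v₀ :+ v₁ :+ v₂ :+ v₃))
                (4 ∙ h₀ ⊠ h₁ ⊠ h₄ ⊞ 4 ∙ h₁ ⊠ h₂ ⊠ h₅ ⊞ 4 ∙ h₁ ⊠ h₃ ⊠ h₆ ⊞
                    sq (v₀ :+ v₁ :+ v₂ :+ v₃ :- nat 2 :* v₁)) refl
      (x₁ ∷ x₂ ∷ x₃ ∷ x₄ ∷ [ e₁₂ ] ∷ [ false ] ∷ [ false ] ∷ [ e₂₃ ] ∷ [ e₂₄ ] ∷ [ false ] ∷ []) (p₁ ∷ p₂ ∷ p₃ ∷ p₄ ∷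
          []≤1 e₁₂ ∷ []≤1 e₂₃ ∷ []≤1 e₂₄ ∷ [])
    blocked e₁₂ e₁₃ e₁₄ false false false _ _ _ _ = by ((nat 0 ≦ v₀) ∷ (nat 0 ≦ v₁) ∷ (nat 0 ≦ v₂) ∷ (nat 0 ≦ v₃) ∷
        (v₄ ≦ nat 1) ∷ (v₅ ≦ nat 1) ∷ (v₆ ≦ nat 1) ∷ []) 0 (nat 4 :* (v₀ :* v₁ :* v₄ :+ v₀ :* v₂ :* v₅ :+
        v₀ :* v₃ :* v₆ :+ v₁ :* v₂ :* (nat 0) :+ v₁ :* v₃ :* (nat 0) :+ v₂ :* v₃ :* (nat 0))) ((v₀ :+ v₁ :+ v₂ :+
        v₃) :* (v₀ :+ v₁ :+ v₂ :+ v₃))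
                (4 ∙ h₀ ⊠ h₁ ⊠ h₄ ⊞ 4 ∙ h₀ ⊠ h₂ ⊠ h₅ ⊞ 4 ∙ h₀ ⊠ h₃ ⊠ h₆ ⊞
                    sq (v₀ :+ v₁ :+ v₂ :+ v₃ :- nat 2 :* v₀)) refl
      (x₁ ∷ x₂ ∷ x₃ ∷ x₄ ∷ [ e₁₂ ] ∷ [ e₁₃ ] ∷ [ e₁₄ ] ∷ [ false ] ∷ [ false ] ∷ [ false ] ∷ []) (p₁ ∷ p₂ ∷ p₃ ∷ p₄ ∷
          []≤1 e₁₂ ∷ []≤1 e₁₃ ∷ []≤1 e₁₄ ∷ [])
    blocked true true _ true _ _ h _ _ _ = ⊥-elim (h refl refl refl)
    blocked true _ true _ true _ _ h _ _ = ⊥-elim (h refl refl refl)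
    blocked _ true true _ _ true _ _ h _ = ⊥-elim (h refl refl refl)
    blocked _ _ _ true true true _ _ _ h = ⊥-elim (h refl refl refl)

  two-of-three : ∀ p q r → (p ≡ true → q ≡ true → r ≡ true → ⊥) → [ p ] ⊕ [ q ] ⊕ [ r ] ≤ # 2
  two-of-three true true true h = ⊥-elim (h refl refl refl)
  two-of-three false q r h = by ((v₀ ≦ nat 1) ∷ (v₁ ≦ nat 1) ∷ []) 0 (nat 0 :+ v₀ :+ v₁) (nat 2) (h₀ ⊞ h₁) refl
    ([ q ] ∷ [ r ] ∷ []) ([]≤1 q ∷ []≤1 r ∷ [])
  two-of-three true false r h = by ((v₀ ≦ nat 1) ∷ []) 0 (nat 1 :+ nat 0 :+ v₀) (nat 2) h₀ refl ([ r ] ∷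
      []) ([]≤1 r ∷ [])
  two-of-three true true false h = ≤-reflexive (identity (nat 1 :+ nat 1 :+ nat 0) (nat 2) refl [])

  -- In the application an outside vertex of weight `v` is lighter than vertices 2, 3 and 4, so the
  -- triangles through vertex 1 in its link are blocked. The missing pairs improve the bound 3α²/8
  -- of `pairSum≤` by 3yv/2.
  bonus : ∀ {y x₂ x₃ x₄ v} → 0# ≤ y → y ≤ v → v ≤ x₂ → v ≤ x₃ → v ≤ x₄ → ∀ e₁₂ e₁₃ e₁₄ e₂₃ e₂₄ e₃₄ →
    (e₁₂ ≡ true → e₁₃ ≡ true → e₂₃ ≡ true → ⊥) → (e₁₂ ≡ true → e₁₄ ≡ true → e₂₄ ≡ true → ⊥) →
    (e₁₃ ≡ true → e₁₄ ≡ true → e₃₄ ≡ true → ⊥) →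
    # 8 ⊛ pairSum y x₂ x₃ x₄ e₁₂ e₁₃ e₁₄ e₂₃ e₂₄ e₃₄ ⊕ # 12 ⊛ y ⊛ v ≤ # 3 ⊛ (y ⊕ x₂ ⊕ x₃ ⊕ x₄) ⊛ (y ⊕ x₂ ⊕ x₃ ⊕ x₄)
  bonus {y} {x₂} {x₃} {x₄} {v} p q r₂ r₃ r₄ e₁₂ e₁₃ e₁₄ e₂₃ e₂₄ e₃₄ t₄ t₃ t₂ = by ((nat 0 ≦ v₀) ∷ (v₀ ≦ v₄) ∷
      (v₄ ≦ v₁) ∷ (v₄ ≦ v₂) ∷ (v₄ ≦ v₃) ∷ (v₅ ≦ nat 1) ∷ (v₆ ≦ nat 1) ∷ (v₇ ≦ nat 1) ∷ (v₈ ≦ nat 1) ∷ (v₉ ≦ nat 1) ∷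
      (var 10 ≦ nat 1) ∷ (v₅ :+ v₆ :+ v₈ ≦ nat 2) ∷ (v₅ :+ v₇ :+ v₉ ≦ nat 2) ∷ (v₆ :+ v₇ :+ var 10 ≦ nat 2) ∷
      []) 0 (nat 8 :* (v₀ :* v₁ :* v₅ :+ v₀ :* v₂ :* v₆ :+ v₀ :* v₃ :* v₇ :+ v₁ :* v₂ :* v₈ :+ v₁ :* v₃ :* v₉ :+
      v₂ :* v₃ :* (var 10)) :+ nat 12 :* v₀ :* v₄) (nat 3 :* (v₀ :+ v₁ :+ v₂ :+ v₃) :* (v₀ :+ v₁ :+ v₂ :+ v₃))
                (8 ∙ h₅ ⊠ h₀ ⊠ h₂ ⊞ 8 ∙ h₆ ⊠ h₀ ⊠ h₃ ⊞ 8 ∙ h₇ ⊠ h₀ ⊠ h₄ ⊞ 8 ∙ h₈ ⊠ h₂ ⊠ h₃ ⊞ 8 ∙ h₈ ⊠ h₂ ⊠ h₀ ⊞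
                8 ∙ h₈ ⊠ h₃ ⊠ h₀ ⊞ 8 ∙ h₈ ⊠ h₂ ⊠ h₁ ⊞ 8 ∙ h₈ ⊠ h₃ ⊠ h₁ ⊞ 12 ∙ h₈ ⊠ h₀ ⊠ h₁ ⊞ 8 ∙ h₈ ⊠ h₁ ⊠ h₁ ⊞
                4 ∙ h₈ ⊠ h₀ ⊠ h₀ ⊞ 8 ∙ h₉ ⊠ h₂ ⊠ h₄ ⊞ 8 ∙ h₉ ⊠ h₂ ⊠ h₀ ⊞ 8 ∙ h₉ ⊠ h₄ ⊠ h₀ ⊞ 8 ∙ h₉ ⊠ h₂ ⊠ h₁ ⊞
                8 ∙ h₉ ⊠ h₄ ⊠ h₁ ⊞ 12 ∙ h₉ ⊠ h₀ ⊠ h₁ ⊞ 8 ∙ h₉ ⊠ h₁ ⊠ h₁ ⊞ 4 ∙ h₉ ⊠ h₀ ⊠ h₀ ⊞ 8 ∙ hyp 10 ⊠ h₃ ⊠ h₄ ⊞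
                8 ∙ hyp 10 ⊠ h₃ ⊠ h₀ ⊞ 8 ∙ hyp 10 ⊠ h₄ ⊠ h₀ ⊞ 8 ∙ hyp 10 ⊠ h₃ ⊠ h₁ ⊞ 8 ∙ hyp 10 ⊠ h₄ ⊠ h₁ ⊞
                12 ∙ hyp 10 ⊠ h₀ ⊠ h₁ ⊞ 8 ∙ hyp 10 ⊠ h₁ ⊠ h₁ ⊞ 4 ∙ hyp 10 ⊠ h₀ ⊠ h₀ ⊞ 4 ∙ hyp 11 ⊠ h₀ ⊠ h₀ ⊞
                4 ∙ hyp 12 ⊠ h₀ ⊠ h₀ ⊞ 4 ∙ hyp 13 ⊠ h₀ ⊠ h₀ ⊞ 4 ∙ hyp 11 ⊠ h₀ ⊠ h₁ ⊞ 4 ∙ hyp 12 ⊠ h₀ ⊠ h₁ ⊞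
                4 ∙ hyp 13 ⊠ h₀ ⊠ h₁ ⊞ sq (v₁ :- v₀) ⊞ sq (v₂ :- v₀) ⊞ sq (v₂ :- v₁) ⊞ sq (v₃ :- v₀) ⊞ sq (v₃ :- v₁) ⊞
                sq (v₃ :- v₂)) refl
    (y ∷ x₂ ∷ x₃ ∷ x₄ ∷ v ∷ [ e₁₂ ] ∷ [ e₁₃ ] ∷ [ e₁₄ ] ∷ [ e₂₃ ] ∷ [ e₂₄ ] ∷ [ e₃₄ ] ∷ [])
    (p ∷ q ∷ r₂ ∷ r₃ ∷ r₄ ∷ []≤1 e₁₂ ∷ []≤1 e₁₃ ∷ []≤1 e₁₄ ∷ []≤1 e₂₃ ∷ []≤1 e₂₄ ∷ []≤1 e₃₄ ∷
     two-of-three e₁₂ e₁₃ e₂₃ t₄ ∷ two-of-three e₁₂ e₁₄ e₂₄ t₃ ∷ two-of-three e₁₃ e₁₄ e₃₄ t₂ ∷ [])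

  -- Equal weights with all six pairs present are extremal, as the squared differences show.
  pairSum≤ : ∀ {x₁ x₂ x₃ x₄} → 0# ≤ x₁ → 0# ≤ x₂ → 0# ≤ x₃ → 0# ≤ x₄ → ∀ e₁₂ e₁₃ e₁₄ e₂₃ e₂₄ e₃₄ →
    # 8 ⊛ pairSum x₁ x₂ x₃ x₄ e₁₂ e₁₃ e₁₄ e₂₃ e₂₄ e₃₄ ≤ # 3 ⊛ (x₁ ⊕ x₂ ⊕ x₃ ⊕ x₄) ⊛ (x₁ ⊕ x₂ ⊕ x₃ ⊕ x₄)
  pairSum≤ {x₁} {x₂} {x₃} {x₄} p₁ p₂ p₃ p₄ e₁₂ e₁₃ e₁₄ e₂₃ e₂₄ e₃₄ =
    by ((nat 0 ≦ v₀) ∷ (nat 0 ≦ v₁) ∷ (nat 0 ≦ v₂) ∷ (nat 0 ≦ v₃) ∷ (v₄ ≦ nat 1) ∷ (v₅ ≦ nat 1) ∷ (v₆ ≦ nat 1) ∷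
        (v₇ ≦ nat 1) ∷ (v₈ ≦ nat 1) ∷ (v₉ ≦ nat 1) ∷ []) 0
      (nat 8 :* (v₀ :* v₁ :* v₄ :+ v₀ :* v₂ :* v₅ :+ v₀ :* v₃ :* v₆ :+ v₁ :* v₂ :* v₇ :+ v₁ :* v₃ :* v₈ :+
          v₂ :* v₃ :* v₉))
      (nat 3 :* (v₀ :+ v₁ :+ v₂ :+ v₃) :* (v₀ :+ v₁ :+ v₂ :+ v₃))
      (8 ∙ h₀ ⊠ h₁ ⊠ h₄ ⊞ 8 ∙ h₀ ⊠ h₂ ⊠ h₅ ⊞ 8 ∙ h₀ ⊠ h₃ ⊠ h₆ ⊞ 8 ∙ h₁ ⊠ h₂ ⊠ h₇ ⊞ 8 ∙ h₁ ⊠ h₃ ⊠ h₈ ⊞ 8 ∙ h₂ ⊠ h₃ ⊠ h₉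
       ⊞ sq (v₀ :- v₁) ⊞ sq (v₀ :- v₂) ⊞ sq (v₀ :- v₃) ⊞ sq (v₁ :- v₂) ⊞ sq (v₁ :- v₃) ⊞ sq (v₂ :- v₃)) refl
      (x₁ ∷ x₂ ∷ x₃ ∷ x₄ ∷ [ e₁₂ ] ∷ [ e₁₃ ] ∷ [ e₁₄ ] ∷ [ e₂₃ ] ∷ [ e₂₄ ] ∷ [ e₃₄ ] ∷ [])
      (p₁ ∷ p₂ ∷ p₃ ∷ p₄ ∷ []≤1 e₁₂ ∷ []≤1 e₁₃ ∷ []≤1 e₁₄ ∷ []≤1 e₂₃ ∷ []≤1 e₂₄ ∷ []≤1 e₃₄ ∷ [])

  -- Here α is the weight of a K₄, σ the rest, v the weight of a vertex outside and
  -- D the part outside of its link.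

  module Scalar {α σ θ} (9≈ : # 9 ≈ σ ⊕ α) (0≤α : 0# ≤ α) (θ> : # 56 < θ) where

    module _ {v w D pres} (θ≤ : θ ≤ D ⊕ # 2 ⊛ α ⊛ (σ ⊖′ v) ⊕ # 2 ⊛ pres)
             (0≤w : 0# ≤ w) (w≤v : w ≤ v) (v≤1 : v ≤ # 1) where

      -- The names count the vertices of the K₄ that are not heavier than the outside vertex: few of
      -- them mean many blocked triangles, many of them a small α. In the conclusion, 6 accounts for
      -- three pairs in both orders, and the other term for all pairs through a vertex of weight
      -- `w`.
      none-below : α ≤ # 4 → # 4 ⊛ pres ≤ α ⊛ α → # 6 ⊕ # 2 ⊛ w ⊛ (σ ⊖′ w ⊖′ v) < D
      none-below α≤4 p D≤ = θ> (by ((nat 9 ≐ v₄ :+ v₀) ∷ (v₇ ≦ v₅ :+ nat 2 :* v₀ :* (v₄ :- v₁) :+ nat 2 :* v₆) ∷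
          (v₅ ≦ nat 6 :+ nat 2 :* v₂ :* (v₄ :- v₂ :- v₁)) ∷ (nat 4 :* v₆ ≦ v₀ :* v₀) ∷
          (nat 4 :* v₂ :* (nat 9 :- v₀ :- v₂ :- v₁) ≦ nat 100 :- nat 36 :* v₀ :+ nat 3 :* v₀ :* v₀ :+
          nat 4 :* v₀ :* v₁) ∷ []) 1 (v₇) (nat 56)
                (2 ∙ h₁ ⊞ 2 ∙ h₂ ⊞ h₃ ⊞ h₄ ⊞ eqn 0 (:- nat 4 :* v₀) ⊞ eqn 0 (:- nat 4 :* v₂)) refl
        (α ∷ v ∷ w ∷ 0# ∷ σ ∷ D ∷ pres ∷ θ ∷ []) (9≈ ∷ θ≤ ∷ D≤ ∷ p ∷ (by ((v₀ ≦ nat 4) ∷ (nat 0 ≦ v₂) ∷ (v₂ ≦ v₁) ∷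
            (v₁ ≦ nat 1) ∷ (nat 0 ≦ v₀) ∷ []) 31 (nat 4 :* v₂ :* (nat 9 :- v₀ :- v₂ :- v₁)) (nat 100 :-
            nat 36 :* v₀ :+ nat 3 :* v₀ :* v₀ :+ nat 4 :* v₀ :* v₁)
                (135 ∙ h₀ ⊠ h₀ ⊞ 256 ∙ h₀ ⊠ h₂ ⊞ 256 ∙ h₀ ⊠ h₃ ⊞ 46 ∙ h₀ ⊠ h₄ ⊞ 128 ∙ h₁ ⊠ h₂ ⊞ 128 ∙ h₂ ⊠ h₄ ⊞
                7 ∙ h₄ ⊠ h₄ ⊞ 16 ∙ sq (nat 4 :* v₂ :- nat 1)) refl
          (α ∷ v ∷ w ∷ []) (α≤4 ∷ 0≤w ∷ w≤v ∷ v≤1 ∷ 0≤α ∷ [])) ∷ []))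

      one-below : ∀ {y} → 0# ≤ y → y ≤ v → α ≤ # 3 ⊕ y → # 8 ⊛ pres ⊕ # 12 ⊛ y ⊛ v ≤ # 3 ⊛ α ⊛ α →
                  # 6 ⊕ # 2 ⊛ w ⊛ (σ ⊖′ w ⊖′ v) < D
      one-below {y} 0≤y y≤v α≤ p D≤ = θ> (by ((nat 9 ≐ v₄ :+ v₀) ∷ (v₇ ≦ v₅ :+ nat 2 :* v₀ :* (v₄ :- v₁) :+
          nat 2 :* v₆) ∷ (v₅ ≦ nat 6 :+ nat 2 :* v₂ :* (v₄ :- v₂ :- v₁)) ∷
          (nat 8 :* v₆ :+ nat 12 :* v₃ :* v₁ ≦ nat 3 :* v₀ :* v₀) ∷ (nat 8 :* v₂ :* (nat 9 :- v₀ :- v₂ :-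
          v₁) ≦ nat 200 :- nat 72 :* v₀ :+ nat 5 :* v₀ :* v₀ :+ nat 8 :* v₀ :* v₁ :+ nat 12 :* v₃ :* v₁) ∷
          []) 3 (v₇) (nat 56)
                (4 ∙ h₁ ⊞ 4 ∙ h₂ ⊞ h₃ ⊞ h₄ ⊞ eqn 0 (:- nat 8 :* v₀) ⊞ eqn 0 (:- nat 8 :* v₂)) refl
        (α ∷ v ∷ w ∷ y ∷ σ ∷ D ∷ pres ∷ θ ∷ []) (9≈ ∷ θ≤ ∷ D≤ ∷ p ∷ (by ((v₀ ≦ nat 3 :+ v₃) ∷ (nat 0 ≦ v₃) ∷
            (v₃ ≦ v₁) ∷ (nat 0 ≦ v₂) ∷ (v₂ ≦ v₁) ∷ (v₁ ≦ nat 1) ∷ (nat 0 ≦ v₀) ∷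
            []) 1050 (nat 8 :* v₂ :* (nat 9 :- v₀ :- v₂ :- v₁)) (nat 200 :- nat 72 :* v₀ :+ nat 5 :* v₀ :* v₀ :+
            nat 8 :* v₀ :* v₁ :+ nat 12 :* v₃ :* v₁)
                (2052 ∙ h₀ ⊠ h₀ ⊞ 12612 ∙ h₀ ⊠ h₄ ⊞ 13656 ∙ h₀ ⊠ h₅ ⊞ 4816 ∙ h₀ ⊠ h₆ ⊞ 7308 ∙ h₁ ⊠ h₂ ⊞
                    2448 ∙ h₁ ⊠ h₆ ⊞
                12612 ∙ h₂ ⊠ h₄ ⊞ 18960 ∙ h₂ ⊠ h₅ ⊞ 3160 ∙ h₂ ⊠ h₆ ⊞ 8408 ∙ h₄ ⊠ h₄ ⊞ 37836 ∙ h₄ ⊠ h₅ ⊞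
                    4204 ∙ h₄ ⊠ h₆ ⊞
                2236 ∙ sq (nat 4 :* v₁ :- nat 3) ⊞ 584 ∙ sq (nat 3 :* v₃ :- nat 2) ⊞ 8019 ∙ sq (v₀ :- nat 4)) refl
          (α ∷ v ∷ w ∷ y ∷ []) (α≤ ∷ 0≤y ∷ y≤v ∷ 0≤w ∷ w≤v ∷ v≤1 ∷ 0≤α ∷ [])) ∷ []))

      two-below : α ≤ # 2 ⊕ # 2 ⊛ v → # 8 ⊛ pres ≤ # 3 ⊛ α ⊛ α → # 6 ⊕ # 2 ⊛ w ⊛ (σ ⊖′ w ⊖′ v) < D
      two-below α≤ p D≤ = θ> (by ((nat 9 ≐ v₄ :+ v₀) ∷ (v₇ ≦ v₅ :+ nat 2 :* v₀ :* (v₄ :- v₁) :+ nat 2 :* v₆) ∷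
          (v₅ ≦ nat 6 :+ nat 2 :* v₂ :* (v₄ :- v₂ :- v₁)) ∷ (nat 8 :* v₆ ≦ nat 3 :* v₀ :* v₀) ∷
          (nat 8 :* v₂ :* (nat 9 :- v₀ :- v₂ :- v₁) ≦ nat 200 :- nat 72 :* v₀ :+ nat 5 :* v₀ :* v₀ :+
          nat 8 :* v₀ :* v₁) ∷ []) 3 (v₇) (nat 56)
                (4 ∙ h₁ ⊞ 4 ∙ h₂ ⊞ h₃ ⊞ h₄ ⊞ eqn 0 (:- nat 8 :* v₀) ⊞ eqn 0 (:- nat 8 :* v₂)) refl
        (α ∷ v ∷ w ∷ 0# ∷ σ ∷ D ∷ pres ∷ θ ∷ []) (9≈ ∷ θ≤ ∷ D≤ ∷ p ∷ (by ((v₀ ≦ nat 2 :+ nat 2 :* v₁) ∷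
            (nat 0 ≦ v₂) ∷ (v₂ ≦ v₁) ∷ (v₁ ≦ nat 1) ∷ (nat 0 ≦ v₀) ∷ []) 0 (nat 8 :* v₂ :* (nat 9 :- v₀ :- v₂ :-
            v₁)) (nat 200 :- nat 72 :* v₀ :+ nat 5 :* v₀ :* v₀ :+ nat 8 :* v₀ :* v₁)
                (8 ∙ h₀ ⊠ h₂ ⊞ 10 ∙ h₀ ⊠ h₃ ⊞ 4 ∙ h₀ ⊠ h₄ ⊞ 16 ∙ h₁ ⊠ h₂ ⊞ 8 ∙ h₂ ⊠ h₃ ⊞ 12 ∙ h₃ ⊠ h₃ ⊞ 2 ∙ h₃ ⊠ h₄ ⊞
                9 ∙ sq (v₀ :- nat 4) ⊞ 24 ∙ sq (v₂ :- nat 1)) refl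
          (α ∷ v ∷ w ∷ []) (α≤ ∷ 0≤w ∷ w≤v ∷ v≤1 ∷ 0≤α ∷ [])) ∷ []))

    module _ {w D pres} (θ≤ : θ ≤ D ⊕ # 2 ⊛ α ⊛ (σ ⊖′ w) ⊕ # 2 ⊛ pres) (0≤w : 0# ≤ w) (w≤1 : w ≤ # 1) where

      -- For the lightest outside vertex, of weight `w`: 8 accounts for four pairs in both orders,
      -- and the second bound for a star centred at a vertex of weight `z`.
      lightest₀ : α ≤ # 4 → # 4 ⊛ pres ≤ α ⊛ α →
                  # 8 < D × (∀ z → 0# ≤ z → z ≤ # 1 → # 2 ⊛ z ⊛ (σ ⊖′ z ⊖′ w) < D)
      lightest₀ α≤4 p = (λ D≤ → θ> (by ((nat 9 ≐ v₄ :+ v₀) ∷ (v₇ ≦ v₅ :+ nat 2 :* v₀ :* (v₄ :- v₂) :+ nat 2 :* v₆) ∷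
          (v₅ ≦ nat 8) ∷ (nat 4 :* v₆ ≦ v₀ :* v₀) ∷ (nat 16 ≦ nat 112 :- nat 36 :* v₀ :+ nat 3 :* v₀ :* v₀ :+
          nat 4 :* v₀ :* v₂) ∷ []) 1 (v₇) (nat 56)
                (2 ∙ h₁ ⊞ 2 ∙ h₂ ⊞ h₃ ⊞ h₄ ⊞ eqn 0 (:- nat 4 :* v₀)) refl
          (α ∷ 0# ∷ w ∷ 0# ∷ σ ∷ D ∷ pres ∷ θ ∷ []) (9≈ ∷ θ≤ ∷ D≤ ∷ p ∷ (by ((v₀ ≦ nat 4) ∷ (nat 0 ≦ v₂) ∷
              (v₂ ≦ nat 1) ∷ (nat 0 ≦ v₄) ∷ (v₄ ≦ nat 1) ∷ (nat 0 ≦ v₀) ∷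
              []) 0 (nat 16) (nat 112 :- nat 36 :* v₀ :+ nat 3 :* v₀ :* v₀ :+ nat 4 :* v₀ :* v₂)
                (6 ∙ h₀ ⊠ h₀ ⊞ 3 ∙ h₀ ⊠ h₅ ⊞ 4 ∙ h₁ ⊠ h₅) refl
          (α ∷ 0# ∷ w ∷ 0# ∷ 0# ∷ []) (α≤4 ∷ 0≤w ∷ w≤1 ∷ ≤-refl ∷ 0≤1 ∷ 0≤α ∷ [])) ∷ []))) ,
        (λ z 0≤z z≤1 D≤ → θ> (by ((nat 9 ≐ v₄ :+ v₀) ∷ (v₇ ≦ v₅ :+ nat 2 :* v₀ :* (v₄ :- v₂) :+ nat 2 :* v₆) ∷
            (v₅ ≦ nat 2 :* v₃ :* (v₄ :- v₃ :- v₂)) ∷ (nat 4 :* v₆ ≦ v₀ :* v₀) ∷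
            (nat 4 :* v₃ :* (nat 9 :- v₀ :- v₃ :- v₂) ≦ nat 112 :- nat 36 :* v₀ :+ nat 3 :* v₀ :* v₀ :+
            nat 4 :* v₀ :* v₂) ∷ []) 1 (v₇) (nat 56)
                (2 ∙ h₁ ⊞ 2 ∙ h₂ ⊞ h₃ ⊞ h₄ ⊞ eqn 0 (:- nat 4 :* v₀) ⊞ eqn 0 (:- nat 4 :* v₃)) refl
          (α ∷ 0# ∷ w ∷ z ∷ σ ∷ D ∷ pres ∷ θ ∷ []) (9≈ ∷ θ≤ ∷ D≤ ∷ p ∷ (by ((v₀ ≦ nat 4) ∷ (nat 0 ≦ v₂) ∷
              (v₂ ≦ nat 1) ∷ (nat 0 ≦ v₄) ∷ (v₄ ≦ nat 1) ∷ (nat 0 ≦ v₀) ∷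
              []) 0 (nat 4 :* v₄ :* (nat 9 :- v₀ :- v₄ :- v₂)) (nat 112 :- nat 36 :* v₀ :+ nat 3 :* v₀ :* v₀ :+
              nat 4 :* v₀ :* v₂)
                (5 ∙ h₀ ⊠ h₀ ⊞ 7 ∙ h₀ ⊠ h₄ ⊞ 2 ∙ h₀ ⊠ h₅ ⊞ 4 ∙ h₁ ⊠ h₃ ⊞ 4 ∙ h₁ ⊠ h₅ ⊞ 4 ∙ h₄ ⊠ h₄ ⊞ 3 ∙ h₄ ⊠ h₅) refl
          (α ∷ 0# ∷ w ∷ 0# ∷ z ∷ []) (α≤4 ∷ 0≤w ∷ w≤1 ∷ 0≤z ∷ z≤1 ∷ 0≤α ∷ [])) ∷ [])))

      lightest₁ : α ≤ # 3 ⊕ w → # 8 ⊛ pres ≤ # 3 ⊛ α ⊛ α →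
                  # 8 < D × (∀ z → 0# ≤ z → z ≤ # 1 → # 2 ⊛ z ⊛ (σ ⊖′ z ⊖′ w) < D)
      lightest₁ α≤ p = (λ D≤ → θ> (by ((nat 9 ≐ v₄ :+ v₀) ∷ (v₇ ≦ v₅ :+ nat 2 :* v₀ :* (v₄ :- v₂) :+ nat 2 :* v₆) ∷
          (v₅ ≦ nat 8) ∷ (nat 8 :* v₆ ≦ nat 3 :* v₀ :* v₀) ∷ (nat 32 ≦ nat 224 :- nat 72 :* v₀ :+
          nat 5 :* v₀ :* v₀ :+ nat 8 :* v₀ :* v₂) ∷ []) 3 (v₇) (nat 56)
                (4 ∙ h₁ ⊞ 4 ∙ h₂ ⊞ h₃ ⊞ h₄ ⊞ eqn 0 (:- nat 8 :* v₀)) refl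
          (α ∷ 0# ∷ w ∷ 0# ∷ σ ∷ D ∷ pres ∷ θ ∷ []) (9≈ ∷ θ≤ ∷ D≤ ∷ p ∷ (by ((v₀ ≦ nat 3 :+ v₂) ∷ (nat 0 ≦ v₂) ∷
              (v₂ ≦ nat 1) ∷ (nat 0 ≦ v₄) ∷ (v₄ ≦ nat 1) ∷ (nat 0 ≦ v₀) ∷
              []) 0 (nat 32) (nat 224 :- nat 72 :* v₀ :+ nat 5 :* v₀ :* v₀ :+ nat 8 :* v₀ :* v₂)
                (8 ∙ h₀ ⊠ h₅ ⊞ h₅ ⊠ h₅ ⊞ 12 ∙ sq (v₀ :- nat 4)) refl
          (α ∷ 0# ∷ w ∷ 0# ∷ 0# ∷ []) (α≤ ∷ 0≤w ∷ w≤1 ∷ ≤-refl ∷ 0≤1 ∷ 0≤α ∷ [])) ∷ []))) ,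
        (λ z 0≤z z≤1 D≤ → θ> (by ((nat 9 ≐ v₄ :+ v₀) ∷ (v₇ ≦ v₅ :+ nat 2 :* v₀ :* (v₄ :- v₂) :+ nat 2 :* v₆) ∷
            (v₅ ≦ nat 2 :* v₃ :* (v₄ :- v₃ :- v₂)) ∷ (nat 8 :* v₆ ≦ nat 3 :* v₀ :* v₀) ∷
            (nat 8 :* v₃ :* (nat 9 :- v₀ :- v₃ :- v₂) ≦ nat 224 :- nat 72 :* v₀ :+ nat 5 :* v₀ :* v₀ :+
            nat 8 :* v₀ :* v₂) ∷ []) 3 (v₇) (nat 56)
                (4 ∙ h₁ ⊞ 4 ∙ h₂ ⊞ h₃ ⊞ h₄ ⊞ eqn 0 (:- nat 8 :* v₀) ⊞ eqn 0 (:- nat 8 :* v₃)) refl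
          (α ∷ 0# ∷ w ∷ z ∷ σ ∷ D ∷ pres ∷ θ ∷ []) (9≈ ∷ θ≤ ∷ D≤ ∷ p ∷ (by ((v₀ ≦ nat 3 :+ v₂) ∷ (nat 0 ≦ v₂) ∷
              (v₂ ≦ nat 1) ∷ (nat 0 ≦ v₄) ∷ (v₄ ≦ nat 1) ∷ (nat 0 ≦ v₀) ∷
              []) 41 (nat 8 :* v₄ :* (nat 9 :- v₀ :- v₄ :- v₂)) (nat 224 :- nat 72 :* v₀ :+ nat 5 :* v₀ :* v₀ :+
              nat 8 :* v₀ :* v₂)
                (48 ∙ h₀ ⊠ h₀ ⊞ 504 ∙ h₀ ⊠ h₄ ⊞ 248 ∙ h₀ ⊠ h₅ ⊞ 48 ∙ h₁ ⊠ h₂ ⊞ 184 ∙ h₁ ⊠ h₅ ⊞ 840 ∙ h₂ ⊠ h₄ ⊞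
                336 ∙ h₄ ⊠ h₄ ⊞ 168 ∙ h₄ ⊠ h₅ ⊞ 17 ∙ h₅ ⊠ h₅ ⊞ 393 ∙ sq (v₀ :- nat 4)) refl
          (α ∷ 0# ∷ w ∷ 0# ∷ z ∷ []) (α≤ ∷ 0≤w ∷ w≤1 ∷ 0≤z ∷ z≤1 ∷ 0≤α ∷ [])) ∷ [])))

  module Setup {n} (G : Triples n) {θ x} (D : Dense G (# 9) θ x) (free : Edges.Free G 2) (θ> : # 56 < θ) where

    open Graph G public
    open Edges G public
    open Dense D public

    Quad : Set
    Quad = Fin n × Fin n × Fin n × Fin n

    IsK₄ : Quad → Set
    IsK₄ (a , b , c , d) = 0# < x a × 0# < x b × 0# < x c × 0# < x d ×
                           Edge a b c × Edge a b d × Edge a c d × Edge b c d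

    isK₄? : ∀ t → Dec (IsK₄ t)
    isK₄? (a , b , c , d) = 0<? (x a) ×-dec 0<? (x b) ×-dec 0<? (x c) ×-dec 0<? (x d) ×-dec
      (E a b c Boolₚ.≟ true) ×-dec (E a b d Boolₚ.≟ true) ×-dec (E a c d Boolₚ.≟ true) ×-dec (E b c d Boolₚ.≟ true)

    weight : Quad → Carrier
    weight (a , b , c , d) = x a ⊕ x b ⊕ x c ⊕ x d

    quads : List Quad
    quads = cartesianProduct (allFin n) (cartesianProduct (allFin n) (cartesianProduct (allFin n) (allFin n)))

    ∈-quads : ∀ t → t ∈ quads
    ∈-quads (a , b , c , d) = ∈-cartesianProduct⁺ (∈-allFin a) (∈-cartesianProduct⁺ (∈-allFin b)
      (∈-cartesianProduct⁺ (∈-allFin c) (∈-allFin d)))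

    mass≈ : mass x ≈ # 9 ⊛ θ
    mass≈ = mass-dense G D

    some-K₄ : ¬ (∀ t → ¬ IsK₄ t)
    -- Without K₄, de Caen's inequality and the tangent at codegree 6 give θ ≤ 54 for total weight
    -- 9.
    some-K₄ none = θ> (by
      ((nat 3 :* v₀ :+ nat 3 :* v₁ ≦ nat 2 :* v₂ :* v₃) ∷ (nat 2 :* nat 1 :* nat 6 :* v₃ :-
          nat 6 :* nat 6 :* (v₂ :* v₂ :- v₄) ≦ nat 1 :* nat 1 :* v₀) ∷
       (v₂ ≐ nat 9) ∷ (v₃ ≐ nat 9 :* v₅) ∷ (nat 0 ≦ v₁) ∷ (nat 0 ≦ v₄) ∷ []) 161 v₅ (nat 56)
      (h₀ ⊞ 3 ∙ h₁ ⊞ 3 ∙ h₄ ⊞ 108 ∙ h₅ ⊞ cst 324 ⊞ eqn 2 (nat 2 :* v₃ :+ nat 108 :* (v₂ :+ nat 9)) ⊞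
          eqn 3 (:- nat 18)) refl
      (squareW G x ∷ dot x (λ b → x b ⊛ link x b) ∷ sum x ∷ mass x ∷ sqs x ∷ θ ∷ [])
      (deCaen G nonneg (λ {a} {b} {c} {d} pa pb pc pd e₁ e₂ e₃ e₄ → none (a , b , c , d) (pa , pb , pc , pd , e₁ ,
          e₂ , e₃ , e₄)) ∷
       squareW≥ G nonneg (# 1) (# 6) ∷ sum≈ ∷ mass≈ ∷ dot-nonneg nonneg (λ i _ →
           *-nonneg (nonneg i) (0≤link nonneg i)) ∷
       dot-nonneg nonneg (λ i _ → nonneg i) ∷ []))

    module OnK₄ {a b c d} (K : IsK₄ (a , b , c , d)) where

      0<xa = proj₁ K
      0<xb = proj₁ (proj₂ K)
      0<xc = proj₁ (proj₂ (proj₂ K))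
      0<xd = proj₁ (proj₂ (proj₂ (proj₂ K)))
      abc = proj₁ (proj₂ (proj₂ (proj₂ (proj₂ K))))
      abd = proj₁ (proj₂ (proj₂ (proj₂ (proj₂ (proj₂ K)))))
      acd = proj₁ (proj₂ (proj₂ (proj₂ (proj₂ (proj₂ (proj₂ K))))))
      bcd = proj₂ (proj₂ (proj₂ (proj₂ (proj₂ (proj₂ (proj₂ K))))))

      a≢b = proj₁ (edge-≢ G abc)
      a≢c = proj₁ (proj₂ (edge-≢ G abc))
      a≢d = proj₁ (proj₂ (edge-≢ G abd))
      b≢c = proj₂ (proj₂ (edge-≢ G abc))
      b≢d = proj₂ (proj₂ (edge-≢ G abd))
      c≢d = proj₂ (proj₂ (edge-≢ G acd))

      α σ : Carrier
      y : Weights n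
      y = x ∖ a ∖ b ∖ c ∖ d
      α = x a ⊕ x b ⊕ x c ⊕ x d
      σ = sum y

      nny : NonNeg y
      nny = ∖-nonneg (∖-nonneg (∖-nonneg (∖-nonneg nonneg a) b) c) d

      9≈ : # 9 ≈ σ ⊕ α
      9≈ = ≈-trans (≈-sym sum≈) (sum-∖₄ G nonneg a≢b a≢c a≢d b≢c b≢d c≢d)

      0≤α : 0# ≤ α
      0≤α = 0≤+ (0≤+ (0≤+ (nonneg a) (nonneg b)) (nonneg c)) (nonneg d)

      module _ {j} (p : 0# < y j) where
        private
          p₁ = ∖-supp (x ∖ a ∖ b ∖ c) p
          p₂ = ∖-supp (x ∖ a ∖ b) (proj₂ p₁)
          p₃ = ∖-supp (x ∖ a) (proj₂ p₂)
          p₄ = ∖-supp x (proj₂ p₃)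
        a≢ : a ≢ j
        a≢ = proj₁ p₄
        b≢ : b ≢ j
        b≢ = proj₁ p₃
        c≢ : c ≢ j
        c≢ = proj₁ p₂
        d≢ : d ≢ j
        d≢ = proj₁ p₁
        0<x : 0# < x j
        0<x = proj₂ p₄
        y≈x : y j ≈ x j
        y≈x = ≈-trans (∖-≢ (x ∖ a ∖ b ∖ c) d≢) (≈-trans (∖-≢ (x ∖ a ∖ b) c≢) (≈-trans (∖-≢ (x ∖ a) b≢) (∖-≢ x a≢)))
        ∉K₄ : j ∉ a ∷ b ∷ c ∷ d ∷ []
        ∉K₄ (here refl) = a≢ refl
        ∉K₄ (there (here refl)) = b≢ refl
        ∉K₄ (there (there (here refl))) = c≢ refl
        ∉K₄ (there (there (there (here refl)))) = d≢ refl

      supp-y : ∀ {j} → 0# < x j → a ≢ j → b ≢ j → c ≢ j → d ≢ j → 0# < y j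
      supp-y p a≢j b≢j c≢j d≢j = supp-∖ (x ∖ a ∖ b ∖ c) d≢j (supp-∖ (x ∖ a ∖ b) c≢j (supp-∖ (x ∖ a) b≢j (supp-∖ x a≢j
          p)))

      pres : Fin n → Carrier
      pres = present G nonneg a≢b a≢c a≢d b≢c b≢d c≢d

      θ≤ : ∀ {j} → 0# < y j → θ ≤ link y j ⊕ # 2 ⊛ α ⊛ (σ ⊖′ y j) ⊕ # 2 ⊛ pres j
      θ≤ {j} p = ≤-respˡ (link≈ j (0<x p)) (link-∖₄≤ G nonneg a≢b a≢c a≢d b≢c b≢d c≢d j)

      Q : Carrier
      Q = x a ⊛ x a ⊕ x b ⊛ x b ⊕ x c ⊛ x c ⊕ x d ⊛ x d

      sqs-y : sqs x ≈ sqs y ⊕ Q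
      sqs-y = equate ((v₀ ≐ v₁ :+ v₂) ∷ (v₁ ≐ v₃ :+ v₄) ∷ (v₃ ≐ v₅ :+ v₆) ∷ (v₅ ≐ v₇ :+ v₈) ∷ []) v₀
        (v₇ :+ (v₂ :+ v₄ :+ v₆ :+ v₈)) ((0 , nat 1) ∷ (1 , nat 1) ∷ (2 , nat 1) ∷ (3 , nat 1) ∷ []) refl
        (sqs x ∷ sqs (x ∖ a) ∷ x a ⊛ x a ∷ sqs (x ∖ a ∖ b) ∷ x b ⊛ x b ∷ sqs (x ∖ a ∖ b ∖ c) ∷ x c ⊛ x c ∷ sqs y ∷
            x d ⊛ x d ∷ [])
        (sqs-∖ x a ∷ ≈-trans (sqs-∖ (x ∖ a) b) (+-congˡ (*-cong xb xb)) ∷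
         ≈-trans (sqs-∖ (x ∖ a ∖ b) c) (+-congˡ (*-cong xc xc)) ∷ ≈-trans (sqs-∖ (x ∖ a ∖ b ∖ c) d) (+-congˡ (*-cong
             xd xd)) ∷ [])
        where
        xb = ∖-≢ x a≢b
        xc = ≈-trans (∖-≢ (x ∖ a) b≢c) (∖-≢ x a≢c)
        xd = ≈-trans (∖-≢ (x ∖ a ∖ b) c≢d) (≈-trans (∖-≢ (x ∖ a) b≢d) (∖-≢ x a≢d))

      2pres≤ : ∀ j → # 2 ⊛ pres j ≤ α ⊛ α ⊖′ Q
      2pres≤ j = by ((nat 0 ≦ v₀) ∷ (nat 0 ≦ v₁) ∷ (nat 0 ≦ v₂) ∷ (nat 0 ≦ v₃) ∷ (v₄ ≦ nat 1) ∷ (v₅ ≦ nat 1) ∷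
          (v₆ ≦ nat 1) ∷
          (v₇ ≦ nat 1) ∷ (v₈ ≦ nat 1) ∷ (v₉ ≦ nat 1) ∷ []) 0
        (nat 2 :* (v₀ :* v₁ :* v₄ :+ v₀ :* v₂ :* v₅ :+ v₀ :* v₃ :* v₆ :+ v₁ :* v₂ :* v₇ :+ v₁ :* v₃ :* v₈ :+
            v₂ :* v₃ :* v₉))
        ((v₀ :+ v₁ :+ v₂ :+ v₃) :* (v₀ :+ v₁ :+ v₂ :+ v₃) :- (v₀ :* v₀ :+ v₁ :* v₁ :+ v₂ :* v₂ :+ v₃ :* v₃))
        (2 ∙ h₀ ⊠ h₁ ⊠ h₄ ⊞ 2 ∙ h₀ ⊠ h₂ ⊠ h₅ ⊞ 2 ∙ h₀ ⊠ h₃ ⊠ h₆ ⊞ 2 ∙ h₁ ⊠ h₂ ⊠ h₇ ⊞ 2 ∙ h₁ ⊠ h₃ ⊠ h₈ ⊞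
            2 ∙ h₂ ⊠ h₃ ⊠ h₉) refl
        (x a ∷ x b ∷ x c ∷ x d ∷ E[ j , a , b ] ∷ E[ j , a , c ] ∷ E[ j , a , d ] ∷ E[ j , b , c ] ∷ E[ j , b , d ] ∷
            E[ j , c , d ] ∷ [])
        (nonneg a ∷ nonneg b ∷ nonneg c ∷ nonneg d ∷ []≤1 (E j a b) ∷ []≤1 (E j a c) ∷ []≤1 (E j a d) ∷
            []≤1 (E j b c) ∷
         []≤1 (E j b d) ∷ []≤1 (E j c d) ∷ [])

      Disjoint : Fin n → Fin n → Fin n → Fin n → Set
      Disjoint p i j k = p ≢ i × p ≢ j × p ≢ k

      clash : ∀ {i j k p q r} → Edge i j k → Edge p q r → 0# < y i → 0# < y j → 0# < y k → 0# < y p → 0# < y q →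
          0# < y r →
              Disjoint p i j k → Disjoint q i j k → Disjoint r i j k → ⊥
      clash {i} {j} {k} {p} {q} {r} e f yi yj yk yp yq yr dp dq dr =
        free (add (add (k₄ abc abd acd bcd) i j k e (∉K₄ yi) (∉K₄ yj) (∉K₄ yk)) p q r f (lem yp dp) (lem yq dq) (lem
            yr dr))
        where
        lem : ∀ {v} → 0# < y v → Disjoint v i j k → v ∉ i ∷ j ∷ k ∷ a ∷ b ∷ c ∷ d ∷ []
        lem p (n₁ , n₂ , n₃) (here e) = n₁ e
        lem p (n₁ , n₂ , n₃) (there (here e)) = n₂ e
        lem p (n₁ , n₂ , n₃) (there (there (here e))) = n₃ e
        lem p (n₁ , n₂ , n₃) (there (there (there m))) = ∉K₄ p m

  module Light {n} (G : Triples n) {θ x} (D : Dense G (# 9) θ x) (free : Edges.Free G 2) (θ> : # 56 < θ)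
               (x≤1 : ∀ i → x i ≤ 1#) where

    open Setup G D free θ>

    module _ {a b c d} (K : IsK₄ (a , b , c , d)) (lightest : ∀ t → IsK₄ t → weight (a , b , c , d) ≤ weight t) where

      open OnK₄ K
      open Scalar {α} {σ} {θ} 9≈ 0≤α θ>

      y≤1 : ∀ i → y i ≤ 1#
      y≤1 i with 0<? (y i)
      ... | yes p = ≤-respˡ (≈-sym (y≈x p)) (x≤1 i)
      ... | no ¬p = ≤-trans (≤-stable ¬p) 0≤1

      α≤4 : α ≤ # 4
      α≤4 = by ((v₀ ≦ nat 1) ∷ (v₁ ≦ nat 1) ∷ (v₂ ≦ nat 1) ∷ (v₃ ≦ nat 1) ∷ []) 0 (v₀ :+ v₁ :+ v₂ :+ v₃) (nat 4)
        (h₀ ⊞ h₁ ⊞ h₂ ⊞ h₃) refl (x a ∷ x b ∷ x c ∷ x d ∷ []) (x≤1 a ∷ x≤1 b ∷ x≤1 c ∷ x≤1 d ∷ [])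

      -- A vertex lighter than a vertex of the K₄ cannot replace it.

      module _ {j} (p : 0# < y j) where
        private
          xj = 0<x p
        block-d : x j < x d → E j a b ≡ true → E j a c ≡ true → E j b c ≡ true → ⊥
        block-d lt e₁ e₂ e₃ = lt (by ((v₀ :+ v₁ :+ v₂ :+ v₃ ≦ v₄ :+ v₀ :+ v₁ :+ v₂) ∷ []) 0 v₃ v₄ h₀ refl
          (x a ∷ x b ∷ x c ∷ x d ∷ x j ∷ []) (lightest (j , a , b , c) (xj , 0<xa , 0<xb , 0<xc , e₁ , e₂ , e₃ ,
              abc) ∷ []))
        block-c : x j < x c → E j a b ≡ true → E j a d ≡ true → E j b d ≡ true → ⊥
        block-c lt e₁ e₂ e₃ = lt (by ((v₀ :+ v₁ :+ v₂ :+ v₃ ≦ v₄ :+ v₀ :+ v₁ :+ v₃) ∷ []) 0 v₂ v₄ h₀ refl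
          (x a ∷ x b ∷ x c ∷ x d ∷ x j ∷ []) (lightest (j , a , b , d) (xj , 0<xa , 0<xb , 0<xd , e₁ , e₂ , e₃ ,
              abd) ∷ []))
        block-b : x j < x b → E j a c ≡ true → E j a d ≡ true → E j c d ≡ true → ⊥
        block-b lt e₁ e₂ e₃ = lt (by ((v₀ :+ v₁ :+ v₂ :+ v₃ ≦ v₄ :+ v₀ :+ v₂ :+ v₃) ∷ []) 0 v₁ v₄ h₀ refl
          (x a ∷ x b ∷ x c ∷ x d ∷ x j ∷ []) (lightest (j , a , c , d) (xj , 0<xa , 0<xc , 0<xd , e₁ , e₂ , e₃ ,
              acd) ∷ []))
        block-a : x j < x a → E j b c ≡ true → E j b d ≡ true → E j c d ≡ true → ⊥
        block-a lt e₁ e₂ e₃ = lt (by ((v₀ :+ v₁ :+ v₂ :+ v₃ ≦ v₄ :+ v₁ :+ v₂ :+ v₃) ∷ []) 0 v₀ v₄ h₀ refl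
          (x a ∷ x b ∷ x c ∷ x d ∷ x j ∷ []) (lightest (j , b , c , d) (xj , 0<xb , 0<xc , 0<xd , e₁ , e₂ , e₃ ,
              bcd) ∷ []))

        pres-blocked : x j < x a → x j < x b → x j < x c → x j < x d → # 4 ⊛ pres j ≤ α ⊛ α
        pres-blocked la lb lc ld = blocked (nonneg a) (nonneg b) (nonneg c) (nonneg d)
          (E j a b) (E j a c) (E j a d) (E j b c) (E j b d) (E j c d) (block-d ld) (block-c lc) (block-b lb) (block-a
              la)

        pres≤ : # 8 ⊛ pres j ≤ # 3 ⊛ α ⊛ α
        pres≤ = pairSum≤ (nonneg a) (nonneg b) (nonneg c) (nonneg d)
          (E j a b) (E j a c) (E j a d) (E j b c) (E j b d) (E j c d)

        v≤1 : y j ≤ # 1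
        v≤1 = y≤1 j

      sum≤₁ : ∀ {p q r s v} → p ≤ v → q ≤ 1# → r ≤ 1# → s ≤ 1# → p ⊕ q ⊕ r ⊕ s ≤ # 3 ⊕ v
      sum≤₁ {p} {q} {r} {s} {v} h₁′ h₂′ h₃′ h₄′ = by ((v₀ ≦ v₄) ∷ (v₁ ≦ nat 1) ∷ (v₂ ≦ nat 1) ∷ (v₃ ≦ nat 1) ∷ []) 0
        (v₀ :+ v₁ :+ v₂ :+ v₃) (nat 3 :+ v₄) (h₀ ⊞ h₁ ⊞ h₂ ⊞ h₃) refl (p ∷ q ∷ r ∷ s ∷ v ∷ []) (h₁′ ∷ h₂′ ∷ h₃′ ∷
            h₄′ ∷ [])

      sum≤₂ : ∀ {p q r s v} → p ≤ v → q ≤ v → r ≤ 1# → s ≤ 1# → p ⊕ q ⊕ r ⊕ s ≤ # 2 ⊕ # 2 ⊛ v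
      sum≤₂ {p} {q} {r} {s} {v} h₁′ h₂′ h₃′ h₄′ = by ((v₀ ≦ v₄) ∷ (v₁ ≦ v₄) ∷ (v₂ ≦ nat 1) ∷ (v₃ ≦ nat 1) ∷ []) 0
        (v₀ :+ v₁ :+ v₂ :+ v₃) (nat 2 :+ nat 2 :* v₄) (h₀ ⊞ h₁ ⊞ h₂ ⊞ h₃) refl (p ∷ q ∷ r ∷ s ∷ v ∷ []) (h₁′ ∷ h₂′ ∷
            h₃′ ∷ h₄′ ∷ [])

      perm : ∀ {p q r s t} (f : Expr) → isZero (nf (f :- (v₀ :+ v₁ :+ v₂ :+ v₃))) ≡ true →
             ⟦ f ⟧ (p ∷ q ∷ r ∷ s ∷ []) ≤ t → p ⊕ q ⊕ r ⊕ s ≤ t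
      perm {p} {q} {r} {s} f z = ≤-respˡ (identity f (v₀ :+ v₁ :+ v₂ :+ v₃) z (p ∷ q ∷ r ∷ s ∷ []))

      -- The cases are that at least two, exactly one, or none of the vertices of the K₄ weigh at
      -- most `y j`. Those with exactly one differ by a renaming that puts this vertex first in
      -- `bonus`.
      heavy-link : ∀ {w} → 0# ≤ w → ∀ {j} → 0# < y j → w ≤ y j →
                   # 6 ⊕ # 2 ⊛ w ⊛ (σ ⊖′ w ⊖′ y j) < link y j
      heavy-link {w} 0≤w {j} p w≤ with ≤-<-connex (x a) (y j) | ≤-<-connex (x b) (y j) | ≤-<-connex (x c) (y j) |
          ≤-<-connex (x d) (y j)
      ... | inj₁ la | inj₁ lb | _ | _ = two-below (θ≤ p) 0≤w w≤ (v≤1 p) (sum≤₂ la lb (x≤1 c) (x≤1 d)) (pres≤ p)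
      ... | inj₁ la | inj₂ _ | inj₁ lc | _ = two-below (θ≤ p) 0≤w w≤ (v≤1 p) (perm (v₀ :+ v₂ :+ v₁ :+
          v₃) refl (sum≤₂ la lc (x≤1 b) (x≤1 d))) (pres≤ p)
      ... | inj₁ la | inj₂ _ | inj₂ _ | inj₁ ld = two-below (θ≤ p) 0≤w w≤ (v≤1 p) (perm (v₀ :+ v₃ :+ v₁ :+
          v₂) refl (sum≤₂ la ld (x≤1 b) (x≤1 c))) (pres≤ p)
      ... | inj₂ _ | inj₁ lb | inj₁ lc | _ = two-below (θ≤ p) 0≤w w≤ (v≤1 p) (perm (v₁ :+ v₂ :+ v₀ :+
          v₃) refl (sum≤₂ lb lc (x≤1 a) (x≤1 d))) (pres≤ p)
      ... | inj₂ _ | inj₁ lb | inj₂ _ | inj₁ ld = two-below (θ≤ p) 0≤w w≤ (v≤1 p) (perm (v₁ :+ v₃ :+ v₀ :+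
          v₂) refl (sum≤₂ lb ld (x≤1 a) (x≤1 c))) (pres≤ p)
      ... | inj₂ _ | inj₂ _ | inj₁ lc | inj₁ ld = two-below (θ≤ p) 0≤w w≤ (v≤1 p) (perm (v₂ :+ v₃ :+ v₀ :+
          v₁) refl (sum≤₂ lc ld (x≤1 a) (x≤1 b))) (pres≤ p)
      ... | inj₂ la | inj₂ lb | inj₂ lc | inj₂ ld = none-below (θ≤ p) 0≤w w≤ (v≤1 p) α≤4
              (pres-blocked p (lt la) (lt lb) (lt lc) (lt ld))
        where
        lt : ∀ {t} → y j < t → x j < t
        lt q r = q (≤-respʳ (≈-sym (y≈x p)) r)
      ... | inj₁ la | inj₂ lb | inj₂ lc | inj₂ ld = one-below (θ≤ p) 0≤w w≤ (v≤1 p) (nonneg a) la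
              (sum≤₁ ≤-refl (x≤1 b) (x≤1 c) (x≤1 d))
              (bonus (nonneg a) la (<⇒≤ lb) (<⇒≤ lc) (<⇒≤ ld) (E j a b) (E j a c) (E j a d) (E j b c) (E j b d) (E j
                  c d)
                (block-d p (lt ld)) (block-c p (lt lc)) (block-b p (lt lb)))
        where
        lt : ∀ {t} → y j < t → x j < t
        lt q r = q (≤-respʳ (≈-sym (y≈x p)) r)
      ... | inj₂ la | inj₁ lb | inj₂ lc | inj₂ ld = one-below (θ≤ p) 0≤w w≤ (v≤1 p) (nonneg b) lb
              (perm (v₁ :+ v₀ :+ v₂ :+ v₃) refl (sum≤₁ ≤-refl (x≤1 a) (x≤1 c) (x≤1 d)))
              (≤-respˡ (identity
                 (nat 8 :* (v₁ :* v₀ :* v₄ :+ v₁ :* v₂ :* v₇ :+ v₁ :* v₃ :* v₈ :+ v₀ :* v₂ :* v₅ :+ v₀ :* v₃ :* v₆ :+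
                     v₂ :* v₃ :* v₉) :+ nat 12 :* v₁ :* var 10)
                 (nat 8 :* (v₀ :* v₁ :* v₄ :+ v₀ :* v₂ :* v₅ :+ v₀ :* v₃ :* v₆ :+ v₁ :* v₂ :* v₇ :+ v₁ :* v₃ :* v₈ :+
                     v₂ :* v₃ :* v₉) :+ nat 12 :* v₁ :* var 10)
                 refl (x a ∷ x b ∷ x c ∷ x d ∷ E[ j , a , b ] ∷ E[ j , a , c ] ∷ E[ j , a , d ] ∷ E[ j , b , c ] ∷
                     E[ j , b , d ] ∷ E[ j , c , d ] ∷ y j ∷ []))
               (≤-respʳ (identity (nat 3 :* (v₁ :+ v₀ :+ v₂ :+ v₃) :* (v₁ :+ v₀ :+ v₂ :+ v₃)) (nat 3 :* (v₀ :+ v₁ :+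
                   v₂ :+ v₃) :* (v₀ :+ v₁ :+ v₂ :+ v₃)) refl (x a ∷ x b ∷ x c ∷ x d ∷ []))
                (bonus (nonneg b) lb (<⇒≤ la) (<⇒≤ lc) (<⇒≤ ld) (E j a b) (E j b c) (E j b d) (E j a c) (E j a d) (E
                    j c d)
                  (λ e₁ e₂ e₃ → block-d p (lt ld) e₁ e₃ e₂) (λ e₁ e₂ e₃ →
                      block-c p (lt lc) e₁ e₃ e₂) (block-a p (lt la)))))
        where
        lt : ∀ {t} → y j < t → x j < t
        lt q r = q (≤-respʳ (≈-sym (y≈x p)) r)
      ... | inj₂ la | inj₂ lb | inj₁ lc | inj₂ ld = one-below (θ≤ p) 0≤w w≤ (v≤1 p) (nonneg c) lc
              (perm (v₂ :+ v₀ :+ v₁ :+ v₃) refl (sum≤₁ ≤-refl (x≤1 a) (x≤1 b) (x≤1 d)))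
              (≤-respˡ (identity
                 (nat 8 :* (v₂ :* v₀ :* v₅ :+ v₂ :* v₁ :* v₇ :+ v₂ :* v₃ :* v₉ :+ v₀ :* v₁ :* v₄ :+ v₀ :* v₃ :* v₆ :+
                     v₁ :* v₃ :* v₈) :+ nat 12 :* v₂ :* var 10)
                 (nat 8 :* (v₀ :* v₁ :* v₄ :+ v₀ :* v₂ :* v₅ :+ v₀ :* v₃ :* v₆ :+ v₁ :* v₂ :* v₇ :+ v₁ :* v₃ :* v₈ :+
                     v₂ :* v₃ :* v₉) :+ nat 12 :* v₂ :* var 10)
                 refl (x a ∷ x b ∷ x c ∷ x d ∷ E[ j , a , b ] ∷ E[ j , a , c ] ∷ E[ j , a , d ] ∷ E[ j , b , c ] ∷
                     E[ j , b , d ] ∷ E[ j , c , d ] ∷ y j ∷ []))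
               (≤-respʳ (identity (nat 3 :* (v₂ :+ v₀ :+ v₁ :+ v₃) :* (v₂ :+ v₀ :+ v₁ :+ v₃)) (nat 3 :* (v₀ :+ v₁ :+
                   v₂ :+ v₃) :* (v₀ :+ v₁ :+ v₂ :+ v₃)) refl (x a ∷ x b ∷ x c ∷ x d ∷ []))
                (bonus (nonneg c) lc (<⇒≤ la) (<⇒≤ lb) (<⇒≤ ld) (E j a c) (E j b c) (E j c d) (E j a b) (E j a d) (E
                    j b d)
                  (λ e₁ e₂ e₃ → block-d p (lt ld) e₃ e₁ e₂) (λ e₁ e₂ e₃ → block-b p (lt lb) e₁ e₃ e₂) (λ e₁ e₂ e₃ →
                      block-a p (lt la) e₁ e₃ e₂))))
        where
        lt : ∀ {t} → y j < t → x j < t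
        lt q r = q (≤-respʳ (≈-sym (y≈x p)) r)
      ... | inj₂ la | inj₂ lb | inj₂ lc | inj₁ ld = one-below (θ≤ p) 0≤w w≤ (v≤1 p) (nonneg d) ld
              (perm (v₃ :+ v₀ :+ v₁ :+ v₂) refl (sum≤₁ ≤-refl (x≤1 a) (x≤1 b) (x≤1 c)))
              (≤-respˡ (identity
                 (nat 8 :* (v₃ :* v₀ :* v₆ :+ v₃ :* v₁ :* v₈ :+ v₃ :* v₂ :* v₉ :+ v₀ :* v₁ :* v₄ :+ v₀ :* v₂ :* v₅ :+
                     v₁ :* v₂ :* v₇) :+ nat 12 :* v₃ :* var 10)
                 (nat 8 :* (v₀ :* v₁ :* v₄ :+ v₀ :* v₂ :* v₅ :+ v₀ :* v₃ :* v₆ :+ v₁ :* v₂ :* v₇ :+ v₁ :* v₃ :* v₈ :+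
                     v₂ :* v₃ :* v₉) :+ nat 12 :* v₃ :* var 10)
                 refl (x a ∷ x b ∷ x c ∷ x d ∷ E[ j , a , b ] ∷ E[ j , a , c ] ∷ E[ j , a , d ] ∷ E[ j , b , c ] ∷
                     E[ j , b , d ] ∷ E[ j , c , d ] ∷ y j ∷ []))
               (≤-respʳ (identity (nat 3 :* (v₃ :+ v₀ :+ v₁ :+ v₂) :* (v₃ :+ v₀ :+ v₁ :+ v₂)) (nat 3 :* (v₀ :+ v₁ :+
                   v₂ :+ v₃) :* (v₀ :+ v₁ :+ v₂ :+ v₃)) refl (x a ∷ x b ∷ x c ∷ x d ∷ []))
                (bonus (nonneg d) ld (<⇒≤ la) (<⇒≤ lb) (<⇒≤ lc) (E j a d) (E j b d) (E j c d) (E j a b) (E j a c) (E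
                    j b c)
                  (λ e₁ e₂ e₃ → block-c p (lt lc) e₃ e₁ e₂) (λ e₁ e₂ e₃ → block-b p (lt lb) e₃ e₁ e₂) (λ e₁ e₂ e₃ →
                      block-a p (lt la) e₃ e₁ e₂))))
        where
        lt : ∀ {t} → y j < t → x j < t
        lt q r = q (≤-respʳ (≈-sym (y≈x p)) r)

      -- A vertex of the K₄ that is not heavier than `o` bounds α by 3 + y o; if there is none, all
      -- four triangles in the link of `o` are blocked.
      star-link : ∀ {o} → 0# < y o → # 8 < link y o × (∀ z → 0# ≤ z → z ≤ # 1 → # 2 ⊛ z ⊛ (σ ⊖′ z ⊖′ y o) < link y o)
      star-link {o} p with ≤-<-connex (x a) (y o) | ≤-<-connex (x b) (y o) | ≤-<-connex (x c) (y o) | ≤-<-connex (x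
          d) (y o)
      ... | inj₁ la | _ | _ | _ = lightest₁ (θ≤ p) (nny o) (v≤1 p) (sum≤₁ la (x≤1 b) (x≤1 c) (x≤1 d)) (pres≤ p)
      ... | inj₂ _ | inj₁ lb | _ | _ = lightest₁ (θ≤ p) (nny o) (v≤1 p) (perm (v₁ :+ v₀ :+ v₂ :+
          v₃) refl (sum≤₁ lb (x≤1 a) (x≤1 c) (x≤1 d))) (pres≤ p)
      ... | inj₂ _ | inj₂ _ | inj₁ lc | _ = lightest₁ (θ≤ p) (nny o) (v≤1 p) (perm (v₂ :+ v₀ :+ v₁ :+
          v₃) refl (sum≤₁ lc (x≤1 a) (x≤1 b) (x≤1 d))) (pres≤ p)
      ... | inj₂ _ | inj₂ _ | inj₂ _ | inj₁ ld = lightest₁ (θ≤ p) (nny o) (v≤1 p) (perm (v₃ :+ v₀ :+ v₁ :+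
          v₂) refl (sum≤₁ ld (x≤1 a) (x≤1 b) (x≤1 c))) (pres≤ p)
      ... | inj₂ la | inj₂ lb | inj₂ lc | inj₂ ld = lightest₀ (θ≤ p) (nny o) (v≤1 p) α≤4 (pres-blocked p (lt la) (lt
          lb) (lt lc) (lt ld))
        where
        lt : ∀ {t} → y o < t → x o < t
        lt q r = q (≤-respʳ (≈-sym (y≈x p)) r)

  sum≤len : ∀ {n} (l : List (Fin n)) {y : Weights n} {M} → NonNeg y → (∀ i → 0# < y i → i ∈ l) → (∀ i → y i ≤ M) →
            0# ≤ M → sum y ≤ # (length l) ⊛ M
  sum≤len {n} [] {y} {M} nn h le 0≤M = ≤-respʳ (≈-trans (sum-0 n) (≈-sym (zeroˡ M)))
    (sum-mono {g = λ _ → 0#} (λ i → ≤-stable λ p → lem (h i p)))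
    where
    lem : ∀ {i} → ¬ i ∈ []
    lem ()
  sum≤len {n} (c ∷ l) {y} {M} nn h le 0≤M =
    by ((v₀ ≐ v₁ :+ v₂) ∷ (v₁ ≦ v₃ :* v₄) ∷ (v₂ ≦ v₄) ∷ (v₅ ≐ nat 1 :+ v₃) ∷ []) 0 v₀ (v₅ :* v₄)
      (h₁ ⊞ h₂ ⊞ eqn 0 (nat 1) ⊞ eqn 3 (:- v₄)) refl
      (sum y ∷ sum (y ∖ c) ∷ y c ∷ # (length l) ∷ M ∷ # (suc (length l)) ∷ [])
      (sum-∖ y c ∷ sum≤len l (∖-nonneg nn c) (λ i p → lem i (∖-supp y p)) le∖ 0≤M ∷ le c ∷ fromℕ-suc (length l) ∷ [])
    where
    lem : ∀ i → c ≢ i × 0# < y i → i ∈ l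
    lem i (c≢i , p) with h i p
    ... | here refl = ⊥-elim (c≢i refl)
    ... | there m   = m
    le∖ : ∀ i → (y ∖ c) i ≤ M
    le∖ i with c Finₚ.≟ i
    ... | yes refl = ≤-respˡ (identity (nat 0) (v₀ :+ :- v₀ :* nat 1) refl (y c ∷ [])) 0≤M
    ... | no _ = ≤-respˡ (identity v₀ (v₀ :+ :- v₁ :* nat 0) refl (y i ∷ y c ∷ [])) (le i)

  fromℕ-mono : ∀ {m n} → m ℕ.≤ n → # m ≤ # n
  fromℕ-mono {n = n} ℕ.z≤n = 0≤fromℕ n
  fromℕ-mono (ℕ.s≤s {m} {n} le) = ≤-respˡ (≈-sym (fromℕ-suc m)) (≤-respʳ (≈-sym (fromℕ-suc n)) (+-monoʳ-≤ 1#
      (fromℕ-mono le)))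

  module LightContradiction {n} (G : Triples n) {θ x} (D : Dense G (# 9) θ x) (free : Edges.Free G 2) (θ> : # 56 < θ)
                            (x≤1 : ∀ i → x i ≤ 1#) where

    open Setup G D free θ>

    -- A support of at most nine vertices has a weight of at least 1, hence equal to 1, and
    -- `few-vertices` applies.
    many-vertices : (l : List (Fin n)) → # (length l) ≤ # 9 → ∃ λ i → 0# < x i × i ∉ l
    many-vertices l len with Finₚ.any? (λ i → 0<? (x i) ×-dec ¬? (Any.any? (i Finₚ.≟_) l))
    ... | yes r = r
    -- The heaviest vertex, as a minimum of `⊖ x` under a trivial condition; `n` is not known to be
    -- a successor here.
    ... | no none with minimum {P = λ _ → 0# ≤ 0#} (λ _ → yes ≤-refl) (λ i → ⊖ x i) (allFin n)
    ...   | inj₂ empty = ⊥-elim (some-K₄ (λ t _ → empty (proj₁ t) (∈-allFin (proj₁ t)) ≤-refl))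
    ...   | inj₁ (a , _ , le) = ⊥-elim (θ> (few-vertices G D l len inl {a} 1≤xa (x≤1 a)))
      where
      inl : ∀ i → 0# < x i → i ∈ l
      inl i p with Any.any? (i Finₚ.≟_) l
      ... | yes m = m
      ... | no ¬m = ⊥-elim (none (i , p , ¬m))
      max : ∀ i → x i ≤ x a
      max i = by ((:- v₁ ≦ :- v₀) ∷ []) 0 v₀ v₁ h₀ refl (x i ∷ x a ∷ []) (le i (∈-allFin i) ≤-refl ∷ [])
      1≤xa : 1# ≤ x a
      1≤xa = by ((v₀ ≦ v₁ :* v₂) ∷ (v₁ ≦ nat 9) ∷ (nat 0 ≦ v₂) ∷ (v₀ ≐ nat 9) ∷ []) 8 (nat 1) v₂
        (h₀ ⊞ h₁ ⊠ h₂ ⊞ eqn 3 (:- nat 1)) refl (sum x ∷ # (length l) ∷ x a ∷ [])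
        (sum≤len l nonneg inl max (nonneg a) ∷ len ∷ nonneg a ∷ sum≈ ∷ [])

    module _ {a b c d} (K : IsK₄ (a , b , c , d)) (lightest : ∀ t → IsK₄ t → weight (a , b , c , d) ≤ weight t) where

      open OnK₄ K
      private
        module L = Light G D free θ> x≤1

      y≤1 : ∀ i → y i ≤ 1#
      y≤1 = L.y≤1 K lightest

      module _ {o} (yo : 0# < y o) (least : ∀ j → 0# < y j → y o ≤ y j) where

        L : Fin n → Fin n → Set
        L p q = 0# < y p × 0# < y q × Edge o p q

        8<link : # 8 < link y o
        8<link = proj₁ (L.star-link K lightest yo)

        star< : ∀ b′ → o ≢ b′ → # 2 ⊛ y b′ ⊛ W y o b′ < link y o
        star< b′ o≢b′ = ≤-<-trans
          (by ((nat 0 ≦ v₀) ∷ (v₁ ≦ v₂ :- v₃ :- v₀) ∷ []) 0 (nat 2 :* v₀ :* v₁) (nat 2 :* v₀ :* (v₂ :- v₀ :-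
              v₃)) (2 ∙ h₀ ⊠ h₁) refl
            (y b′ ∷ W y o b′ ∷ σ ∷ y o ∷ []) (nny b′ ∷ W-bound nny o≢b′ ∷ []))
          (proj₂ (L.star-link K lightest yo) (y b′) (nny b′) (y≤1 b′))

        avoiding : ∀ b′ → o ≢ b′ → ∃₂ λ p q → L p q × p ≢ b′ × q ≢ b′
        avoiding b′ o≢b′ = lem (find-avoiding G nny o b′ (star< b′ o≢b′))
          where
          lem : (∃₂ λ p q → 0# < y p × 0# < y q × Edge o p q × p ≢ b′ × q ≢ b′) → ∃₂ λ p q → L p q × p ≢ b′ × q ≢ b′
          lem (p , q , yp , yq , e , n₁ , n₂) = p , q , (yp , yq , e) , n₁ , n₂

        outside : ∀ l → length l ℕ.≤ 4 → ∃₂ λ p q → L p q × ¬ InPairs p q l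
        outside l le = lem (find-pair G nny y≤1 o l (≤-<-trans le8 8<link))
          where
          lem : (∃₂ λ p q → 0# < y p × 0# < y q × Edge o p q × ¬ InPairs p q l) → ∃₂ λ p q → L p q × ¬ InPairs p q l
          lem (p , q , yp , yq , e , ¬m) = p , q , (yp , yq , e) , ¬m
          le8 : # 2 ⊛ # (length l) ≤ # 8
          le8 = by ((v₀ ≦ nat 4) ∷ []) 0 (nat 2 :* v₀) (nat 8) (2 ∙ h₀) refl (# (length l) ∷ []) (fromℕ-mono le ∷ [])

        -- Pairs through `o` contribute at most 2 y o (σ - y o - y j) to the link of `j`, and three
        -- other pairs at most 6. `heavy-link` with w = y o exceeds the sum.
        finish : ∀ {j} → 0# < y j → j ≢ o → ∀ l → length l ℕ.≤ 3 →
                 (∀ {u v} → 0# < y u → 0# < y v → u ≢ o → v ≢ o → Edge j u v → InPairs u v l) → ⊥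
        finish {j} yj j≢o l len h = L.heavy-link K lightest (nny o) yj (least j yj)
          (by ((v₀ ≐ v₁ :+ nat 2 :* v₂ :* v₃) ∷ (v₁ ≦ nat 2 :* v₄) ∷ (v₄ ≦ nat 3) ∷ (nat 0 ≦ v₂) ∷
              (v₃ ≦ v₅ :- v₆ :- v₂) ∷ []) 0
            v₀ (nat 6 :+ nat 2 :* v₂ :* (v₅ :- v₂ :- v₆)) (h₁ ⊞ 2 ∙ h₂ ⊞ 2 ∙ h₃ ⊠ h₄ ⊞ eqn 0 (nat 1)) refl
            (link y j ∷ link (y ∖ o) j ∷ y o ∷ W y j o ∷ # (length l) ∷ σ ∷ y j ∷ [])
            (link-∖ y o j ∷ pairs-bound G (∖-nonneg nny o) le j l (λ pu pv e →
               let o≢u , yu = ∖-supp y pu ; o≢v , yv = ∖-supp y pv in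
               h yu yv (λ e → o≢u (≡.sym e)) (λ e → o≢v (≡.sym e)) e) ∷ fromℕ-mono len ∷ nny o ∷ W-bound nny j≢o ∷
                   []))
          where
          le : ∀ i → (y ∖ o) i ≤ 1#
          le i with o Finₚ.≟ i
          ... | yes refl = ≤-respˡ (identity (nat 0) (v₀ :+ :- v₀ :* nat 1) refl (y o ∷ [])) 0≤1
          ... | no _ = ≤-respˡ (identity v₀ (v₀ :+ :- v₁ :* nat 0) refl (y i ∷ y o ∷ [])) (y≤1 i)

        fifth : ∀ p q r s → ∃ λ t → 0# < y t × t ≢ o × t ≢ p × t ≢ q × t ≢ r × t ≢ s
        -- Nine vertices are named, and the support has a tenth.
        fifth p q r s = lem (many-vertices (a ∷ b ∷ c ∷ d ∷ o ∷ p ∷ q ∷ r ∷ s ∷ []) ≤-refl)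
          where
          lem : (∃ λ i → 0# < x i × i ∉ a ∷ b ∷ c ∷ d ∷ o ∷ p ∷ q ∷ r ∷ s ∷ []) →
                ∃ λ t → 0# < y t × t ≢ o × t ≢ p × t ≢ q × t ≢ r × t ≢ s
          lem (t , 0<xt , t∉) = t , supp-y 0<xt (λ e → t∉ (here (≡.sym e))) (λ e → t∉ (there (here (≡.sym e))))
                  (λ e → t∉ (there (there (here (≡.sym e))))) (λ e → t∉ (there (there (there (here (≡.sym e)))))) ,
                (λ e → t∉ (there (there (there (there (here e)))))) , (λ e →
                    t∉ (there (there (there (there (there (here e))))))) ,
                (λ e → t∉ (there (there (there (there (there (there (here e)))))))) ,
                (λ e → t∉ (there (there (there (there (there (there (there (here e))))))))) ,
                (λ e → t∉ (there (there (there (there (there (there (there (there (here e))))))))))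

        contradiction : ⊥
        contradiction = Intersecting.contradiction Edge (λ i j k → E i j k Boolₚ.≟ true) (e₂₃ G) (edge-≢ G) (λ i →
            0# < y i)
          clash yo avoiding outside finish fifth

      light-K₄ : ⊥
      light-K₄ with minimum (λ i → 0<? (y i)) y (allFin n)
      ... | inj₁ (o , yo , least) = contradiction yo (λ j yj → least j (∈-allFin j) yj)
      -- Without weight outside the K₄ the total 9 would be at most 4.
      ... | inj₂ none = 0<fromℕ 4 (by ((nat 9 ≐ v₀ :+ v₁) ∷ (v₀ ≦ nat 0) ∷ (v₁ ≦ nat 4) ∷ []) 0 (nat 5) (nat 0)
              (h₁ ⊞ h₂ ⊞ eqn 0 (nat 1)) refl (σ ∷ α ∷ [])
              (9≈ ∷ ≤-respʳ (sum-0 n) (sum-mono {g = λ _ → 0#} (λ i → ≤-stable (none i (∈-allFin i)))) ∷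
                  L.α≤4 K lightest ∷ []))

    light-case : ⊥
    light-case with minimum isK₄? weight quads
    ... | inj₁ (t , K , least) = light-K₄ K (λ u → least u (∈-quads u))
    ... | inj₂ none = some-K₄ (λ t → none t (∈-quads t))

  -- k = 2 with a weight above 1, when a K₄ avoids the heaviest vertex

  comb : ∀ {n} → List (Carrier × Weights n) → Weights n
  comb []            j = 0#
  comb ((c , f) ∷ l) j = c ⊛ f j ⊕ comb l j

  dot-comb : ∀ {n} (z : Weights n) l → dot z (comb l) ≈ List.foldr (λ cf s → proj₁ cf ⊛ dot z (proj₂ cf) ⊕ s) 0# l
  dot-comb z []            = ≈-trans (dot-const z 0#) (zeroˡ _)
  dot-comb z ((c , f) ∷ l) = ≈-trans (dot-+ z _ _) (+-cong (dot-* z c f) (dot-comb z l))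

  -- x is the heaviest weight, α the weight of a K₄ without it, Q and c its sums of squares
  -- and cubes; M₁ and M₂ count the missing triples with two and with one vertex in the K₄.

  heavy-count : ∀ {x α Q p θ c M₁ M₂} → # 100 ≤ # 100 ⊛ x → # 100 ⊛ x ≤ # 152 → α ⊛ α ≤ # 4 ⊛ Q → α ≤ # 4 ⊛ x →
      # 56 ≤ θ →
    θ ≤ (# 9 ⊖′ x) ⊛ (# 9 ⊖′ x) ⊖′ Q ⊖′ p → 0# ≤ p → c ≤ x ⊛ Q →
    let r = # 9 ⊖′ x ⊖′ α ; ρ = r ⊛ r ⊖′ p in
    M₁ ⊕ # 2 ⊛ M₂ ≤ # 2 ⊛ ρ ⊛ (x ⊕ α) ⊕ # 2 ⊛ x ⊛ α ⊛ r ⊕ (α ⊛ α ⊖′ Q) ⊛ r ⊖′ r ⊛ θ →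
    # 2 ⊛ M₁ ⊕ M₂ ≤ α ⊛ ρ ⊕ # 2 ⊛ x ⊛ α ⊛ r ⊕ # 2 ⊛ (α ⊛ α ⊖′ Q) ⊛ (r ⊕ x) ⊕ α ⊛ α ⊛ α ⊖′ # 3 ⊛ α ⊛ Q ⊕
        # 2 ⊛ c ⊖′ α ⊛ θ →
    ρ ⊛ (α ⊛ α ⊖′ Q) ≤ # 2 ⊛ r ⊛ M₁ ⊕ # 2 ⊛ α ⊛ M₂ → 0# ≤ M₁ → 0# ≤ M₂ → 0# ≤ α → 0# ≤ r → # 1 ≤ # 0
  heavy-count {x} {α} {Q} {p} {θ} {c} {M₁} {M₂} k₀ k₁ k₂ k₃ k₄ k₅ k₆ k₇ k₈ k₉ l₀ l₁ l₂ l₃ l₄ =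
    by ((nat 100 ≦ nat 100 :* v₀) ∷ (nat 100 :* v₀ ≦ nat 152) ∷ (v₁ :* v₁ ≦ nat 4 :* v₂) ∷ (v₁ ≦ nat 4 :* v₀) ∷
        (nat 56 ≦ v₄) ∷ (v₄ ≦ (nat 9 :- v₀) :* (nat 9 :- v₀) :- v₂ :- v₃) ∷ (nat 0 ≦ v₃) ∷ (v₅ ≦ v₀ :* v₂) ∷
        (v₆ :+ nat 2 :* v₇ ≦ nat 2 :* ((nat 9 :- v₀ :- v₁) :* (nat 9 :- v₀ :- v₁) :- v₃) :* (v₀ :+ v₁) :+
        nat 2 :* v₀ :* v₁ :* (nat 9 :- v₀ :- v₁) :+ (v₁ :* v₁ :- v₂) :* (nat 9 :- v₀ :- v₁) :- (nat 9 :- v₀ :-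
        v₁) :* v₄) ∷ (nat 2 :* v₆ :+ v₇ ≦ v₁ :* ((nat 9 :- v₀ :- v₁) :* (nat 9 :- v₀ :- v₁) :- v₃) :+
        nat 2 :* v₀ :* v₁ :* (nat 9 :- v₀ :- v₁) :+ nat 2 :* (v₁ :* v₁ :- v₂) :* (nat 9 :- v₀ :- v₁ :+ v₀) :+
        v₁ :* v₁ :* v₁ :- nat 3 :* v₁ :* v₂ :+ nat 2 :* v₅ :- v₁ :* v₄) ∷
        (((nat 9 :- v₀ :- v₁) :* (nat 9 :- v₀ :- v₁) :- v₃) :* (v₁ :* v₁ :- v₂) ≦ nat 2 :* (nat 9 :- v₀ :-
        v₁) :* v₆ :+ nat 2 :* v₁ :* v₇) ∷ (nat 0 ≦ v₆) ∷ (nat 0 ≦ v₇) ∷ (nat 0 ≦ v₁) ∷ (nat 0 ≦ nat 9 :- v₀ :- v₁) ∷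
        []) 43442691609492302539106198399999999 (nat 1) (nat 0)
                (3113867108761506242813821725000000 ∙ hyp 10 ⊞ 5980974763324618284287882900000000 ∙ h₈ ⊞
                34132678200007276787298167000000 ∙ h₈ ⊠ h₀ ⊞ 2007203623086116562596376631250000 ∙ h₈ ⊠ hyp 13 ⊞
                175927305968365861069377384375000 ∙ h₉ ⊠ h₁ ⊞ 3193057394518679006189752090625000 ∙ h₉ ⊠ h₃ ⊞
                1848823051571771035844515900000000 ∙ hyp 11 ⊠ hyp 13 ⊞ 2054720073637254843010642828000000 ∙ hyp 12 ⊞
                196195028422382481912176657875000 ∙ hyp 12 ⊠ h₁ ⊞ 5406384365869458366624642278125000 ∙ hyp 12 ⊠ h₃ ⊞
                29041025757201594524922861315000 ∙ h₄ ⊠ h₀ ⊠ h₀ ⊞ 60571699193404470669935002687500 ∙ h₄ ⊠ h₀ ⊠ h₁ ⊞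
                724526542215473787910084475062500 ∙ h₄ ⊠ h₀ ⊠ h₃ ⊞ 45638439417639819628297696875000 ∙ h₄ ⊠ h₁ ⊠ h₁ ⊞
                337835360997420057909007528125000 ∙ h₄ ⊠ h₁ ⊠ h₃ ⊞ 3113867108761506242813821725000000 ∙ h₄ ⊠ h₃ ⊠ h₃ ⊞
                3290080344192065972515699329000000 ∙ h₅ ⊠ h₃ ⊞ 13809426818824206068236636390000 ∙ h₅ ⊠ h₀ ⊠ h₀ ⊞
                41886078719788837480835183750000 ∙ h₅ ⊠ h₀ ⊠ hyp 13 ⊞ 11381029408728415323148268750000 ∙ h₅ ⊠ h₁ ⊠ h₁
                    ⊞
                89853346089028221256027401125000 ∙ h₅ ⊠ h₁ ⊠ h₃ ⊞ 8314128126366301811599950446875000 ∙ h₅ ⊠ h₃ ⊠ h₃ ⊞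
                16264674922422387536174799804000000 ∙ h₆ ⊞ 1176622427597536930580504122500000 ∙ h₆ ⊠ h₀ ⊠ h₃ ⊞
                16654124685122964887993817750000 ∙ h₆ ⊠ h₁ ⊠ h₁ ⊞ 703436020971168028394107237500000 ∙ h₆ ⊠ h₁ ⊠ h₃ ⊞
                6800077646448726248492585325000000 ∙ h₆ ⊠ hyp 13 ⊠ hyp 13 ⊞
                    778466777190376560703455431250000 ∙ h₆ ⊠ h₂ ⊞
                6695983183644652307643891125625 ∙ h₂ ⊠ h₀ ⊠ h₀ ⊞ 24571739354636463518406018750000 ∙ h₂ ⊠ h₀ ⊠ h₁ ⊞
                368868706310922391461751842062500 ∙ h₂ ⊠ h₀ ⊠ h₃ ⊞ 20336167253216934985171764843750 ∙ h₂ ⊠ h₁ ⊠ h₁ ⊞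
                210314520259964697922085822656250 ∙ h₂ ⊠ h₁ ⊠ h₃ ⊞ 351854611936731722138754768750000 ∙ h₇ ⊠ h₁ ⊞
                6386114789037358012379504181250000 ∙ h₇ ⊠ h₃ ⊞ 37574697787192897103809909197 ∙ h₀ ⊠ h₀ ⊠ h₀ ⊠ h₀ ⊞
                35687678432537101559733421875 ∙ h₀ ⊠ h₁ ⊠ h₁ ⊠ h₁ ⊞ 5311160064818459557184331328125 ∙ h₀ ⊠ h₁ ⊠ h₃ ⊠
                    h₃ ⊞
                88773836796768304890576562500 ∙ h₁ ⊠ h₁ ⊠ h₁ ⊠ hyp 13 ⊞
                3264779433366771552062177343750 ∙ h₁ ⊠ hyp 13 ⊠ hyp 13 ⊠ hyp 13 ⊞
                1192452599232799863231825581250000 ∙ h₃ ⊠ h₃ ⊠ h₃ ⊠ h₃ ⊞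
                85789113557410183014380487500000 ∙ h₃ ⊠ hyp 13 ⊠ hyp 13 ⊠ hyp 13) refl
      (x ∷ α ∷ Q ∷ p ∷ θ ∷ c ∷ M₁ ∷ M₂ ∷ []) (k₀ ∷ k₁ ∷ k₂ ∷ k₃ ∷ k₄ ∷ k₅ ∷ k₆ ∷ k₇ ∷ k₈ ∷ k₉ ∷ l₀ ∷ l₁ ∷ l₂ ∷ l₃ ∷
          l₄ ∷ [])

  -- A mixed K₄ that is not lighter than the given one has outside vertices of total weight at least
  -- α - 2x. The hypothesis on (x + α)(α - 2x) is what the links of these two vertices then imply.
  heavy-size : ∀ {x α Q θ} → # 100 ≤ # 100 ⊛ x → # 100 ⊛ x ≤ # 152 → α ⊛ α ≤ # 4 ⊛ Q → # 56 ≤ θ →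
    θ ≤ (# 9 ⊖′ x) ⊛ (# 9 ⊖′ x) ⊖′ Q → let r = # 9 ⊖′ x ⊖′ α in
    (x ⊕ α) ⊛ (α ⊖′ # 2 ⊛ x) ≤ # 2 ⊛ x ⊛ r ⊕ # 2 ⊛ α ⊛ (r ⊕ x) ⊕ α ⊛ α ⊖′ Q ⊖′ θ → 0# ≤ α → α ≤ # 4 ⊛ x → 0# ≤ r →
        # 1 ≤ # 0
  heavy-size {x} {α} {Q} {θ} k₀ k₁ k₂ k₃ k₄ k₅ k₆ k₇ k₈ = by ((nat 100 ≦ nat 100 :* v₀) ∷ (nat 100 :* v₀ ≦ nat 152) ∷
      (v₁ :* v₁ ≦ nat 4 :* v₂) ∷ (nat 56 ≦ v₄) ∷ (v₄ ≦ (nat 9 :- v₀) :* (nat 9 :- v₀) :- v₂) ∷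
      ((v₀ :+ v₁) :* (v₁ :- nat 2 :* v₀) ≦ nat 2 :* v₀ :* (nat 9 :- v₀ :- v₁) :+ nat 2 :* v₁ :* (nat 9 :- v₀ :- v₁ :+
      v₀) :+ v₁ :* v₁ :- v₂ :- v₄) ∷ (nat 0 ≦ v₁) ∷ (v₁ ≦ nat 4 :* v₀) ∷ (nat 0 ≦ nat 9 :- v₀ :- v₁) ∷
      []) 15721935 (nat 1) (nat 0)
                (7560000 ∙ h₂ ⊞ 30240000 ∙ h₃ ⊞ 13410000 ∙ h₄ ⊞ 16830000 ∙ h₅ ⊞ 5391 ∙ h₁ ⊠ h₁ ⊞ 168300 ∙ h₁ ⊠ h₇ ⊞
                426400 ∙ sq (nat 3 :* v₁ :- nat 11) ⊞ 4153600 ∙ sq (nat 3 :* v₁ :- nat 10)) refl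
      (x ∷ α ∷ Q ∷ 0# ∷ θ ∷ []) (k₀ ∷ k₁ ∷ k₂ ∷ k₃ ∷ k₄ ∷ k₅ ∷ k₆ ∷ k₇ ∷ k₈ ∷ [])

  1≰0 : ¬ (# 1 ≤ # 0)
  1≰0 = 0<1

  module HeavySetup {n} (G : Triples n) {θ x} (D : Dense G (# 9) θ x) (free : Edges.Free G 2) (θ> : # 56 < θ)
                    {h} (hmax : ∀ i → x i ≤ x h) (1<xh : 1# < x h) where

    open Setup G D free θ> public

    X q : Carrier
    X = x h
    x₁ : Weights n
    x₁ = x ∖ h
    q = sum x₁

    0<X : 0# < X
    0<X = <-≤-trans 0<1 (<⇒≤ 1<xh)

    nn₁ : NonNeg x₁
    nn₁ = ∖-nonneg nonneg h

    9≈q : # 9 ≈ q ⊕ X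
    9≈q = ≈-trans (≈-sym sum≈) (sum-∖ x h)

    link₁ : link x₁ h ≈ θ
    link₁ = ≈-trans (link-∖-self x h) (link≈ h 0<X)

    θ≤q² : θ ≤ q ⊛ q ⊖′ sqs x₁
    θ≤q² = ≤-respˡ link₁ (link≤ G nn₁ h)

    0≤sqs : ∀ {y : Weights n} → NonNeg y → 0# ≤ sqs y
    0≤sqs nn = dot-nonneg nn (λ i _ → nn i)

    -- 56 < θ ≤ (9 - X)², and 9 - √56 is about 1.517.
    X≤ : # 100 ⊛ X ≤ # 152
    X≤ = ≤-stable λ gt → 1≰0 (by ((nat 9 ≐ v₀ :+ v₁) ∷ (nat 56 ≦ v₂) ∷ (v₂ ≦ v₀ :* v₀ :- v₃) ∷ (nat 0 ≦ v₃) ∷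
        (nat 152 ≦ nat 100 :* v₁) ∷ (nat 0 ≦ v₀) ∷ []) 495 (nat 1) (nat 0)
      (10000 ∙ h₁ ⊞ 10000 ∙ h₂ ⊞ 10000 ∙ h₃ ⊞ 200 ∙ h₄ ⊠ h₅ ⊞ h₄ ⊠ h₄ ⊞ eqn 0 (:- nat 59600 :* nat 1) ⊞
       eqn 0 (:- nat 10000 :* v₀) ⊞ eqn 0 (:- nat 10000 :* v₁)) refl
      (q ∷ X ∷ θ ∷ sqs x₁ ∷ []) (9≈q ∷ <⇒≤ θ> ∷ θ≤q² ∷ 0≤sqs nn₁ ∷ <⇒≤ gt ∷ sum-nonneg nn₁ ∷ []))

    -- Seven vertices meeting all pairs of the link of `h` give 8θ ≤ 7(9 - X)², and X > 1 makes the
    -- right side less than 7 · 64, so that θ ≤ 56.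
    noCopy : ∀ {l} → Copy 1 l → All (λ i → 0# < x₁ i) l → ⊥
    noCopy {l} c ps = θ> (by ((v₀ ≐ nat 4 :+ nat 3 :* nat 1) ∷ ((v₀ :+ nat 1) :* v₁ ≦ v₀ :* (v₂ :* v₂)) ∷
        (nat 9 ≐ v₂ :+ v₃) ∷ (nat 1 ≦ v₃) ∷ (nat 0 ≦ v₂) ∷ []) 7 v₁ (nat 56)
      (h₁ ⊞ 14 ∙ h₃ ⊠ h₄ ⊞ 7 ∙ h₃ ⊠ h₃ ⊞ eqn 0 (:- nat 1 :* v₁) ⊞ eqn 0 (v₂ :* v₂) ⊞
       eqn 2 (:- nat 7 :* v₂) ⊞ eqn 2 (:- nat 49) ⊞ eqn 2 (:- nat 7 :* v₃)) refl
      (# (length l) ∷ θ ∷ q ∷ X ∷ [])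
      (copy-length G c ∷ ≤-respˡ (*-congˡ link₁) (cover G h l nn₁ λ 0<p 0<q p∉ q∉ → not-edge G λ e →
         free (add c h _ _ e (λ m → All.lookup ps m (≤-reflexive (∖-at x h))) p∉ q∉)) ∷ 9≈q ∷ <⇒≤ 1<xh ∷
             sum-nonneg nn₁ ∷ []))

    module Avoiding {a b c d} (K : IsK₄ (a , b , c , d)) (h≢a : h ≢ a) (h≢b : h ≢ b) (h≢c : h ≢ c) (h≢d : h ≢ d)
      (lightest : ∀ {i j k l} → IsK₄ (i , j , k , l) → h ≢ i → h ≢ j → h ≢ k → h ≢ l → weight (a , b , c , d) ≤ weight (i , j , k , l)) where

      open OnK₄ K

      z : Weights n
      z = y ∖ h
      nnz : NonNeg z
      nnz = ∖-nonneg nny h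
      r ρ : Carrier
      r = # 9 ⊖′ X ⊖′ α
      ρ = r ⊛ r ⊖′ sqs z

      yh≈X : y h ≈ X
      yh≈X = ≈-trans (∖-≢ (x ∖ a ∖ b ∖ c) (λ e → h≢d (≡.sym e))) (≈-trans (∖-≢ (x ∖ a ∖ b) (λ e → h≢c (≡.sym e)))
        (≈-trans (∖-≢ (x ∖ a) (λ e → h≢b (≡.sym e))) (∖-≢ x (λ e → h≢a (≡.sym e)))))

      σ≈ : σ ≈ sum z ⊕ X
      σ≈ = ≈-trans (sum-∖ y h) (+-congˡ yh≈X)

      r≈ : sum z ≈ r
      r≈ = equate ((nat 9 ≐ v₀ :+ v₁) ∷ (v₀ ≐ v₂ :+ v₃) ∷ []) v₂ (nat 9 :- v₃ :- v₁) ((0 , :- nat 1) ∷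
          (1 , :- nat 1) ∷ []) refl
        (σ ∷ α ∷ sum z ∷ X ∷ []) (9≈ ∷ σ≈ ∷ [])

      0≤r : 0# ≤ r
      0≤r = ≤-respʳ r≈ (sum-nonneg nnz)

      W≤r : ∀ i j → W z i j ≤ r
      W≤r i j = ≤-respʳ r≈ (W≤sum G nnz i j)

      link≤ρ : ∀ i → link z i ≤ ρ
      link≤ρ i = ≤-respʳ (+-congʳ (*-cong r≈ r≈)) (link≤ G nnz i)

      dot-1 : dot z (λ _ → 1#) ≈ r
      dot-1 = ≈-trans (≈-sym (sum≈dot z)) r≈

      module _ {j} (p : 0# < z j) where
        h≢ : h ≢ j
        h≢ = proj₁ (∖-supp y p)
        yj : 0# < y j
        yj = proj₂ (∖-supp y p)
        z≈y : z j ≈ y j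
        z≈y = ∖-≢ y h≢
        0<x₁ : 0# < x₁ j
        0<x₁ = supp-∖ x h≢ (0<x yj)

      -- Such an edge would complete a copy of K₄ ∪ e without `h`.
      independent : ∀ {i j k} → 0# < z i → 0# < z j → 0# < z k → ¬ Edge i j k
      independent zi zj zk e = noCopy
        (add (k₄ abc abd acd bcd) _ _ _ e (∉K₄ (yj zi)) (∉K₄ (yj zj)) (∉K₄ (yj zk)))
        (0<x₁ zi ∷ 0<x₁ zj ∷ 0<x₁ zk ∷ supp-∖ x h≢a 0<xa ∷ supp-∖ x h≢b 0<xb ∷ supp-∖ x h≢c 0<xc ∷
            supp-∖ x h≢d 0<xd ∷ [])

      link-z : ∀ {j} → 0# < z j → link z j ≈ 0#
      link-z p = link≈0 G nnz (independent p)

      link-y : ∀ j → link y j ≈ link z j ⊕ # 2 ⊛ X ⊛ W z j h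
      link-y j = ≈-trans (link-∖ y h j) (+-congˡ (*-cong (*-congˡ yh≈X) (≈-sym (W-∖-self y h j))))

      W-y : ∀ j i → W y j i ≤ W z j i ⊕ X
      W-y j i = by ((v₀ ≐ v₁ :+ v₂ :* v₃) ∷ (v₃ ≦ nat 1) ∷ (nat 0 ≦ v₂) ∷
          []) 0 v₀ (v₁ :+ v₂) (h₂ ⊠ h₁ ⊞ eqn 0 (nat 1)) refl
        (W y j i ∷ W z j i ∷ X ∷ E[ j , i , h ] ∷ [])
        (≈-trans (W-∖ y h j i) (+-congˡ (*-congʳ yh≈X)) ∷ []≤1 (E j i h) ∷ nonneg h ∷ [])

      sqs-x : sqs x ≈ sqs z ⊕ X ⊛ X ⊕ Q
      sqs-x = ≈-trans sqs-y (+-congʳ (≈-trans (sqs-∖ y h) (+-congˡ (*-cong yh≈X yh≈X))))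

      θ≤Q : θ ≤ (# 9 ⊖′ X) ⊛ (# 9 ⊖′ X) ⊖′ Q ⊖′ sqs z
      θ≤Q = by ((v₀ ≦ v₁ :* v₁ :- v₂) ∷ (nat 9 ≐ v₁ :+ v₃) ∷ (v₄ ≐ v₂ :+ v₃ :* v₃) ∷ (v₄ ≐ v₅ :+ v₃ :* v₃ :+ v₆) ∷
          []) 0
        v₀ ((nat 9 :- v₃) :* (nat 9 :- v₃) :- v₆ :- v₅) (h₀ ⊞ eqn 1 (:- (nat 9 :- v₃ :+ v₁)) ⊞ eqn 2 (nat 1) ⊞
            eqn 3 (:- nat 1)) refl
        (θ ∷ q ∷ sqs x₁ ∷ X ∷ sqs x ∷ sqs z ∷ Q ∷ []) (θ≤q² ∷ 9≈q ∷ sqs-∖ x h ∷ sqs-x ∷ [])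

      α²≤4Q : α ⊛ α ≤ # 4 ⊛ Q
      α²≤4Q = by [] 0 ((v₀ :+ v₁ :+ v₂ :+ v₃) :* (v₀ :+ v₁ :+ v₂ :+ v₃)) (nat 4 :* (v₀ :* v₀ :+ v₁ :* v₁ :+
          v₂ :* v₂ :+ v₃ :* v₃))
        (sq (v₀ :- v₁) ⊞ sq (v₀ :- v₂) ⊞ sq (v₀ :- v₃) ⊞ sq (v₁ :- v₂) ⊞ sq (v₁ :- v₃) ⊞ sq (v₂ :- v₃)) refl
        (x a ∷ x b ∷ x c ∷ x d ∷ []) []

      α≤4X : α ≤ # 4 ⊛ X
      α≤4X = by ((v₀ ≦ v₄) ∷ (v₁ ≦ v₄) ∷ (v₂ ≦ v₄) ∷ (v₃ ≦ v₄) ∷ []) 0 (v₀ :+ v₁ :+ v₂ :+ v₃) (nat 4 :* v₄) (h₀ ⊞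
          h₁ ⊞ h₂ ⊞ h₃) refl
        (x a ∷ x b ∷ x c ∷ x d ∷ X ∷ []) (hmax a ∷ hmax b ∷ hmax c ∷ hmax d ∷ [])

      100≤X : # 100 ≤ # 100 ⊛ X
      100≤X = by ((nat 1 ≦ v₀) ∷ []) 0 (nat 100) (nat 100 :* v₀) (100 ∙ h₀) refl (X ∷ []) (<⇒≤ 1<xh ∷ [])

      -- All pairs in the link of `j` meet `h` or the K₄, and the codegrees counting them omit the
      -- weight of `j`. A large weight of `j` would therefore push its link below θ.
      vertex-bound : ∀ {j} → 0# < z j →
        # 2 ⊛ (X ⊕ α) ⊛ z j ≤ # 2 ⊛ X ⊛ r ⊕ # 2 ⊛ α ⊛ (r ⊕ X) ⊕ α ⊛ α ⊖′ Q ⊖′ θ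
      vertex-bound {j} p = by
        ((v₀ ≦ v₁ :+ nat 2 :* v₂ :* (v₃ :- v₄) :+ nat 2 :* v₅) ∷ (v₁ ≐ v₆ :+ nat 2 :* v₇ :* v₈) ∷ (v₆ ≐ nat 0) ∷
            (v₈ ≦ v₉ :- var 10) ∷
         (v₃ ≐ v₉ :+ v₇) ∷ (var 10 ≐ v₄) ∷ (nat 2 :* v₅ ≦ v₂ :* v₂ :- var 11) ∷ (nat 0 ≦ v₇) ∷ []) 0
        (nat 2 :* (v₇ :+ v₂) :* var 10) (nat 2 :* v₇ :* v₉ :+ nat 2 :* v₂ :* (v₉ :+ v₇) :+ v₂ :* v₂ :- var 11 :- v₀)
        (h₀ ⊞ hyp 6 ⊞ 2 ∙ hyp 7 ⊠ h₃ ⊞ eqn 1 (nat 1) ⊞ eqn 2 (nat 1) ⊞ eqn 4 (nat 2 :* v₂) ⊞ eqn 5 (nat 2 :* v₂)) refl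
        (θ ∷ link y j ∷ α ∷ σ ∷ y j ∷ pres j ∷ link z j ∷ X ∷ W z j h ∷ r ∷ z j ∷ Q ∷ [])
        (θ≤ (yj p) ∷ link-y j ∷ link-z p ∷ ≤-respˡ (W-sym z h j) (≤-respʳ (+-congʳ r≈) (W≤ G nnz h j)) ∷
            ≈-trans σ≈ (+-congʳ r≈) ∷ z≈y p ∷ 2pres≤ j ∷ nonneg h ∷ [])

      -- A K₄ with two vertices outside a, b, c, d, h would be lighter.

      no-mixed : ∀ {i i′} → 0# < x i → 0# < x i′ → h ≢ i → h ≢ i′ → ∀ {j j′} → 0# < z j → 0# < z j′ →
                 Edge i i′ j → Edge i i′ j′ → Edge i j j′ → Edge i′ j j′ → ⊥
      no-mixed {i} {i′} xi xi′ h≢i h≢i′ {j} {j′} zj zj′ e₁ e₂ e₃ e₄ = 1≰0 (heavy-size {X} {α} {Q} {θ} 100≤X X≤ α²≤4Q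
          (<⇒≤ θ>)
        (≤-trans θ≤Q (by ((nat 0 ≦ v₁) ∷ []) 0 (v₀ :- v₁) v₀ h₀ refl ((# 9 ⊖′ X) ⊛ (# 9 ⊖′ X) ⊖′ Q ∷ sqs z ∷
            []) (0≤sqs nnz ∷ [])))
        (by ((v₀ ≐ nat 9 :- v₁ :- v₂) ∷ (v₂ ≦ v₃ :+ v₄ :+ v₅ :+ v₆) ∷ (v₃ ≦ v₁) ∷ (v₄ ≦ v₁) ∷ (v₇ ≐ v₅) ∷ (v₈ ≐ v₆) ∷
            (nat 0 ≦ v₁) ∷ (nat 0 ≦ v₂) ∷
             (nat 2 :* (v₁ :+ v₂) :* v₇ ≦ nat 2 :* v₁ :* v₀ :+ nat 2 :* v₂ :* (v₀ :+ v₁) :+ v₂ :* v₂ :- v₉ :-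
                 var 10) ∷
             (nat 2 :* (v₁ :+ v₂) :* v₈ ≦ nat 2 :* v₁ :* v₀ :+ nat 2 :* v₂ :* (v₀ :+ v₁) :+ v₂ :* v₂ :- v₉ :-
                 var 10) ∷ []) 1
          ((v₁ :+ v₂) :* (v₂ :- nat 2 :* v₁))
          (nat 2 :* v₁ :* (nat 9 :- v₁ :- v₂) :+ nat 2 :* v₂ :* ((nat 9 :- v₁ :- v₂) :+ v₁) :+ v₂ :* v₂ :- v₉ :-
              var 10)
          (2 ∙ (hyp 6 ⊞ hyp 7) ⊠ (h₁ ⊞ h₂ ⊞ h₃) ⊞ hyp 8 ⊞ hyp 9 ⊞ eqn 4 (:- nat 2 :* (v₁ :+ v₂)) ⊞
              eqn 5 (:- nat 2 :* (v₁ :+ v₂))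
           ⊞ eqn 0 (nat 4 :* (v₁ :+ v₂))) refl
          (r ∷ X ∷ α ∷ x i ∷ x i′ ∷ x j ∷ x j′ ∷ z j ∷ z j′ ∷ Q ∷ θ ∷ [])
          (≈-refl ∷ lightest {i} {i′} {j} {j′} (xi , xi′ , 0<x (yj zj) , 0<x (yj zj′) , e₁ , e₂ , e₃ ,
              e₄) h≢i h≢i′ (h≢ zj) (h≢ zj′) ∷
           hmax i ∷ hmax i′ ∷ ≈-trans (z≈y zj) (y≈x (yj zj)) ∷ ≈-trans (z≈y zj′) (y≈x (yj zj′)) ∷ nonneg h ∷ 0≤α ∷
           vertex-bound zj ∷ vertex-bound zj′ ∷ []))
        0≤α α≤4X 0≤r)

      -- By `no-mixed`, for distinct `j` and `k` one of the triples `ii′j`, `ii′k`, `ijk`, `i′jk` is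
      -- missing. So at most 1 plus the number of missing ones among the first two counts the edges
      -- among the last two; this is summed over `j` and `k`.
      mixed-count : ∀ {i i′} → 0# < x i → 0# < x i′ → h ≢ i → h ≢ i′ →
                    link z i ⊕ link z i′ ≤ ρ ⊕ # 2 ⊛ r ⊛ (r ⊖′ W z i i′)
      mixed-count {i} {i′} xi xi′ h≢i h≢i′ = ≤-respˡ left (≤-respʳ right (dot-mono nnz (λ j zj →
          dot-mono nnz (λ k zk → point j k zj zk))))
        where
        w = E[ i , i′ ,_]
        F : Fin n → List (Carrier × Weights n)
        -- For k ≠ j the value is 1 + (1 - w j) + (1 - w k). At k = j, where both triples are
        -- degenerate, δ takes the 1 away.
        F j = ((1# ⊖′ w j) ⊕ # 2 , λ _ → 1#) ∷ (⊖ 1# , w) ∷ (⊖ 1# , δ j) ∷ []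
        left : dot z (λ j → dot z (λ k → E[ i , j , k ] ⊕ E[ i′ , j , k ])) ≈ link z i ⊕ link z i′
        left = ≈-trans (dot-congʳ (λ j → dot-+ z _ _)) (dot-+ z _ _)
        right : dot z (λ j → dot z (comb (F j))) ≈ ρ ⊕ # 2 ⊛ r ⊛ (r ⊖′ W z i i′)
        right = ≈-trans (dot-congʳ (λ j → ≈-trans (dot-comb z (F j)) (≈-trans
            (+-cong (*-congˡ dot-1) (+-congˡ (+-congʳ (*-congˡ (≈-trans (dot-comm z (δ j)) (dot-δ j z))))))
            (identity ((nat 1 :- v₀ :+ nat 2) :* v₁ :+ (:- nat 1 :* v₂ :+ (:- nat 1 :* v₃ :+ nat 0)))
                      ((nat 3 :* v₁ :- v₂) :* nat 1 :+ (:- v₁ :* v₀ :+ (:- nat 1 :* v₃ :+ nat 0))) refl (w j ∷ r ∷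
                          W z i i′ ∷ z j ∷ [])))))
          (≈-trans (dot-comb z (((# 3 ⊛ r ⊖′ W z i i′) , λ _ → 1#) ∷ (⊖ r , w) ∷ (⊖ 1# , z) ∷ []))
            (≈-trans (+-congʳ (*-congˡ dot-1)) (identity
              ((nat 3 :* v₀ :- v₁) :* v₀ :+ (:- v₀ :* v₁ :+ (:- nat 1 :* v₂ :+ nat 0)))
              (v₀ :* v₀ :- v₂ :+ nat 2 :* v₀ :* (v₀ :- v₁)) refl (r ∷ W z i i′ ∷ sqs z ∷ []))))
        point : ∀ j k → 0# < z j → 0# < z k → E[ i , j , k ] ⊕ E[ i′ , j , k ] ≤ comb (F j) k
        point j k zj zk with j Finₚ.≟ k
        ... | yes refl rewrite E-irr₂₃ i j | E-irr₂₃ i′ j =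
                by ((v₀ ≦ nat 1) ∷ []) 0 (nat 0 :+ nat 0) ((nat 1 :- v₀ :+ nat 2) :* nat 1 :+ (:- nat 1 :* v₀ :+
                    (:- nat 1 :* nat 1 :+ nat 0)))
                  (2 ∙ h₀) refl (w j ∷ []) ([]≤1 (E i i′ j) ∷ [])
        ... | no _ with E i i′ j in e₁ | E i i′ k in e₂ | E i j k in e₃ | E i′ j k in e₄
        ...   | true | true | true | true = ⊥-elim (no-mixed xi xi′ h≢i h≢i′ zj zk e₁ e₂ e₃ e₄)
        ...   | true | true | false | f = by ((v₀ ≦ nat 1) ∷ []) 0 (nat 0 :+ v₀)
                  ((nat 1 :- nat 1 :+ nat 2) :* nat 1 :+ (:- nat 1 :* nat 1 :+ (:- nat 1 :* nat 0 :+
                      nat 0))) h₀ refl ([ f ] ∷ []) ([]≤1 f ∷ [])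
        ...   | true | true | true | false = by [] 0 (nat 1 :+ nat 0)
                  ((nat 1 :- nat 1 :+ nat 2) :* nat 1 :+ (:- nat 1 :* nat 1 :+ (:- nat 1 :* nat 0 :+
                      nat 0))) (cst 0) refl [] []
        ...   | false | g | e | f = by ((v₀ ≦ nat 1) ∷ (v₁ ≦ nat 1) ∷ (v₂ ≦ nat 1) ∷ []) 0 (v₁ :+ v₂)
                  ((nat 1 :- nat 0 :+ nat 2) :* nat 1 :+ (:- nat 1 :* v₀ :+ (:- nat 1 :* nat 0 :+ nat 0))) (h₀ ⊞ h₁ ⊞
                      h₂) refl
                  ([ g ] ∷ [ e ] ∷ [ f ] ∷ []) ([]≤1 g ∷ []≤1 e ∷ []≤1 f ∷ [])
        ...   | true | false | e | f = by ((v₁ ≦ nat 1) ∷ (v₂ ≦ nat 1) ∷ []) 0 (v₁ :+ v₂)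
                  ((nat 1 :- nat 1 :+ nat 2) :* nat 1 :+ (:- nat 1 :* nat 0 :+ (:- nat 1 :* nat 0 :+ nat 0))) (h₀ ⊞
                      h₁) refl
                  (0# ∷ [ e ] ∷ [ f ] ∷ []) ([]≤1 e ∷ []≤1 f ∷ [])

      -- Sum the equation link = θ over the vertices outside; by `independent`, only pairs that meet
      -- `h` or the K₄ occur in their links.
      outside-sum : r ⊛ θ ≤ # 2 ⊛ X ⊛ ρ ⊕ # 2 ⊛ (x a ⊛ (link z a ⊕ X ⊛ r) ⊕ x b ⊛ (link z b ⊕ X ⊛ r) ⊕
          x c ⊛ (link z c ⊕ X ⊛ r) ⊕ x d ⊛ (link z d ⊕ X ⊛ r))
        ⊕ # 2 ⊛ (x a ⊛ x b ⊛ W z a b ⊕ x a ⊛ x c ⊛ W z a c ⊕ x a ⊛ x d ⊛ W z a d ⊕ x b ⊛ x c ⊛ W z b c ⊕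
            x b ⊛ x d ⊛ W z b d ⊕ x c ⊛ x d ⊛ W z c d)
      outside-sum = ≤-respˡ (≈-trans (dot-const z θ) (≈-trans (*-congˡ r≈) (*-comm θ r))) (≤-trans (dot-mono nnz
          point) (≤-respˡ (≈-sym combined)
        (by ((v₀ ≦ v₁) ∷ (nat 0 ≦ v₂) ∷ []) 0
          (nat 2 :* v₂ :* v₀ :+ (nat 2 :* (v₄ :+ v₅ :+ v₆ :+ v₇) :* v₂ :* v₃ :+ (nat 2 :* v₄ :* v₈ :+
              (nat 2 :* v₅ :* v₉ :+ (nat 2 :* v₆ :* (var 10) :+ (nat 2 :* v₇ :* (var 11) :+
              (nat 2 :* (v₄ :* v₅) :* (var 12) :+ (nat 2 :* (v₄ :* v₆) :* (var 13) :+
              (nat 2 :* (v₄ :* v₇) :* (var 14) :+ (nat 2 :* (v₅ :* v₆) :* (var 15) :+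
              (nat 2 :* (v₅ :* v₇) :* (var 16) :+ (nat 2 :* (v₆ :* v₇) :* (var 17) :+ nat 0))))))))))))
          (nat 2 :* v₂ :* v₁ :+ nat 2 :* (v₄ :* (v₈ :+ v₂ :* v₃) :+ v₅ :* (v₉ :+ v₂ :* v₃) :+ v₆ :* (var 10 :+
              v₂ :* v₃) :+ v₇ :* (var 11 :+ v₂ :* v₃)) :+ nat 2 :* (v₄ :* v₅ :* (var 12) :+ v₄ :* v₆ :* (var 13) :+
              v₄ :* v₇ :* (var 14) :+ v₅ :* v₆ :* (var 15) :+ v₅ :* v₇ :* (var 16) :+ v₆ :* v₇ :* (var 17)))
          (2 ∙ h₁ ⊠ h₀) refl
          (link z h ∷ ρ ∷ X ∷ r ∷ x a ∷ x b ∷ x c ∷ x d ∷ link z a ∷ link z b ∷ link z c ∷ link z d ∷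
           W z a b ∷ W z a c ∷ W z a d ∷ W z b c ∷ W z b d ∷ W z c d ∷ [])
          (link≤ρ h ∷ nonneg h ∷ []))))
        where
        terms : List (Carrier × Weights n)
        terms = (# 2 ⊛ X , (λ j → W z j h)) ∷ (# 2 ⊛ (x a ⊕ x b ⊕ x c ⊕ x d) ⊛ X , (λ _ → 1#)) ∷
          (# 2 ⊛ x a , (λ j → W z j a)) ∷ (# 2 ⊛ x b , (λ j → W z j b)) ∷ (# 2 ⊛ x c , (λ j → W z j c)) ∷
              (# 2 ⊛ x d , (λ j → W z j d)) ∷
          (# 2 ⊛ (x a ⊛ x b) , E[_, a , b ]) ∷ (# 2 ⊛ (x a ⊛ x c) , E[_, a , c ]) ∷
              (# 2 ⊛ (x a ⊛ x d) , E[_, a , d ]) ∷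
          (# 2 ⊛ (x b ⊛ x c) , E[_, b , c ]) ∷ (# 2 ⊛ (x b ⊛ x d) , E[_, b , d ]) ∷
              (# 2 ⊛ (x c ⊛ x d) , E[_, c , d ]) ∷ []
        lk : ∀ i → dot z (λ j → W z j i) ≈ link z i
        lk i = dot-congʳ (λ j → W-sym z j i)
        wt : ∀ i k → dot z (E[_, i , k ]) ≈ W z i k
        wt i k = dot-congʳ (λ j → ≈-reflexive (≡.cong [_] (≡.trans (swap₁₂ j i k) (swap₂₃ i j k))))
        combined : dot z (comb terms) ≈ ⟦ nat 2 :* v₂ :* v₀ :+ (nat 2 :* (v₄ :+ v₅ :+ v₆ :+ v₇) :* v₂ :* v₃ :+
            (nat 2 :* v₄ :* v₈ :+ (nat 2 :* v₅ :* v₉ :+ (nat 2 :* v₆ :* (var 10) :+ (nat 2 :* v₇ :* (var 11) :+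
            (nat 2 :* (v₄ :* v₅) :* (var 12) :+ (nat 2 :* (v₄ :* v₆) :* (var 13) :+
            (nat 2 :* (v₄ :* v₇) :* (var 14) :+ (nat 2 :* (v₅ :* v₆) :* (var 15) :+
            (nat 2 :* (v₅ :* v₇) :* (var 16) :+ (nat 2 :* (v₆ :* v₇) :* (var 17) :+ nat 0))))))))))) ⟧
          (link z h ∷ ρ ∷ X ∷ r ∷ x a ∷ x b ∷ x c ∷ x d ∷ link z a ∷ link z b ∷ link z c ∷ link z d ∷
           W z a b ∷ W z a c ∷ W z a d ∷ W z b c ∷ W z b d ∷ W z c d ∷ [])
        combined = ≈-trans (dot-comb z terms) (+-cong (*-congˡ (lk h)) (+-cong (*-congˡ dot-1)
          (+-cong (*-congˡ (lk a)) (+-cong (*-congˡ (lk b)) (+-cong (*-congˡ (lk c)) (+-cong (*-congˡ (lk d))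
          (+-cong (*-congˡ (wt a b)) (+-cong (*-congˡ (wt a c)) (+-cong (*-congˡ (wt a d))
          (+-cong (*-congˡ (wt b c)) (+-cong (*-congˡ (wt b d)) (+-congʳ (*-congˡ (wt c d))))))))))))))
        point : ∀ j → 0# < z j → θ ≤ comb terms j
        point j p = by ((v₀ ≐ v₁ :+ nat 2 :* (v₂ :* v₆ :+ v₃ :* v₇ :+ v₄ :* v₈ :+ v₅ :* v₉) :+
            nat 2 :* (v₂ :* v₃ :* (var 10) :+ v₂ :* v₄ :* (var 11) :+ v₂ :* v₅ :* (var 12) :+ v₃ :* v₄ :* (var 13) :+
            v₃ :* v₅ :* (var 14) :+ v₄ :* v₅ :* (var 15))) ∷ (v₁ ≐ var 16 :+ nat 2 :* (var 17) :* (var 18)) ∷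
            (var 16 ≐ nat 0) ∷ (v₆ ≦ var 19 :+ var 17) ∷ (v₇ ≦ var 20 :+ var 17) ∷ (v₈ ≦ var 21 :+ var 17) ∷
            (v₉ ≦ var 22 :+ var 17) ∷ (nat 0 ≦ v₂) ∷ (nat 0 ≦ v₃) ∷ (nat 0 ≦ v₄) ∷ (nat 0 ≦ v₅) ∷
            []) 0 (v₀) (nat 2 :* (var 17) :* (var 18) :+ (nat 2 :* (v₂ :+ v₃ :+ v₄ :+ v₅) :* (var 17) :* (nat 1) :+
            (nat 2 :* v₂ :* (var 19) :+ (nat 2 :* v₃ :* (var 20) :+ (nat 2 :* v₄ :* (var 21) :+
            (nat 2 :* v₅ :* (var 22) :+ (nat 2 :* (v₂ :* v₃) :* (var 10) :+ (nat 2 :* (v₂ :* v₄) :* (var 11) :+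
            (nat 2 :* (v₂ :* v₅) :* (var 12) :+ (nat 2 :* (v₃ :* v₄) :* (var 13) :+
            (nat 2 :* (v₃ :* v₅) :* (var 14) :+ (nat 2 :* (v₄ :* v₅) :* (var 15) :+ nat 0))))))))))))
                (2 ∙ h₃ ⊠ h₇ ⊞ 2 ∙ h₄ ⊠ h₈ ⊞ 2 ∙ h₅ ⊠ h₉ ⊞ 2 ∙ h₆ ⊠ hyp 10 ⊞ eqn 0 (nat 1 :* (nat 1)) ⊞
                eqn 1 (nat 1 :* (nat 1)) ⊞ eqn 2 (nat 1 :* (nat 1))) refl
          (θ ∷ link y j ∷ x a ∷ x b ∷ x c ∷ x d ∷ W y j a ∷ W y j b ∷ W y j c ∷ W y j d ∷
           E[ j , a , b ] ∷ E[ j , a , c ] ∷ E[ j , a , d ] ∷ E[ j , b , c ] ∷ E[ j , b , d ] ∷ E[ j , c , d ] ∷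
           link z j ∷ X ∷ W z j h ∷ W z j a ∷ W z j b ∷ W z j c ∷ W z j d ∷ [])
          (≈-trans (≈-sym (link≈ j (0<x (yj p)))) (link-∖₄ G nonneg a≢b a≢c a≢d b≢c b≢d c≢d j) ∷ link-y j ∷ link-z p ∷
           W-y j a ∷ W-y j b ∷ W-y j c ∷ W-y j d ∷ nonneg a ∷ nonneg b ∷ nonneg c ∷ nonneg d ∷ [])

      -- Here the equation link = θ is used at a vertex of the K₄. Triples with `h` and triples
      -- inside the K₄ are bounded trivially; those with all other vertices outside, or with one
      -- outside and one in the K₄, keep their actual weight.
      inside-a : θ ≤ link z a ⊕ # 2 ⊛ X ⊛ r ⊕ # 2 ⊛ (x b ⊛ (W z a b ⊕ X) ⊕ x c ⊛ (W z a c ⊕ X) ⊕ x d ⊛ (W z a d ⊕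
          X)) ⊕ # 2 ⊛ (x b ⊛ x c ⊕ x b ⊛ x d ⊕ x c ⊛ x d)
      inside-a = by ((v₀ ≐ v₄ :+ nat 2 :* (v₆ :* (var 10) :+ v₇ :* (var 11) :+ v₈ :* (var 12) :+ v₉ :* (var 13)) :+
          nat 2 :* (v₆ :* v₇ :* (var 17) :+ v₆ :* v₈ :* (var 18) :+ v₆ :* v₉ :* (var 19) :+ v₇ :* v₈ :* (var 20) :+
          v₇ :* v₉ :* (var 21) :+ v₈ :* v₉ :* (var 22))) ∷ (v₄ ≐ v₁ :+ nat 2 :* v₂ :* v₅) ∷ (v₅ ≦ v₃) ∷
          (nat 0 ≦ v₂) ∷ (var 10 ≐ nat 0) ∷ (var 11 ≦ var 14 :+ v₂) ∷ (var 12 ≦ var 15 :+ v₂) ∷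
          (var 13 ≦ var 16 :+ v₂) ∷ (nat 0 ≦ v₆) ∷ (nat 0 ≦ v₇) ∷ (nat 0 ≦ v₈) ∷ (nat 0 ≦ v₉) ∷ (var 17 ≐ nat 0) ∷
          (var 18 ≐ nat 0) ∷ (var 19 ≐ nat 0) ∷ (var 20 ≦ nat 1) ∷ (var 21 ≦ nat 1) ∷ (var 22 ≦ nat 1) ∷
          []) 0 (v₀) (v₁ :+ nat 2 :* v₂ :* v₃ :+ nat 2 :* (v₇ :* (var 14 :+ v₂) :+ v₈ :* (var 15 :+ v₂) :+
          v₉ :* (var 16 :+ v₂)) :+ nat 2 :* (v₇ :* v₈ :+ v₇ :* v₉ :+ v₈ :* v₉))
                (2 ∙ h₂ ⊠ h₃ ⊞ 2 ∙ h₅ ⊠ h₉ ⊞ 2 ∙ h₆ ⊠ hyp 10 ⊞ 2 ∙ h₇ ⊠ hyp 11 ⊞ 2 ∙ hyp 15 ⊠ h₉ ⊠ hyp 10 ⊞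
                2 ∙ hyp 16 ⊠ h₉ ⊠ hyp 11 ⊞ 2 ∙ hyp 17 ⊠ hyp 10 ⊠ hyp 11 ⊞ eqn 0 (nat 1 :* (nat 1)) ⊞
                eqn 1 (nat 1 :* (nat 1)) ⊞ eqn 4 (nat 2 :* v₆) ⊞ eqn 12 (nat 2 :* (v₆ :* v₇)) ⊞
                eqn 13 (nat 2 :* (v₆ :* v₈)) ⊞ eqn 14 (nat 2 :* (v₆ :* v₉))) refl
          (θ ∷ link z a ∷ X ∷ r ∷ link y a ∷ W z a h ∷ x a ∷ x b ∷ x c ∷ x d ∷ W y a a ∷ W y a b ∷ W y a c ∷ W y a d ∷
           W z a b ∷ W z a c ∷ W z a d ∷ E[ a , a , b ] ∷ E[ a , a , c ] ∷ E[ a , a , d ] ∷ E[ a , b , c ] ∷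
           E[ a , b , d ] ∷ E[ a , c , d ] ∷ [])
          (≈-trans (≈-sym (link≈ a 0<xa)) (link-∖₄ G nonneg a≢b a≢c a≢d b≢c b≢d c≢d a) ∷ link-y a ∷ W≤r a h ∷
              nonneg h ∷
           W-diag y a ∷ W-y a b ∷ W-y a c ∷ W-y a d ∷ nonneg a ∷ nonneg b ∷ nonneg c ∷ nonneg d ∷
           ≈-reflexive (≡.cong [_] (irr a b)) ∷ ≈-reflexive (≡.cong [_] (irr a c)) ∷
               ≈-reflexive (≡.cong [_] (irr a d)) ∷
           []≤1 (E a b c) ∷ []≤1 (E a b d) ∷ []≤1 (E a c d) ∷ [])

      inside-b : θ ≤ link z b ⊕ # 2 ⊛ X ⊛ r ⊕ # 2 ⊛ (x a ⊛ (W z a b ⊕ X) ⊕ x c ⊛ (W z b c ⊕ X) ⊕ x d ⊛ (W z b d ⊕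
          X)) ⊕ # 2 ⊛ (x a ⊛ x c ⊕ x a ⊛ x d ⊕ x c ⊛ x d)
      inside-b = by ((v₀ ≐ v₄ :+ nat 2 :* (v₆ :* (var 10) :+ v₇ :* (var 11) :+ v₈ :* (var 12) :+ v₉ :* (var 13)) :+
          nat 2 :* (v₆ :* v₇ :* (var 17) :+ v₆ :* v₈ :* (var 18) :+ v₆ :* v₉ :* (var 19) :+ v₇ :* v₈ :* (var 20) :+
          v₇ :* v₉ :* (var 21) :+ v₈ :* v₉ :* (var 22))) ∷ (v₄ ≐ v₁ :+ nat 2 :* v₂ :* v₅) ∷ (v₅ ≦ v₃) ∷
          (nat 0 ≦ v₂) ∷ (var 11 ≐ nat 0) ∷ (var 10 ≦ var 14 :+ v₂) ∷ (var 12 ≦ var 15 :+ v₂) ∷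
          (var 13 ≦ var 16 :+ v₂) ∷ (nat 0 ≦ v₆) ∷ (nat 0 ≦ v₇) ∷ (nat 0 ≦ v₈) ∷ (nat 0 ≦ v₉) ∷ (var 17 ≐ nat 0) ∷
          (var 18 ≦ nat 1) ∷ (var 19 ≦ nat 1) ∷ (var 20 ≐ nat 0) ∷ (var 21 ≐ nat 0) ∷ (var 22 ≦ nat 1) ∷
          []) 0 (v₀) (v₁ :+ nat 2 :* v₂ :* v₃ :+ nat 2 :* (v₆ :* (var 14 :+ v₂) :+ v₈ :* (var 15 :+ v₂) :+
          v₉ :* (var 16 :+ v₂)) :+ nat 2 :* (v₆ :* v₈ :+ v₆ :* v₉ :+ v₈ :* v₉))
                (2 ∙ h₂ ⊠ h₃ ⊞ 2 ∙ h₅ ⊠ h₈ ⊞ 2 ∙ h₆ ⊠ hyp 10 ⊞ 2 ∙ h₇ ⊠ hyp 11 ⊞ 2 ∙ hyp 13 ⊠ h₈ ⊠ hyp 10 ⊞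
                2 ∙ hyp 14 ⊠ h₈ ⊠ hyp 11 ⊞ 2 ∙ hyp 17 ⊠ hyp 10 ⊠ hyp 11 ⊞ eqn 0 (nat 1 :* (nat 1)) ⊞
                eqn 1 (nat 1 :* (nat 1)) ⊞ eqn 4 (nat 2 :* v₇) ⊞ eqn 12 (nat 2 :* (v₆ :* v₇)) ⊞
                eqn 15 (nat 2 :* (v₇ :* v₈)) ⊞ eqn 16 (nat 2 :* (v₇ :* v₉))) refl
          (θ ∷ link z b ∷ X ∷ r ∷ link y b ∷ W z b h ∷ x a ∷ x b ∷ x c ∷ x d ∷ W y b a ∷ W y b b ∷ W y b c ∷ W y b d ∷
           W z a b ∷ W z b c ∷ W z b d ∷ E[ b , a , b ] ∷ E[ b , a , c ] ∷ E[ b , a , d ] ∷ E[ b , b , c ] ∷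
           E[ b , b , d ] ∷ E[ b , c , d ] ∷ [])
          (≈-trans (≈-sym (link≈ b 0<xb)) (link-∖₄ G nonneg a≢b a≢c a≢d b≢c b≢d c≢d b) ∷ link-y b ∷ W≤r b h ∷
              nonneg h ∷
           W-diag y b ∷ ≤-respʳ (+-congʳ (W-sym z b a)) (W-y b a) ∷ W-y b c ∷ W-y b d ∷ nonneg a ∷ nonneg b ∷
               nonneg c ∷
           nonneg d ∷ ≈-reflexive (≡.cong [_] (E-irr₁₃ b a)) ∷ []≤1 (E b a c) ∷ []≤1 (E b a d) ∷
           ≈-reflexive (≡.cong [_] (irr b c)) ∷ ≈-reflexive (≡.cong [_] (irr b d)) ∷ []≤1 (E b c d) ∷ [])

      inside-c : θ ≤ link z c ⊕ # 2 ⊛ X ⊛ r ⊕ # 2 ⊛ (x a ⊛ (W z a c ⊕ X) ⊕ x b ⊛ (W z b c ⊕ X) ⊕ x d ⊛ (W z c d ⊕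
          X)) ⊕ # 2 ⊛ (x a ⊛ x b ⊕ x a ⊛ x d ⊕ x b ⊛ x d)
      inside-c = by ((v₀ ≐ v₄ :+ nat 2 :* (v₆ :* (var 10) :+ v₇ :* (var 11) :+ v₈ :* (var 12) :+ v₉ :* (var 13)) :+
          nat 2 :* (v₆ :* v₇ :* (var 17) :+ v₆ :* v₈ :* (var 18) :+ v₆ :* v₉ :* (var 19) :+ v₇ :* v₈ :* (var 20) :+
          v₇ :* v₉ :* (var 21) :+ v₈ :* v₉ :* (var 22))) ∷ (v₄ ≐ v₁ :+ nat 2 :* v₂ :* v₅) ∷ (v₅ ≦ v₃) ∷
          (nat 0 ≦ v₂) ∷ (var 12 ≐ nat 0) ∷ (var 10 ≦ var 14 :+ v₂) ∷ (var 11 ≦ var 15 :+ v₂) ∷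
          (var 13 ≦ var 16 :+ v₂) ∷ (nat 0 ≦ v₆) ∷ (nat 0 ≦ v₇) ∷ (nat 0 ≦ v₈) ∷ (nat 0 ≦ v₉) ∷ (var 17 ≦ nat 1) ∷
          (var 18 ≐ nat 0) ∷ (var 19 ≦ nat 1) ∷ (var 20 ≐ nat 0) ∷ (var 21 ≦ nat 1) ∷ (var 22 ≐ nat 0) ∷
          []) 0 (v₀) (v₁ :+ nat 2 :* v₂ :* v₃ :+ nat 2 :* (v₆ :* (var 14 :+ v₂) :+ v₇ :* (var 15 :+ v₂) :+
          v₉ :* (var 16 :+ v₂)) :+ nat 2 :* (v₆ :* v₇ :+ v₆ :* v₉ :+ v₇ :* v₉))
                (2 ∙ h₂ ⊠ h₃ ⊞ 2 ∙ h₅ ⊠ h₈ ⊞ 2 ∙ h₆ ⊠ h₉ ⊞ 2 ∙ h₇ ⊠ hyp 11 ⊞ 2 ∙ hyp 12 ⊠ h₈ ⊠ h₉ ⊞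
                2 ∙ hyp 14 ⊠ h₈ ⊠ hyp 11 ⊞ 2 ∙ hyp 16 ⊠ h₉ ⊠ hyp 11 ⊞ eqn 0 (nat 1 :* (nat 1)) ⊞
                eqn 1 (nat 1 :* (nat 1)) ⊞ eqn 4 (nat 2 :* v₈) ⊞ eqn 13 (nat 2 :* (v₆ :* v₈)) ⊞
                eqn 15 (nat 2 :* (v₇ :* v₈)) ⊞ eqn 17 (nat 2 :* (v₈ :* v₉))) refl
          (θ ∷ link z c ∷ X ∷ r ∷ link y c ∷ W z c h ∷ x a ∷ x b ∷ x c ∷ x d ∷ W y c a ∷ W y c b ∷ W y c c ∷ W y c d ∷
           W z a c ∷ W z b c ∷ W z c d ∷ E[ c , a , b ] ∷ E[ c , a , c ] ∷ E[ c , a , d ] ∷ E[ c , b , c ] ∷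
           E[ c , b , d ] ∷ E[ c , c , d ] ∷ [])
          (≈-trans (≈-sym (link≈ c 0<xc)) (link-∖₄ G nonneg a≢b a≢c a≢d b≢c b≢d c≢d c) ∷ link-y c ∷ W≤r c h ∷
              nonneg h ∷
           W-diag y c ∷ ≤-respʳ (+-congʳ (W-sym z c a)) (W-y c a) ∷ ≤-respʳ (+-congʳ (W-sym z c b)) (W-y c b) ∷
               W-y c d ∷
           nonneg a ∷ nonneg b ∷ nonneg c ∷ nonneg d ∷ []≤1 (E c a b) ∷ ≈-reflexive (≡.cong [_] (E-irr₁₃ c a)) ∷
           []≤1 (E c a d) ∷ ≈-reflexive (≡.cong [_] (E-irr₁₃ c b)) ∷ []≤1 (E c b d) ∷
               ≈-reflexive (≡.cong [_] (irr c d)) ∷ [])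

      inside-d : θ ≤ link z d ⊕ # 2 ⊛ X ⊛ r ⊕ # 2 ⊛ (x a ⊛ (W z a d ⊕ X) ⊕ x b ⊛ (W z b d ⊕ X) ⊕ x c ⊛ (W z c d ⊕
          X)) ⊕ # 2 ⊛ (x a ⊛ x b ⊕ x a ⊛ x c ⊕ x b ⊛ x c)
      inside-d = by ((v₀ ≐ v₄ :+ nat 2 :* (v₆ :* (var 10) :+ v₇ :* (var 11) :+ v₈ :* (var 12) :+ v₉ :* (var 13)) :+
          nat 2 :* (v₆ :* v₇ :* (var 17) :+ v₆ :* v₈ :* (var 18) :+ v₆ :* v₉ :* (var 19) :+ v₇ :* v₈ :* (var 20) :+
          v₇ :* v₉ :* (var 21) :+ v₈ :* v₉ :* (var 22))) ∷ (v₄ ≐ v₁ :+ nat 2 :* v₂ :* v₅) ∷ (v₅ ≦ v₃) ∷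
          (nat 0 ≦ v₂) ∷ (var 13 ≐ nat 0) ∷ (var 10 ≦ var 14 :+ v₂) ∷ (var 11 ≦ var 15 :+ v₂) ∷
          (var 12 ≦ var 16 :+ v₂) ∷ (nat 0 ≦ v₆) ∷ (nat 0 ≦ v₇) ∷ (nat 0 ≦ v₈) ∷ (nat 0 ≦ v₉) ∷ (var 17 ≦ nat 1) ∷
          (var 18 ≦ nat 1) ∷ (var 19 ≐ nat 0) ∷ (var 20 ≦ nat 1) ∷ (var 21 ≐ nat 0) ∷ (var 22 ≐ nat 0) ∷
          []) 0 (v₀) (v₁ :+ nat 2 :* v₂ :* v₃ :+ nat 2 :* (v₆ :* (var 14 :+ v₂) :+ v₇ :* (var 15 :+ v₂) :+
          v₈ :* (var 16 :+ v₂)) :+ nat 2 :* (v₆ :* v₇ :+ v₆ :* v₈ :+ v₇ :* v₈))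
                (2 ∙ h₂ ⊠ h₃ ⊞ 2 ∙ h₅ ⊠ h₈ ⊞ 2 ∙ h₆ ⊠ h₉ ⊞ 2 ∙ h₇ ⊠ hyp 10 ⊞ 2 ∙ hyp 12 ⊠ h₈ ⊠ h₉ ⊞
                2 ∙ hyp 13 ⊠ h₈ ⊠ hyp 10 ⊞ 2 ∙ hyp 15 ⊠ h₉ ⊠ hyp 10 ⊞ eqn 0 (nat 1 :* (nat 1)) ⊞
                eqn 1 (nat 1 :* (nat 1)) ⊞ eqn 4 (nat 2 :* v₉) ⊞ eqn 14 (nat 2 :* (v₆ :* v₉)) ⊞
                eqn 16 (nat 2 :* (v₇ :* v₉)) ⊞ eqn 17 (nat 2 :* (v₈ :* v₉))) refl
          (θ ∷ link z d ∷ X ∷ r ∷ link y d ∷ W z d h ∷ x a ∷ x b ∷ x c ∷ x d ∷ W y d a ∷ W y d b ∷ W y d c ∷ W y d d ∷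
           W z a d ∷ W z b d ∷ W z c d ∷ E[ d , a , b ] ∷ E[ d , a , c ] ∷ E[ d , a , d ] ∷ E[ d , b , c ] ∷
           E[ d , b , d ] ∷ E[ d , c , d ] ∷ [])
          (≈-trans (≈-sym (link≈ d 0<xd)) (link-∖₄ G nonneg a≢b a≢c a≢d b≢c b≢d c≢d d) ∷ link-y d ∷ W≤r d h ∷
              nonneg h ∷
           W-diag y d ∷ ≤-respʳ (+-congʳ (W-sym z d a)) (W-y d a) ∷ ≤-respʳ (+-congʳ (W-sym z d b)) (W-y d b) ∷
           ≤-respʳ (+-congʳ (W-sym z d c)) (W-y d c) ∷ nonneg a ∷ nonneg b ∷ nonneg c ∷ nonneg d ∷ []≤1 (E d a b) ∷
           []≤1 (E d a c) ∷ ≈-reflexive (≡.cong [_] (E-irr₁₃ d a)) ∷ []≤1 (E d b c) ∷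
           ≈-reflexive (≡.cong [_] (E-irr₁₃ d b)) ∷ ≈-reflexive (≡.cong [_] (E-irr₁₃ d c)) ∷ [])

      contradiction : ⊥
      contradiction = 1≰0 (heavy-count {X} {α} {Q} {sqs z} {θ} {c₃} {M₁} {M₂} 100≤X X≤ α²≤4Q α≤4X (<⇒≤ θ>) θ≤Q (0≤sqs
          nnz) c₃≤ LZ LE LN LM₁ LM₂ 0≤α 0≤r)
        where
        env : List Carrier
        env = x a ∷ x b ∷ x c ∷ x d ∷ link z a ∷ link z b ∷ link z c ∷ link z d ∷
              W z a b ∷ W z a c ∷ W z a d ∷ W z b c ∷ W z b d ∷ W z c d ∷ X ∷ r ∷ ρ ∷ θ ∷ []
        c₃ M₁ M₂ : Carrier
        c₃ = ⟦ v₀ :* v₀ :* v₀ :+ v₁ :* v₁ :* v₁ :+ v₂ :* v₂ :* v₂ :+ v₃ :* v₃ :* v₃ ⟧ env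
        M₁ = ⟦ ((v₀ :+ v₁ :+ v₂ :+ v₃) :* (v₀ :+ v₁ :+ v₂ :+ v₃) :- (v₀ :* v₀ :+ v₁ :* v₁ :+ v₂ :* v₂ :+
            v₃ :* v₃)) :* (var 15) :- nat 2 :* (v₀ :* v₁ :* v₈ :+ v₀ :* v₂ :* v₉ :+ v₀ :* v₃ :* (var 10) :+
            v₁ :* v₂ :* (var 11) :+ v₁ :* v₃ :* (var 12) :+ v₂ :* v₃ :* (var 13)) ⟧ env
        M₂ = ⟦ (v₀ :+ v₁ :+ v₂ :+ v₃) :* (var 16) :- (v₀ :* v₄ :+ v₁ :* v₅ :+ v₂ :* v₆ :+ v₃ :* v₇) ⟧ env
        c₃≤ : c₃ ≤ X ⊛ Q
        c₃≤ = by ((v₀ ≦ var 14) ∷ (v₁ ≦ var 14) ∷ (v₂ ≦ var 14) ∷ (v₃ ≦ var 14) ∷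
            []) 0 (v₀ :* v₀ :* v₀ :+ v₁ :* v₁ :* v₁ :+ v₂ :* v₂ :* v₂ :+ v₃ :* v₃ :* v₃) (var 14 :* (v₀ :* v₀ :+
            v₁ :* v₁ :+ v₂ :* v₂ :+ v₃ :* v₃))
                (hyp 0 ⊠ sq (v₀) ⊞ hyp 1 ⊠ sq (v₁) ⊞ hyp 2 ⊠ sq (v₂) ⊞ hyp 3 ⊠ sq (v₃)) refl
          env (hmax a ∷ hmax b ∷ hmax c ∷ hmax d ∷ [])
        -- `LZ` and `LE` bound the missing triples from above, by the links outside and inside the
        -- K₄. `LN` bounds them from below, by the absence of mixed K₄. `heavy-count` shows that
        -- these are incompatible.
        LZ = by ((var 15 :* (var 17) ≦ nat 2 :* (var 14) :* (var 16) :+ nat 2 :* (v₀ :* (v₄ :+ var 14 :* (var 15)) :+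
            v₁ :* (v₅ :+ var 14 :* (var 15)) :+ v₂ :* (v₆ :+ var 14 :* (var 15)) :+ v₃ :* (v₇ :+
            var 14 :* (var 15))) :+ nat 2 :* (v₀ :* v₁ :* v₈ :+ v₀ :* v₂ :* v₉ :+ v₀ :* v₃ :* (var 10) :+
            v₁ :* v₂ :* (var 11) :+ v₁ :* v₃ :* (var 12) :+ v₂ :* v₃ :* (var 13))) ∷
            []) 0 (((v₀ :+ v₁ :+ v₂ :+ v₃) :* (v₀ :+ v₁ :+ v₂ :+ v₃) :- (v₀ :* v₀ :+ v₁ :* v₁ :+ v₂ :* v₂ :+
            v₃ :* v₃)) :* (var 15) :- nat 2 :* (v₀ :* v₁ :* v₈ :+ v₀ :* v₂ :* v₉ :+ v₀ :* v₃ :* (var 10) :+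
            v₁ :* v₂ :* (var 11) :+ v₁ :* v₃ :* (var 12) :+ v₂ :* v₃ :* (var 13)) :+ nat 2 :* ((v₀ :+ v₁ :+ v₂ :+
            v₃) :* (var 16) :- (v₀ :* v₄ :+ v₁ :* v₅ :+ v₂ :* v₆ :+ v₃ :* v₇))) (nat 2 :* (var 16) :* (var 14 :+
            (v₀ :+ v₁ :+ v₂ :+ v₃)) :+ nat 2 :* (var 14) :* (v₀ :+ v₁ :+ v₂ :+ v₃) :* (var 15) :+ ((v₀ :+ v₁ :+ v₂ :+
            v₃) :* (v₀ :+ v₁ :+ v₂ :+ v₃) :- (v₀ :* v₀ :+ v₁ :* v₁ :+ v₂ :* v₂ :+ v₃ :* v₃)) :* (var 15) :-
            var 15 :* (var 17))
                (h₀) refl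
          env (outside-sum ∷ [])
        LE = by ((var 17 ≦ v₄ :+ nat 2 :* (var 14) :* (var 15) :+ nat 2 :* (v₁ :* (v₈ :+ var 14) :+ v₂ :* (v₉ :+
            var 14) :+ v₃ :* (var 10 :+ var 14)) :+ nat 2 :* (v₁ :* v₂ :+ v₁ :* v₃ :+ v₂ :* v₃)) ∷
            (var 17 ≦ v₅ :+ nat 2 :* (var 14) :* (var 15) :+ nat 2 :* (v₀ :* (v₈ :+ var 14) :+ v₂ :* (var 11 :+
            var 14) :+ v₃ :* (var 12 :+ var 14)) :+ nat 2 :* (v₀ :* v₂ :+ v₀ :* v₃ :+ v₂ :* v₃)) ∷
            (var 17 ≦ v₆ :+ nat 2 :* (var 14) :* (var 15) :+ nat 2 :* (v₀ :* (v₉ :+ var 14) :+ v₁ :* (var 11 :+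
            var 14) :+ v₃ :* (var 13 :+ var 14)) :+ nat 2 :* (v₀ :* v₁ :+ v₀ :* v₃ :+ v₁ :* v₃)) ∷
            (var 17 ≦ v₇ :+ nat 2 :* (var 14) :* (var 15) :+ nat 2 :* (v₀ :* (var 10 :+ var 14) :+ v₁ :* (var 12 :+
            var 14) :+ v₂ :* (var 13 :+ var 14)) :+ nat 2 :* (v₀ :* v₁ :+ v₀ :* v₂ :+ v₁ :* v₂)) ∷ (nat 0 ≦ v₀) ∷
            (nat 0 ≦ v₁) ∷ (nat 0 ≦ v₂) ∷ (nat 0 ≦ v₃) ∷ []) 0 (nat 2 :* (((v₀ :+ v₁ :+ v₂ :+ v₃) :* (v₀ :+ v₁ :+
            v₂ :+ v₃) :- (v₀ :* v₀ :+ v₁ :* v₁ :+ v₂ :* v₂ :+ v₃ :* v₃)) :* (var 15) :- nat 2 :* (v₀ :* v₁ :* v₈ :+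
            v₀ :* v₂ :* v₉ :+ v₀ :* v₃ :* (var 10) :+ v₁ :* v₂ :* (var 11) :+ v₁ :* v₃ :* (var 12) :+
            v₂ :* v₃ :* (var 13))) :+ ((v₀ :+ v₁ :+ v₂ :+ v₃) :* (var 16) :- (v₀ :* v₄ :+ v₁ :* v₅ :+ v₂ :* v₆ :+
            v₃ :* v₇))) ((v₀ :+ v₁ :+ v₂ :+ v₃) :* (var 16) :+ nat 2 :* (var 14) :* (v₀ :+ v₁ :+ v₂ :+
            v₃) :* (var 15) :+ nat 2 :* ((v₀ :+ v₁ :+ v₂ :+ v₃) :* (v₀ :+ v₁ :+ v₂ :+ v₃) :- (v₀ :* v₀ :+ v₁ :* v₁ :+
            v₂ :* v₂ :+ v₃ :* v₃)) :* (var 15 :+ var 14) :+ (v₀ :+ v₁ :+ v₂ :+ v₃) :* (v₀ :+ v₁ :+ v₂ :+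
            v₃) :* (v₀ :+ v₁ :+ v₂ :+ v₃) :- nat 3 :* (v₀ :+ v₁ :+ v₂ :+ v₃) :* (v₀ :* v₀ :+ v₁ :* v₁ :+ v₂ :* v₂ :+
            v₃ :* v₃) :+ nat 2 :* (v₀ :* v₀ :* v₀ :+ v₁ :* v₁ :* v₁ :+ v₂ :* v₂ :* v₂ :+ v₃ :* v₃ :* v₃) :- (v₀ :+
            v₁ :+ v₂ :+ v₃) :* (var 17))
                (h₀ ⊠ h₄ ⊞ h₁ ⊠ h₅ ⊞ h₂ ⊠ h₆ ⊞ h₃ ⊠ h₇) refl
          env (inside-a ∷ inside-b ∷ inside-c ∷ inside-d ∷ nonneg a ∷ nonneg b ∷ nonneg c ∷ nonneg d ∷ [])
        LN = by ((v₄ :+ v₅ ≦ var 16 :+ nat 2 :* (var 15) :* (var 15 :- v₈)) ∷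
            (v₄ :+ v₆ ≦ var 16 :+ nat 2 :* (var 15) :* (var 15 :- v₉)) ∷
            (v₄ :+ v₇ ≦ var 16 :+ nat 2 :* (var 15) :* (var 15 :- var 10)) ∷
            (v₅ :+ v₆ ≦ var 16 :+ nat 2 :* (var 15) :* (var 15 :- var 11)) ∷
            (v₅ :+ v₇ ≦ var 16 :+ nat 2 :* (var 15) :* (var 15 :- var 12)) ∷
            (v₆ :+ v₇ ≦ var 16 :+ nat 2 :* (var 15) :* (var 15 :- var 13)) ∷ (nat 0 ≦ v₀) ∷ (nat 0 ≦ v₁) ∷
            (nat 0 ≦ v₂) ∷ (nat 0 ≦ v₃) ∷ (v₄ ≦ var 16) ∷ (v₅ ≦ var 16) ∷ (v₆ ≦ var 16) ∷ (v₇ ≦ var 16) ∷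
            []) 0 (var 16 :* ((v₀ :+ v₁ :+ v₂ :+ v₃) :* (v₀ :+ v₁ :+ v₂ :+ v₃) :- (v₀ :* v₀ :+ v₁ :* v₁ :+
            v₂ :* v₂ :+ v₃ :* v₃))) (nat 2 :* (var 15) :* (((v₀ :+ v₁ :+ v₂ :+ v₃) :* (v₀ :+ v₁ :+ v₂ :+ v₃) :-
            (v₀ :* v₀ :+ v₁ :* v₁ :+ v₂ :* v₂ :+ v₃ :* v₃)) :* (var 15) :- nat 2 :* (v₀ :* v₁ :* v₈ :+
            v₀ :* v₂ :* v₉ :+ v₀ :* v₃ :* (var 10) :+ v₁ :* v₂ :* (var 11) :+ v₁ :* v₃ :* (var 12) :+
            v₂ :* v₃ :* (var 13))) :+ nat 2 :* (v₀ :+ v₁ :+ v₂ :+ v₃) :* ((v₀ :+ v₁ :+ v₂ :+ v₃) :* (var 16) :-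
            (v₀ :* v₄ :+ v₁ :* v₅ :+ v₂ :* v₆ :+ v₃ :* v₇)))
                (2 ∙ h₀ ⊠ h₆ ⊠ h₇ ⊞ 2 ∙ h₁ ⊠ h₆ ⊠ h₈ ⊞ 2 ∙ h₂ ⊠ h₆ ⊠ h₉ ⊞ 2 ∙ h₃ ⊠ h₇ ⊠ h₈ ⊞ 2 ∙ h₄ ⊠ h₇ ⊠ h₉ ⊞
                2 ∙ h₅ ⊠ h₈ ⊠ h₉ ⊞ 2 ∙ hyp 10 ⊠ h₆ ⊠ h₆ ⊞ 2 ∙ hyp 11 ⊠ h₇ ⊠ h₇ ⊞ 2 ∙ hyp 12 ⊠ h₈ ⊠ h₈ ⊞
                2 ∙ hyp 13 ⊠ h₉ ⊠ h₉) refl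
          env (mixed-count 0<xa 0<xb h≢a h≢b ∷ mixed-count 0<xa 0<xc h≢a h≢c ∷ mixed-count 0<xa 0<xd h≢a h≢d ∷
               mixed-count 0<xb 0<xc h≢b h≢c ∷ mixed-count 0<xb 0<xd h≢b h≢d ∷ mixed-count 0<xc 0<xd h≢c h≢d ∷
               nonneg a ∷ nonneg b ∷ nonneg c ∷ nonneg d ∷ link≤ρ a ∷ link≤ρ b ∷ link≤ρ c ∷ link≤ρ d ∷ [])
        LM₁ = by ((nat 0 ≦ v₀) ∷ (nat 0 ≦ v₁) ∷ (nat 0 ≦ v₂) ∷ (nat 0 ≦ v₃) ∷ (v₈ ≦ var 15) ∷ (v₉ ≦ var 15) ∷
            (var 10 ≦ var 15) ∷ (var 11 ≦ var 15) ∷ (var 12 ≦ var 15) ∷ (var 13 ≦ var 15) ∷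
            []) 0 (nat 0) (((v₀ :+ v₁ :+ v₂ :+ v₃) :* (v₀ :+ v₁ :+ v₂ :+ v₃) :- (v₀ :* v₀ :+ v₁ :* v₁ :+ v₂ :* v₂ :+
            v₃ :* v₃)) :* (var 15) :- nat 2 :* (v₀ :* v₁ :* v₈ :+ v₀ :* v₂ :* v₉ :+ v₀ :* v₃ :* (var 10) :+
            v₁ :* v₂ :* (var 11) :+ v₁ :* v₃ :* (var 12) :+ v₂ :* v₃ :* (var 13)))
                (2 ∙ h₀ ⊠ h₁ ⊠ h₄ ⊞ 2 ∙ h₀ ⊠ h₂ ⊠ h₅ ⊞ 2 ∙ h₀ ⊠ h₃ ⊠ h₆ ⊞ 2 ∙ h₁ ⊠ h₂ ⊠ h₇ ⊞ 2 ∙ h₁ ⊠ h₃ ⊠ h₈ ⊞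
                2 ∙ h₂ ⊠ h₃ ⊠ h₉) refl
          env (nonneg a ∷ nonneg b ∷ nonneg c ∷ nonneg d ∷ W≤r a b ∷ W≤r a c ∷ W≤r a d ∷ W≤r b c ∷ W≤r b d ∷
              W≤r c d ∷ [])
        LM₂ = by ((nat 0 ≦ v₀) ∷ (nat 0 ≦ v₁) ∷ (nat 0 ≦ v₂) ∷ (nat 0 ≦ v₃) ∷ (v₄ ≦ var 16) ∷ (v₅ ≦ var 16) ∷
            (v₆ ≦ var 16) ∷ (v₇ ≦ var 16) ∷ []) 0 (nat 0) ((v₀ :+ v₁ :+ v₂ :+ v₃) :* (var 16) :- (v₀ :* v₄ :+
            v₁ :* v₅ :+ v₂ :* v₆ :+ v₃ :* v₇))
                (h₀ ⊠ h₄ ⊞ h₁ ⊠ h₅ ⊞ h₂ ⊠ h₆ ⊞ h₃ ⊠ h₇) refl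
          env (nonneg a ∷ nonneg b ∷ nonneg c ∷ nonneg d ∷ link≤ρ a ∷ link≤ρ b ∷ link≤ρ c ∷ link≤ρ d ∷ [])

  -- k = 2 with a weight above 1, when every K₄ contains the heaviest vertex

  module Through {n} (G : Triples n) {θ x} (D : Dense G (# 9) θ x) (free : Edges.Free G 2) (θ> : # 56 < θ)
                 {h} (hmax : ∀ i → x i ≤ x h) (1<xh : 1# < x h) where

    open HeavySetup G D free θ> hmax 1<xh

    P m S : Carrier
    P = sqs x₁
    m = mass x₁
    S = dot x₁ (λ b → x₁ b ⊛ link x₁ b)

    0≤P : 0# ≤ P
    0≤P = 0≤sqs nn₁

    0≤q : 0# ≤ q
    0≤q = sum-nonneg nn₁

    100≤X : # 100 ≤ # 100 ⊛ X
    100≤X = by ((nat 1 ≦ v₀) ∷ []) 0 (nat 100) (nat 100 :* v₀) (100 ∙ h₀) refl (X ∷ []) (<⇒≤ 1<xh ∷ [])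

    m≈ : m ≈ θ ⊛ (# 9 ⊖′ # 3 ⊛ X)
    m≈ = equate ((v₀ ≐ v₁ :+ nat 3 :* v₂ :* v₃) ∷ (v₀ ≐ nat 9 :* v₃) ∷ []) v₁ (v₃ :* (nat 9 :- nat 3 :* v₂))
      ((0 , :- nat 1) ∷ (1 , nat 1) ∷ []) refl (mass x ∷ m ∷ X ∷ θ ∷ [])
      (≈-trans (mass-∖ x h) (+-congˡ (*-congˡ (link≈ h 0<X))) ∷ mass≈ ∷ [])

    S≤ : S ≤ q ⊛ q ⊛ P
    S≤ = ≤-respʳ (dot-* x₁ (q ⊛ q) x₁) (dot-mono nn₁ λ b _ →
      ≤-respʳ (*-comm _ _) (*-mono-nonneg (nn₁ b) ≤-refl (0≤link nn₁ b) (link≤sq G nn₁ b)))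

    -- Removing `h` lowers every other link by at most 2Xq.
    ≤S : P ⊛ (θ ⊖′ # 2 ⊛ X ⊛ q) ≤ S
    ≤S = ≤-respˡ (≈-trans (dot-* x₁ (θ ⊖′ # 2 ⊛ X ⊛ q) x₁) (*-comm _ _)) (dot-mono nn₁ λ b p →
      by ((v₀ ≐ v₁ :+ nat 2 :* v₂ :* v₃) ∷ (v₃ ≦ v₄) ∷ (nat 0 ≦ v₂) ∷ (nat 0 ≦ v₅) ∷ []) 0
        ((v₀ :- nat 2 :* v₂ :* v₄) :* v₅) (v₅ :* v₁) (2 ∙ h₁ ⊠ h₂ ⊠ h₃ ⊞ eqn 0 (v₅)) refl
        (θ ∷ link x₁ b ∷ X ∷ W x b h ∷ q ∷ x₁ b ∷ [])
        (≈-trans (≈-sym (link≈ b (proj₂ (∖-supp x p)))) (link-∖ x h b) ∷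
         ≤-respˡ (W-∖-self x h b) (W≤sum G nn₁ b h) ∷ nonneg h ∷ nn₁ b ∷ []))

    module _ (through : ∀ {a b c d} → IsK₄ (a , b , c , d) → h ≢ a → h ≢ b → h ≢ c → h ≢ d → ⊥) where

      K₄-free₁ : K₄-free G x₁
      K₄-free₁ pa pb pc pd e₁ e₂ e₃ e₄ =
        let h≢a , xa = ∖-supp x pa ; h≢b , xb = ∖-supp x pb ; h≢c , xc = ∖-supp x pc ; h≢d , xd = ∖-supp x pd in
        through (xa , xb , xc , xd , e₁ , e₂ , e₃ , e₄) h≢a h≢b h≢c h≢d

      -- The tangent point of the quadratic mean is optimal, up to rounding, for θ = 56.

      P≤ : # 100 ⊛ P ≤ # 193
      P≤ with ≤-<-connex (# 100 ⊛ X) (# 139)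
      ... | inj₁ X≤ = ≤-stable λ gt → 1≰0 (
          by ((nat 100 ≦ nat 100 :* v₀) ∷ (nat 100 :* v₀ ≦ nat 139) ∷ (nat 56 ≦ v₁) ∷ (nat 193 ≦ nat 100 :* v₂) ∷
              (nat 3 :* v₃ :+ nat 3 :* v₄ ≦ nat 2 :* v₆ :* v₅) ∷ (nat 2 :* nat 100 :* (nat 644 :-
              nat 116 :* v₀) :* v₅ :- (nat 644 :- nat 116 :* v₀) :* (nat 644 :- nat 116 :* v₀) :* (v₆ :* v₆ :-
              v₂) ≦ nat 100 :* nat 100 :* v₃) ∷ (v₂ :* (v₁ :- nat 2 :* v₀ :* v₆) ≦ v₄) ∷
              (v₅ ≐ v₁ :* (nat 9 :- nat 3 :* v₀)) ∷ (nat 9 ≐ v₆ :+ v₀) ∷ (nat 0 ≦ v₂) ∷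
              []) 6856371264369860 (nat 1) (nat 0)
                (1235812500000000 ∙ h₄ ⊞ 370743750000 ∙ h₅ ⊞ 3707437500000000 ∙ h₆ ⊞
                    162026252116 ∙ h₀ ⊠ h₀ ⊠ h₀ ⊠ h₁ ⊞
                489130573974 ∙ h₀ ⊠ h₀ ⊠ h₁ ⊠ h₁ ⊞ 489170805516 ∙ h₀ ⊠ h₁ ⊠ h₁ ⊠ h₁ ⊞
                    162016596379 ∙ h₁ ⊠ h₁ ⊠ h₁ ⊠ h₁ ⊞
                58647264000000 ∙ h₂ ⊠ h₀ ⊠ h₀ ⊞ 137952750000000 ∙ h₂ ⊠ h₀ ⊠ h₁ ⊞ 81144375000000 ∙ h₂ ⊠ h₁ ⊠ h₁ ⊞
                1417404342900 ∙ h₃ ⊠ h₀ ⊠ h₀ ⊞ 3059536740000 ∙ h₃ ⊠ h₀ ⊠ h₁ ⊞ 1654536000000 ∙ h₃ ⊠ h₁ ⊠ h₁ ⊞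
                37074375000000 ∙ h₂ ⊠ h₃ ⊞
                eqn 7 ((:- nat 47751795000000000) :+ nat 8601255000000000 :* v₀ :+ nat 2471625000000000 :* v₆) ⊞
                eqn 8 ((:- nat 1383847019100000000) :+ nat 652289519700000000 :* v₀ :- nat 22244625000000000 :* v₁ :-
                    nat 153760779900000000 :* v₆ :- nat 100290633300000000 :* v₀ :* v₀ :+
                    nat 7414875000000000 :* v₀ :* v₁ :- nat 7414875000000000 :* v₀ :* v₂ :+
                    nat 55392082200000000 :* v₀ :* v₆ :+ nat 4988727900000000 :* v₀ :* v₀ :* v₀ :-
                    nat 4988727900000000 :* v₀ :* v₀ :* v₆)) refl
          (X ∷ θ ∷ P ∷ squareW G x₁ ∷ S ∷ m ∷ q ∷ [])
          (100≤X ∷ X≤ ∷ <⇒≤ θ> ∷ <⇒≤ gt ∷ deCaen G nn₁ K₄-free₁ ∷ squareW≥ G nn₁ (# 100) (# 644 ⊖′ # 116 ⊛ X) ∷ ≤S ∷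
              m≈ ∷ 9≈q ∷ 0≤P ∷ []))
      -- Here P ≤ (9 - X)² - θ already suffices, as 7.61² - 56 is less than 1.93.
      ... | inj₂ X> = by ((nat 139 ≦ nat 100 :* v₀) ∷ (nat 56 ≦ v₁) ∷ (v₁ ≦ v₃ :* v₃ :- v₂) ∷ (nat 9 ≐ v₃ :+ v₀) ∷
          (nat 0 ≦ v₃) ∷ []) 579120 (nat 100 :* v₂) (nat 193)
                (57912100 ∙ h₁ ⊞ 57912100 ∙ h₂ ⊞ 5793 ∙ h₀ ⊠ h₀ ⊞ 1158421 ∙ h₀ ⊠ h₄ ⊞ 136219 ∙ h₄ ⊞
                eqn 3 ((:- nat 360324600) :- nat 57930000 :* v₀ :- nat 57912100 :* v₃)) refl
          (X ∷ θ ∷ P ∷ q ∷ []) (<⇒≤ X> ∷ <⇒≤ θ> ∷ θ≤q² ∷ 9≈q ∷ 0≤q ∷ [])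

      -- An edge `bcd` either forms a K₄ with `h`, and then weighs at least `t`, or contains a pair
      -- missing from the link of `h`, which is charged `t`. The weights of the edges sum to at most
      -- 3Pq². The missing pairs amount to q² - θ - P, and each has codegree at most q.
      heavy-triples : ∀ {t} → 0# ≤ t →
        (∀ {b c d} → 0# < x₁ b → 0# < x₁ c → 0# < x₁ d → Edge b c d → Edge h b c → Edge h b d → Edge h c d →
            t ≤ x₁ b ⊕ x₁ c ⊕ x₁ d) →
        t ⊛ m ≤ # 3 ⊛ P ⊛ (q ⊛ q) ⊕ # 3 ⊛ t ⊛ q ⊛ (q ⊛ q ⊖′ θ ⊖′ P)
      heavy-triples {t} 0≤t heavy = ≤-respˡ (trip-mass G x₁ t) (≤-trans (trip-mono G nn₁ {λ _ _ _ → t}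
          {λ b c d → f b c ⊕ f b d ⊕ f c d ⊕ (x₁ b ⊕ x₁ c ⊕ x₁ d)} point) (≤-respˡ (≈-sym (trip-pairs G x₁ f))
        (by ((v₀ ≦ v₁) ∷ (v₂ ≦ v₃ :* v₃ :* v₄) ∷ []) 0 (nat 3 :* v₀ :+ nat 3 :* v₂) (nat 3 :* v₄ :* (v₃ :* v₃) :+
            nat 3 :* v₁)
          (3 ∙ h₀ ⊞ 3 ∙ h₁) refl (dot x₁ (λ b → dot x₁ (λ c → W x₁ b c ⊛ f b c)) ∷ t ⊛ q ⊛ (q ⊛ q ⊖′ θ ⊖′ P) ∷ S ∷
              q ∷ P ∷ [])
          (missing ∷ S≤ ∷ []) ⟫ identity (v₀ :+ nat 3 :* (v₁ :* v₂ :* v₃)) (v₀ :+ nat 3 :* v₁ :* v₂ :* v₃) refl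
            (# 3 ⊛ P ⊛ (q ⊛ q) ∷ t ∷ q ∷ q ⊛ q ⊖′ θ ⊖′ P ∷ []))))
        where
        _⟫_ : ∀ {a b c} → a ≤ b → b ≈ c → a ≤ c
        p ⟫ e = ≤-respʳ e p
        f : Fin n → Fin n → Carrier
        f b c = t ⊛ (1# ⊖′ E[ h , b , c ])
        point : ∀ {b c d} → 0# < x₁ b → 0# < x₁ c → 0# < x₁ d → Edge b c d →
            t ≤ f b c ⊕ f b d ⊕ f c d ⊕ (x₁ b ⊕ x₁ c ⊕ x₁ d)
        point {b} {c} {d} pb pc pd e with E h b c in e₁ | E h b d in e₂ | E h c d in e₃
        ... | true | true | true = ≤-respʳ (identity v₀ (v₁ :* (nat 1 :- nat 1) :+ v₁ :* (nat 1 :- nat 1) :+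
            v₁ :* (nat 1 :- nat 1) :+ v₀) refl
                (x₁ b ⊕ x₁ c ⊕ x₁ d ∷ t ∷ [])) (heavy pb pc pd e e₁ e₂ e₃)
        ... | false | p | q′ = by ((nat 0 ≦ v₀) ∷ (v₁ ≦ nat 1) ∷ (v₂ ≦ nat 1) ∷ (nat 0 ≦ v₃) ∷ (nat 0 ≦ v₄) ∷
            (nat 0 ≦ v₅) ∷ []) 0
                v₀ (v₀ :* (nat 1 :- nat 0) :+ v₀ :* (nat 1 :- v₁) :+ v₀ :* (nat 1 :- v₂) :+ (v₃ :+ v₄ :+ v₅))
                (h₀ ⊠ h₁ ⊞ h₀ ⊠ h₂ ⊞ h₃ ⊞ h₄ ⊞ h₅) refl (t ∷ [ p ] ∷ [ q′ ] ∷ x₁ b ∷ x₁ c ∷ x₁ d ∷ [])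
                (0≤t ∷ []≤1 p ∷ []≤1 q′ ∷ nn₁ b ∷ nn₁ c ∷ nn₁ d ∷ [])
        ... | true | false | p = by ((nat 0 ≦ v₀) ∷ (v₁ ≦ nat 1) ∷ (nat 0 ≦ v₂) ∷ (nat 0 ≦ v₃) ∷ (nat 0 ≦ v₄) ∷ []) 0
                v₀ (v₀ :* (nat 1 :- nat 1) :+ v₀ :* (nat 1 :- nat 0) :+ v₀ :* (nat 1 :- v₁) :+ (v₂ :+ v₃ :+ v₄))
                (h₀ ⊠ h₁ ⊞ h₂ ⊞ h₃ ⊞ h₄) refl (t ∷ [ p ] ∷ x₁ b ∷ x₁ c ∷ x₁ d ∷ [])
                (0≤t ∷ []≤1 p ∷ nn₁ b ∷ nn₁ c ∷ nn₁ d ∷ [])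
        ... | true | true | false = by ((nat 0 ≦ v₁) ∷ (nat 0 ≦ v₂) ∷ (nat 0 ≦ v₃) ∷ []) 0
                v₀ (v₀ :* (nat 1 :- nat 1) :+ v₀ :* (nat 1 :- nat 1) :+ v₀ :* (nat 1 :- nat 0) :+ (v₁ :+ v₂ :+ v₃))
                (h₀ ⊞ h₁ ⊞ h₂) refl (t ∷ x₁ b ∷ x₁ c ∷ x₁ d ∷ []) (nn₁ b ∷ nn₁ c ∷ nn₁ d ∷ [])
        g : Fin n → List (Carrier × Weights n)
        g b = (t ⊛ q , λ _ → 1#) ∷ (⊖ (t ⊛ q) , E[ h , b ,_]) ∷ (⊖ (t ⊛ q) , δ b) ∷ []
        missing : dot x₁ (λ b → dot x₁ (λ c → W x₁ b c ⊛ f b c)) ≤ t ⊛ q ⊛ (q ⊛ q ⊖′ θ ⊖′ P)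
        missing = ≤-respʳ (≈-trans (dot-congʳ (λ b → dot-comb x₁ (g b))) (≈-trans (dot-congʳ inner) (≈-trans
            (dot-comb x₁ outer)
            (≈-trans (+-cong (*-congˡ (≈-sym (sum≈dot x₁))) (+-congʳ (*-congˡ link₁)))
              (identity (v₀ :* v₁ :* v₁ :+ (:- v₀ :* v₂ :+ (:- v₀ :* v₃ :+ nat 0))) (v₀ :* (v₁ :* v₁ :- v₂ :-
                  v₃)) refl
                (t ⊛ q ∷ q ∷ θ ∷ P ∷ [])))))) (dot-mono nn₁ λ b _ → dot-mono nn₁ λ c _ → pair b c)
          where
          outer : List (Carrier × Weights n)
          outer = (t ⊛ q ⊛ q , λ _ → 1#) ∷ (⊖ (t ⊛ q) , W x₁ h) ∷ (⊖ (t ⊛ q) , x₁) ∷ []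
          inner : ∀ b → _ ≈ comb outer b
          inner b = ≈-trans (+-cong (*-congˡ (≈-sym (sum≈dot x₁))) (+-congˡ (+-congʳ (*-congˡ (≈-trans (dot-comm x₁
              (δ b)) (dot-δ b x₁))))))
            (+-congʳ (≈-sym (*-identityʳ _)))
          pair : ∀ b c → W x₁ b c ⊛ f b c ≤ comb (g b) c
          pair b c with b Finₚ.≟ c
          ... | yes refl rewrite E-irr₂₃ h b = by ((v₀ ≐ nat 0) ∷ []) 0 (v₀ :* (v₁ :* (nat 1 :- nat 0)))
                  (v₁ :* v₂ :* nat 1 :+ (:- (v₁ :* v₂) :* nat 0 :+ (:- (v₁ :* v₂) :* nat 1 :+
                      nat 0))) (eqn 0 (v₁)) refl
                  (W x₁ b b ∷ t ∷ q ∷ []) (W-diag x₁ b ∷ [])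
          ... | no _ = by ((v₀ ≦ v₂) ∷ (nat 0 ≦ v₁) ∷ (v₃ ≦ nat 1) ∷ []) 0 (v₀ :* (v₁ :* (nat 1 :- v₃)))
                  (v₁ :* v₂ :* nat 1 :+ (:- (v₁ :* v₂) :* v₃ :+ (:- (v₁ :* v₂) :* nat 0 :+
                      nat 0))) (h₀ ⊠ h₁ ⊠ h₂) refl
                  (W x₁ b c ∷ t ∷ q ∷ E[ h , b , c ] ∷ []) (W≤sum G nn₁ b c ∷ 0≤t ∷ []≤1 (E h b c) ∷ [])

      LightTriple : Carrier → Set
      LightTriple t = ∃₂ λ b c → ∃ λ d → IsK₄ (h , b , c , d) × x b ⊕ x c ⊕ x d ≤ t

      light-triple : ∀ {t} → 0# ≤ t → # 3 ⊛ P ⊛ (q ⊛ q) ⊕ # 3 ⊛ t ⊛ q ⊛ (q ⊛ q ⊖′ θ ⊖′ P) < t ⊛ m → LightTriple t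
      light-triple {t} 0≤t lt with Finₚ.any? (λ b → Finₚ.any? λ c → Finₚ.any? λ d →
          isK₄? (h , b , c , d) ×-dec (x b ⊕ x c ⊕ x d ≤? t))
      ... | yes (b , c , d , r) = b , c , d , r
      ... | no none = ⊥-elim (lt (heavy-triples 0≤t λ {b} {c} {d} pb pc pd e e₁ e₂ e₃ → <⇒≤ λ le →
              let h≢b , xb = ∖-supp x pb ; h≢c , xc = ∖-supp x pc ; h≢d , xd = ∖-supp x pd in
              none (b , c , d , (0<X , xb , xc , xd , e₁ , e₂ , e₃ , e) ,
                ≤-respˡ (+-cong (+-cong (∖-≢ x h≢b) (∖-≢ x h≢c)) (∖-≢ x h≢d)) le)))

      module OnTriple {b c d} (K : IsK₄ (h , b , c , d)) where

        open OnK₄ K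

        β p P′ D₀ : Carrier
        β = x b ⊕ x c ⊕ x d
        p = x b ⊛ x b ⊕ x c ⊛ x c ⊕ x d ⊛ x d
        P′ = sqs y
        D₀ = θ ⊖′ # 2 ⊛ α ⊛ σ ⊖′ α ⊛ α ⊕ Q

        P≈ : P ≈ P′ ⊕ p
        P≈ = equate ((v₀ ≐ v₁ :+ v₂) ∷ (v₀ ≐ v₃ :+ (v₂ :+ v₄ :+ v₅ :+ v₆)) ∷ []) v₁ (v₃ :+ (v₄ :+ v₅ :+ v₆))
          ((0 , :- nat 1) ∷ (1 , nat 1) ∷ []) refl (sqs x ∷ P ∷ X ⊛ X ∷ P′ ∷ x b ⊛ x b ∷ x c ⊛ x c ∷ x d ⊛ x d ∷ [])
          (sqs-∖ x h ∷ sqs-y ∷ [])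

        -- Mixed pairs account for at most 2ασ of the link of `j`, and pairs inside the K₄ for at
        -- most α² - Q.
        D₀≤ : ∀ {j} → 0# < y j → D₀ ≤ link y j
        D₀≤ {j} pj = by ((v₀ ≦ v₁ :+ nat 2 :* v₂ :* (v₃ :- v₄) :+ nat 2 :* v₅) ∷ (nat 2 :* v₅ ≦ v₂ :* v₂ :- v₆) ∷
            (nat 0 ≦ v₂) ∷ (nat 0 ≦ v₄) ∷ []) 0
          (v₀ :- nat 2 :* v₂ :* v₃ :- v₂ :* v₂ :+ v₆) v₁ (h₀ ⊞ h₁ ⊞ 2 ∙ h₂ ⊠ h₃) refl
          (θ ∷ link y j ∷ α ∷ σ ∷ y j ∷ pres j ∷ Q ∷ []) (θ≤ pj ∷ 2pres≤ j ∷ 0≤α ∷ nny j ∷ [])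

        σD₀≤ : D₀ ⊛ σ ≤ mass y
        σD₀≤ = ≤-respˡ (dot-const y D₀) (dot-mono nny λ j pj → D₀≤ pj)

        Sy≤ : dot y (λ i → y i ⊛ link y i) ≤ σ ⊛ σ ⊛ P′
        Sy≤ = ≤-respʳ (dot-* y (σ ⊛ σ) y) (dot-mono nny λ i _ →
          ≤-respʳ (*-comm _ _) (*-mono-nonneg (nny i) ≤-refl (0≤link nny i) (link≤sq G nny i)))

        Trio : Set
        Trio = Fin n × Fin n × Fin n

        IsEdge : Trio → Set
        IsEdge (i , k , l) = 0# < y i × 0# < y k × 0# < y l × Edge i k l

        isEdge? : ∀ t → Dec (IsEdge t)
        isEdge? (i , k , l) = 0<? (y i) ×-dec 0<? (y k) ×-dec 0<? (y l) ×-dec (E i k l Boolₚ.≟ true)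

        weight₃ : Trio → Carrier
        weight₃ (i , k , l) = y i ⊕ y k ⊕ y l

        trios : List Trio
        trios = cartesianProduct (allFin n) (cartesianProduct (allFin n) (allFin n))

        ∈-trios : ∀ t → t ∈ trios
        ∈-trios (i , k , l) = ∈-cartesianProduct⁺ (∈-allFin i) (∈-cartesianProduct⁺ (∈-allFin k) (∈-allFin l))

        -- The weights of the ordered edges sum to 3 Σ (y i)² link y i, at most 3σ²P′. A small sum
        -- of squares thus forces a light edge.
        edge-weight : ∀ {γ} → (∀ t → IsEdge t → γ ≤ weight₃ t) → γ ⊛ mass y ≤ # 3 ⊛ (σ ⊛ σ ⊛ P′)
        edge-weight {γ} le = ≤-respˡ (trip-mass G y γ) (≤-trans (trip-mono G nny {λ _ _ _ → γ} {λ i k l →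
            y i ⊕ y k ⊕ y l}
          λ pi pk pl e → le (_ , _ , _) (pi , pk , pl , e)) (≤-respˡ (≈-sym (trip-vertices G y))
          (*-mono-nonneg (0≤fromℕ 3) ≤-refl (dot-nonneg nny λ i _ → *-nonneg (nny i) (0≤link nny i)) Sy≤)))

        no-edges : (∀ t → ¬ IsEdge t) → mass y ≤ 0#
        no-edges none = ≤-respˡ (≈-trans (trip-mass G y 1#) (*-identityˡ _)) (≤-respʳ (≈-trans (trip-mass G y 0#)
            (zeroˡ _))
          (trip-mono G nny {λ _ _ _ → 1#} {λ _ _ _ → 0#} λ pi pk pl e → ⊥-elim (none (_ , _ , _) (pi , pk , pl , e))))

        module _ {i k l} (e : IsEdge (i , k , l)) where

          private
            yi = proj₁ e
            yk = proj₁ (proj₂ e)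
            yl = proj₁ (proj₂ (proj₂ e))
            ikl = proj₂ (proj₂ (proj₂ e))
            γ = weight₃ (i , k , l)
            y₁ = y ∖ i
            y₂ = y₁ ∖ k
            y₃ = y₂ ∖ l
            nny₁ = ∖-nonneg nny i
            nny₂ = ∖-nonneg nny₁ k
            nny₃ = ∖-nonneg nny₂ l
            yk≈ : y₁ k ≈ y k
            yk≈ = ∖-≢ y (proj₁ (edge-≢ G ikl))
            yl≈ : y₂ l ≈ y l
            yl≈ = ≈-trans (∖-≢ y₁ (proj₂ (proj₂ (edge-≢ G ikl)))) (∖-≢ y (proj₁ (proj₂ (edge-≢ G ikl))))

          -- A second edge disjoint from `ikl` and from the K₄ is excluded, so any further vertex
          -- has an empty link off `ikl`. If no vertex remains, `i` itself serves.
          unlinked : ∃ λ j → 0# < y j × link y₃ j ≈ 0#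
          unlinked with Finₚ.any? (λ j → 0<? (y₃ j))
          ... | yes (j , pj) = j , supp pj , link≈0 G nny₃ λ pu pv f →
                  clash ikl f yi yk yl (supp pj) (supp pu) (supp pv) (off pj) (off pu) (off pv)
            where
            supp : ∀ {u} → 0# < y₃ u → 0# < y u
            supp pu = proj₂ (∖-supp y (proj₂ (∖-supp y₁ (proj₂ (∖-supp y₂ pu)))))
            off : ∀ {u} → 0# < y₃ u → u ≢ i × u ≢ k × u ≢ l
            off pu = (λ u≡i → proj₁ (∖-supp y (proj₂ (∖-supp y₁ (proj₂ (∖-supp y₂ pu))))) (≡.sym u≡i)) ,
                     (λ u≡k → proj₁ (∖-supp y₁ (proj₂ (∖-supp y₂ pu))) (≡.sym u≡k)) , (λ u≡l →
                         proj₁ (∖-supp y₂ pu) (≡.sym u≡l))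
          ... | no none = i , yi , link≈0 G nny₃ λ {u} pu → ⊥-elim (none (u , pu))

          -- The link of `j` consists of pairs meeting the edge. Counted one vertex of the edge
          -- after the other, they amount to at most 2γσ - γ² less the sum of the three squares, and
          -- that sum is at least γ² / 3.
          3D₀≤ : # 3 ⊛ D₀ ≤ # 6 ⊛ γ ⊛ σ ⊖′ # 4 ⊛ γ ⊛ γ
          3D₀≤ with unlinked
          ... | j , pj , link₃ = by ((v₀ ≦ v₁) ∷ (v₁ ≐ v₂ :+ nat 2 :* v₅ :* v₈) ∷ (v₂ ≐ v₃ :+ nat 2 :* v₆ :* v₉) ∷
              (v₃ ≐ v₄ :+ nat 2 :* v₇ :* (var 10)) ∷ (v₄ ≐ nat 0) ∷ (v₈ ≦ var 11 :- v₅) ∷ (v₉ ≦ var 12 :- v₆) ∷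
              (var 10 ≦ var 13 :- v₇) ∷ (nat 0 ≦ v₅) ∷ (nat 0 ≦ v₆) ∷ (nat 0 ≦ v₇) ∷ (var 11 ≐ var 12 :+ v₅) ∷
              (var 12 ≐ var 13 :+ v₆) ∷ []) 0 (nat 3 :* v₀) (nat 6 :* (v₅ :+ v₆ :+ v₇) :* (var 11) :- nat 4 :* (v₅ :+
              v₆ :+ v₇) :* (v₅ :+ v₆ :+ v₇))
                (3 ∙ h₀ ⊞ 6 ∙ h₅ ⊠ h₈ ⊞ 6 ∙ h₆ ⊠ h₉ ⊞ 6 ∙ h₇ ⊠ hyp 10 ⊞ sq (v₅ :- v₆) ⊞ sq (v₆ :- v₇) ⊞
                    sq (v₅ :- v₇) ⊞
                eqn 1 (nat 3) ⊞ eqn 2 (nat 3) ⊞ eqn 3 (nat 3) ⊞ eqn 4 (nat 3) ⊞ eqn 12 (:- (nat 6 :* v₇)) ⊞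
                eqn 11 ((:- (nat 6 :* v₆)) :- nat 6 :* v₇)) refl
            (D₀ ∷ link y j ∷ link y₁ j ∷ link y₂ j ∷ link y₃ j ∷ y i ∷ y k ∷ y l ∷ W y j i ∷ W y₁ j k ∷ W y₂ j l ∷
                σ ∷ sum y₁ ∷ sum y₂ ∷ [])
            (D₀≤ pj ∷ link-∖ y i j ∷ ≈-trans (link-∖ y₁ k j) (+-congˡ (*-congʳ (*-congˡ yk≈))) ∷
             ≈-trans (link-∖ y₂ l j) (+-congˡ (*-congʳ (*-congˡ yl≈))) ∷ link₃ ∷
             W≤ G nny j i ∷ ≤-respʳ (+-congˡ (-‿cong yk≈)) (W≤ G nny₁ j k) ∷
                 ≤-respʳ (+-congˡ (-‿cong yl≈)) (W≤ G nny₂ j l) ∷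
             nny i ∷ nny k ∷ nny l ∷ sum-∖ y i ∷ ≈-trans (sum-∖ y₁ k) (+-congˡ yk≈) ∷ [])

        β²≤ : β ⊛ β ≤ # 3 ⊛ p
        β²≤ = by [] 0 ((v₀ :+ v₁ :+ v₂) :* (v₀ :+ v₁ :+ v₂)) (nat 3 :* (v₀ :* v₀ :+ v₁ :* v₁ :+ v₂ :* v₂))
          (sq (v₀ :- v₁) ⊞ sq (v₀ :- v₂) ⊞ sq (v₁ :- v₂)) refl (x b ∷ x c ∷ x d ∷ []) []

        0≤β : 0# ≤ β
        0≤β = 0≤+ (0≤+ (nonneg b) (nonneg c)) (nonneg d)

        α≈ : α ≈ X ⊕ β
        α≈ = identity (v₀ :+ v₁ :+ v₂ :+ v₃) (v₀ :+ (v₁ :+ v₂ :+ v₃)) refl (X ∷ x b ∷ x c ∷ x d ∷ [])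

        Q≈ : Q ≈ X ⊛ X ⊕ p
        Q≈ = identity (v₀ :+ v₁ :+ v₂ :+ v₃) (v₀ :+ (v₁ :+ v₂ :+ v₃)) refl (X ⊛ X ∷ x b ⊛ x b ∷ x c ⊛ x c ∷
            x d ⊛ x d ∷ [])

        -- D₁ is three times the bound for D₀ obtained from θ ≥ 56 and β² ≤ 3 p.

        D₁ : Carrier
        D₁ = # 3 ⊛ (# 9 ⊖′ X ⊖′ β) ⊛ (# 9 ⊖′ X ⊖′ β) ⊖′ # 75 ⊕ # 3 ⊛ X ⊛ X ⊕ β ⊛ β

        D₁≤ : D₁ ≤ # 3 ⊛ D₀
        D₁≤ = by ((nat 56 ≦ v₃) ∷ (v₁ :* v₁ ≦ nat 3 :* v₂) ∷ (nat 9 ≐ v₅ :+ v₄) ∷ (v₄ ≐ v₀ :+ v₁) ∷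
            (v₆ ≐ v₀ :* v₀ :+ v₂) ∷ []) 0 (nat 3 :* (nat 9 :- v₀ :- v₁) :* (nat 9 :- v₀ :- v₁) :- nat 75 :+
            nat 3 :* v₀ :* v₀ :+ v₁ :* v₁) (nat 3 :* (v₃ :- nat 2 :* v₄ :* v₅ :- v₄ :* v₄ :+ v₆))
                (3 ∙ h₀ ⊞ h₁ ⊞ eqn 2 (:- (nat 6 :* v₄)) ⊞ eqn 3 (nat 54 :- nat 3 :* v₀ :- nat 3 :* v₁ :-
                    nat 3 :* v₄) ⊞
                eqn 4 (:- nat 3)) refl
          (X ∷ β ∷ p ∷ θ ∷ α ∷ σ ∷ Q ∷ []) (<⇒≤ θ> ∷ β²≤ ∷ 9≈ ∷ α≈ ∷ Q≈ ∷ [])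

        -- The square of 10 γ - 14 comes from the tangent to γ² at 7/5, close to the critical value of γ.

        tangent : 0# ≤ D₀ → # 2 ≤ σ → ∀ {γ} → γ ⊛ D₀ ≤ # 3 ⊛ (σ ⊛ P′) → # 3 ⊛ D₀ ≤ # 6 ⊛ γ ⊛ σ ⊖′ # 4 ⊛ γ ⊛ γ →
          D₀ ⊛ (# 75 ⊛ D₀ ⊖′ # 196) ≤ # 3 ⊛ (σ ⊛ P′) ⊛ (# 150 ⊛ σ ⊖′ # 280)
        tangent 0≤D 2≤σ {γ} r₁ r₂ = by ((nat 0 ≦ v₀) ∷ (nat 2 ≦ v₁) ∷ (v₂ :* v₀ ≦ nat 3 :* v₃) ∷
            (nat 3 :* v₀ ≦ nat 6 :* v₂ :* v₁ :- nat 4 :* v₂ :* v₂) ∷ []) 0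
          (v₀ :* (nat 75 :* v₀ :- nat 196)) (nat 3 :* v₃ :* (nat 150 :* v₁ :- nat 280))
          (h₂ ⊠ (150 ∙ h₁ ⊞ cst 20) ⊞ 25 ∙ h₀ ⊠ h₃ ⊞ h₀ ⊠ sq (nat 10 :* v₂ :- nat 14)) refl
          (D₀ ∷ σ ∷ γ ∷ σ ⊛ P′ ∷ []) (0≤D ∷ 2≤σ ∷ r₁ ∷ r₂ ∷ [])

        -- The lightest edge outside the K₄ satisfies two opposite bounds on its weight γ. `tangent`
        -- eliminates γ, and `bad` refutes the resulting inequality between `D₀`, σ and `P′`.
        impossible : # 6 ≤ D₁ → # 2 ≤ σ →
          (D₀ ⊛ (# 75 ⊛ D₀ ⊖′ # 196) ≤ # 3 ⊛ (σ ⊛ P′) ⊛ (# 150 ⊛ σ ⊖′ # 280) → ⊥) → ⊥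
        impossible 6≤D₁ 2≤σ bad with minimum isEdge? weight₃ trios
        ... | inj₂ none = 0<fromℕ 3 (by ((v₀ :* v₁ ≦ nat 0) ∷ (nat 6 ≦ v₂) ∷ (v₂ ≦ nat 3 :* v₀) ∷ (nat 2 ≦ v₁) ∷
            []) 2 (nat 4) (nat 0)
                (3 ∙ h₀ ⊞ (h₁ ⊞ h₂) ⊠ h₃ ⊞ 2 ∙ (h₁ ⊞ h₂) ⊞ 6 ∙ h₃) refl (D₀ ∷ σ ∷ D₁ ∷ [])
                (≤-trans σD₀≤ (no-edges λ t → none t (∈-trios t)) ∷ 6≤D₁ ∷ D₁≤ ∷ 2≤σ ∷ []))
        ... | inj₁ (t , e , least) = bad (tangent 0≤D₀ 2≤σ γD₀≤ (3D₀≤ e))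
          where
          0≤D₀ : 0# ≤ D₀
          0≤D₀ = by ((nat 6 ≦ v₁) ∷ (v₁ ≦ nat 3 :* v₀) ∷ []) 2 (nat 0) v₀ (h₀ ⊞ h₁ ⊞ cst 6) refl (D₀ ∷ D₁ ∷
              []) (6≤D₁ ∷ D₁≤ ∷ [])
          0≤γ : 0# ≤ weight₃ t
          0≤γ = 0≤+ (0≤+ (nny _) (nny _)) (nny _)
          γD₀≤ : weight₃ t ⊛ D₀ ≤ # 3 ⊛ (σ ⊛ P′)
          γD₀≤ = 0≤⇒≤ (*-cancel-0≤ {a = σ} (<-≤-trans (0<fromℕ 1) 2≤σ)
            (by ((v₀ :* v₁ ≦ nat 3 :* (v₂ :* v₂ :* v₃)) ∷ (v₄ :* v₂ ≦ v₁) ∷ (nat 0 ≦ v₀) ∷ []) 0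
              (nat 0) (v₂ :* (nat 3 :* (v₂ :* v₃) :- v₀ :* v₄)) (h₀ ⊞ h₂ ⊠ h₁) refl
              (weight₃ t ∷ mass y ∷ σ ∷ P′ ∷ D₀ ∷ []) (edge-weight (λ u → least u (∈-trios u)) ∷ σD₀≤ ∷ 0≤γ ∷ [])))

        P′≤ : # 300 ⊛ P′ ⊕ # 100 ⊛ β ⊛ β ≤ # 579
        P′≤ = by ((nat 100 :* v₀ ≦ nat 193) ∷ (v₀ ≐ v₁ :+ v₂) ∷ (v₃ :* v₃ ≦ nat 3 :* v₂) ∷ []) 0
          (nat 300 :* v₁ :+ nat 100 :* v₃ :* v₃) (nat 579) (3 ∙ h₀ ⊞ 100 ∙ h₂ ⊞ eqn 1 (:- nat 300)) refl
          (P ∷ P′ ∷ p ∷ β ∷ []) (P≤ ∷ P≈ ∷ β²≤ ∷ [])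

        -- The thresholds 3.76 - 1.8X here and 1.25 in `large-X` are weights for which
        -- `light-triple` provides a triple; they nearly agree at X = 1.39.
        small-X : # 100 ⊛ X ≤ # 139 → # 100 ⊛ β ≤ # 376 ⊖′ # 180 ⊛ X → ⊥
        small-X X≤ β≤ = impossible
          (by ((nat 100 ≦ nat 100 :* v₀) ∷ (nat 100 :* v₀ ≦ nat 139) ∷ (nat 0 ≦ v₁) ∷
              (nat 100 :* v₁ ≦ nat 376 :- nat 180 :* v₀) ∷ []) 7414874999 (nat 6) (nat 3 :* (nat 9 :- v₀ :-
              v₁) :* (nat 9 :- v₀ :- v₁) :- nat 75 :+ nat 3 :* v₀ :* v₀ :+ v₁ :* v₁)
                (5927822 ∙ h₀ ⊠ h₀ ⊠ h₀ ⊞ 16111302 ∙ h₀ ⊠ h₀ ⊠ h₁ ⊞ 1735305 ∙ h₀ ⊠ h₀ ⊠ h₃ ⊞ 14594280 ∙ h₀ ⊠ h₁ ⊠ h₁ ⊞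
                3310905 ∙ h₀ ⊠ h₁ ⊠ h₃ ⊞ 76050 ∙ h₀ ⊠ h₃ ⊠ h₃ ⊞ 4410800 ∙ h₁ ⊠ h₁ ⊠ h₁ ⊞ 1575600 ∙ h₁ ⊠ h₁ ⊠ h₃ ⊞
                76050 ∙ h₁ ⊠ h₃ ⊠ h₃) refl
            (X ∷ β ∷ []) (100≤X ∷ X≤ ∷ 0≤β ∷ β≤ ∷ []))
          (by ((nat 100 ≦ nat 100 :* v₀) ∷ (nat 100 :* v₀ ≦ nat 139) ∷ (nat 0 ≦ v₁) ∷
              (nat 100 :* v₁ ≦ nat 376 :- nat 180 :* v₀) ∷ (nat 9 ≐ v₂ :+ v₃) ∷ (v₃ ≐ v₀ :+ v₁) ∷
              []) 19499 (nat 2) (v₂)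
                (2176 ∙ h₀ ⊞ 2020 ∙ h₁ ⊞ 195 ∙ h₃ ⊞ eqn 4 (nat 19500) ⊞ eqn 5 (nat 19500)) refl
            (X ∷ β ∷ σ ∷ α ∷ []) (100≤X ∷ X≤ ∷ 0≤β ∷ β≤ ∷ 9≈ ∷ α≈ ∷ []))
          λ bad → 1≰0 (by ((nat 100 ≦ nat 100 :* v₀) ∷ (nat 100 :* v₀ ≦ nat 139) ∷ (nat 0 ≦ v₁) ∷
              (nat 100 :* v₁ ≦ nat 376 :- nat 180 :* v₀) ∷ (nat 9 ≐ v₂ :+ v₃) ∷ (v₃ ≐ v₀ :+ v₁) ∷
              (nat 300 :* v₄ :+ nat 100 :* v₁ :* v₁ ≦ nat 579) ∷ (nat 3 :* (nat 9 :- v₀ :- v₁) :* (nat 9 :- v₀ :-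
              v₁) :- nat 75 :+ nat 3 :* v₀ :* v₀ :+ v₁ :* v₁ ≦ nat 3 :* v₅) ∷
              (v₅ :* (nat 75 :* v₅ :- nat 196) ≦ nat 3 :* (v₂ :* v₄) :* (nat 150 :* v₂ :- nat 280)) ∷
              []) 438918601972415759 (nat 1) (nat 0)
                (222446250000000 ∙ h₈ ⊞ 1853718750000000 ∙ h₇ ⊠ h₇ ⊞ 120662529000000 ∙ h₇ ⊠ h₀ ⊠ h₀ ⊞
                208717860000000 ∙ h₇ ⊠ h₀ ⊠ h₁ ⊞ 33838447500000 ∙ h₇ ⊠ h₀ ⊠ h₃ ⊞ 91080600000000 ∙ h₇ ⊠ h₁ ⊠ h₁ ⊞
                30724200000000 ∙ h₇ ⊠ h₁ ⊠ h₃ ⊞ 1482975000000 ∙ h₇ ⊠ h₃ ⊠ h₃ ⊞ 6250177440000 ∙ h₆ ⊠ h₀ ⊠ h₀ ⊞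
                11758593600000 ∙ h₆ ⊠ h₀ ⊠ h₁ ⊞ 927201600000 ∙ h₆ ⊠ h₀ ⊠ h₃ ⊞ 5529771000000 ∙ h₆ ⊠ h₁ ⊠ h₁ ⊞
                873814500000 ∙ h₆ ⊠ h₁ ⊠ h₃ ⊞ 33366937500 ∙ h₆ ⊠ h₃ ⊠ h₃ ⊞ 32564537448 ∙ h₀ ⊠ h₀ ⊠ h₀ ⊠ h₀ ⊞
                441606685640 ∙ h₀ ⊠ h₀ ⊠ h₀ ⊠ h₃ ⊞ 156927713040 ∙ h₀ ⊠ h₀ ⊠ h₁ ⊠ h₁ ⊞
                    871136111400 ∙ h₀ ⊠ h₀ ⊠ h₁ ⊠ h₃ ⊞
                196145124825 ∙ h₀ ⊠ h₀ ⊠ h₃ ⊠ h₃ ⊞ 395952826560 ∙ h₀ ⊠ h₁ ⊠ h₁ ⊠ h₁ ⊞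
                    521621988000 ∙ h₀ ⊠ h₁ ⊠ h₁ ⊠ h₃ ⊞
                317345028000 ∙ h₀ ⊠ h₁ ⊠ h₃ ⊠ h₃ ⊞ 20654799750 ∙ h₀ ⊠ h₃ ⊠ h₃ ⊠ h₃ ⊞
                    208386782640 ∙ h₁ ⊠ h₁ ⊠ h₁ ⊠ h₁ ⊞
                87052820000 ∙ h₁ ⊠ h₁ ⊠ h₁ ⊠ h₃ ⊞ 126934567500 ∙ h₁ ⊠ h₁ ⊠ h₃ ⊠ h₃ ⊞ 17674020000 ∙ h₁ ⊠ h₃ ⊠ h₃ ⊠ h₃ ⊞
                630264375 ∙ h₃ ⊠ h₃ ⊠ h₃ ⊠ h₃ ⊞
                eqn 4 ((:- (nat 714052462500000000 :* v₄)) :- nat 100100812500000000 :* v₂ :* v₄ :+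
                    nat 100100812500000000 :* v₃ :* v₄) ⊞
                eqn 5 ((:- (nat 1614959775000000000 :* v₄)) :+ nat 100100812500000000 :* v₀ :* v₄ :+
                    nat 100100812500000000 :* v₁ :* v₄ :+ nat 100100812500000000 :* v₃ :* v₄)) refl
            (X ∷ β ∷ σ ∷ α ∷ P′ ∷ D₀ ∷ []) (100≤X ∷ X≤ ∷ 0≤β ∷ β≤ ∷ 9≈ ∷ α≈ ∷ P′≤ ∷ D₁≤ ∷ bad ∷ []))

        large-X : # 139 ≤ # 100 ⊛ X → # 100 ⊛ β ≤ # 125 → ⊥
        large-X X≥ β≤ = impossible
          (by ((nat 139 ≦ nat 100 :* v₀) ∷ (nat 100 :* v₀ ≦ nat 152) ∷ (nat 0 ≦ v₁) ∷ (nat 100 :* v₁ ≦ nat 125) ∷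
              []) 10984999 (nat 6) (nat 3 :* (nat 9 :- v₀ :- v₁) :* (nat 9 :- v₀ :- v₁) :- nat 75 :+
              nat 3 :* v₀ :* v₀ :+ v₁ :* v₁)
                (219662 ∙ h₀ ⊠ h₀ ⊠ h₀ ⊞ 677355 ∙ h₀ ⊠ h₀ ⊠ h₁ ⊞ 22672 ∙ h₀ ⊠ h₀ ⊠ h₃ ⊞ 696231 ∙ h₀ ⊠ h₁ ⊠ h₁ ⊞
                45851 ∙ h₀ ⊠ h₁ ⊠ h₃ ⊞ 338 ∙ h₀ ⊠ h₃ ⊠ h₃ ⊞ 238538 ∙ h₁ ⊠ h₁ ⊠ h₁ ⊞ 23179 ∙ h₁ ⊠ h₁ ⊠ h₃ ⊞
                338 ∙ h₁ ⊠ h₃ ⊠ h₃) refl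
            (X ∷ β ∷ []) (X≥ ∷ X≤ ∷ 0≤β ∷ β≤ ∷ []))
          (by ((nat 139 ≦ nat 100 :* v₀) ∷ (nat 100 :* v₀ ≦ nat 152) ∷ (nat 0 ≦ v₁) ∷ (nat 100 :* v₁ ≦ nat 125) ∷
              (nat 9 ≐ v₂ :+ v₃) ∷ (v₃ ≐ v₀ :+ v₁) ∷ []) 1299 (nat 2) (v₂)
                (423 ∙ h₀ ⊞ 436 ∙ h₁ ⊞ 13 ∙ h₃ ⊞ eqn 4 (nat 1300) ⊞ eqn 5 (nat 1300)) refl
            (X ∷ β ∷ σ ∷ α ∷ []) (X≥ ∷ X≤ ∷ 0≤β ∷ β≤ ∷ 9≈ ∷ α≈ ∷ []))
          λ bad → 1≰0 (by ((nat 139 ≦ nat 100 :* v₀) ∷ (nat 100 :* v₀ ≦ nat 152) ∷ (nat 0 ≦ v₁) ∷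
              (nat 100 :* v₁ ≦ nat 125) ∷ (nat 9 ≐ v₂ :+ v₃) ∷ (v₃ ≐ v₀ :+ v₁) ∷
              (nat 300 :* v₄ :+ nat 100 :* v₁ :* v₁ ≦ nat 579) ∷ (nat 3 :* (nat 9 :- v₀ :- v₁) :* (nat 9 :- v₀ :-
              v₁) :- nat 75 :+ nat 3 :* v₀ :* v₀ :+ v₁ :* v₁ ≦ nat 3 :* v₅) ∷
              (v₅ :* (nat 75 :* v₅ :- nat 196) ≦ nat 3 :* (v₂ :* v₄) :* (nat 150 :* v₂ :- nat 280)) ∷
              []) 3651529151360 (nat 1) (nat 0)
                (13182000000 ∙ h₈ ⊞ 109850000000 ∙ h₇ ⊠ h₇ ⊞ 59816120000 ∙ h₇ ⊠ h₀ ⊠ h₀ ⊞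
                    124408180000 ∙ h₇ ⊠ h₀ ⊠ h₁ ⊞
                5894720000 ∙ h₇ ⊠ h₀ ⊠ h₃ ⊞ 64723880000 ∙ h₇ ⊠ h₁ ⊠ h₁ ⊞ 6026540000 ∙ h₇ ⊠ h₁ ⊠ h₃ ⊞
                    87880000 ∙ h₇ ⊠ h₃ ⊠ h₃ ⊞
                3180477300 ∙ h₆ ⊠ h₀ ⊠ h₀ ⊞ 6522079200 ∙ h₆ ⊠ h₀ ⊠ h₁ ⊞ 161124600 ∙ h₆ ⊠ h₀ ⊠ h₃ ⊞
                    3343579200 ∙ h₆ ⊠ h₁ ⊠ h₁ ⊞
                165079200 ∙ h₆ ⊠ h₁ ⊠ h₃ ⊞ 1977300 ∙ h₆ ⊠ h₃ ⊠ h₃ ⊞ 897260574 ∙ h₀ ⊠ h₀ ⊠ h₀ ⊠ h₁ ⊞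
                590232412 ∙ h₀ ⊠ h₀ ⊠ h₀ ⊠ h₃ ⊞ 2774636013 ∙ h₀ ⊠ h₀ ⊠ h₁ ⊠ h₁ ⊞ 1893851202 ∙ h₀ ⊠ h₀ ⊠ h₁ ⊠ h₃ ⊞
                98879482 ∙ h₀ ⊠ h₀ ⊠ h₃ ⊠ h₃ ⊞ 2860355868 ∙ h₀ ⊠ h₁ ⊠ h₁ ⊠ h₁ ⊞ 2023027314 ∙ h₀ ⊠ h₁ ⊠ h₁ ⊠ h₃ ⊞
                204056918 ∙ h₀ ⊠ h₁ ⊠ h₃ ⊠ h₃ ⊞ 3588884 ∙ h₀ ⊠ h₃ ⊠ h₃ ⊠ h₃ ⊞ 983019975 ∙ h₁ ⊠ h₁ ⊠ h₁ ⊠ h₁ ⊞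
                719487616 ∙ h₁ ⊠ h₁ ⊠ h₁ ⊠ h₃ ⊞ 105289483 ∙ h₁ ⊠ h₁ ⊠ h₃ ⊠ h₃ ⊞ 3681158 ∙ h₁ ⊠ h₃ ⊠ h₃ ⊠ h₃ ⊞
                37349 ∙ h₃ ⊠ h₃ ⊠ h₃ ⊠ h₃ ⊞
                eqn 4 ((:- (nat 42314220000000 :* v₄)) :- nat 5931900000000 :* v₂ :* v₄ :+
                    nat 5931900000000 :* v₃ :* v₄) ⊞
                eqn 5 ((:- (nat 95701320000000 :* v₄)) :+ nat 5931900000000 :* v₀ :* v₄ :+
                    nat 5931900000000 :* v₁ :* v₄ :+ nat 5931900000000 :* v₃ :* v₄)) refl
            (X ∷ β ∷ σ ∷ α ∷ P′ ∷ D₀ ∷ []) (X≥ ∷ X≤ ∷ 0≤β ∷ β≤ ∷ 9≈ ∷ α≈ ∷ P′≤ ∷ D₁≤ ∷ bad ∷ []))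

      contradiction : ⊥
      contradiction with ≤-<-connex (# 100 ⊛ X) (# 139)
      ... | inj₁ X≤139 = small (light-triple {t} 0≤t λ le → 1≰0 (by ((nat 100 ≦ nat 100 :* v₀) ∷
          (nat 100 :* v₀ ≦ nat 139) ∷ (nat 56 ≦ v₁) ∷ (nat 100 :* v₂ ≦ nat 193) ∷ (nat 0 ≦ v₂) ∷ (nat 0 ≦ v₃) ∷
          (v₃ :* v₄ ≦ nat 3 :* v₂ :* (v₅ :* v₅) :+ nat 3 :* v₃ :* v₅ :* (v₅ :* v₅ :- v₁ :- v₂)) ∷
          (nat 100 :* v₃ ≐ nat 376 :- nat 180 :* v₀) ∷ (v₄ ≐ v₁ :* (nat 9 :- nat 3 :* v₀)) ∷ (nat 9 ≐ v₅ :+ v₀) ∷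
          []) 24391972799999 (nat 1) (nat 0)
                (9886500000000 ∙ h₆ ⊞ 12819109 ∙ h₀ ⊠ h₀ ⊠ h₀ ⊠ h₀ ⊞ 340887780 ∙ h₀ ⊠ h₀ ⊠ h₀ ⊠ h₁ ⊞
                676060800 ∙ h₀ ⊠ h₀ ⊠ h₁ ⊠ h₁ ⊞ 348526000 ∙ h₀ ⊠ h₁ ⊠ h₁ ⊠ h₁ ⊞ 226175820000 ∙ h₂ ⊠ h₀ ⊠ h₀ ⊞
                597698400000 ∙ h₂ ⊠ h₀ ⊠ h₁ ⊞ 382200000000 ∙ h₂ ⊠ h₁ ⊠ h₁ ⊞ 9426050400 ∙ h₃ ⊠ h₀ ⊠ h₀ ⊞
                18872178000 ∙ h₃ ⊠ h₀ ⊠ h₁ ⊞ 9422400000 ∙ h₃ ⊠ h₁ ⊠ h₁ ⊞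
                eqn 7 ((:- (nat 98865000000 :* v₄)) :- nat 296595000000 :* v₁ :* v₅ :-
                    nat 296595000000 :* v₂ :* v₅ :+ nat 296595000000 :* v₅ :* v₅ :* v₅) ⊞
                eqn 8 ((:- nat 37173240000000) :+ nat 17795700000000 :* v₀) ⊞
                eqn 9 ((:- nat 9033097320000000) :+ nat 6331710060000000 :* v₀ :+ nat 111519720000000 :* v₁ :-
                    nat 155415780000000 :* v₂ :- nat 1003677480000000 :* v₅ :- nat 1072487520000000 :* v₀ :* v₀ :-
                    nat 53387100000000 :* v₀ :* v₁ :- nat 23727600000000 :* v₀ :* v₂ :+
                    nat 592003620000000 :* v₀ :* v₅ :- nat 29659500000000 :* v₂ :* v₅ :-
                    nat 111519720000000 :* v₅ :* v₅ :+ nat 53387100000000 :* v₀ :* v₀ :* v₀ :-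
                    nat 53387100000000 :* v₀ :* v₀ :* v₅ :+ nat 53387100000000 :* v₀ :* v₅ :* v₅)) refl
              (X ∷ θ ∷ P ∷ t ∷ m ∷ q ∷ []) (100≤X ∷ X≤139 ∷ <⇒≤ θ> ∷ P≤ ∷ 0≤P ∷ 0≤t ∷ le ∷ 100t≈ ∷ m≈ ∷ 9≈q ∷ [])))
        where
        r = reciprocal (0<fromℕ 99)
        t = (# 376 ⊖′ # 180 ⊛ X) ⊛ proj₁ r
        100t≈ : # 100 ⊛ t ≈ # 376 ⊖′ # 180 ⊛ X
        100t≈ = equate ((nat 100 :* v₀ ≐ nat 1) ∷ []) (nat 100 :* (v₁ :* v₀)) v₁ ((0 , v₁) ∷ []) refl
          (proj₁ r ∷ # 376 ⊖′ # 180 ⊛ X ∷ []) (proj₂ (proj₂ r) ∷ [])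
        0≤t : 0# ≤ t
        0≤t = *-nonneg (by ((nat 100 :* v₀ ≦ nat 139) ∷ []) 4 (nat 0) (nat 376 :- nat 180 :* v₀) (9 ∙ h₀ ⊞
            cst 629) refl (X ∷ []) (X≤139 ∷ []))
          (<⇒≤ (proj₁ (proj₂ r)))
        small : LightTriple t → ⊥
        small (b , c , d , K , le) = OnTriple.small-X K X≤139 (≤-respʳ 100t≈ (*-mono-nonneg (0≤fromℕ 100) ≤-refl
          (OnTriple.0≤β K) le))
      ... | inj₂ X>139 = large (light-triple {t} 0≤t λ le → 1≰0 (by ((nat 139 ≦ nat 100 :* v₀) ∷
          (nat 100 :* v₀ ≦ nat 152) ∷ (nat 56 ≦ v₁) ∷ (v₁ ≦ v₅ :* v₅ :- v₂) ∷ (nat 0 ≦ v₂) ∷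
          (v₃ :* v₄ ≦ nat 3 :* v₂ :* (v₅ :* v₅) :+ nat 3 :* v₃ :* v₅ :* (v₅ :* v₅ :- v₁ :- v₂)) ∷
          (nat 4 :* v₃ ≐ nat 5) ∷ (v₄ ≐ v₁ :* (nat 9 :- nat 3 :* v₀)) ∷ (nat 9 ≐ v₅ :+ v₀) ∷
          []) 1295970923168 (nat 1) (nat 0)
                (219700000000 ∙ h₅ ⊞ 2409435375 ∙ h₀ ⊠ h₀ ⊠ h₀ ⊠ h₀ ⊞ 7338913596 ∙ h₀ ⊠ h₀ ⊠ h₀ ⊠ h₁ ⊞
                7451044602 ∙ h₀ ⊠ h₀ ⊠ h₁ ⊠ h₁ ⊞ 2521572972 ∙ h₀ ⊠ h₁ ⊠ h₁ ⊠ h₁ ⊞ 225421560000 ∙ h₂ ⊠ h₀ ⊠ h₀ ⊞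
                459061590000 ∙ h₂ ⊠ h₀ ⊠ h₁ ⊞ 233705940000 ∙ h₂ ⊠ h₁ ⊠ h₁ ⊞ 181741560000 ∙ h₃ ⊠ h₀ ⊠ h₀ ⊞
                370434090000 ∙ h₃ ⊠ h₀ ⊠ h₁ ⊞ 188758440000 ∙ h₃ ⊠ h₁ ⊠ h₁ ⊞
                eqn 6 ((:- (nat 54925000000 :* v₄)) :- nat 164775000000 :* v₁ :* v₅ :-
                    nat 164775000000 :* v₂ :* v₅ :+ nat 164775000000 :* v₅ :* v₅ :* v₅) ⊞
                eqn 7 (:- nat 274625000000) ⊞
                eqn 8 ((:- nat 480483900000000) :+ nat 160161300000000 :* v₀ :+ nat 823875000000 :* v₁ :-
                    nat 5108025000000 :* v₂ :- nat 53387100000000 :* v₅ :- nat 17795700000000 :* v₀ :* v₀ :+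
                    nat 659100000000 :* v₀ :* v₂ :+ nat 11863800000000 :* v₀ :* v₅ :- nat 659100000000 :* v₂ :* v₅ :-
                    nat 823875000000 :* v₅ :* v₅ :+ nat 659100000000 :* v₀ :* v₀ :* v₀ :-
                    nat 659100000000 :* v₀ :* v₀ :* v₅)) refl
              (X ∷ θ ∷ P ∷ t ∷ m ∷ q ∷ []) (<⇒≤ X>139 ∷ X≤ ∷ <⇒≤ θ> ∷ θ≤q² ∷ 0≤P ∷ le ∷ 4t≈ ∷ m≈ ∷ 9≈q ∷ [])))
        where
        r = reciprocal (0<fromℕ 3)
        t = # 5 ⊛ proj₁ r
        4t≈ : # 4 ⊛ t ≈ # 5
        4t≈ = equate ((nat 4 :* v₀ ≐ nat 1) ∷ []) (nat 4 :* (nat 5 :* v₀)) (nat 5) ((0 , nat 5) ∷ []) refl (proj₁ r ∷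
            []) (proj₂ (proj₂ r) ∷ [])
        0≤t : 0# ≤ t
        0≤t = *-nonneg (0≤fromℕ 5) (<⇒≤ (proj₁ (proj₂ r)))
        large : LightTriple t → ⊥
        large (b , c , d , K , le) = OnTriple.large-X K (<⇒≤ X>139)
          (by ((v₀ ≦ v₁) ∷ (nat 4 :* v₁ ≐ nat 5) ∷ []) 0 (nat 100 :* v₀) (nat 125) (100 ∙ h₀ ⊞ eqn 1 (nat 25)) refl
            (OnTriple.β K ∷ t ∷ []) (le ∷ 4t≈ ∷ []))

    heavy-case : ⊥
    heavy-case with minimum avoids? weight quads
      where
      avoids? : ∀ t → Dec (IsK₄ t × h ≢ proj₁ t × h ≢ proj₁ (proj₂ t) × h ≢ proj₁ (proj₂ (proj₂ t)) × h ≢ proj₂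
          (proj₂ (proj₂ t)))
      avoids? t = isK₄? t ×-dec ¬? (h Finₚ.≟ _) ×-dec ¬? (h Finₚ.≟ _) ×-dec ¬? (h Finₚ.≟ _) ×-dec ¬? (h Finₚ.≟ _)
    ... | inj₁ (t , (K , n₁ , n₂ , n₃ , n₄) , least) = Avoiding.contradiction K n₁ n₂ n₃ n₄
            λ K′ m₁ m₂ m₃ m₄ → least _ (∈-quads _) (K′ , m₁ , m₂ , m₃ , m₄)
    ... | inj₂ none = contradiction λ K n₁ n₂ n₃ n₄ → none _ (∈-quads _) (K , n₁ , n₂ , n₃ , n₄)

  -- The bounds for all k

  core₂ : Core 2
  core₂ {zero} G D free = ⊥-elim (0<size 2 (≤-reflexive (≈-sym (Dense.sum≈ D))))
  core₂ {suc n} G {θ} {x} D free = ≤-respʳ (identity (nat 56)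
      ((nat 3 :+ nat 3 :* nat 2 :- nat 1) :* (nat 3 :+ nat 3 :* nat 2 :- nat 2)) refl []) (≤-stable lem)
    where
    D₉ : Dense G (# 9) θ x
    D₉ = record { nonneg = Dense.nonneg D ; link≈ = Dense.link≈ D
                ; sum≈ = ≈-trans (Dense.sum≈ D) (identity (nat 3 :+ nat 3 :* nat 2) (nat 9) refl []) }
    lem : ¬ ¬ (θ ≤ # 56)
    lem θ> with argmax x
    ... | h , hmax with ≤-<-connex (x h) 1#
    ...   | inj₁ xh≤1 = LightContradiction.light-case G D₉ free θ> (λ i → ≤-trans (hmax i) xh≤1)
    ...   | inj₂ 1<xh = Through.heavy-case G D₉ free θ> hmax 1<xh

  -- Each `Core` is turned into `Bound` before the next step, since that step applies it to weights
  -- of another total.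
  bound : ∀ k → Bound (2 ℕ.+ k)
  bound zero    = core⇒bound 2 core₂
  bound (suc k) = core⇒bound (3 ℕ.+ k) (step (2 ℕ.+ k) (fromℕ-mono {2} {2 ℕ.+ k} (ℕ.s≤s (ℕ.s≤s ℕ.z≤n))) (bound k))

  -- The mass as a multiple of the Lagrange polynomial

  OnSubsets : ℕ → Set
  OnSubsets n = Subset n → Carrier

  subsetSum : ∀ {n} → OnSubsets n → Weights n → Carrier
  subsetSum {n} φ x = List.foldr (λ e s → φ e ⊛ monomial ℝ x e ⊕ s) 0# (subsets n)

  private
    module _ {A : Set} where

      foldr-++ : ∀ (f : A → Carrier) xs ys →
                 List.foldr (λ e s → f e ⊕ s) 0# (xs List.++ ys) ≈ List.foldr (λ e s →
                     f e ⊕ s) 0# xs ⊕ List.foldr (λ e s → f e ⊕ s) 0# ys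
      foldr-++ f []       ys = ≈-sym (+-identityˡ _)
      foldr-++ f (e ∷ xs) ys = ≈-trans (+-congˡ (foldr-++ f xs ys)) (≈-sym (+-assoc _ _ _))

      foldr-map : ∀ {B : Set} (f : A → Carrier) (g : B → A) c (h : B → Carrier) → (∀ b → f (g b) ≈ c ⊛ h b) → ∀ xs →
                  List.foldr (λ e s → f e ⊕ s) 0# (List.map g xs) ≈ c ⊛ List.foldr (λ e s → h e ⊕ s) 0# xs
      foldr-map f g c h eq []       = ≈-sym (zeroʳ c)
      foldr-map f g c h eq (b ∷ xs) = ≈-trans (+-cong (eq b) (foldr-map f g c h eq xs)) (≈-sym (distribˡ _ _ _))

  subsetSum-suc : ∀ {n} (φ : OnSubsets (suc n)) x →
              subsetSum φ x ≈ x zero ⊛ subsetSum (φ ∘ (true ∷_)) (x ∘ suc) ⊕ subsetSum (φ ∘ (false ∷_)) (x ∘ suc)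
  subsetSum-suc {n} φ x = ≈-trans (foldr-++ (λ e → φ e ⊛ monomial ℝ x e) (List.map (true ∷_) (subsets n)) (List.map
      (false ∷_) (subsets n)))
    (+-cong (foldr-map (λ e → φ e ⊛ monomial ℝ x e) (true ∷_) (x zero) (λ e → φ (true ∷ e) ⊛ monomial ℝ (x ∘ suc) e)
              (λ e → identity (v₀ :* (v₁ :* v₂)) (v₁ :* (v₀ :* v₂)) refl (φ (true ∷ e) ∷ x zero ∷
                  monomial ℝ (x ∘ suc) e ∷ [])) (subsets n))
            (≈-trans (foldr-map (λ e → φ e ⊛ monomial ℝ x e) (false ∷_) 1# (λ e → φ (false ∷
                e) ⊛ monomial ℝ (x ∘ suc) e)
              (λ e → identity (v₀ :* (nat 1 :* v₁)) (nat 1 :* (v₀ :* v₁)) refl (φ (false ∷ e) ∷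
                  monomial ℝ (x ∘ suc) e ∷ [])) (subsets n))
              (*-identityˡ _)))

  opaque
    unfolding dot

    dot-suc : ∀ {n} (x f : Weights (suc n)) → dot x f ≈ x zero ⊛ f zero ⊕ dot (x ∘ suc) (f ∘ suc)
    dot-suc x f = ≈-refl

    dot-zero : (x f : Weights 0) → dot x f ≈ 0#
    dot-zero x f = ≈-refl

  -- Index tuples with repetitions yield sets that are too small; vanishing off r-sets removes them
  -- from the iterated sums.
  Uniform : ∀ {n} → ℕ → OnSubsets n → Set
  Uniform r φ = ∀ e → ∣ e ∣ ≢ r → φ e ≈ 0#

  inner : ∀ {n r} {φ : OnSubsets (suc n)} → Uniform (suc r) φ → Uniform r (φ ∘ (true ∷_))
  inner u e ne = u (true ∷ e) (ne ∘ ℕₚ.suc-injective)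

  outer : ∀ {n r} {φ : OnSubsets (suc n)} → Uniform r φ → Uniform r (φ ∘ (false ∷_))
  outer u e = u (false ∷ e)

  subsetSum-0 : ∀ {n} (φ : OnSubsets n) x → (∀ e → φ e ≈ 0#) → subsetSum φ x ≈ 0#
  subsetSum-0 {n} φ x z = lem (subsets n)
    where
    lem : ∀ l → List.foldr (λ e s → φ e ⊛ monomial ℝ x e ⊕ s) 0# l ≈ 0#
    lem []      = ≈-refl
    lem (e ∷ l) = ≈-trans (+-cong (≈-trans (*-congʳ (z e)) (zeroˡ _)) (lem l)) (+-identityˡ _)

  subsetSum₀ : ∀ {n} (φ : OnSubsets n) x → Uniform 0 φ → subsetSum φ x ≈ φ Subset.⊥
  subsetSum₀ {zero}  φ x u = ≈-trans (+-identityʳ _) (*-identityʳ _)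
  subsetSum₀ {suc n} φ x u = ≈-trans (subsetSum-suc φ x) (≈-trans (+-cong
    (≈-trans (*-congˡ (subsetSum-0 (φ ∘ (true ∷_)) (x ∘ suc) (λ e → u (true ∷ e) (λ ())))) (zeroʳ _))
    (subsetSum₀ (φ ∘ (false ∷_)) (x ∘ suc) (outer u))) (+-identityˡ _))

  subsetSum₁ : ∀ {n} (φ : OnSubsets n) x → Uniform 1 φ → dot x (λ i → φ ⁅ i ⁆) ≈ subsetSum φ x
  subsetSum₁ {zero}  φ x u = ≈-trans (dot-zero x _) (≈-sym (subsetSum-0 φ x (λ { [] → u [] (λ ()) })))
  subsetSum₁ {suc n} φ x u = ≈-trans (dot-suc x _) (≈-trans (+-cong
    (*-congˡ (≈-sym (subsetSum₀ (φ ∘ (true ∷_)) (x ∘ suc) (inner u))))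
    (subsetSum₁ (φ ∘ (false ∷_)) (x ∘ suc) (outer u))) (≈-sym (subsetSum-suc φ x)))

  subsetSum₂ : ∀ {n} (φ : OnSubsets n) x → Uniform 2 φ → dot x (λ i → dot x (λ j →
      φ (⁅ i ⁆ ∪ ⁅ j ⁆))) ≈ # 2 ⊛ subsetSum φ x
  subsetSum₂ {zero}  φ x u = ≈-trans (dot-zero x _) (≈-sym (≈-trans (*-congˡ (subsetSum-0 φ x (λ { [] →
      u [] (λ ()) }))) (zeroʳ _)))
  subsetSum₂ {suc n} φ x u = begin
    dot x (λ i → dot x (λ j → φ (⁅ i ⁆ ∪ ⁅ j ⁆)))
      ≈⟨ dot-suc x _ ⟩
    x zero ⊛ dot x (λ j → φ (⁅ zero ⁆ ∪ ⁅ j ⁆)) ⊕ dot x′ (λ i → dot x (λ j → φ (⁅ suc i ⁆ ∪ ⁅ j ⁆)))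
      ≈⟨ +-cong (*-congˡ (≈-trans (dot-suc x _) (+-cong (≈-trans (*-congˡ (u _ (λ e → lem n e))) (zeroʳ _))
           (≈-trans (dot-congʳ (λ j → ≈-reflexive (≡.cong (φ ∘ (true ∷_)) (Subsetₚ.∪-identityˡ ⁅ j ⁆)))) (subsetSum₁
               _ x′ (inner u))))))
         (≈-trans (dot-congʳ (λ i → ≈-trans (dot-suc x _) (+-congʳ (*-congˡ (≈-reflexive (≡.cong (φ ∘ (true ∷_))
             (Subsetₚ.∪-identityʳ ⁅ i ⁆)))))))
           (≈-trans (dot-+ x′ _ _) (+-cong (≈-trans (dot-* x′ (x zero) _) (*-congˡ (subsetSum₁ _ x′ (inner u))))
               (subsetSum₂ _ x′ (outer u))))) ⟩
    x zero ⊛ (0# ⊕ A) ⊕ (x zero ⊛ A ⊕ # 2 ⊛ B)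
      ≈⟨ identity (v₀ :* (nat 0 :+ v₁) :+ (v₀ :* v₁ :+ nat 2 :* v₂)) (nat 2 :* (v₀ :* v₁ :+ v₂)) refl (x zero ∷ A ∷
          B ∷ []) ⟩
    # 2 ⊛ (x zero ⊛ A ⊕ B)
      ≈⟨ *-congˡ (subsetSum-suc φ x) ⟨
    # 2 ⊛ subsetSum φ x ∎
    where
    x′ = x ∘ suc
    A B : Carrier
    A = subsetSum (φ ∘ (true ∷_)) x′
    B = subsetSum (φ ∘ (false ∷_)) x′
    lem : ∀ n → suc ∣ Subset.⊥ {n} ∪ Subset.⊥ ∣ ≢ 2
    lem n e with ≡.trans (≡.sym (≡.cong suc (≡.trans (≡.cong ∣_∣ (Subsetₚ.∪-identityˡ (Subset.⊥ {n}))) (Subsetₚ.∣⊥∣≡0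
        n)))) e
    ... | ()

  -- Split off vertex 0. It can take the first, second or third place, and each choice leaves a sum
  -- over ordered pairs, twice the sum over 2-sets; hence 6 = 3 · 2.
  subsetSum₃ : ∀ {n} (φ : OnSubsets n) x → Uniform 3 φ → dot x (λ i → dot x (λ j → dot x (λ k →
      φ (triangle i j k)))) ≈ # 6 ⊛ subsetSum φ x
  subsetSum₃ {zero}  φ x u = ≈-trans (dot-zero x _) (≈-sym (≈-trans (*-congˡ (subsetSum-0 φ x (λ { [] →
      u [] (λ ()) }))) (zeroʳ _)))
  subsetSum₃ {suc n} φ x u = begin
    dot x (λ i → dot x (λ j → dot x (λ k → φ (triangle i j k))))
      ≈⟨ dot-suc x _ ⟩
    x zero ⊛ dot x (λ j → dot x (λ k → φ (triangle zero j k))) ⊕ dot x′ (λ i → dot x (λ j → dot x (λ k →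
        φ (triangle (suc i) j k))))
      ≈⟨ +-cong (*-congˡ first) (≈-trans (dot-congʳ rest) (≈-trans (dot-+ x′ _ _) (+-cong
           (≈-trans (dot-* x′ (x zero) _) (*-congˡ (subsetSum₂ _ x′ (inner u))))
           (≈-trans (dot-+ x′ _ _) (+-cong (≈-trans (dot-* x′ (x zero) _) (*-congˡ (subsetSum₂ _ x′ (inner u))))
               (subsetSum₃ _ x′ (outer u))))))) ⟩
    x zero ⊛ (# 2 ⊛ A) ⊕ (x zero ⊛ (# 2 ⊛ A) ⊕ (x zero ⊛ (# 2 ⊛ A) ⊕ # 6 ⊛ B))
      ≈⟨ identity (v₀ :* (nat 2 :* v₁) :+ (v₀ :* (nat 2 :* v₁) :+ (v₀ :* (nat 2 :* v₁) :+
          nat 6 :* v₂))) (nat 6 :* (v₀ :* v₁ :+ v₂)) refl (x zero ∷ A ∷ B ∷ []) ⟩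
    # 6 ⊛ (x zero ⊛ A ⊕ B)
      ≈⟨ *-congˡ (subsetSum-suc φ x) ⟨
    # 6 ⊛ subsetSum φ x ∎
    where
    x′ = x ∘ suc
    ψ : OnSubsets n
    ψ = φ ∘ (true ∷_)
    A B : Carrier
    A = subsetSum ψ x′
    B = subsetSum (φ ∘ (false ∷_)) x′
    φ≈ : ∀ {p q} → p ≡ q → φ p ≈ φ q
    φ≈ e = ≈-reflexive (≡.cong φ e)
    at₀₀ : ∀ k → φ (triangle zero zero k) ≈ 0#
    at₀₀ k = u _ (∣degenerate∣ zero k)
    at₀₂ : ∀ (j : Fin (suc n)) → φ (triangle zero j zero) ≈ 0#
    at₀₂ j = ≈-trans (φ≈ (≡.cong (⁅ zero ⁆ ∪_) (Subsetₚ.∪-comm ⁅ j ⁆ ⁅ zero ⁆))) (at₀₀ j)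
    at₁₂ : ∀ (i : Fin (suc n)) → φ (triangle i zero zero) ≈ 0#
    at₁₂ i = ≈-trans (φ≈ (≡.trans (Subsetₚ.∪-comm ⁅ i ⁆ _) (Subsetₚ.∪-assoc ⁅ zero ⁆ ⁅ zero ⁆ ⁅ i ⁆))) (at₀₀ i)
    skip : ∀ (f : Weights (suc n)) → f zero ≈ 0# → dot x f ≈ dot x′ (f ∘ suc)
    skip f z = ≈-trans (dot-suc x f) (≈-trans (+-congʳ (≈-trans (*-congˡ z) (zeroʳ _))) (+-identityˡ _))
    vanish : ∀ (f : Weights (suc n)) → (∀ k → f k ≈ 0#) → dot x f ≈ 0#
    vanish f z = ≈-trans (dot-congʳ z) (≈-trans (dot-const x 0#) (zeroˡ _))
    first : dot x (λ j → dot x (λ k → φ (triangle zero j k))) ≈ # 2 ⊛ A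
    first = ≈-trans (skip _ (vanish _ at₀₀)) (≈-trans (dot-congʳ (λ j → ≈-trans (skip _ (at₀₂ (suc j)))
      (dot-congʳ (λ k → φ≈ (≡.cong (true ∷_) (Subsetₚ.∪-identityˡ (⁅ j ⁆ ∪ ⁅ k ⁆))))))) (subsetSum₂ ψ x′ (inner u)))
    rest : ∀ i → dot x (λ j → dot x (λ k → φ (triangle (suc i) j k))) ≈
           x zero ⊛ dot x′ (λ k → ψ (⁅ i ⁆ ∪ ⁅ k ⁆)) ⊕
           (x zero ⊛ dot x′ (λ j → ψ (⁅ i ⁆ ∪ ⁅ j ⁆)) ⊕ dot x′ (λ j → dot x′ (λ k → φ (false ∷ triangle i j k))))
    rest i = ≈-trans (dot-suc x _) (+-cong
      (*-congˡ (≈-trans (skip _ (at₁₂ (suc i))) (dot-congʳ (λ k → φ≈ (≡.cong (λ p → true ∷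
          (⁅ i ⁆ ∪ p)) (Subsetₚ.∪-identityˡ ⁅ k ⁆))))))
      (≈-trans (dot-congʳ (λ j → ≈-trans (dot-suc x _) (+-congʳ (*-congˡ (φ≈ (≡.cong (λ p → true ∷
          (⁅ i ⁆ ∪ p)) (Subsetₚ.∪-identityʳ ⁅ j ⁆)))))))
        (≈-trans (dot-+ x′ _ _) (+-congʳ (dot-* x′ (x zero) _)))))

  module _ {n} (G : Hypergraph 3 n) where

    open Graph (triples G) using (mass)

    -- Filtering the list of subsets amounts to multiplying by the indicator of the edges, after
    -- which `subsetSum₃` applies.
    mass≈lagrangePoly : ∀ x → mass x ≈ # 6 ⊛ lagrangePoly ℝ G x
    mass≈lagrangePoly x = ≈-trans (subsetSum₃ φ x (λ e ne → ≈-reflexive (≡.cong [_] (dec-false (Hypergraph.E? G e)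
        (ne ∘ Hypergraph.uniform G)))))
        (*-congˡ (lem (subsets n)))
      where
      φ : OnSubsets n
      φ e = [ does (Hypergraph.E? G e) ]
      lem : ∀ l → List.foldr (λ e s → φ e ⊛ monomial ℝ x e ⊕ s) 0# l ≈
                  List.foldr _⊕_ 0# (List.map (monomial ℝ x) (List.filter (Hypergraph.E? G) l))
      lem []      = ≈-refl
      lem (e ∷ l) with Hypergraph.E? G e
      ... | yes _ = +-cong (*-identityˡ _) (lem l)
      ... | no _  = ≈-trans (+-congʳ (zeroˡ _)) (≈-trans (+-identityˡ _) (lem l))

  -- Uniform weights on a complete 3-graph

  module _ (s : ℕ) (v : Carrier) where

    open Graph (triples (K 3 s))

    private
      u : Weights s
      u _ = v
      Σu : sum u ≈ # s ⊛ v
      Σu = sum-const s v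
      dot-δ-u : ∀ i → dot u (δ i) ≈ v
      dot-δ-u i = ≈-trans (dot-comm u (δ i)) (dot-δ i u)

    W-uniform : ∀ {i j} → i ≢ j → W u i j ≈ (# s ⊖′ # 2) ⊛ v
    W-uniform {i} {j} i≢j = ≈-trans (dot-congʳ point) (≈-trans (dot-comb u ((1# , λ _ → 1#) ∷ (⊖ 1# , δ i) ∷
        (⊖ 1# , δ j) ∷ []))
      (≈-trans (+-cong (*-congˡ (≈-trans (≈-sym (sum≈dot u)) Σu)) (+-cong (*-congˡ (dot-δ-u i)) (+-congʳ (*-congˡ
          (dot-δ-u j)))))
        (identity (nat 1 :* (v₀ :* v₁) :+ (:- nat 1 :* v₁ :+ (:- nat 1 :* v₁ :+ nat 0))) ((v₀ :-
            nat 2) :* v₁) refl (# s ∷ v ∷ []))))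
      where
      point : ∀ k → E[ i , j , k ] ≈ comb ((1# , λ _ → 1#) ∷ (⊖ 1# , δ i) ∷ (⊖ 1# , δ j) ∷ []) k
      point k with i Finₚ.≟ k | j Finₚ.≟ k
      ... | yes refl | yes refl = ⊥-elim (i≢j refl)
      ... | yes refl | no _ = ≈-trans (≈-reflexive (≡.cong [_] (E-irr₁₃ i j)))
              (identity (nat 0) (nat 1 :* nat 1 :+ (:- nat 1 :* nat 1 :+ (:- nat 1 :* nat 0 :+ nat 0))) refl [])
      ... | no _ | yes refl = ≈-trans (≈-reflexive (≡.cong [_] (E-irr₂₃ i j)))
              (identity (nat 0) (nat 1 :* nat 1 :+ (:- nat 1 :* nat 0 :+ (:- nat 1 :* nat 1 :+ nat 0))) refl [])
      ... | no i≢k | no j≢k = ≈-trans (≈-reflexive (≡.cong [_] (dec-true (∣ triangle i j k ∣ ℕₚ.≟ 3) (∣triangle∣ i≢j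
          i≢k j≢k))))
              (identity (nat 1) (nat 1 :* nat 1 :+ (:- nat 1 :* nat 0 :+ (:- nat 1 :* nat 0 :+ nat 0))) refl [])

    link-uniform : ∀ i → link u i ≈ (# s ⊖′ # 1) ⊛ (# s ⊖′ # 2) ⊛ (v ⊛ v)
    link-uniform i = ≈-trans (dot-congʳ point) (≈-trans (dot-comb u ((c , λ _ → 1#) ∷ (⊖ c , δ i) ∷ []))
      (≈-trans (+-cong (*-congˡ (≈-trans (≈-sym (sum≈dot u)) Σu)) (+-congʳ (*-congˡ (dot-δ-u i))))
        (identity ((v₀ :- nat 2) :* v₁ :* (v₀ :* v₁) :+ (:- ((v₀ :- nat 2) :* v₁) :* v₁ :+ nat 0)) ((v₀ :-
            nat 1) :* (v₀ :- nat 2) :* (v₁ :* v₁)) refl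
          (# s ∷ v ∷ []))))
      where
      c : Carrier
      c = (# s ⊖′ # 2) ⊛ v
      point : ∀ j → W u i j ≈ comb ((c , λ _ → 1#) ∷ (⊖ c , δ i) ∷ []) j
      point j with i Finₚ.≟ j
      ... | yes refl = ≈-trans (W-diag u i) (identity (nat 0) (v₀ :* nat 1 :+ (:- v₀ :* nat 1 :+ nat 0)) refl (c ∷
          []))
      ... | no i≢j = ≈-trans (W-uniform i≢j) (identity v₀ (v₀ :* nat 1 :+ (:- v₀ :* nat 0 :+ nat 0)) refl (c ∷ []))

    mass-uniform : mass u ≈ # s ⊛ (# s ⊖′ # 1) ⊛ (# s ⊖′ # 2) ⊛ (v ⊛ v ⊛ v)
    mass-uniform = ≈-trans (dot-congʳ link-uniform) (≈-trans (dot-const u _) (≈-trans (*-congˡ Σu)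
      (identity ((v₀ :- nat 1) :* (v₀ :- nat 2) :* (v₁ :* v₁) :* (v₀ :* v₁)) (v₀ :* (v₀ :- nat 1) :* (v₀ :-
          nat 2) :* (v₁ :* v₁ :* v₁)) refl
        (# s ∷ v ∷ []))))

  -- The Lagrangian of the complete 3-graph and the Lagrangian density

  module _ (k : ℕ) where

    private
      H : Hypergraph 3 (4 ℕ.+ (2 ℕ.+ k) ℕ.* 3)
      H = K 3 4 ⊔ (2 ℕ.+ k) · K 3 3
      s = 3 ℕ.+ (2 ℕ.+ k) ℕ.* 3
      S c : Carrier
      S = size (2 ℕ.+ k)
      c = (S ⊖′ # 1) ⊛ (S ⊖′ # 2)
      s≈S : # s ≈ S
      s≈S = ≈-trans (fromℕ-+ 3 ((2 ℕ.+ k) ℕ.* 3)) (+-congˡ (≈-trans (fromℕ-* (2 ℕ.+ k) 3) (*-comm _ _)))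
      S⁻¹ = reciprocal (0<size (2 ℕ.+ k))
      6⁻¹ = reciprocal (0<fromℕ 5)
      v i₆ : Carrier
      v = proj₁ S⁻¹
      i₆ = proj₁ 6⁻¹
      Sv≈1 : S ⊛ v ≈ 1#
      Sv≈1 = proj₂ (proj₂ S⁻¹)

    -- 6 λ(K₃ˢ) = (s - 1)(s - 2) / s²

    top : Carrier
    top = c ⊛ (v ⊛ v)

    private
      module Sum = Mult +-rawMonoid

    6× : ∀ l → (3 ℕ.!) Sum.× l ≈ # 6 ⊛ l
    6× l = identity (v₀ :+ (v₀ :+ (v₀ :+ (v₀ :+ (v₀ :+ (v₀ :+ nat 0)))))) (nat 6 :* v₀) refl (l ∷ [])

    -- This is `bound` at total weight 1, divided by the square of the size.
    lagrangePoly≤ : ∀ {n} (G : Hypergraph 3 n) → (H -free) G → ∀ x → Simplex ℝ x → # 6 ⊛ lagrangePoly ℝ G x ≤ top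
    lagrangePoly≤ G free x (nn , Σx) = ≤-respˡ (mass≈lagrangePoly G x)
      (by ((v₀ :* v₁ ≐ nat 1) ∷ (v₀ :* v₀ :* v₂ ≦ v₃ :* (v₄ :* v₄ :* v₄)) ∷ (v₄ ≐ nat 1) ∷ []) 0 v₂ (v₃ :* (v₁ :* v₁))
        (sq v₁ ⊠ h₁ ⊞ eqn 0 (:- (v₂ :* (v₀ :* v₁ :+ nat 1))) ⊞ eqn 2 (v₁ :* v₁ :* v₃ :* (v₄ :* v₄ :+ v₄ :+
            nat 1))) refl
        (S ∷ v ∷ Graph.mass (triples G) x ∷ c ∷ sum x ∷ [])
        (Sv≈1 ∷ bound k (triples G) nn (λ {l} cp _ → free⇒Free G free cp) ∷ Σx ∷ []))

    -- `H` has s + 1 vertices, too many for an injection.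
    complete-free : (H -free) (K 3 s)
    complete-free (f , inj , _) = Finₚ.<⇒notInjective (ℕₚ.n<1+n s) inj

    l : Carrier
    l = top ⊛ i₆

    6l≈top : # 6 ⊛ l ≈ top
    6l≈top = equate ((nat 6 :* v₀ ≐ nat 1) ∷ []) (nat 6 :* (v₁ :* v₀)) v₁ ((0 , v₁) ∷ []) refl (i₆ ∷ top ∷
        []) (proj₂ (proj₂ 6⁻¹) ∷ [])

    cancel-6 : ∀ {a b} → # 6 ⊛ a ≤ # 6 ⊛ b → a ≤ b
    cancel-6 {a} {b} p = by ((nat 6 :* v₀ ≦ nat 6 :* v₁) ∷ []) 5 v₀ v₁ h₀ refl (a ∷ b ∷ []) (p ∷ [])

    complete-lagrangian : IsLagrangian ℝ (K 3 s) l
    complete-lagrangian = ((λ _ → v) , ((λ _ → <⇒≤ (proj₁ (proj₂ S⁻¹))) ,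
        ≈-trans (sum-const s v) (≈-trans (*-congʳ s≈S) Sv≈1)) ,
        antisym (cancel-6 (≤-reflexive value)) (cancel-6 (≤-reflexive (≈-sym value)))) ,
      λ x sx → cancel-6 (≤-respʳ (≈-sym 6l≈top) (lagrangePoly≤ (K 3 s) complete-free x sx))
      where
      value : # 6 ⊛ lagrangePoly ℝ (K 3 s) (λ _ → v) ≈ # 6 ⊛ l
      value = ≈-trans (≈-sym (mass≈lagrangePoly (K 3 s) _)) (≈-trans (mass-uniform s v) (≈-trans
        (equate ((v₀ ≐ v₁) ∷ (v₁ :* v₂ ≐ nat 1) ∷ []) (v₀ :* (v₀ :- nat 1) :* (v₀ :- nat 2) :* (v₂ :* v₂ :* v₂))
          ((v₁ :- nat 1) :* (v₁ :- nat 2) :* (v₂ :* v₂))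
          ((0 , nat 2 :* v₂ :* v₂ :* v₂ :- nat 3 :* v₀ :* v₂ :* v₂ :* v₂ :- nat 3 :* v₁ :* v₂ :* v₂ :* v₂ :+
              v₀ :* v₀ :* v₂ :* v₂ :* v₂ :+ v₀ :* v₁ :* v₂ :* v₂ :* v₂ :+ v₁ :* v₁ :* v₂ :* v₂ :* v₂) ∷
              (1 , (v₁ :- nat 1) :* (v₁ :- nat 2) :* (v₂ :* v₂)) ∷ []) refl
          (# s ∷ S ∷ v ∷ []) (s≈S ∷ Sv≈1 ∷ [])) (≈-sym 6l≈top)))

    perfect : λPerfect ℝ H
    -- Since `K 3 s` is itself free, the upper bound is one of the values and hence their supremum.
    perfect = l , complete-lagrangian , upper , λ b ub → ub _ (s , K 3 s , l , complete-free , complete-lagrangian ,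
        ≈-refl)
      where
      upper : ∀ d → FreeValue ℝ H d → d ≤ (3 ℕ.!) Sum.× l
      upper d (n , G , l′ , free , ((x , sx , e) , _) , d≈) = ≤-respˡ (≈-sym d≈) (≤-respˡ (≈-sym (6× l′))
        (≤-respʳ (≈-sym (≈-trans (6× l) 6l≈top)) (≤-respˡ (*-congˡ e) (lagrangePoly≤ G free x sx))))

open import Data.Nat.Base using (_≤_)

theorem1p5 : (ℝ : CompleteOrderedField) (k : ℕ) → 2 ≤ k →
    λPerfect ℝ (K 3 4 ⊔ k · K 3 3)
theorem1p5 ℝ (suc zero)    (ℕ.s≤s ())
theorem1p5 ℝ (suc (suc k)) _ = perfect ℝ k
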